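{- For an integer $i\ge 3$ let $C_i$ denote the plane map whose underlying graph is a cycle of length $i$. For each $k\ge1$ there is a homomorphism $C_{2k+3}\to C_{2k+1}$, and there is a gap between $C_{2k+3}$ and $C_{2k+1}$: there is no core $N$ of signed genus $0$ with $C_{2k+3}<N<C_{2k+1}$, where $A<B$ means there is a homomorphism $A\to B$ but none $B\to A$.
   Context: Maps. A map $M$ is a tuple $(C,\alpha_0,\alpha_1,\alpha_2)$, where $C$ is a finite set (of crosses) and $\alpha_0,\alpha_1,\alpha_2$ are fixed-point-free involutions of $C$ with $\alpha_0\alpha_2=\alpha_2\alpha_0$, together with a finite number (possibly zero) of isolated vertices. Vertex permutation $\tau=\alpha_1\alpha_2$, face permutation $\phi=\alpha_1\alpha_0$. Vertices: orbits of $\langle\alpha_1,\alpha_2\rangle$ on $C$ plus isolated vertices; edges: orbits of $\langle\alpha_0,\alpha_2\rangle$; faces: orbits of $\langle\alpha_0,\alpha_1\rangle$ plus one face per isolated vertex; connected components: orbits of $\langle\alpha_0,\alpha_1,\alpha_2\rangle$ plus one per isolated vertex. The underlying graph has the vertices and edges with the induced incidence. A cross is incident with the vertex/face containing it; two crosses are coincident with a face if they lie in the same cycle of $\phi$; the degree of a face is the number of crosses in one of its $\phi$-cycles. $\mathbf v,\mathbf e,\mathbf f,\mathbf k$ count vertices, edges, faces, components. For connected $M$ with an edge, $\mathbf o(M)$ is the number of orbits of $\langle\alpha_0\alpha_2,\alpha_1\alpha_2\rangle$ on $C$; an edgeless connected map has $\mathbf o=2$; in general $\mathbf o$ is the minimum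 over components. $\boldsymbol\chi=\mathbf v-\mathbf e+\mathbf f$, $\mathbf{eg}=2\mathbf k-\boldsymbol\chi$, $\mathbf g=\mathbf{eg}/\mathbf o$, signed genus $\mathbf{sg}=(2\mathbf o-3)\mathbf g$; a map is plane if $\mathbf{eg}=0$. Isomorphism: same number of isolated vertices and a bijection of crosses commuting with each $\alpha_i$. Deletion and submaps: $M\backslash e$ removes the four crosses of edge $e$, restricts $\alpha_0,\alpha_2$, and chooses $\alpha_1$ so that the new vertex permutation cycles are those of $\tau$ with the crosses of $e$ removed (a vertex all of whose crosses lie in $e$ becomes isolated). Deleting a vertex deletes its incident edges then removes it. A submap is obtained by deleting some edges then some vertices; proper if different from $M$. Vertex gluing: for distinct crosses $a,b$ let $M^{(a\,b)}=(C,\alpha_0,(a\;b)\alpha_1(a\;b),\alpha_2)$. If $a,b$ are incident with distinct vertices and either are coincident with a common face or lie in different components, passing to $M^{(a\,b)}$ is a vertex gluing; deleting an isolated vertex when gluing it to another vertex is also a vertex gluing. Duplicate edges: two distinct edges incident with a common face of degree two; gluing them replaces $M$ by (a map isomorphic to) $M\backslash f$ for one of them $f$. Homomorphisms and cores: for $\mathbf{sg}(M)=\mathbf{sg}(M')$, a homomorphism $M\to M'$ exists if $M'$ has a submap isomorphic to a map obtained from $M$ by a finite sequence of vertex gluings and duplicate edge gluings. A map is a core if there is no homomorphism from it to a proper submap of itself. -}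

module Defs where

open import Data.Nat as ℕ using (ℕ; zero; suc; _+_; _*_; _∸_; _≤_; _<_; _⊓_)
open import Data.Nat.DivMod using (_mod_; _/_; _%_)
open import Data.Integer as ℤ using (ℤ; +_)
open import Data.Integer.DivMod using (_/ℕ_)
open import Data.Fin as Fin using (Fin; toℕ)
open import Data.Bool using (Bool; true; false; _∧_; _∨_; not; if_then_else_)
open import Data.List using (List; []; _∷_; _++_; map; replicate; allFin; filterᵇ)
open import Data.Bool.ListAction using (any; all)
open import Data.Vec as Vec using (Vec; lookup; tabulate)
open import Data.Product using (Σ; ∃; _×_; _,_)
open import Data.Sum using (_⊎_)
open import Function using (_∘_)
open import Function.Bundles using (_↔_; Inverse)
open import Function.Definitions using (Injective)
open import Relation.Nullary using (¬_; does)
open import Relation.Binary.PropositionalEquality using (_≡_; _≢_)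
open import Relation.Binary.Construct.Closure.ReflexiveTransitive using (Star)

-- Maps (raw data).  Crosses are Fin n.  The axioms are in IsMap.

record Map : Set where
  field
    n   : ℕ                 -- number of crosses
    α₀  : Fin n → Fin n
    α₁  : Fin n → Fin n
    α₂  : Fin n → Fin n
    iso : ℕ                 -- number of isolated vertices

open Map

IsMap : Map → Set
IsMap M =
  (∀ x → α₀ M (α₀ M x) ≡ x) × (∀ x → α₁ M (α₁ M x) ≡ x) × (∀ x → α₂ M (α₂ M x) ≡ x) ×
  (∀ x → α₀ M x ≢ x) × (∀ x → α₁ M x ≢ x) × (∀ x → α₂ M x ≢ x) ×
  (∀ x → α₀ M (α₂ M x) ≡ α₂ M (α₀ M x))

-- Orbits of the group generated by a list of permutations of Fin n
-- (computed as forward reachability, iterated n times).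

eqᵇ : ∀ {n} → Fin n → Fin n → Bool
eqᵇ x y = does (x Fin.≟ y)

iter : ∀ {A : Set} → ℕ → (A → A) → A → A
iter zero    f a = a
iter (suc k) f a = f (iter k f a)

closeStep : ∀ {n} → List (Fin n → Fin n) → Vec Bool n → Vec Bool n
closeStep {n} gs S =
  tabulate (λ y → lookup S y ∨ any (λ g → any (λ z → lookup S z ∧ eqᵇ (g z) y) (allFin n)) gs)

reach : ∀ {n} → List (Fin n → Fin n) → Fin n → Fin n → Bool
reach {n} gs x = lookup (iter n (closeStep gs) (tabulate (eqᵇ x)))

isRep : ∀ {n} → List (Fin n → Fin n) → Fin n → Bool
isRep {n} gs x = all (λ y → not ((toℕ y ℕ.<ᵇ toℕ x) ∧ reach gs x y)) (allFin n)

countᵇ : ∀ {A : Set} → (A → Bool) → List A → ℕ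
countᵇ p []       = 0
countᵇ p (x ∷ xs) = (if p x then 1 else 0) + countᵇ p xs

orbits : ∀ {n} → List (Fin n → Fin n) → ℕ
orbits {n} gs = countᵇ (isRep gs) (allFin n)

cycleSize : ∀ {n} → (Fin n → Fin n) → Fin n → ℕ
cycleSize {n} σ x = countᵇ (reach (σ ∷ []) x) (allFin n)

τ φ : (M : Map) → Fin (n M) → Fin (n M)
τ M = α₁ M ∘ α₂ M
φ M = α₁ M ∘ α₀ M

vGens eGens fGens cGens oGens : (M : Map) → List (Fin (n M) → Fin (n M))
vGens M = α₁ M ∷ α₂ M ∷ []
eGens M = α₀ M ∷ α₂ M ∷ []
fGens M = α₀ M ∷ α₁ M ∷ []
cGens M = α₀ M ∷ α₁ M ∷ α₂ M ∷ []
oGens M = (α₀ M ∘ α₂ M) ∷ (α₁ M ∘ α₂ M) ∷ []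

𝐯 𝐞 𝐟 𝐤 : Map → ℕ
𝐯 M = orbits (vGens M) + iso M
𝐞 M = orbits (eGens M)
𝐟 M = orbits (fGens M) + iso M
𝐤 M = orbits (cGens M) + iso M

χ : Map → ℤ
χ M = + 𝐯 M ℤ.- + 𝐞 M ℤ.+ + 𝐟 M

eg : Map → ℤ
eg M = + (2 * 𝐤 M) ℤ.- χ M

oComp : (M : Map) → Fin (n M) → ℕ
oComp M c = countᵇ (λ x → reach (cGens M) c x ∧ isRep (oGens M) x) (allFin (n M))

-- minimum of a list (the value for the empty list, i.e. the empty map,
-- is an arbitrary convention; it does not affect sg of the empty map)
minL : List ℕ → ℕ
minL []           = 2
minL (x ∷ [])     = x
minL (x ∷ y ∷ xs) = x ⊓ minL (y ∷ xs)

-- o(M): minimum over components; isolated vertices (edgeless components) give 2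
𝐨 : Map → ℕ
𝐨 M = minL (map (oComp M) (filterᵇ (isRep (cGens M)) (allFin (n M))) ++ replicate (iso M) 2)

divℤ : ℤ → ℕ → ℤ
divℤ z zero    = + 0
divℤ z (suc m) = z /ℕ suc m

𝐠 : Map → ℤ
𝐠 M = divℤ (eg M) (𝐨 M)

sg : Map → ℤ
sg M = (+ (2 * 𝐨 M) ℤ.- + 3) ℤ.* 𝐠 M

record _≅_ (M M' : Map) : Set where
  field
    bij    : Fin (n M) ↔ Fin (n M')
    comm₀  : ∀ x → Inverse.to bij (α₀ M x) ≡ α₀ M' (Inverse.to bij x)
    comm₁  : ∀ x → Inverse.to bij (α₁ M x) ≡ α₁ M' (Inverse.to bij x)
    comm₂  : ∀ x → Inverse.to bij (α₂ M x) ≡ α₂ M' (Inverse.to bij x)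
    isoEq  : iso M ≡ iso M'

-- Submaps.  A submap is obtained by deleting a set of edges and then a
-- set of vertices (with their incident edges).  It is described by the
-- crosses that survive (keepE, a union of edges), the non-isolated
-- vertices of M that survive (keepV, a union of vertices), and the
-- number keepI of isolated vertices of M that survive.

record SubData (M : Map) : Set where
  field
    keepE : Fin (n M) → Bool
    keepV : Fin (n M) → Bool
    keepI : ℕ
open SubData

ValidSub : (M : Map) → SubData M → Set
ValidSub M d =
  (∀ x → keepE d (α₀ M x) ≡ keepE d x) × (∀ x → keepE d (α₂ M x) ≡ keepE d x) ×
  (∀ x → keepV d (α₁ M x) ≡ keepV d x) × (∀ x → keepV d (α₂ M x) ≡ keepV d x) ×
  (∀ x → keepE d x ≡ true → keepV d x ≡ true) × keepI d ≤ iso M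

Proper : (M : Map) → SubData M → Set
Proper M d = (∃ λ x → keepE d x ≡ false) ⊎ (∃ λ x → keepV d x ≡ false) ⊎ keepI d < iso M

nextIn : ∀ {n} → (Fin n → Bool) → (Fin n → Fin n) → ℕ → Fin n → Fin n
nextIn K σ zero    y = y
nextIn K σ (suc f) y = if K (σ y) then σ y else nextIn K σ f (σ y)

-- α₁ of the submap: new vertex permutation τ' = τ with deleted crosses
-- skipped, and α₁' = τ' α₂
subα₁ : (M : Map) → SubData M → Fin (n M) → Fin (n M)
subα₁ M d y = nextIn (keepE d) (τ M) (n M) (α₂ M y)

subIsoCount : (M : Map) → SubData M → ℕ
subIsoCount M d = keepI d +
  countᵇ (λ x → isRep (vGens M) x ∧ keepV d x ∧
                 all (λ y → not (reach (vGens M) x y ∧ keepE d y)) (allFin (n M)))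
         (allFin (n M))

record SubIso (X M : Map) (d : SubData M) : Set where
  field
    emb      : Fin (n X) → Fin (n M)
    emb-inj  : Injective _≡_ _≡_ emb
    emb-into : ∀ x → keepE d (emb x) ≡ true
    emb-onto : ∀ y → keepE d y ≡ true → ∃ λ x → emb x ≡ y
    comm₀    : ∀ x → emb (α₀ X x) ≡ α₀ M (emb x)
    comm₁    : ∀ x → emb (α₁ X x) ≡ subα₁ M d (emb x)
    comm₂    : ∀ x → emb (α₂ X x) ≡ α₂ M (emb x)
    isoEq    : iso X ≡ subIsoCount M d

HasSubmap : Map → Map → Set
HasSubmap X Y = Σ (SubData X) λ d → ValidSub X d × SubIso Y X d

swapF : ∀ {n} → Fin n → Fin n → Fin n → Fin n
swapF a b x = if eqᵇ x a then b else (if eqᵇ x b then a else x)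

glue : (M : Map) → Fin (n M) → Fin (n M) → Map
glue M a b = record M { α₁ = swapF a b ∘ α₁ M ∘ swapF a b }

VertexGluing : Map → Map → Set
VertexGluing M X =
  (Σ (Fin (n M)) λ a → Σ (Fin (n M)) λ b →
     a ≢ b × reach (vGens M) a b ≡ false ×
     (reach (φ M ∷ []) a b ≡ true ⊎ reach (cGens M) a b ≡ false) ×
     X ≅ glue M a b)
  ⊎
  -- deleting an isolated vertex when gluing it to another vertex
  (1 ≤ iso M × (1 ≤ n M ⊎ 2 ≤ iso M) × X ≅ record M { iso = iso M ∸ 1 })

delEdge : (M : Map) → Fin (n M) → SubData M
delEdge M y = record { keepE = λ z → not (reach (eGens M) y z)
                     ; keepV = λ _ → true ; keepI = iso M }

DuplicateGluing : Map → Map → Set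
DuplicateGluing M X =
  Σ (Fin (n M)) λ x → Σ (Fin (n M)) λ y →
    reach (eGens M) x y ≡ false ×
    reach (fGens M) x y ≡ true ×
    cycleSize (φ M) x ≡ 2 ×
    SubIso X M (delEdge M y)

Step : Map → Map → Set
Step M X = VertexGluing M X ⊎ DuplicateGluing M X

Hom : Map → Map → Set
Hom M M' = sg M ≡ sg M' × Σ Map λ X → Star Step M X × HasSubmap M' X

IsCore : Map → Set
IsCore N = ¬ (Σ (SubData N) λ d → ValidSub N d × Proper N d ×
                Σ Map λ S → SubIso S N d × Hom N S)

_≺_ : Map → Map → Set
A ≺ B = Hom A B × ¬ Hom B A

-- The plane cycle map.  Cyc m is C_{m+3}.  Crosses c = 4j + 2s + t with
-- j ∈ Z_L the edge {j, j+1}, s the end (0: at vertex j, 1: at vertex j+1),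
-- t the side.

Cyc : ℕ → Map
Cyc m = record { n = N ; α₀ = toF ∘ a0 ∘ toℕ ; α₁ = toF ∘ a1 ∘ toℕ
               ; α₂ = toF ∘ a2 ∘ toℕ ; iso = 0 }
  where
    L = 3 + m
    N = 4 * L
    toF : ℕ → Fin N
    toF c = c mod N
    jj ss tt : ℕ → ℕ
    jj c = c / 4
    ss c = (c % 4) / 2
    tt c = c % 2
    a0 a1 a2 : ℕ → ℕ
    a0 c = 4 * jj c + 2 * (1 ∸ ss c) + tt c
    a2 c = 4 * jj c + 2 * ss c + (1 ∸ tt c)
    a1 c = if ss c ℕ.≡ᵇ 0 then 4 * ((jj c + L ∸ 1) % L) + 2 + tt c
                           else 4 * ((jj c + 1) % L) + tt c

C : ℕ → Map
C i = Cyc (i ∸ 3)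

{-# OPTIONS --safe #-}
-- Homomorphisms are read backwards.  Along a chain of gluings from N to C_r, r = 2k+1, an orientation, the labels of the
-- vertices modulo r and the vanishing of the first cohomology pull back from C_r to N, and so does the fact that in each
-- component at most one face winds positively and at most one negatively around C_r (each exactly once).  The labels orient
-- every edge, so crossing edges is a flow of value r in the dual from the one face to the other.  By the max-flow min-cut
-- argument, either the flow can be augmented to the value r + 2, or there is a tight cut, which is a closed walk with
-- increasing labels of length r: it spans a submap C_r of N and gives a homomorphism from C_r to N.  In the first case N
-- has labels modulo r + 2, and it is folded onto C_{r+2}: two vertices next to each other on a face, at equal height, are
-- glued.  If they are already the same vertex v, cohomology shows that v separates the map there, and after reflecting the
-- heights of one side the fold succeeds at the neighbouring corner.  When no fold and no digon is left, every face is
-- monotone and the map is the cycle.  The same folding sends C_{r+2} to C_r.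
module Submission where

open import Defs
open import Data.Nat as ℕ using (ℕ; zero; suc; z≤n; s≤s)
import Data.Nat.Properties as ℕₚ
open import Data.Integer as ℤ using (ℤ; +_; -[1+_]; _+_; _-_; _*_; -_)
import Data.Integer.Properties as ℤₚ
open import Data.Integer.Tactic.RingSolver using (solve-∀)
open import Data.Fin as Fin using (Fin; toℕ; zero; suc)
import Data.Fin.Properties as Finₚ
open import Data.Fin.Permutation using (permutation)
open import Data.Bool using (Bool; true; false; _∧_; _∨_; not; if_then_else_)
import Data.Bool.Properties as Boolₚ
open import Data.Bool.ListAction using (any; all)
open import Data.List as List using (List; []; _∷_; allFin)
open import Data.List.Membership.Propositional using (_∈_)
open import Data.List.Membership.Propositional.Properties using (∈-allFin)
open import Data.List.Relation.Unary.Any using (here; there)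
open import Data.Vec using (Vec; lookup; tabulate)
open import Data.Vec.Properties using (lookup∘tabulate)
open import Data.Product using (Σ; ∃; _×_; _,_; proj₁; proj₂)
open import Data.Sum using (_⊎_; inj₁; inj₂; [_,_]′)
open import Data.Empty using (⊥; ⊥-elim)
open import Function using (_∘_; id)
open import Relation.Nullary using (¬_; Dec; yes; no; does)
open import Relation.Nullary.Decidable using (dec-true; dec-false; _×-dec_)
open import Relation.Binary.PropositionalEquality using (_≡_; _≢_; refl; sym; trans; cong; cong₂; subst; subst₂)
open import Relation.Binary.Definitions using (tri<; tri≈; tri>)
import Algebra.Properties.CommutativeMonoid.Sum as MonoidSum
open import Data.Integer.DivMod using (_%ℕ_; _/ℕ_; n%ℕd<d; a≡a%ℕn+[a/ℕn]*n)
open import Function.Bundles using (Inverse; mk↔ₛ′; Equivalence)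
open import Relation.Binary.Construct.Closure.ReflexiveTransitive using (Star; ε; _◅_)
open import Data.Nat.DivMod using (_mod_; _/_; _%_; m≡m%n+[m/n]*n; [m+n]%n≡m%n; [m+kn]%n≡m%n; n%n≡0; m<n⇒m%n≡m; m%n<n; m*n/n≡m; +-distrib-/-∣ʳ; m<n*o⇒m/o<n; 0/n≡0)
open import Data.Nat.Divisibility using (divides)
open import Function.Construct.Identity using (↔-id)

-- Labels modulo r pull back along a gluing for free; the obstacle is the winding of faces.
-- Separating two components cuts one face into two, whose windings could be anything. But rises are
-- antisymmetric, so the marks of a component sum to zero, and the winding that appears is minus the
-- sum of the old marks on one side. At most one mark of each sign per component makes this 0 or a
-- unit, and the condition is restored after the cut. The same condition, read forwards, forces a
-- face of rising darts to close after a single turn. The modulus grows by 2 because reversing the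
-- rise of an edge changes it by 2: reversing along a dual path from the positive to the negative
-- mark adds twice the marks to the face sums, which become r + 2 times the marks. Integer heights
-- for the new rises exist because the first cohomology vanishes. Odd length enters through
-- two-colourings, which pull back like orientations: they rule out that only a proper part of the
-- target is reached, and that the folding ends in a single edge.

true≢false : true ≢ false
true≢false ()

absurdᵇ : {A : Set} → {b : Bool} → b ≡ true → b ≡ false → A
absurdᵇ refl ()

¬true : {b : Bool} → b ≢ true → b ≡ false
¬true {true}  h = ⊥-elim (h refl)
¬true {false} h = refl

∧-split : ∀ {b c} → b ∧ c ≡ true → b ≡ true × c ≡ true
∧-split {true} {true} refl = refl , refl

≡ᵇ-both : ∀ {b c : Bool} → (b ≡ true → c ≡ true) → (c ≡ true → b ≡ true) → b ≡ c
≡ᵇ-both {true}  {c}     f g = sym (f refl)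
≡ᵇ-both {false} {true}  f g = g refl
≡ᵇ-both {false} {false} f g = refl

-- Equality tests and transpositions

eqᵇ-refl : {n : ℕ} → (x : Fin n) → eqᵇ x x ≡ true
eqᵇ-refl x = dec-true (x Fin.≟ x) refl

eqᵇ-≢ : {n : ℕ} → {x y : Fin n} → x ≢ y → eqᵇ x y ≡ false
eqᵇ-≢ {x = x} {y} = dec-false (x Fin.≟ y)

eqᵇ-sound : {n : ℕ} → {x y : Fin n} → eqᵇ x y ≡ true → x ≡ y
eqᵇ-sound {x = x} {y} h with x Fin.≟ y
... | yes p = p
eqᵇ-sound () | no _

swap-a : {n : ℕ} → (a b : Fin n) → swapF a b a ≡ b
swap-a a b rewrite eqᵇ-refl a = refl

swap-b : {n : ℕ} → (a b : Fin n) → swapF a b b ≡ a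
swap-b a b with b Fin.≟ a
... | yes p = p
... | no _ rewrite eqᵇ-refl b = refl

swap-other : {n : ℕ} → {a b x : Fin n} → x ≢ a → x ≢ b → swapF a b x ≡ x
swap-other p q rewrite eqᵇ-≢ p | eqᵇ-≢ q = refl

data SwapView {n : ℕ} (a b : Fin n) : Fin n → Fin n → Set where
  at-a  : SwapView a b a b
  at-b  : SwapView a b b a
  other : ∀ {x} → x ≢ a → x ≢ b → SwapView a b x x

swapView : {n : ℕ} → (a b x : Fin n) → SwapView a b x (swapF a b x)
swapView a b x with x Fin.≟ a
... | yes refl = at-a
... | no p with x Fin.≟ b
... | yes refl = at-b
... | no q = other p q

swap-invol : {n : ℕ} → (a b x : Fin n) → swapF a b (swapF a b x) ≡ x
swap-invol a b x with swapF a b x | swapView a b x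
... | _ | at-a = swap-b a b
... | _ | at-b = swap-a a b
... | _ | other p q = swap-other p q

swap-inv : {n : ℕ} {A : Set} → {a b : Fin n} (h : Fin n → A) → h a ≡ h b → ∀ x → h (swapF a b x) ≡ h x
swap-inv {a = a} {b} h e x with swapF a b x | swapView a b x
... | _ | at-a = sym e
... | _ | at-b = e
... | _ | other p q = refl

-- Sums over finite sets

open MonoidSum ℤₚ.+-0-commutativeMonoid public using () renaming (sum to ∑; sum-cong-≗ to ∑-cong; ∑-distrib-+ to ∑-+; sum-permute to ∑-permute)

∑-zero : {n : ℕ} → (f : Fin n → ℤ) → (∀ x → f x ≡ + 0) → ∑ f ≡ + 0
∑-zero {zero}  f h = refl
∑-zero {suc n} f h rewrite h zero = trans (ℤₚ.+-identityˡ _) (∑-zero (f ∘ suc) (h ∘ suc))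

∑-* : {n : ℕ} → (c : ℤ) (f : Fin n → ℤ) → ∑ (λ x → c ℤ.* f x) ≡ c ℤ.* ∑ f
∑-* {zero}  c f = sym (ℤₚ.*-zeroʳ c)
∑-* {suc n} c f = trans (cong (λ z → c ℤ.* f zero ℤ.+ z) (∑-* c (f ∘ suc))) (sym (ℤₚ.*-distribˡ-+ c (f zero) _))

∑-- : {n : ℕ} → (f h : Fin n → ℤ) → ∑ (λ x → f x ℤ.- h x) ≡ ∑ f ℤ.- ∑ h
∑-- f h = trans (∑-+ f (λ x → ℤ.- h x)) (cong (λ z → ∑ f ℤ.+ z)
  (trans (∑-cong (λ x → sym (ℤₚ.-1*i≡-i (h x)))) (trans (∑-* (ℤ.- + 1) h) (ℤₚ.-1*i≡-i (∑ h)))))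

⟦_⟧ : Bool → ℤ
⟦ true ⟧ = + 1
⟦ false ⟧ = + 0

δ : {n : ℕ} → Fin n → Fin n → ℤ
δ a x = ⟦ eqᵇ x a ⟧

δ-same : {n : ℕ} → (a : Fin n) → δ a a ≡ + 1
δ-same a rewrite eqᵇ-refl a = refl

δ-diff : {n : ℕ} → {a x : Fin n} → x ≢ a → δ a x ≡ + 0
δ-diff p rewrite eqᵇ-≢ p = refl

∑-δ : {n : ℕ} → (a : Fin n) (f : Fin n → ℤ) → (∀ x → x ≢ a → f x ≡ + 0) → ∑ f ≡ f a
∑-δ zero f h = trans (cong (λ z → f zero ℤ.+ z) (∑-zero (f ∘ suc) (λ x → h (suc x) λ ()))) (ℤₚ.+-identityʳ _)
∑-δ (suc a) f h rewrite h zero (λ ()) = trans (ℤₚ.+-identityˡ _)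
  (∑-δ a (f ∘ suc) (λ x p → h (suc x) (p ∘ Finₚ.suc-injective)))

∑-mono : {n : ℕ} → (f h : Fin n → ℤ) → (∀ x → f x ℤ.≤ h x) → ∑ f ℤ.≤ ∑ h
∑-mono {zero}  f h p = ℤₚ.≤-refl
∑-mono {suc n} f h p = ℤₚ.+-mono-≤ (p zero) (∑-mono (f ∘ suc) (h ∘ suc) (p ∘ suc))

∑-nonneg : {n : ℕ} → (f : Fin n → ℤ) → (∀ x → + 0 ℤ.≤ f x) → + 0 ℤ.≤ ∑ f
∑-nonneg {n} f p = subst (ℤ._≤ ∑ f) (∑-zero {n} (λ _ → + 0) (λ _ → refl)) (∑-mono {n} (λ _ → + 0) f p)

nonneg-sum-zero : ∀ {a b} → + 0 ℤ.≤ a → + 0 ℤ.≤ b → a ℤ.+ b ≡ + 0 → a ≡ + 0 × b ≡ + 0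
nonneg-sum-zero {+ zero} {+ zero} (ℤ.+≤+ _) (ℤ.+≤+ _) e = refl , refl

∑-nonneg-zero : {n : ℕ} → (f : Fin n → ℤ) → (∀ x → + 0 ℤ.≤ f x) → ∑ f ≡ + 0 → ∀ x → f x ≡ + 0
∑-nonneg-zero {suc n} f p e zero = proj₁ (nonneg-sum-zero (p zero) (∑-nonneg (f ∘ suc) (p ∘ suc)) e)
∑-nonneg-zero {suc n} f p e (suc x) =
  ∑-nonneg-zero (f ∘ suc) (p ∘ suc) (proj₂ (nonneg-sum-zero (p zero) (∑-nonneg (f ∘ suc) (p ∘ suc)) e)) x

double-zero : ∀ {a} → a ≡ ℤ.- a → a ≡ + 0
double-zero {+ zero} e = refl

count : {n : ℕ} → (Fin n → Bool) → ℕ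
count {zero}  p = 0
count {suc n} p = (if p zero then 1 else 0) ℕ.+ count (p ∘ suc)

∑-count : {n : ℕ} → (p : Fin n → Bool) → ∑ (λ x → ⟦ p x ⟧) ≡ + count p
∑-count {zero}  p = refl
∑-count {suc n} p with p zero
... | true  = cong (λ z → + 1 ℤ.+ z) (∑-count (p ∘ suc))
... | false = trans (ℤₚ.+-identityˡ _) (∑-count (p ∘ suc))

count≤n : {n : ℕ} → (p : Fin n → Bool) → count p ℕ.≤ n
count≤n {zero}  p = z≤n
count≤n {suc n} p with p zero
... | true  = s≤s (count≤n (p ∘ suc))
... | false = ℕₚ.m≤n⇒m≤1+n (count≤n (p ∘ suc))

count-mono : {n : ℕ} → (p q : Fin n → Bool) → (∀ x → p x ≡ true → q x ≡ true) → count p ℕ.≤ count q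
count-mono {zero}  p q h = z≤n
count-mono {suc n} p q h with p zero | q zero | h zero
... | true  | true  | _ = s≤s (count-mono (p ∘ suc) (q ∘ suc) (h ∘ suc))
... | true  | false | k = ⊥-elim (true≢false (sym (k refl)))
... | false | true  | _ = ℕₚ.m≤n⇒m≤1+n (count-mono (p ∘ suc) (q ∘ suc) (h ∘ suc))
... | false | false | _ = count-mono (p ∘ suc) (q ∘ suc) (h ∘ suc)

count-strict : {n : ℕ} → (p q : Fin n → Bool) → (∀ x → p x ≡ true → q x ≡ true) →
  ∀ a → p a ≡ false → q a ≡ true → count p ℕ.< count q
count-strict {suc n} p q h zero pa qa rewrite pa | qa = s≤s (count-mono (p ∘ suc) (q ∘ suc) (h ∘ suc))
count-strict {suc n} p q h (suc a) pa qa with p zero | q zero | h zero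
... | true  | true  | _ = s≤s (count-strict (p ∘ suc) (q ∘ suc) (h ∘ suc) a pa qa)
... | true  | false | k = ⊥-elim (true≢false (sym (k refl)))
... | false | true  | _ = ℕₚ.m≤n⇒m≤1+n (count-strict (p ∘ suc) (q ∘ suc) (h ∘ suc) a pa qa)
... | false | false | _ = count-strict (p ∘ suc) (q ∘ suc) (h ∘ suc) a pa qa

record Enum {n} (K : Fin n → Bool) : Set where
  field
    size : ℕ
    size-count : size ≡ count K
    emb  : Fin size → Fin n
    inj  : ∀ {i j} → emb i ≡ emb j → i ≡ j
    into : ∀ i → K (emb i) ≡ true
    onto : ∀ x → K x ≡ true → ∃ λ i → emb i ≡ x

enum : {n : ℕ} → (K : Fin n → Bool) → Enum K
enum {zero} K = record { size = 0 ; size-count = refl ; emb = λ () ; inj = λ { {()} } ; into = λ () ; onto = λ () }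
enum {suc n} K with enum (K ∘ suc)
... | E with K zero in eq
... | true = record
  { size = suc (Enum.size E) ; size-count = trans (cong suc (Enum.size-count E)) (cong (λ b → (if b then 1 else 0) ℕ.+ count (K ∘ suc)) (sym eq))
  ; emb = λ { zero → zero ; (suc i) → suc (Enum.emb E i) }
  ; inj = λ { {zero} {zero} _ → refl ; {suc i} {suc j} e → cong suc (Enum.inj E (Finₚ.suc-injective e)) }
  ; into = λ { zero → eq ; (suc i) → Enum.into E i }
  ; onto = λ { zero _ → zero , refl ; (suc x) k → suc (proj₁ (Enum.onto E x k)) , cong suc (proj₂ (Enum.onto E x k)) } }
... | false = record
  { size = Enum.size E ; size-count = trans (Enum.size-count E) (cong (λ b → (if b then 1 else 0) ℕ.+ count (K ∘ suc)) (sym eq))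
  ; emb = suc ∘ Enum.emb E
  ; inj = λ e → Enum.inj E (Finₚ.suc-injective e)
  ; into = Enum.into E
  ; onto = λ { zero k → absurdᵇ k eq ; (suc x) k → proj₁ (Enum.onto E x k) , cong suc (proj₂ (Enum.onto E x k)) } }

-- Permutations of finite sets

Inj : {n : ℕ} → (Fin n → Fin n) → Set
Inj σ = ∀ {x y} → σ x ≡ σ y → x ≡ y

iter-+ : {A : Set} → (i j : ℕ) (σ : A → A) (x : A) → iter (i ℕ.+ j) σ x ≡ iter i σ (iter j σ x)
iter-+ zero    j σ x = refl
iter-+ (suc i) j σ x = cong σ (iter-+ i j σ x)

iter-suc : {A : Set} → (i : ℕ) (σ : A → A) (x : A) → iter (suc i) σ x ≡ iter i σ (σ x)
iter-suc zero    σ x = refl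
iter-suc (suc i) σ x = cong σ (iter-suc i σ x)

iter-inj : {n : ℕ} → {σ : Fin n → Fin n} → Inj σ → (i : ℕ) → Inj (iter i σ)
iter-inj σ-inj zero    e = e
iter-inj σ-inj (suc i) e = iter-inj σ-inj i (σ-inj e)

iter-collision : {n : ℕ} → {σ : Fin n → Fin n} → Inj σ → ∀ i k x → iter i σ x ≡ iter (i ℕ.+ k) σ x → iter k σ x ≡ x
iter-collision {σ = σ} σ-inj i k x e = sym (iter-inj σ-inj i (trans e (iter-+ i k σ x)))

period : {n : ℕ} → {σ : Fin n → Fin n} → Inj σ → ∀ x → ∃ λ p → p ℕ.< n × iter (suc p) σ x ≡ x
period {n} {σ} σ-inj x with Finₚ.pigeonhole (ℕₚ.n<1+n n) (λ i → iter (toℕ i) σ x)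
... | i , j , i<j , e with ℕₚ.m≤n⇒∃[o]m+o≡n i<j
... | p , q = p , bound , iter-collision σ-inj (toℕ i) (suc p) x (trans e (cong (λ k → iter k σ x) (trans (sym q) (sym (ℕₚ.+-suc (toℕ i) p)))))
  where
  bound : p ℕ.< n
  bound = ℕ.s≤s⁻¹ (ℕₚ.≤-trans (s≤s (s≤s (ℕₚ.m≤n+m p (toℕ i)))) (subst (ℕ._< suc n) (sym q) (Finₚ.toℕ<n j)))

-- A power of the permutation itself: one step less than a full turn around the cycle of `x`.
inverse : {n : ℕ} → {σ : Fin n → Fin n} → Inj σ → Fin n → Fin n
inverse {σ = σ} σ-inj x = iter (proj₁ (period σ-inj x)) σ x

inverseʳ : {n : ℕ} → {σ : Fin n → Fin n} (σ-inj : Inj σ) → ∀ x → σ (inverse σ-inj x) ≡ x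
inverseʳ σ-inj x = proj₂ (proj₂ (period σ-inj x))

inverseˡ : {n : ℕ} → {σ : Fin n → Fin n} (σ-inj : Inj σ) → ∀ x → inverse σ-inj (σ x) ≡ x
inverseˡ σ-inj x = σ-inj (inverseʳ σ-inj _)

∑-perm : {n : ℕ} → {σ : Fin n → Fin n} → Inj σ → (f : Fin n → ℤ) → ∑ (f ∘ σ) ≡ ∑ f
∑-perm {σ = σ} σ-inj f = sym (∑-permute f (permutation σ (inverse σ-inj) (inverseʳ σ-inj) (inverseˡ σ-inj)))

-- Reindexing along `σ` shows that the sum is its own negative. This is how the contributions of the
-- two darts of an edge cancel.
∑-anti : {n : ℕ} → {σ : Fin n → Fin n} → Inj σ → (f : Fin n → ℤ) → (∀ x → f (σ x) ≡ ℤ.- f x) → ∑ f ≡ + 0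
∑-anti {σ = σ} σ-inj f h = double-zero (trans (sym (∑-perm σ-inj f))
  (trans (∑-cong h) (trans (∑-cong (λ x → sym (ℤₚ.-1*i≡-i (f x)))) (trans (∑-* (ℤ.- + 1) f) (ℤₚ.-1*i≡-i (∑ f))))))

invol-inj : {n : ℕ} → {σ : Fin n → Fin n} → (∀ x → σ (σ x) ≡ x) → Inj σ
invol-inj {σ = σ} h {x} {y} e = trans (sym (h x)) (trans (cong σ e) (h y))

-- On a finite set the backward direction is obtained by going forward around the rest of the cycle.
forward-inv : {n : ℕ} → {σ : Fin n → Fin n} → Inj σ → (S : Fin n → Bool) →
  (∀ x → S x ≡ true → S (σ x) ≡ true) → ∀ x → S (σ x) ≡ S x
forward-inv {σ = σ} σ-inj S h x = ≡ᵇ-both back (h x)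
  where
  fwd : ∀ i → S (σ x) ≡ true → S (iter i σ (σ x)) ≡ true
  fwd zero    e = e
  fwd (suc i) e = h _ (fwd i e)
  back : S (σ x) ≡ true → S x ≡ true
  back e with period σ-inj x
  ... | p , _ , q = subst (λ z → S z ≡ true) (trans (sym (iter-suc p σ x)) q) (fwd p e)

least : {P : ℕ → Set} → (∀ i → Dec (P i)) → ∀ i → P i → ∃ λ j → P j × (∀ k → k ℕ.< j → ¬ P k)
least {P} P? zero p = 0 , p , λ k ()
least {P} P? (suc i) p with P? 0
... | yes p₀ = 0 , p₀ , λ k ()
... | no ¬p₀ with least {P ∘ suc} (P? ∘ suc) i p
... | j , pj , below = suc j , pj , λ { zero _ → ¬p₀ ; (suc k) (s≤s lt) → below k lt }

-- Orbits

any⁻ : {A : Set} → (p : A → Bool) (xs : List A) → any p xs ≡ true → ∃ λ x → x ∈ xs × p x ≡ true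
any⁻ p (x ∷ xs) h with p x in eq
... | true  = x , here refl , eq
... | false with any⁻ p xs h
... | y , i , q = y , there i , q

any⁺ : {A : Set} → (p : A → Bool) {xs : List A} {x : A} → x ∈ xs → p x ≡ true → any p xs ≡ true
any⁺ p (here refl) h rewrite h = refl
any⁺ p {y ∷ _} (there i) h with p y
... | true  = refl
... | false = any⁺ p i h

all⁻ : {A : Set} → (p : A → Bool) {xs : List A} → all p xs ≡ true → ∀ {x} → x ∈ xs → p x ≡ true
all⁻ p {y ∷ ys} h i with p y in eq
all⁻ p {y ∷ ys} h (here refl) | true = eq
all⁻ p {y ∷ ys} h (there i)   | true = all⁻ p h i

all⁺ : {A : Set} → (p : A → Bool) (xs : List A) → (∀ x → x ∈ xs → p x ≡ true) → all p xs ≡ true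
all⁺ p []       h = refl
all⁺ p (x ∷ xs) h rewrite h x (here refl) = all⁺ p xs (λ y i → h y (there i))

module _ {n : ℕ} (gs : List (Fin n → Fin n)) where

  close⁻ : (S : Vec Bool n) (y : Fin n) → lookup (closeStep gs S) y ≡ true →
    lookup S y ≡ true ⊎ (∃ λ g → g ∈ gs × ∃ λ z → lookup S z ≡ true × g z ≡ y)
  close⁻ S y h with trans (sym (lookup∘tabulate _ y)) h
  ... | e with lookup S y
  ... | true = inj₁ refl
  ... | false with any⁻ _ gs e
  ... | g , i , e' with any⁻ _ (allFin n) e'
  ... | z , _ , e'' with ∧-split {lookup S z} e''
  ... | p , q = inj₂ (g , i , z , p , eqᵇ-sound q)

  close⁺ˡ : (S : Vec Bool n) (y : Fin n) → lookup S y ≡ true → lookup (closeStep gs S) y ≡ true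
  close⁺ˡ S y h = trans (lookup∘tabulate _ y) (cong (_∨ any (λ g → any (λ z → lookup S z ∧ eqᵇ (g z) y) (allFin n)) gs) h)

  close⁺ʳ : (S : Vec Bool n) {g : Fin n → Fin n} (z : Fin n) → g ∈ gs → lookup S z ≡ true →
    lookup (closeStep gs S) (g z) ≡ true
  close⁺ʳ S {g} z i h = trans (lookup∘tabulate _ (g z)) (trans (cong (lookup S (g z) ∨_)
    (any⁺ _ i (any⁺ _ (∈-allFin z) (trans (cong₂ _∧_ h (eqᵇ-refl (g z))) refl)))) (Boolₚ.∨-zeroʳ _))

  level : Fin n → ℕ → Vec Bool n
  level x k = iter k (closeStep gs) (tabulate (eqᵇ x))

  level-0 : ∀ x → lookup (level x 0) x ≡ true
  level-0 x = trans (lookup∘tabulate _ x) (eqᵇ-refl x)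

  level-ind : {x : Fin n} (P : Fin n → Set) → P x → (∀ {g} → g ∈ gs → ∀ z → P z → P (g z)) →
    ∀ k y → lookup (level x k) y ≡ true → P y
  level-ind {x} P p step zero y h with eqᵇ-sound {x = x} {y} (trans (sym (lookup∘tabulate _ y)) h)
  ... | refl = p
  level-ind {x} P p step (suc k) y h with close⁻ (level x k) y h
  ... | inj₁ q = level-ind P p step k y q
  ... | inj₂ (g , i , z , q , refl) = step i z (level-ind P p step k z q)

  reach-ind : (x y : Fin n) (P : Fin n → Set) → P x → (∀ {g} → g ∈ gs → ∀ z → P z → P (g z)) →
    reach gs x y ≡ true → P y
  reach-ind x y P p step h = level-ind P p step n y h

  private
    Closed : Vec Bool n → Set
    Closed S = ∀ y → lookup (closeStep gs S) y ≡ true → lookup S y ≡ true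

    closed? : (S : Vec Bool n) → Closed S ⊎ (∃ λ y → lookup (closeStep gs S) y ≡ true × lookup S y ≡ false)
    closed? S with Finₚ.any? (λ y → (lookup (closeStep gs S) y ∧ not (lookup S y)) Boolₚ.≟ true)
    ... | yes (y , e) with ∧-split {lookup (closeStep gs S) y} e
    ... | p , q = inj₂ (y , p , trans (sym (Boolₚ.not-involutive _)) (cong not q))
    closed? S | no ¬e = inj₁ λ y h → f y h
      where
      f : ∀ y → lookup (closeStep gs S) y ≡ true → lookup S y ≡ true
      f y h with lookup S y in eq
      ... | true = refl
      ... | false = ⊥-elim (¬e (y , cong₂ _∧_ h (cong not eq)))

    -- A round that does not close the set adds an element, so a set of `n` elements is closed after
    -- `n` rounds. Hence the bounded iteration in `reach` computes the whole orbit.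
    growth : ∀ x k → Closed (level x k) ⊎ k ℕ.< count (lookup (level x k))
    growth x zero = inj₂ (ℕₚ.≤-trans (s≤s z≤n)
      (count-strict (λ _ → false) (lookup (level x 0)) (λ _ ()) x refl (level-0 x)))
    growth x (suc k) with closed? (level x k)
    ... | inj₁ c = inj₁ λ y h → close⁺ˡ (level x k) y (back y (close⁻ (level x (suc k)) y h))
      where
      back : ∀ y → lookup (level x (suc k)) y ≡ true ⊎ (∃ λ g → g ∈ gs × ∃ λ z → lookup (level x (suc k)) z ≡ true × g z ≡ y) →
        lookup (level x k) y ≡ true
      back y (inj₁ q) = c y q
      back y (inj₂ (g , i , z , q , refl)) = c (g z) (close⁺ʳ (level x k) z i (c z q))
    ... | inj₂ (y , p , q) with growth x k
    ... | inj₁ c = absurdᵇ (c y p) q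
    ... | inj₂ lt = inj₂ (ℕₚ.≤-<-trans lt (count-strict (lookup (level x k)) (lookup (level x (suc k))) (close⁺ˡ (level x k)) y q p))

  reach-refl : ∀ x → reach gs x x ≡ true
  reach-refl x = go n
    where
    go : ∀ k → lookup (level x k) x ≡ true
    go zero    = level-0 x
    go (suc k) = close⁺ˡ (level x k) x (go k)

  reach-step : ∀ x {g} → g ∈ gs → ∀ y → reach gs x y ≡ true → reach gs x (g y) ≡ true
  reach-step x {g} i y h with growth x n
  ... | inj₁ c = c (g y) (close⁺ʳ (level x n) y i h)
  ... | inj₂ lt = ⊥-elim (ℕₚ.<⇒≱ lt (count≤n _))

  reach-inv : ∀ x {g} → g ∈ gs → Inj g → ∀ y → reach gs x (g y) ≡ reach gs x y
  reach-inv x i g-inj = forward-inv g-inj (reach gs x) (reach-step x i)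

  reach-fun : {A : Set} (x y : Fin n) (h : Fin n → A) → (∀ {g} → g ∈ gs → ∀ z → h (g z) ≡ h z) →
    reach gs x y ≡ true → h y ≡ h x
  reach-fun x y h inv = reach-ind x y (λ z → h z ≡ h x) refl (λ i z e → trans (inv i z) e)

  module _ (inj : ∀ {g} → g ∈ gs → Inj g) where
    reach-sym : ∀ x y → reach gs x y ≡ true → reach gs y x ≡ true
    reach-sym x y h = trans (sym (reach-fun x y (reach gs y) (λ i → reach-inv y i (inj i)) h)) (reach-refl y)

    reach-trans : ∀ x y z → reach gs x y ≡ true → reach gs y z ≡ true → reach gs x z ≡ true
    reach-trans x y z p q = trans (reach-fun y z (reach gs x) (λ i → reach-inv x i (inj i)) q) p

-- The arc of the `σ`-cycle from `a` up to the point before `b` is closed under `σ'`, because the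
-- transposition redirects the step into `b` to `a`; and `b` is not on this arc.
split-cycle : {n : ℕ} → {σ σ' : Fin n → Fin n} → Inj σ → {a b : Fin n} → a ≢ b → (∀ x → σ' x ≡ swapF a b (σ x)) →
  reach (σ ∷ []) a b ≡ true → reach (σ' ∷ []) a b ≡ false
split-cycle {n} {σ} {σ'} σ-inj {a} {b} a≢b eq h = ¬true λ h' → notb (reach-ind (σ' ∷ []) a b Arc arc-a step h')
  where
  path : ∃ λ j → iter j σ a ≡ b
  path = reach-ind (σ ∷ []) a b (λ y → ∃ λ j → iter j σ a ≡ y) (0 , refl)
    (λ { (here refl) z (j , refl) → suc j , refl }) h
  first = least (λ i → iter i σ a Fin.≟ b) (proj₁ path) (proj₂ path)
  J = proj₁ first
  below = proj₂ (proj₂ first)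
  Arc : Fin n → Set
  Arc y = ∃ λ i → i ℕ.< J × iter i σ a ≡ y
  notb : ¬ Arc b
  notb (i , lt , e) = below i lt e
  arc-a : Arc a
  arc-a with J | proj₁ (proj₂ first)
  ... | zero  | e = ⊥-elim (a≢b e)
  ... | suc _ | e = 0 , s≤s z≤n , refl
  step : ∀ {g} → g ∈ σ' ∷ [] → ∀ z → Arc z → Arc (g z)
  step (here refl) z (i , lt , refl) with suc i ℕ.≟ J
  ... | yes e = subst Arc (sym (trans (eq _) (trans (cong (swapF a b) (trans (cong (λ k → iter k σ a) e) (proj₁ (proj₂ first)))) (swap-b a b)))) arc-a
  ... | no ne = suc i , lt' , sym (trans (eq _) (swap-other ne-a (below (suc i) lt')))
    where
    lt' : suc i ℕ.< J
    lt' = ℕₚ.≤∧≢⇒< lt ne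
    -- A return to `a` before `b` would allow `b` to be reached earlier than at its first hit `J`.
    ne-a : iter (suc i) σ a ≢ a
    ne-a e with ℕₚ.m≤n⇒∃[o]m+o≡n (ℕₚ.<⇒≤ lt')
    ... | o , q = below o (subst (o ℕ.<_) q (ℕₚ.m<n+m o (s≤s z≤n)))
      (trans (trans (cong (iter o σ) (sym e)) (sym (iter-+ o (suc i) σ a)))
             (trans (cong (λ k → iter k σ a) (trans (ℕₚ.+-comm o (suc i)) q)) (proj₁ (proj₂ first))))

-- Heights

-- φ is the face permutation and bar the reversal of darts, so φ ∘ bar rotates around vertices.
-- ω x is the rise of the dart x, η the height along its face, well defined modulo g at vertices (η-τ).
-- A face on which the heights wind around once carries a mark: there J is ±1 and η jumps by g.
record State {n : ℕ} (g : ℕ) (D : Fin n → Bool) (φ bar : Fin n → Fin n) : Set where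
  field
    ω η J e : Fin n → ℤ
    ω-unit : ∀ x → D x ≡ true → ω x ≡ + 1 ⊎ ω x ≡ - + 1
    ω-bar  : ∀ x → ω (bar x) ≡ - ω x
    η-φ    : ∀ x → η (φ x) ≡ η x + ω x - + g * J x
    η-τ    : ∀ x → η (φ (bar x)) ≡ η x + + g * e x
    J-val  : ∀ x → J x ≡ + 0 ⊎ J x ≡ + 1 ⊎ J x ≡ - + 1
    J-uniq : ∀ x y → reach (φ ∷ bar ∷ []) x y ≡ true → J x ≡ J y → J x ≢ + 0 → x ≡ y

record Perms {n : ℕ} (φ bar : Fin n → Fin n) : Set where
  field
    φ-inj   : Inj φ
    bar-inv : ∀ x → bar (bar x) ≡ x

-- Vanishing of the first cohomology: a 1-form ζ with zero sum around each face (witnessed by q) is the differential of a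
-- function p of the vertices.  This is the only form in which planarity is used.
Exact : {n : ℕ} (φ bar : Fin n → Fin n) → Set
Exact {n} φ bar = (ζ q : Fin n → ℤ) → (∀ x → ζ (bar x) ≡ - ζ x) → (∀ x → q (φ x) ≡ q x + ζ x) →
  Σ (Fin n → ℤ) λ p → (∀ x → p (φ (bar x)) ≡ p x) × (∀ x → p (φ x) ≡ p x + ζ x)

infix 4 _≡_[_]

record _≡_[_] (a b : ℤ) (g : ℕ) : Set where
  constructor via
  field
    multiple : ℤ
    equation : a ≡ b + + g * multiple

cong-refl : ∀ {a g} → a ≡ a [ g ]
cong-refl {a} {g} = via (+ 0) (lem a (+ g))
  where
  lem : ∀ a g → a ≡ a + g * + 0
  lem = solve-∀

cong-trans : ∀ {a b c g} → a ≡ b [ g ] → b ≡ c [ g ] → a ≡ c [ g ]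
cong-trans {c = c} {g} (via t refl) (via u refl) = via (u + t) (lem c (+ g) t u)
  where
  lem : ∀ c g t u → c + g * u + g * t ≡ c + g * (u + t)
  lem = solve-∀

cong-sym : ∀ {a b g} → a ≡ b [ g ] → b ≡ a [ g ]
cong-sym {b = b} {g} (via t refl) = via (- t) (lem b (+ g) t)
  where
  lem : ∀ b g t → b ≡ b + g * t + g * (- t)
  lem = solve-∀

height-fixed : ∀ h w u → h ≡ h + w - u → w ≡ u
height-fixed h w u e = trans (l₁ h w u) (trans (cong (λ z → z - h + u) (sym e)) (l₂ h u))
  where
  l₁ : ∀ h w u → w ≡ h + w - u - h + u
  l₁ = solve-∀
  l₂ : ∀ h u → h - h + u ≡ u
  l₂ = solve-∀

-- Heights at one vertex differ by multiples of `g`, so this is what excludes loops and faces of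
-- degree one.
unit-cong : ∀ {g w} → 2 ℕ.≤ g → w ≡ + 1 ⊎ w ≡ - + 1 → ¬ (∃ λ t → w ≡ + g * t)
unit-cong {g} {w} g≥2 u (t , e) = ℕₚ.<⇒≢ (absurd ℤ.∣ t ∣ refl) (sym (trans (sym (ℤₚ.abs-* (+ g) t)) (trans (cong ℤ.∣_∣ (sym e)) (unit u))))
  where
  unit : w ≡ + 1 ⊎ w ≡ - + 1 → ℤ.∣ w ∣ ≡ 1
  unit (inj₁ refl) = refl
  unit (inj₂ refl) = refl
  absurd : ∀ k → k ≡ ℤ.∣ t ∣ → 1 ℕ.< g ℕ.* ℤ.∣ t ∣
  absurd zero k0 = ⊥-elim (ℕₚ.0≢1+n (trans (sym (trans (cong (g ℕ.*_) (sym k0)) (ℕₚ.*-zeroʳ g)))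
    (trans (sym (ℤₚ.abs-* (+ g) t)) (trans (cong ℤ.∣_∣ (sym e)) (unit u)))))
  absurd (suc k) k1 = ℕₚ.≤-trans g≥2 (subst (λ z → g ℕ.≤ g ℕ.* z) k1 (ℕₚ.m≤m*n g (suc k)))

module _ {n : ℕ} {φ bar : Fin n → Fin n} (o : Perms φ bar) where
  open Perms o

  conn-gens-inj : ∀ {h} → h ∈ φ ∷ bar ∷ [] → Inj h
  conn-gens-inj (here refl) = φ-inj
  conn-gens-inj (there (here refl)) = invol-inj bar-inv

  conn-φ : ∀ x y → reach (φ ∷ bar ∷ []) x (φ y) ≡ reach (φ ∷ bar ∷ []) x y
  conn-φ x = reach-inv (φ ∷ bar ∷ []) x (here refl) φ-inj

  conn-bar : ∀ x y → reach (φ ∷ bar ∷ []) x (bar y) ≡ reach (φ ∷ bar ∷ []) x y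
  conn-bar x = reach-inv (φ ∷ bar ∷ []) x (there (here refl)) (invol-inj bar-inv)

  conn-sym : ∀ x y → reach (φ ∷ bar ∷ []) x y ≡ true → reach (φ ∷ bar ∷ []) y x ≡ true
  conn-sym = reach-sym (φ ∷ bar ∷ []) conn-gens-inj

  conn-trans : ∀ x y z → reach (φ ∷ bar ∷ []) x y ≡ true → reach (φ ∷ bar ∷ []) y z ≡ true → reach (φ ∷ bar ∷ []) x z ≡ true
  conn-trans = reach-trans (φ ∷ bar ∷ []) conn-gens-inj

  conn-fun : {A : Set} (h : Fin n → A) → (∀ x → h (φ x) ≡ h x) → (∀ x → h (bar x) ≡ h x) →
    ∀ x y → reach (φ ∷ bar ∷ []) x y ≡ true → h y ≡ h x
  conn-fun h p q x y = reach-fun (φ ∷ bar ∷ []) x y h (λ { (here refl) → p ; (there (here refl)) → q })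

  τ-inj : Inj (φ ∘ bar)
  τ-inj e = invol-inj bar-inv (φ-inj e)

  τ-fun : {A : Set} (h : Fin n → A) → (∀ x → h (φ (bar x)) ≡ h x) → ∀ x y → reach (φ ∘ bar ∷ []) x y ≡ true → h y ≡ h x
  τ-fun h p x y = reach-fun (φ ∘ bar ∷ []) x y h (λ { (here refl) → p })

  τ-conn : ∀ x y → reach (φ ∘ bar ∷ []) x y ≡ true → reach (φ ∷ bar ∷ []) x y ≡ true
  τ-conn x y h = trans (τ-fun (reach (φ ∷ bar ∷ []) x) (λ z → trans (conn-φ x (bar z)) (conn-bar x z)) x y h)
    (reach-refl (φ ∷ bar ∷ []) x)

  τ-cong : ∀ {g D} (s : State g D φ bar) x y → reach (φ ∘ bar ∷ []) x y ≡ true → State.η s y ≡ State.η s x [ g ]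
  τ-cong {g} s x y = reach-ind (φ ∘ bar ∷ []) x y (λ z → State.η s z ≡ State.η s x [ g ])
    cong-refl (λ { (here refl) z h → cong-trans (via (State.e s z) (State.η-τ s z)) h })

  -- Sum the height law over the components selected by `K`: the heights telescope along `φ`, the
  -- rises cancel in pairs under `bar`, and only `g` times the marks remains.
  mark-sum : (K η ω J : Fin n → ℤ) (g : ℕ) .{{_ : ℕ.NonZero g}} → (∀ x → K (φ x) ≡ K x) → (∀ x → K (bar x) ≡ K x) →
    (∀ x → ω (bar x) ≡ - ω x) → (∀ x → η (φ x) ≡ η x + ω x - + g * J x) → ∑ (λ x → K x * J x) ≡ + 0
  mark-sum K η ω J g Kφ Kbar ω-bar η-φ = ℤₚ.*-cancelˡ-≡ (+ g) _ _ (trans main (sym (ℤₚ.*-zeroʳ (+ g))))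
    where
    lem : ∀ k a a' w g j → a' ≡ a + w - g * j → g * (k * j) ≡ k * w - (k * a' - k * a)
    lem k a a' w g j refl = ring k a w g j
      where
      ring : ∀ k a w g j → g * (k * j) ≡ k * w - (k * (a + w - g * j) - k * a)
      ring = solve-∀
    s1 : ∑ (λ x → K x * ω x) ≡ + 0
    s1 = ∑-anti (invol-inj bar-inv) (λ x → K x * ω x) (λ x → trans (cong₂ _*_ (Kbar x) (ω-bar x)) (sym (ℤₚ.neg-distribʳ-* (K x) (ω x))))
    s2 : ∑ (λ x → K x * η (φ x)) ≡ ∑ (λ x → K x * η x)
    s2 = trans (∑-cong (λ x → cong (_* η (φ x)) (sym (Kφ x)))) (∑-perm φ-inj (λ x → K x * η x))
    main : + g * ∑ (λ x → K x * J x) ≡ + 0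
    main = trans (sym (∑-* (+ g) (λ x → K x * J x))) (trans (∑-cong (λ x → lem (K x) (η x) (η (φ x)) (ω x) (+ g) (J x) (η-φ x)))
      (trans (∑-- (λ x → K x * ω x) (λ x → K x * η (φ x) - K x * η x)) (trans (cong₂ _-_ s1 (trans (∑-- (λ x → K x * η (φ x)) (λ x → K x * η x))
         (trans (cong (_- ∑ (λ x → K x * η x)) s2) (ℤₚ.+-inverseʳ (∑ (λ x → K x * η x)))))) refl)))

  -- Without an opposite mark every product of `J x` with a selected mark would be nonnegative, and
  -- the one at `x` positive, although the selected marks sum to zero.
  mark-partner : (K : Fin n → Bool) (η ω J : Fin n → ℤ) (g : ℕ) .{{_ : ℕ.NonZero g}} → (∀ x → K (φ x) ≡ K x) → (∀ x → K (bar x) ≡ K x) →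
    (∀ x → ω (bar x) ≡ - ω x) → (∀ x → η (φ x) ≡ η x + ω x - + g * J x) → (∀ x → J x ≡ + 0 ⊎ J x ≡ + 1 ⊎ J x ≡ - + 1) →
    ∀ x → K x ≡ true → J x ≢ + 0 → ∃ λ y → K y ≡ true × J y ≡ - J x
  mark-partner K η ω J g Kφ Kbar ω-bar η-φ J-val x Kx Jx
    with Finₚ.any? (λ y → (K y ∧ does (J y ℤ.≟ - J x)) Boolₚ.≟ true)
  ... | yes (y , h) with ∧-split {K y} h
  ... | Ky , h' with J y ℤ.≟ - J x
  ... | yes e = y , Ky , e
  mark-partner K η ω J g Kφ Kbar ω-bar η-φ J-val x Kx Jx | yes (y , h) | Ky , () | no _
  mark-partner K η ω J g Kφ Kbar ω-bar η-φ J-val x Kx Jx | no none = ⊥-elim (nonzero (∑-nonneg-zero f f≥0 f0 x))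
    where
    f : Fin n → ℤ
    f y = J x * (⟦ K y ⟧ * J y)
    f0 : ∑ f ≡ + 0
    f0 = trans (∑-* (J x) (λ y → ⟦ K y ⟧ * J y)) (trans (cong (J x *_) (mark-sum (⟦_⟧ ∘ K) η ω J g (cong ⟦_⟧ ∘ Kφ) (cong ⟦_⟧ ∘ Kbar) ω-bar η-φ)) (ℤₚ.*-zeroʳ (J x)))
    nonzero : f x ≢ + 0
    nonzero e rewrite Kx = nz (J x) (J-val x) Jx e
      where
      nz : ∀ j → j ≡ + 0 ⊎ j ≡ + 1 ⊎ j ≡ - + 1 → j ≢ + 0 → j * (+ 1 * j) ≢ + 0
      nz j (inj₁ refl) h _ = h refl
      nz j (inj₂ (inj₁ refl)) h ()
      nz j (inj₂ (inj₂ refl)) h ()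
    opposite : ∀ y → K y ≡ true → J y ≢ - J x
    opposite y Ky e = none (y , cong₂ _∧_ Ky (dec-true (J y ℤ.≟ - J x) e))
    f≥0 : ∀ y → + 0 ℤ.≤ f y
    f≥0 y with K y in Ky
    ... | false rewrite ℤₚ.*-zeroʳ (J x) = ℤₚ.≤-refl
    ... | true = pos (J x) (J y) (J-val x) (J-val y) (opposite y Ky)
      where
      pos : ∀ i j → i ≡ + 0 ⊎ i ≡ + 1 ⊎ i ≡ - + 1 → j ≡ + 0 ⊎ j ≡ + 1 ⊎ j ≡ - + 1 → j ≢ - i → + 0 ℤ.≤ i * (+ 1 * j)
      pos _ _ (inj₁ refl) _ _ = ℤₚ.≤-refl
      pos _ _ (inj₂ (inj₁ refl)) (inj₁ refl) _ = ℤₚ.≤-refl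
      pos _ _ (inj₂ (inj₁ refl)) (inj₂ (inj₁ refl)) _ = ℤ.+≤+ z≤n
      pos _ _ (inj₂ (inj₁ refl)) (inj₂ (inj₂ refl)) h = ⊥-elim (h refl)
      pos _ _ (inj₂ (inj₂ refl)) (inj₁ refl) _ = ℤₚ.≤-refl
      pos _ _ (inj₂ (inj₂ refl)) (inj₂ (inj₁ refl)) h = ⊥-elim (h refl)
      pos _ _ (inj₂ (inj₂ refl)) (inj₂ (inj₂ refl)) _ = ℤ.+≤+ z≤n

  -- Vertices see heights only modulo `g`, so each face can be moved by its own multiple of `g`; the
  -- change is absorbed by `e`.
  state-shift : ∀ {g D} → State g D φ bar → (f : Fin n → ℤ) → (∀ x → f (φ x) ≡ f x) → State g D φ bar
  state-shift {g} s f fφ = record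
    { State s
    ; η = λ x → η x + + g * f x
    ; e = λ x → e x + (f (φ (bar x)) - f x)
    ; η-φ = λ x → trans (cong₂ (λ u v → u + + g * v) (η-φ x) (fφ x)) (l1 (η x) (ω x) (+ g) (J x) (f x))
    ; η-τ = λ x → trans (cong (λ u → u + + g * f (φ (bar x))) (η-τ x)) (l2 (η x) (e x) (+ g) (f (φ (bar x))) (f x)) }
    where
    open State s
    l1 : ∀ η w g j f → η + w - g * j + g * f ≡ η + g * f + w - g * j
    l1 = solve-∀
    l2 : ∀ η e g f' f → η + g * e + g * f' ≡ η + g * f + g * (e + (f' - f))
    l2 = solve-∀

  state-raise : ∀ {g D} → State g D φ bar → (f : Fin n → ℤ) → (∀ x → f (φ x) ≡ f x) → (∀ x → f (bar x) ≡ f x) → State g D φ bar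
  state-raise {g} s f fφ fbar = record
    { State s
    ; η = λ x → η x + f x
    ; η-φ = λ x → trans (cong₂ _+_ (η-φ x) (fφ x)) (l1 (η x) (ω x) (+ g) (J x) (f x))
    ; η-τ = λ x → trans (cong₂ _+_ (η-τ x) (trans (fφ (bar x)) (fbar x))) (l2 (η x) (e x) (+ g) (f x)) }
    where
    open State s
    l1 : ∀ η w g j f → η + w - g * j + f ≡ η + f + w - g * j
    l1 = solve-∀
    l2 : ∀ η e g f → η + g * e + f ≡ η + f + g * e
    l2 = solve-∀

-- Gluing two vertices, and splitting one, multiplies the face permutation by a transposition.
module Swap {n : ℕ} {φ φ' bar : Fin n → Fin n} (o : Perms φ bar)
  {a b : Fin n} (eq : ∀ x → φ' x ≡ swapF a b (φ x)) where
  open Perms o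

  eq⁻ : ∀ x → φ x ≡ swapF a b (φ' x)
  eq⁻ x = trans (sym (swap-invol a b (φ x))) (cong (swapF a b) (sym (eq x)))

  φ'-inj : Inj φ'
  φ'-inj {x} {y} h = φ-inj (trans (eq⁻ x) (trans (cong (swapF a b) h) (sym (eq⁻ y))))

  o' : Perms φ' bar
  o' = record { φ-inj = φ'-inj ; bar-inv = bar-inv }

  along : {A : Set} (h : Fin n → A) → h a ≡ h b → ∀ x → h (φ' x) ≡ h (φ x)
  along h e x = trans (cong h (eq x)) (swap-inv h e (φ x))

  conn-swap : reach (φ ∷ bar ∷ []) a b ≡ true → ∀ x y → reach (φ' ∷ bar ∷ []) x y ≡ true → reach (φ ∷ bar ∷ []) x y ≡ true
  conn-swap ab x y h = trans (conn-fun o' (reach (φ ∷ bar ∷ []) x)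
    (λ z → trans (along (reach (φ ∷ bar ∷ []) x) (sym (reach-fun (φ ∷ bar ∷ []) a b (reach (φ ∷ bar ∷ []) x) (λ { (here refl) → conn-φ o x ; (there (here refl)) → conn-bar o x }) ab)) z) (conn-φ o x z))
    (conn-bar o x) x y h) (reach-refl (φ ∷ bar ∷ []) x)

  -- With equal integer heights at `a` and `b` the transposition is invisible to `η`, and since it
  -- joins nothing new, uniqueness of marks is kept.
  state-swap : ∀ {g D} (s : State g D φ bar) → State.η s a ≡ State.η s b → reach (φ ∷ bar ∷ []) a b ≡ true → State g D φ' bar
  state-swap s ηab ab = record
    { State s
    ; η-φ = λ x → trans (along η ηab x) (η-φ x)
    ; η-τ = λ x → trans (along η ηab (bar x)) (η-τ x)
    ; J-uniq = λ x y h → J-uniq x y (conn-swap ab x y h) }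
    where open State s

  -- A witness `q` for the faces of `φ` serves those of `φ'` only if it agrees at `a` and `b`.
  -- Subtracting from `ζ` the differential of a multiple of `v`, which lives on the vertices of `φ`,
  -- achieves this; the multiple is added to the potential again at the end.
  exact-split-vertex : (v : Fin n → ℤ) → v a ≡ + 1 → v b ≡ + 0 → (∀ x → v (φ (bar x)) ≡ v x) →
    reach (φ' ∘ bar ∷ []) a b ≡ true → Exact φ' bar → Exact φ bar
  exact-split-vertex v va vb vτ ya ex ζ q ζ-bar q-φ = result
    where
    vφ : ∀ x → v (bar x) ≡ v (φ x)
    vφ x = trans (sym (vτ (bar x))) (cong (v ∘ φ) (bar-inv x))
    s = q a - q b
    ζ' q' : Fin n → ℤ
    ζ' x = ζ x - s * (v (φ x) - v x)
    q' x = q x - s * v x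
    ζ'-bar : ∀ x → ζ' (bar x) ≡ - ζ' x
    ζ'-bar x rewrite ζ-bar x | vτ x | vφ x = lem (ζ x) s (v x) (v (φ x))
      where
      lem : ∀ z s v v' → - z - s * (v - v') ≡ - (z - s * (v' - v))
      lem = solve-∀
    q'ab : q' a ≡ q' b
    q'ab rewrite va | vb = lem (q a) (q b)
      where
      lem : ∀ a b → a - (a - b) * + 1 ≡ b - (a - b) * + 0
      lem = solve-∀
    q'-φ : ∀ x → q' (φ' x) ≡ q' x + ζ' x
    q'-φ x = trans (along q' q'ab x) (trans (cong (λ z → z - s * v (φ x)) (q-φ x)) (lem (q x) (ζ x) s (v x) (v (φ x))))
      where
      lem : ∀ q z s v v' → q + z - s * v' ≡ q - s * v + (z - s * (v' - v))
      lem = solve-∀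
    P = ex ζ' q' ζ'-bar q'-φ
    p' = proj₁ P
    p'ab : p' a ≡ p' b
    p'ab = sym (τ-fun o' p' (proj₁ (proj₂ P)) a b ya)
    result : Σ (Fin n → ℤ) λ p → (∀ x → p (φ (bar x)) ≡ p x) × (∀ x → p (φ x) ≡ p x + ζ x)
    result = (λ x → p' x + s * v x)
      , (λ x → cong₂ (λ y z → y + s * z) (trans (sym (along p' p'ab (bar x))) (proj₁ (proj₂ P) x)) (vτ x))
      , (λ x → trans (cong (λ y → y + s * v (φ x)) (trans (sym (along p' p'ab x)) (proj₂ (proj₂ P) x))) (lem (p' x) (ζ x) s (v x) (v (φ x))))
      where
      lem : ∀ p z s v v' → p + (z - s * (v' - v)) + s * v' ≡ p + s * v + z
      lem = solve-∀

  exact-split : reach (φ ∘ bar ∷ []) a b ≡ false → reach (φ' ∘ bar ∷ []) a b ≡ true → Exact φ' bar → Exact φ bar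
  exact-split na = exact-split-vertex (λ x → ⟦ reach (φ ∘ bar ∷ []) a x ⟧) (cong ⟦_⟧ (reach-refl (φ ∘ bar ∷ []) a))
    (cong ⟦_⟧ na) (λ x → cong ⟦_⟧ (reach-inv (φ ∘ bar ∷ []) a (here refl) (τ-inj o) x))

  -- The transposition cuts the common face of `a` and `b` in two, and `f` tells the pieces apart.
  -- Moving the witness by a constant on one piece makes it a witness for the uncut face. Along that
  -- face the potential differs from the witness by a constant, so it agrees at `a` and `b` and
  -- descends to the merged vertex.
  exact-merge-arc : (f : Fin n → ℤ) → f a ≡ + 1 → f b ≡ + 0 → (∀ x → f (φ' x) ≡ f x) →
    reach (φ ∷ []) a b ≡ true → Exact φ bar → Exact φ' bar
  exact-merge-arc f fa fb fφ ab ex ζ q' ζ-bar q'-φ = p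
      , (λ x → trans (along p pab (bar x)) (proj₁ (proj₂ P) x)) , (λ x → trans (along p pab x) (proj₂ (proj₂ P) x))
    where
    q : Fin n → ℤ
    q x = q' x + (q' b - q' a) * f x
    qab : q a ≡ q b
    qab rewrite fa | fb = lem (q' a) (q' b)
      where
      lem : ∀ a b → a + (b - a) * + 1 ≡ b + (b - a) * + 0
      lem = solve-∀
    q-φ : ∀ x → q (φ x) ≡ q x + ζ x
    q-φ x = trans (sym (along q qab x)) (trans (cong₂ (λ y z → y + (q' b - q' a) * z) (q'-φ x) (fφ x)) (lem (q' x) (ζ x) ((q' b - q' a) * f x)))
      where
      lem : ∀ q z w → q + z + w ≡ q + w + z
      lem = solve-∀
    P = ex ζ q ζ-bar q-φ
    p = proj₁ P
    diff : ∀ x → p (φ x) - q (φ x) ≡ p x - q x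
    diff x = trans (cong₂ _-_ (proj₂ (proj₂ P) x) (q-φ x)) (lem (p x) (q x) (ζ x))
      where
      lem : ∀ p q z → p + z - (q + z) ≡ p - q
      lem = solve-∀
    pab : p a ≡ p b
    pab = trans (lem (p a) (q a)) (trans (cong₂ _+_ (sym (reach-fun (φ ∷ []) a b (λ x → p x - q x) (λ { (here refl) → diff }) ab)) qab) (sym (lem (p b) (q b))))
      where
      lem : ∀ p q → p ≡ p - q + q
      lem = solve-∀

  exact-merge-face : a ≢ b → reach (φ ∷ []) a b ≡ true → Exact φ bar → Exact φ' bar
  exact-merge-face a≢b ab = exact-merge-arc (λ x → ⟦ reach (φ' ∷ []) a x ⟧) (cong ⟦_⟧ (reach-refl (φ' ∷ []) a))
    (cong ⟦_⟧ (split-cycle φ-inj a≢b eq ab)) (λ x → cong ⟦_⟧ (reach-inv (φ' ∷ []) a (here refl) φ'-inj x)) ab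

  -- Here two faces merge, and the witness must be shown to agree at `a` and `b`. The sum of `ζ`
  -- over the side `K` vanishes by antisymmetry, while the witness evaluates it to `q b - q a`. The
  -- potential is then moved by a constant on `K` until it agrees at `a` and `b` as well.
  exact-merge-sides : (K : Fin n → ℤ) → K a ≡ + 1 → K b ≡ + 0 → (∀ x → K (φ x) ≡ K x) → (∀ x → K (bar x) ≡ K x) →
    Exact φ bar → Exact φ' bar
  exact-merge-sides K Ka Kb Kφ Kbar ex ζ q ζ-bar q-φ' = p'
      , (λ x → trans (along p' p'ab (bar x)) (cong₂ (λ y z → y + c * z) (proj₁ (proj₂ P) x) (trans (Kφ (bar x)) (Kbar x))))
      , (λ x → trans (along p' p'ab x) (trans (cong₂ (λ y z → y + c * z) (proj₂ (proj₂ P) x) (Kφ x)) (lem (p x) (ζ x) (c * K x))))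
    where
    -- `q (φ' x)` is `u (φ x)`, so sums weighted by `K` can be reindexed along `φ`, which preserves
    -- `K`, whereas `φ'` does not.
    u : Fin n → ℤ
    u x = q (swapF a b x)
    s1 : ∑ (λ x → K x * ζ x) ≡ + 0
    s1 = ∑-anti (invol-inj bar-inv) (λ x → K x * ζ x) (λ x → trans (cong₂ _*_ (Kbar x) (ζ-bar x)) (sym (ℤₚ.neg-distribʳ-* (K x) (ζ x))))
    s2 : ∑ (λ x → K x * u (φ x)) ≡ ∑ (λ x → K x * u x)
    s2 = trans (∑-cong (λ x → cong (_* u (φ x)) (sym (Kφ x)))) (∑-perm φ-inj (λ x → K x * u x))
    s3 : ∑ (λ x → K x * u x - K x * q x) ≡ q b - q a
    s3 = trans (∑-δ a (λ x → K x * u x - K x * q x) off) at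
      where
      at : K a * u a - K a * q a ≡ q b - q a
      at rewrite Ka | swap-a a b | ℤₚ.*-identityˡ (q a) | ℤₚ.*-identityˡ (q b) = refl
      off : ∀ x → x ≢ a → K x * u x - K x * q x ≡ + 0
      off x x≢a = go (x Fin.≟ b)
       where
       go : Dec (x ≡ b) → K x * u x - K x * q x ≡ + 0
       go (yes refl) rewrite Kb = refl
       go (no x≢b) = trans (cong (λ z → K x * z - K x * q x) (cong q (swap-other x≢a x≢b))) (ℤₚ.+-inverseʳ (K x * q x))
    s4 : ∑ (λ x → K x * ζ x) ≡ ∑ (λ x → K x * u (φ x)) - ∑ (λ x → K x * q x)
    s4 = trans (∑-cong (λ x → trans (lem4 (K x) (ζ x) (q x)) (cong (λ z → K x * z - K x * q x) (trans (sym (q-φ' x)) (cong q (eq x))))))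
      (∑-- (λ x → K x * u (φ x)) (λ x → K x * q x))
      where
      lem4 : ∀ k z q → k * z ≡ k * (q + z) - k * q
      lem4 = solve-∀
    qba : q b - q a ≡ + 0
    qba = trans (sym s3) (trans (∑-- (λ x → K x * u x) (λ x → K x * q x)) (trans (cong (_- ∑ (λ x → K x * q x)) (sym s2)) (trans (sym s4) s1)))
    qab : q a ≡ q b
    qab = sym (ℤₚ.i-j≡0⇒i≡j (q b) (q a) qba)
    P = ex ζ q ζ-bar (λ x → trans (sym (along q qab x)) (q-φ' x))
    p = proj₁ P
    c = p b - p a
    p' : Fin n → ℤ
    p' x = p x + c * K x
    p'ab : p' a ≡ p' b
    p'ab = trans (cong (λ z → p a + c * z) Ka) (trans (lem' (p a) (p b)) (cong (λ z → p b + c * z) (sym Kb)))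
      where
      lem' : ∀ a b → a + (b - a) * + 1 ≡ b + (b - a) * + 0
      lem' = solve-∀
    lem : ∀ p z w → p + z + w ≡ p + w + z
    lem = solve-∀

  exact-merge-components : reach (φ ∷ bar ∷ []) a b ≡ false → Exact φ bar → Exact φ' bar
  exact-merge-components nab = exact-merge-sides (λ x → ⟦ reach (φ ∷ bar ∷ []) a x ⟧) (cong ⟦_⟧ (reach-refl (φ ∷ bar ∷ []) a))
    (cong ⟦_⟧ nab) (λ x → cong ⟦_⟧ (conn-φ o a x)) (λ x → cong ⟦_⟧ (conn-bar o a x))

-- Signs of marks

Sign : ℤ → Set
Sign j = j ≡ + 0 ⊎ j ≡ + 1 ⊎ j ≡ - + 1

sign-split : ∀ {j s} → Sign j → s ≡ + 1 ⊎ s ≡ - + 1 → j ≡ + 0 ⊎ j ≡ s ⊎ j ≡ - s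
sign-split (inj₁ e) _ = inj₁ e
sign-split (inj₂ (inj₁ refl)) (inj₁ refl) = inj₂ (inj₁ refl)
sign-split (inj₂ (inj₁ refl)) (inj₂ refl) = inj₂ (inj₂ refl)
sign-split (inj₂ (inj₂ refl)) (inj₁ refl) = inj₂ (inj₂ refl)
sign-split (inj₂ (inj₂ refl)) (inj₂ refl) = inj₂ (inj₁ refl)

sign-unit : ∀ {s} → s ≡ + 1 ⊎ s ≡ - + 1 → Sign s
sign-unit (inj₁ e) = inj₂ (inj₁ e)
sign-unit (inj₂ e) = inj₂ (inj₂ e)

sign-neg : ∀ {j} → Sign j → Sign (- j)
sign-neg (inj₁ refl) = inj₁ refl
sign-neg (inj₂ (inj₁ refl)) = inj₂ (inj₂ refl)
sign-neg (inj₂ (inj₂ refl)) = inj₂ (inj₁ refl)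

unit≢0 : ∀ {s} → s ≡ + 1 ⊎ s ≡ - + 1 → s ≢ + 0
unit≢0 (inj₁ refl) ()
unit≢0 (inj₂ refl) ()

sign≢0 : ∀ {j} → Sign j → j ≢ + 0 → j ≡ + 1 ⊎ j ≡ - + 1
sign≢0 (inj₁ e) h = ⊥-elim (h e)
sign≢0 (inj₂ h) _ = h

unit≢neg : ∀ {s} → s ≡ + 1 ⊎ s ≡ - + 1 → s ≢ - s
unit≢neg (inj₁ refl) ()
unit≢neg (inj₂ refl) ()

search : ∀ {n} {P : Fin n → Set} → (∀ x → Dec (P x)) → (∃ P) ⊎ (∀ x → ¬ P x)
search P? with Finₚ.any? P?
... | yes h = inj₁ h
... | no h = inj₂ (λ x p → h (x , p))

-- Marks can be pushed backwards along a face.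
module Clear {n : ℕ} {φ bar : Fin n → Fin n} (o : Perms φ bar)
  {g : ℕ} {D : Fin n → Bool} (s : State g D φ bar) (x : Fin n) (moves : φ x ≢ x) where
  open Perms o
  open State s
  private
    y = φ x
    j = J y
    η' J' : Fin n → ℤ
    η' z = η z - + g * j * δ y z
    J' z = J z + j * (δ x z - δ y z)

    J'-x : J' x ≡ J x + j
    J'-x = trans (cong₂ (λ u v → J x + j * (u - v)) (δ-same x) (δ-diff (moves ∘ sym))) (lem (J x) j)
      where
      lem : ∀ a j → a + j * (+ 1 - + 0) ≡ a + j
      lem = solve-∀
    J'-y : J' y ≡ + 0
    J'-y = trans (cong₂ (λ u v → j + j * (u - v)) (δ-diff moves) (δ-same y)) (lem j)
      where
      lem : ∀ j → j + j * (+ 0 - + 1) ≡ + 0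
      lem = solve-∀
    J'-other : ∀ z → z ≢ x → z ≢ y → J' z ≡ J z
    J'-other z p q = trans (cong₂ (λ u v → J z + j * (u - v)) (δ-diff p) (δ-diff q)) (lem (J z) j)
      where
      lem : ∀ a j → a + j * (+ 0 - + 0) ≡ a
      lem = solve-∀

    conn-xy : reach (φ ∷ bar ∷ []) x y ≡ true
    conn-xy = reach-step (φ ∷ bar ∷ []) x (here refl) x (reach-refl (φ ∷ bar ∷ []) x)

    -- Two neighbouring marks of the same sign would coincide by uniqueness. So a pushed mark never
    -- accumulates: it cancels against an opposite one, moves to a free place, or there was nothing
    -- to push.
    J'x-cases : J' x ≡ + 0 ⊎ (J x ≡ + 0 × J' x ≡ j) ⊎ (j ≡ + 0 × J' x ≡ J x)
    J'x-cases with J-val y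
    ... | inj₁ j0 = inj₂ (inj₂ (j0 , trans J'-x (trans (cong (λ z → J x + z) j0) (ℤₚ.+-identityʳ (J x)))))
    ... | inj₂ ju with sign-split (J-val x) ju
    ... | inj₁ e = inj₂ (inj₁ (e , trans J'-x (trans (cong (_+ j) e) (ℤₚ.+-identityˡ j))))
    ... | inj₂ (inj₁ e) = ⊥-elim (moves (sym (J-uniq x y conn-xy e (λ z → unit≢0 ju (trans (sym e) z)))))
    ... | inj₂ (inj₂ e) = inj₁ (trans J'-x (trans (cong (_+ j) e) (ℤₚ.+-inverseˡ j)))

    J'-val : ∀ z → Sign (J' z)
    J'-val z = go (z Fin.≟ x) (z Fin.≟ y)
      where
      go : Dec (z ≡ x) → Dec (z ≡ y) → Sign (J' z)
      go (yes refl) _ with J'x-cases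
      ... | inj₁ e = inj₁ e
      ... | inj₂ (inj₁ (_ , e)) = subst Sign (sym e) (J-val y)
      ... | inj₂ (inj₂ (_ , e)) = subst Sign (sym e) (J-val x)
      go _ (yes refl) = inj₁ J'-y
      go (no p) (no q) = subst Sign (sym (J'-other z p q)) (J-val z)

    uniq-x : ∀ z → z ≢ x → z ≢ y → reach (φ ∷ bar ∷ []) x z ≡ true → J' x ≡ J' z → J' x ≢ + 0 → ⊥
    uniq-x z p q c e nz with J'x-cases
    ... | inj₁ e0 = nz e0
    ... | inj₂ (inj₁ (_ , ej)) = q (sym (J-uniq y z
          (conn-trans o y x z (conn-sym o x y conn-xy) c)
          (trans (sym ej) (trans e (J'-other z p q))) (λ h → nz (trans ej h))))
    ... | inj₂ (inj₂ (_ , ex)) = p (sym (J-uniq x z c (trans (sym ex) (trans e (J'-other z p q))) (λ h → nz (trans ex h))))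

    J'-uniq : ∀ z w → reach (φ ∷ bar ∷ []) z w ≡ true → J' z ≡ J' w → J' z ≢ + 0 → z ≡ w
    J'-uniq z w c e nz = go (z Fin.≟ y) (w Fin.≟ y) (z Fin.≟ x) (w Fin.≟ x)
      where
      go : Dec (z ≡ y) → Dec (w ≡ y) → Dec (z ≡ x) → Dec (w ≡ x) → z ≡ w
      go (yes refl) _ _ _ = ⊥-elim (nz J'-y)
      go _ (yes refl) _ _ = ⊥-elim (nz (trans e J'-y))
      go _ _ (yes refl) (yes refl) = refl
      go _ (no q) (yes refl) (no p) = ⊥-elim (uniq-x w p q c e nz)
      go (no q) _ (no p) (yes refl) = ⊥-elim (uniq-x z p q (conn-sym o z w c) (sym e) (λ h → nz (trans e h)))
      go (no q) (no q') (no p) (no p') = J-uniq z w c (trans (sym (J'-other z p q)) (trans e (J'-other w p' q'))) (λ h → nz (trans (J'-other z p q) h))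

    δ-φ : ∀ z → δ y (φ z) ≡ δ x z
    δ-φ z = go (z Fin.≟ x)
      where
      go : Dec (z ≡ x) → δ y (φ z) ≡ δ x z
      go (yes refl) = trans (δ-same y) (sym (δ-same x))
      go (no p) = trans (δ-diff (λ h → p (φ-inj h))) (sym (δ-diff p))

  clear : State g D φ bar
  clear = record
    { State s
    ; η = η' ; J = J' ; e = λ z → e z + j * (δ y z - δ y (φ (bar z)))
    ; η-φ = λ z → trans (cong₂ (λ u v → u - + g * j * v) (η-φ z) (δ-φ z)) (l1 (η z) (ω z) (+ g) (J z) j (δ x z) (δ y z))
    ; η-τ = λ z → trans (cong (_- + g * j * δ y (φ (bar z))) (η-τ z)) (l2 (η z) (e z) (+ g) j (δ y z) (δ y (φ (bar z))))
    ; J-val = J'-val ; J-uniq = J'-uniq }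
    where
    l1 : ∀ η w g a j d d' → η + w - g * a - g * j * d ≡ η - g * j * d' + w - g * (a + j * (d - d'))
    l1 = solve-∀
    l2 : ∀ η e g j d d' → η + g * e - g * j * d' ≡ η - g * j * d + g * (e + j * (d - d'))
    l2 = solve-∀

  clear-J : State.J clear (φ x) ≡ + 0
  clear-J = J'-y

  clear-J-other : ∀ z → z ≢ x → J z ≡ + 0 → State.J clear z ≡ + 0
  clear-J-other z p h = go (z Fin.≟ y)
    where
    go : Dec (z ≡ y) → J' z ≡ + 0
    go (yes refl) = J'-y
    go (no q) = trans (J'-other z p q) h

-- Marks under a transposition of darts

module Jump {n : ℕ} {φ φ' bar : Fin n → Fin n} (o : Perms φ bar)
  {a b : Fin n} (a≢b : a ≢ b) (eq : ∀ x → φ' x ≡ swapF a b (φ x)) where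

  -- Only the darts before `a` and before `b` get a new successor. A height difference `g * t`
  -- between `a` and `b` is therefore charged to the marks of these two darts, with opposite signs.
  turn : Fin n → ℤ
  turn z = δ a (φ z) - δ b (φ z)

  turn-a : ∀ z → φ z ≡ a → turn z ≡ + 1
  turn-a z refl = cong₂ _-_ (δ-same (φ z)) (δ-diff a≢b)

  turn-b : ∀ z → φ z ≡ b → turn z ≡ - + 1
  turn-b z refl = cong₂ _-_ (δ-diff (a≢b ∘ sym)) (δ-same (φ z))

  turn-other : ∀ z → φ z ≢ a → φ z ≢ b → turn z ≡ + 0
  turn-other z p q = cong₂ _-_ (δ-diff p) (δ-diff q)

  height-jump : ∀ {g D} (s : State g D φ bar) (t : ℤ) → State.η s b ≡ State.η s a + + g * t →
    ∀ z → State.η s (φ' z) ≡ State.η s (φ z) + + g * (t * turn z)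
  height-jump {g} s t ηb z = go (φ z Fin.≟ a) (φ z Fin.≟ b)
    where
    open State s
    l3 : ∀ η g t → η + g * t ≡ η + g * (t * + 1)
    l3 = solve-∀
    l4 : ∀ η g t → η ≡ η + g * t + g * (t * - + 1)
    l4 = solve-∀
    l5 : ∀ η g t → η ≡ η + g * (t * + 0)
    l5 = solve-∀
    go : Dec (φ z ≡ a) → Dec (φ z ≡ b) → η (φ' z) ≡ η (φ z) + + g * (t * turn z)
    go (yes p) _ = trans (cong η (trans (eq z) (trans (cong (swapF a b) p) (swap-a a b)))) (trans ηb
      (trans (l3 (η a) (+ g) t) (cong₂ (λ u v → η u + + g * (t * v)) (sym p) (sym (turn-a z p)))))
    go _ (yes q) = trans (cong η (trans (eq z) (trans (cong (swapF a b) q) (swap-b a b)))) (trans (l4 (η a) (+ g) t)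
      (trans (cong (_+ + g * (t * - + 1)) (sym ηb)) (cong₂ (λ u v → η u + + g * (t * v)) (sym q) (sym (turn-b z q)))))
    go (no p) (no q) = trans (cong η (trans (eq z) (swap-other p q))) (trans (l5 (η (φ z)) (+ g) t)
      (cong (λ v → η (φ z) + + g * (t * v)) (sym (turn-other z p q))))

  face-jump : ∀ {g D} (s : State g D φ bar) (t : ℤ) → State.η s b ≡ State.η s a + + g * t →
    ∀ z → State.η s (φ' z) ≡ State.η s z + State.ω s z - + g * (State.J s z - t * turn z)
  face-jump {g} s t ηb z = trans (height-jump s t ηb z) (trans (cong (_+ + g * (t * turn z)) (η-φ z)) (l1 (η z) (ω z) (+ g) (J z) (t * turn z)))
    where
    open State s
    l1 : ∀ η w g j u → η + w - g * j + g * u ≡ η + w - g * (j - u)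
    l1 = solve-∀

  state-jump : ∀ {g D} (s : State g D φ bar) (t : ℤ) → State.η s b ≡ State.η s a + + g * t →
    (∀ z → Sign (State.J s z - t * turn z)) →
    (∀ x y → reach (φ' ∷ bar ∷ []) x y ≡ true → State.J s x - t * turn x ≡ State.J s y - t * turn y → State.J s x - t * turn x ≢ + 0 → x ≡ y) →
    State g D φ' bar
  state-jump {g} s t ηb val uniq = record
    { State s
    ; J = λ z → J z - t * turn z ; e = λ z → e z + t * turn (bar z)
    ; η-φ = face-jump s t ηb
    ; η-τ = λ z → trans (height-jump s t ηb (bar z)) (trans (cong (_+ + g * (t * turn (bar z))) (η-τ z)) (l2 (η z) (e z) (+ g) (t * turn (bar z))))
    ; J-val = val ; J-uniq = uniq }
    where
    open State s
    l2 : ∀ η e g u → η + g * e + g * u ≡ η + g * (e + u)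
    l2 = solve-∀

module Unglue {n : ℕ} {φ φ' bar : Fin n → Fin n} (o : Perms φ bar)
  {a b : Fin n} (a≢b : a ≢ b) (eq : ∀ x → φ' x ≡ swapF a b (φ x))
  {g : ℕ} {D : Fin n → Bool} (s : State g D φ' bar) (ab : reach (φ' ∘ bar ∷ []) a b ≡ true) where
  open Perms o
  open Swap o eq using (eq⁻; φ'-inj; o')
  open State s
  private
    module R = Swap o' eq⁻
    module RJ = Jump o' a≢b eq⁻
    Conn Conn' : Fin n → Fin n → Bool
    Conn  = reach (φ ∷ bar ∷ [])
    Conn' = reach (φ' ∷ bar ∷ [])
    ab' : Conn' a b ≡ true
    ab' = τ-conn o' a b ab
    jump = τ-cong o' s a b ab
    d = _≡_[_].multiple jump
    ηb : η b ≡ η a + + g * d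
    ηb = _≡_[_].equation jump

  -- The gluing has cut the common face, so `a` and `b` lie on different faces of `φ'`; moving one
  -- of these faces by a multiple of `g` makes the two heights equal.
  state-unglue-face : reach (φ ∷ []) a b ≡ true → State g D φ bar
  state-unglue-face face = R.state-swap (state-shift o' s f f-φ) ηab ab'
    where
    f : Fin n → ℤ
    f x = d * ⟦ reach (φ' ∷ []) a x ⟧
    f-φ : ∀ x → f (φ' x) ≡ f x
    f-φ x = cong (λ z → d * ⟦ z ⟧) (reach-inv (φ' ∷ []) a (here refl) φ'-inj x)
    ηab : η a + + g * f a ≡ η b + + g * f b
    ηab = trans (cong (λ z → η a + + g * (d * ⟦ z ⟧)) (reach-refl (φ' ∷ []) a)) (trans (lem (η a) (+ g) d)
      (trans (cong (_+ + g * (d * + 0)) (sym ηb)) (cong (λ z → η b + + g * (d * ⟦ z ⟧)) (sym (split-cycle φ-inj a≢b eq face)))))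
      where
      lem : ∀ η g d → η + g * (d * + 1) ≡ η + g * d + g * (d * + 0)
      lem = solve-∀

  module _ .{{_ : ℕ.NonZero g}} (nab : Conn a b ≡ false) where
    private
      K : Fin n → Bool
      K = Conn a
      Kφ : ∀ x → K (φ x) ≡ K x
      Kφ = conn-φ o a
      Kbar : ∀ x → K (bar x) ≡ K x
      Kbar = conn-bar o a
      Ka : K a ≡ true
      Ka = reach-refl (φ ∷ bar ∷ []) a
      xa xb : Fin n
      xa = inverse φ-inj a
      xb = inverse φ-inj b
      J₁ : ℤ → Fin n → ℤ
      J₁ t x = J x - t * RJ.turn x
      up : ∀ x y → Conn x y ≡ true → Conn' x y ≡ true
      up = R.conn-swap ab'

      φ'xa : φ' xa ≡ b
      φ'xa = trans (eq xa) (trans (cong (swapF a b) (inverseʳ φ-inj a)) (swap-a a b))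
      φ'xb : φ' xb ≡ a
      φ'xb = trans (eq xb) (trans (cong (swapF a b) (inverseʳ φ-inj b)) (swap-b a b))
      Kxa : K xa ≡ true
      Kxa = trans (sym (Kφ xa)) (trans (cong K (inverseʳ φ-inj a)) Ka)
      Kxb : K xb ≡ false
      Kxb = trans (sym (Kφ xb)) (trans (cong K (inverseʳ φ-inj b)) nab)
      J₁-xa : ∀ t → J₁ t xa ≡ J xa + t
      J₁-xa t = trans (cong (λ z → J xa - t * z) (RJ.turn-b xa φ'xa)) (lem (J xa) t)
        where
        lem : ∀ j t → j - t * - + 1 ≡ j + t
        lem = solve-∀
      J₁-xb : ∀ t → J₁ t xb ≡ J xb - t
      J₁-xb t = trans (cong (λ z → J xb - t * z) (RJ.turn-a xb φ'xb)) (lem (J xb) t)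
        where
        lem : ∀ j t → j - t * + 1 ≡ j - t
        lem = solve-∀
      J₁-other : ∀ t x → x ≢ xa → x ≢ xb → J₁ t x ≡ J x
      J₁-other t x p q = trans (cong (λ z → J x - t * z) (RJ.turn-other x (λ h → q (φ'-inj (trans h (sym φ'xb)))) (λ h → p (φ'-inj (trans h (sym φ'xa)))))) (lem (J x) t)
        where
        lem : ∀ j t → j - t * + 0 ≡ j
        lem = solve-∀

      total : ∑ (λ x → ⟦ K x ⟧ * J₁ d x) ≡ + 0
      total = mark-sum o (⟦_⟧ ∘ K) η ω (J₁ d) g (cong ⟦_⟧ ∘ Kφ) (cong ⟦_⟧ ∘ Kbar) ω-bar
        (RJ.face-jump s d ηb)

      -- After the separation the marks on `K` must sum to zero, and the only change to the old
      -- marks on `K` is the contribution `d` at `xa`.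
      d-sum : d ≡ - ∑ (λ x → ⟦ K x ⟧ * J x)
      d-sum = neg-unique (trans (sym split) total)
        where
        neg-unique : ∀ {u v} → u + v ≡ + 0 → v ≡ - u
        neg-unique {u} {v} h = trans (lem u v) (trans (cong (_- u) h) (ℤₚ.+-identityˡ (- u)))
          where
          lem : ∀ u v → v ≡ u + v - u
          lem = solve-∀
        f : Fin n → ℤ
        f x = ⟦ K x ⟧ * J₁ d x - ⟦ K x ⟧ * J x
        f-xa : f xa ≡ d
        f-xa = trans (cong₂ (λ u v → ⟦ u ⟧ * v - ⟦ u ⟧ * J xa) Kxa (J₁-xa d)) (lem (J xa) d)
          where
          lem : ∀ j d → + 1 * (j + d) - + 1 * j ≡ d
          lem = solve-∀
        f-other : ∀ x → x ≢ xa → f x ≡ + 0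
        f-other x p = go (x Fin.≟ xb)
          where
          go : Dec (x ≡ xb) → f x ≡ + 0
          go (yes refl) = cong (λ u → ⟦ u ⟧ * J₁ d xb - ⟦ u ⟧ * J xb) Kxb
          go (no q) = trans (cong (λ v → ⟦ K x ⟧ * v - ⟦ K x ⟧ * J x) (J₁-other d x p q)) (ℤₚ.+-inverseʳ (⟦ K x ⟧ * J x))
        split : ∑ (λ x → ⟦ K x ⟧ * J₁ d x) ≡ ∑ (λ x → ⟦ K x ⟧ * J x) + d
        split = trans (lem (∑ (λ x → ⟦ K x ⟧ * J₁ d x)) (∑ (λ x → ⟦ K x ⟧ * J x))) (cong (λ z → ∑ (λ x → ⟦ K x ⟧ * J x) + z)
          (trans (sym (∑-- (λ x → ⟦ K x ⟧ * J₁ d x) (λ x → ⟦ K x ⟧ * J x))) (trans (∑-δ xa f f-other) f-xa)))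
          where
          lem : ∀ u v → u ≡ v + (u - v)
          lem = solve-∀

      both : (m : Fin n) → K m ≡ true → Conn' m a ≡ true
      both m h = up m a (conn-sym o a m h)

      K-mark : ∀ {m m'} → K m ≡ true → K m' ≡ true → Conn' m m' ≡ true
      K-mark {m} {m'} h h' = up m m' (conn-trans o m a m' (conn-sym o a m h) h')

      mark? : ∀ s → (∃ λ m → K m ≡ true × J m ≡ s) ⊎ (∀ m → K m ≡ true → J m ≢ s)
      mark? s with search (λ m → (K m ∧ does (J m ℤ.≟ s)) Boolₚ.≟ true)
      ... | inj₁ (m , h) with ∧-split {K m} h
      ... | h₁ , h₂ with J m ℤ.≟ s
      ... | yes e = inj₁ (m , h₁ , e)
      mark? s | inj₁ (m , h) | h₁ , () | no _
      mark? s | inj₂ none = inj₂ λ m Km e → none m (cong₂ _∧_ Km (dec-true (J m ℤ.≟ s) e))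

      -- A lone mark `σ` on the side `K` forces `d` to be `- σ`. The separation adds `- σ` at `xa`
      -- and `σ` at `xb`: this supplies the missing partner on `K`, or cancels the mark if it sat at
      -- `xa`, while the other side cannot have had a mark `σ` of its own because the unique one lay
      -- in `K`.
      one-sided : ∀ s → s ≡ + 1 ⊎ s ≡ - + 1 → ∀ m → K m ≡ true → J m ≡ s → (∀ m' → K m' ≡ true → J m' ≢ - s) → State g D φ bar
      one-sided σ su m Km Jm no- = RJ.state-jump s (- σ) (subst (λ t → η b ≡ η a + + g * t) d-σ ηb) val uniq
        where
        f-m : ⟦ K m ⟧ * J m ≡ σ
        f-m = trans (cong₂ (λ u v → ⟦ u ⟧ * v) Km Jm) (ℤₚ.*-identityˡ σ)
        f-other : ∀ x → x ≢ m → ⟦ K x ⟧ * J x ≡ + 0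
        f-other x p with K x in Kx
        ... | false = refl
        ... | true with sign-split (J-val x) su
        ... | inj₁ e = trans (ℤₚ.*-identityˡ (J x)) e
        ... | inj₂ (inj₁ e) = ⊥-elim (p (J-uniq x m (K-mark Kx Km) (trans e (sym Jm)) (λ z → unit≢0 su (trans (sym e) z))))
        ... | inj₂ (inj₂ e) = ⊥-elim (no- x Kx e)
        d-σ : d ≡ - σ
        d-σ = trans d-sum (cong -_ (trans (∑-δ m (λ x → ⟦ K x ⟧ * J x) f-other) f-m))
        neg2 : ∀ x → J₁ (- σ) xb ≡ J xb + σ
        neg2 _ = trans (J₁-xb (- σ)) (cong (λ z → J xb + z) (ℤₚ.neg-involutive σ))
        xb-val : J₁ (- σ) xb ≡ σ ⊎ J₁ (- σ) xb ≡ + 0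
        xb-val with sign-split (J-val xb) su
        ... | inj₁ e = inj₁ (trans (neg2 xb) (trans (cong (_+ σ) e) (ℤₚ.+-identityˡ σ)))
        ... | inj₂ (inj₂ e) = inj₂ (trans (neg2 xb) (trans (cong (_+ σ) e) (ℤₚ.+-inverseˡ σ)))
        ... | inj₂ (inj₁ e) = absurdᵇ (trans (cong K (J-uniq xb m xb-m (trans e (sym Jm)) (λ z → unit≢0 su (trans (sym e) z)))) Km) Kxb
          where
          xb-m : Conn' xb m ≡ true
          xb-m = conn-trans o' xb a m (trans (cong (Conn' xb) (sym φ'xb)) (trans (conn-φ o' xb xb) (reach-refl (φ' ∷ bar ∷ []) xb)))
            (conn-sym o' m a (both m Km))
        xa-val : J₁ (- σ) xa ≡ - σ ⊎ J₁ (- σ) xa ≡ + 0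
        xa-val with sign-split (J-val xa) su
        ... | inj₁ e = inj₁ (trans (J₁-xa (- σ)) (trans (cong (_+ - σ) e) (ℤₚ.+-identityˡ (- σ))))
        ... | inj₂ (inj₁ e) = inj₂ (trans (J₁-xa (- σ)) (trans (cong (_+ - σ) e) (ℤₚ.+-inverseʳ σ)))
        ... | inj₂ (inj₂ e) = ⊥-elim (no- xa Kxa e)
        val : ∀ z → Sign (J₁ (- σ) z)
        val z = go (z Fin.≟ xa) (z Fin.≟ xb)
          where
          go : Dec (z ≡ xa) → Dec (z ≡ xb) → Sign (J₁ (- σ) z)
          go (yes refl) _ with xa-val
          ... | inj₁ e = subst Sign (sym e) (sign-neg (sign-unit su))
          ... | inj₂ e = inj₁ e
          go _ (yes refl) with xb-val
          ... | inj₁ e = subst Sign (sym e) (sign-unit su)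
          ... | inj₂ e = inj₁ e
          go (no p) (no q) = subst Sign (sym (J₁-other (- σ) z p q)) (J-val z)
        K-eq : ∀ x y → Conn x y ≡ true → K y ≡ K x
        K-eq x y = conn-fun o K Kφ Kbar x y
        no-xa : ∀ y → Conn xa y ≡ true → J₁ (- σ) xa ≡ J₁ (- σ) y → J₁ (- σ) xa ≢ + 0 → y ≢ xa → ⊥
        no-xa y c e nz p with xa-val
        ... | inj₂ h = nz h
        ... | inj₁ h = no- y (trans (K-eq xa y c) Kxa) (trans (sym (J₁-other (- σ) y p q)) (trans (sym e) h))
          where
          q : y ≢ xb
          q refl = absurdᵇ (trans (K-eq xa xb c) Kxa) Kxb
        no-xb : ∀ y → Conn xb y ≡ true → J₁ (- σ) xb ≡ J₁ (- σ) y → J₁ (- σ) xb ≢ + 0 → y ≢ xb → ⊥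
        no-xb y c e nz p with xb-val
        ... | inj₂ h = nz h
        ... | inj₁ h = absurdᵇ (trans (cong K (J-uniq y m y-m (trans Jy (sym Jm)) (λ z → unit≢0 su (trans (sym Jy) z)))) Km) Ky
          where
          Ky : K y ≡ false
          Ky = trans (K-eq xb y c) Kxb
          q : y ≢ xa
          q refl = absurdᵇ Kxa Ky
          Jy : J y ≡ σ
          Jy = trans (sym (J₁-other (- σ) y q p)) (trans (sym e) h)
          xb-a : Conn' xb a ≡ true
          xb-a = trans (cong (Conn' xb) (sym φ'xb)) (trans (conn-φ o' xb xb) (reach-refl (φ' ∷ bar ∷ []) xb))
          y-m : Conn' y m ≡ true
          y-m = conn-trans o' y xb m (conn-sym o' xb y (up xb y c))
            (conn-trans o' xb a m xb-a (conn-sym o' m a (both m Km)))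
        uniq : ∀ x y → Conn x y ≡ true → J₁ (- σ) x ≡ J₁ (- σ) y → J₁ (- σ) x ≢ + 0 → x ≡ y
        uniq x y c e nz = go (x Fin.≟ xa) (x Fin.≟ xb) (y Fin.≟ xa) (y Fin.≟ xb) (x Fin.≟ y)
          where
          c' = conn-sym o x y c
          go : Dec (x ≡ xa) → Dec (x ≡ xb) → Dec (y ≡ xa) → Dec (y ≡ xb) → Dec (x ≡ y) → x ≡ y
          go _ _ _ _ (yes h) = h
          go (yes refl) _ _ _ (no h) = ⊥-elim (no-xa y c e nz (h ∘ sym))
          go _ (yes refl) _ _ (no h) = ⊥-elim (no-xb y c e nz (h ∘ sym))
          go _ _ (yes refl) _ (no h) = ⊥-elim (no-xa x c' (sym e) (nz ∘ trans e) h)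
          go _ _ _ (yes refl) (no h) = ⊥-elim (no-xb x c' (sym e) (nz ∘ trans e) h)
          go (no p) (no q) (no p') (no q') _ = J-uniq x y (up x y c)
            (trans (sym (J₁-other (- σ) x p q)) (trans e (J₁-other (- σ) y p' q'))) (nz ∘ trans (J₁-other (- σ) x p q))

      balanced : ∑ (λ x → ⟦ K x ⟧ * J x) ≡ + 0 → State g D φ bar
      balanced h = R.state-swap s ηab ab'
        where
        d0 : d ≡ + 0
        d0 = trans d-sum (cong -_ h)
        ηab : η a ≡ η b
        ηab = sym (trans ηb (trans (cong (λ t → η a + + g * t) d0) (lem (η a) (+ g))))
          where
          lem : ∀ η g → η + g * + 0 ≡ η
          lem = solve-∀

    state-unglue-components : State g D φ bar
    state-unglue-components with mark? (+ 1) | mark? (- + 1)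
    ... | inj₁ (m , Km , Jm) | inj₂ none = one-sided (+ 1) (inj₁ refl) m Km Jm none
    ... | inj₂ none | inj₁ (m , Km , Jm) = one-sided (- + 1) (inj₂ refl) m Km Jm none
    ... | inj₂ none | inj₂ none' = balanced (∑-zero (λ x → ⟦ K x ⟧ * J x) f)
      where
      f : ∀ x → ⟦ K x ⟧ * J x ≡ + 0
      f x with K x in Kx
      ... | false = refl
      ... | true with J-val x
      ... | inj₁ e = trans (ℤₚ.*-identityˡ (J x)) e
      ... | inj₂ (inj₁ e) = ⊥-elim (none x Kx e)
      ... | inj₂ (inj₂ e) = ⊥-elim (none' x Kx e)
    ... | inj₁ (m , Km , Jm) | inj₁ (m' , Km' , Jm') = balanced
      (trans (∑-cong pointwise) (trans (∑-- (δ m) (δ m')) (cong₂ _-_ (trans (∑-δ m (δ m) (λ x → δ-diff)) (δ-same m)) (trans (∑-δ m' (δ m') (λ x → δ-diff)) (δ-same m')))))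
      where
      m≢m' : m ≢ m'
      m≢m' refl with trans (sym Jm) Jm'
      ... | ()
      f : ∀ x → Dec (x ≡ m) → Dec (x ≡ m') → ∀ k → K x ≡ k → ⟦ k ⟧ * J x ≡ δ m x - δ m' x
      f x (yes refl) _ true Kx = trans (cong (+ 1 *_) Jm) (sym (cong₂ _-_ (δ-same m) (δ-diff m≢m')))
      f x (yes refl) _ false Kx = absurdᵇ Km Kx
      f x _ (yes refl) true Kx = trans (cong (+ 1 *_) Jm') (sym (cong₂ _-_ (δ-diff (m≢m' ∘ sym)) (δ-same m')))
      f x _ (yes refl) false Kx = absurdᵇ Km' Kx
      f x (no p) (no q) false Kx = sym (cong₂ _-_ (δ-diff p) (δ-diff q))
      f x (no p) (no q) true Kx = trans (trans (ℤₚ.*-identityˡ (J x)) J0) (sym (cong₂ _-_ (δ-diff p) (δ-diff q)))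
        where
        J0 : J x ≡ + 0
        J0 with J-val x
        ... | inj₁ e = e
        ... | inj₂ (inj₁ e) = ⊥-elim (p (J-uniq x m (K-mark Kx Km) (trans e (sym Jm)) (λ z → unit≢0 (inj₁ refl) (trans (sym e) z))))
        ... | inj₂ (inj₂ e) = ⊥-elim (q (J-uniq x m' (K-mark Kx Km') (trans e (sym Jm')) (λ z → unit≢0 (inj₂ refl) (trans (sym e) z))))
      pointwise : ∀ x → ⟦ K x ⟧ * J x ≡ δ m x - δ m' x
      pointwise x = f x (x Fin.≟ m) (x Fin.≟ m') (K x) refl

-- Joining two components

module Join {n : ℕ} {φ bar : Fin n → Fin n} (o : Perms φ bar) {g : ℕ} .{{_ : ℕ.NonZero g}} {D : Fin n → Bool}
  (s : State g D φ bar) (x y : Fin n) (apart : reach (φ ∷ bar ∷ []) x y ≡ false) where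
  open Perms o
  open State s
  private
    Conn : Fin n → Fin n → Bool
    Conn = reach (φ ∷ bar ∷ [])
    disjoint : ∀ z → Conn x z ≡ true → Conn y z ≡ true → ⊥
    disjoint z p q = absurdᵇ (conn-trans o x z y p (conn-sym o y z q)) apart
    Union : Fin n → Set
    Union z = Conn x z ≡ true ⊎ Conn y z ≡ true
    union-conn : ∀ z w → Conn z w ≡ true → Union z → Union w
    union-conn z w c (inj₁ h) = inj₁ (conn-trans o x z w h c)
    union-conn z w c (inj₂ h) = inj₂ (conn-trans o y z w h c)

  record Joined : Set where
    field
      a b   : Fin n
      in-a  : Conn x a ≡ true
      in-b  : Conn y b ≡ true
      state : (φ' : Fin n → Fin n) → (∀ z → φ' z ≡ swapF a b (φ z)) → State g D φ' bar

  private
    module At (a b : Fin n) (in-a : Conn x a ≡ true) (in-b : Conn y b ≡ true) where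
      a≢b : a ≢ b
      a≢b refl = disjoint a in-a in-b

      conn-cases : (φ' : Fin n → Fin n) → (∀ z → φ' z ≡ swapF a b (φ z)) → ∀ z w → reach (φ' ∷ bar ∷ []) z w ≡ true →
        Conn z w ≡ true ⊎ (Union z × Union w)
      conn-cases φ' eq z w = reach-ind (φ' ∷ bar ∷ []) z w (λ u → Conn z u ≡ true ⊎ (Union z × Union u)) (inj₁ (reach-refl (φ ∷ bar ∷ []) z)) step
        where
        P : Fin n → Set
        P u = Conn z u ≡ true ⊎ (Union z × Union u)
        φ-P : ∀ u → P u → P (φ u)
        φ-P u (inj₁ h) = inj₁ (trans (conn-φ o z u) h)
        φ-P u (inj₂ (p , q)) = inj₂ (p , union-conn u (φ u) (trans (conn-φ o u u) (reach-refl (φ ∷ bar ∷ []) u)) q)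
        move : ∀ u v → Union u → Union v → P u → P v
        move u v _ q (inj₂ (p , _)) = inj₂ (p , q)
        move u v r q (inj₁ h) = inj₂ (union-conn u z (conn-sym o z u h) r , q)
        sw-P : ∀ u → P u → P (swapF a b u)
        sw-P u h with swapF a b u | swapView a b u
        ... | _ | at-a = move a b (inj₁ in-a) (inj₂ in-b) h
        ... | _ | at-b = move b a (inj₂ in-b) (inj₁ in-a) h
        ... | _ | other _ _ = h
        step : ∀ {h} → h ∈ φ' ∷ bar ∷ [] → ∀ u → P u → P (h u)
        step (here refl) u h = subst P (sym (eq u)) (sw-P (φ u) (φ-P u h))
        step (there (here refl)) u (inj₁ h) = inj₁ (trans (conn-bar o z u) h)
        step (there (here refl)) u (inj₂ (p , q)) = inj₂ (p , union-conn u (bar u) (trans (conn-bar o u u) (reach-refl (φ ∷ bar ∷ []) u)) q)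

      module Raised (t : ℤ) where
        c = η a + + g * t - η b
        f : Fin n → ℤ
        f z = c * ⟦ Conn y z ⟧
        s̃ : State g D φ bar
        s̃ = state-raise o s f (λ z → cong (λ k → c * ⟦ k ⟧) (conn-φ o y z)) (λ z → cong (λ k → c * ⟦ k ⟧) (conn-bar o y z))
        η̃b : State.η s̃ b ≡ State.η s̃ a + + g * t
        η̃b = trans (cong (λ k → η b + c * ⟦ k ⟧) in-b) (trans (lem (η a) (η b) (+ g) t)
          (cong (λ k → η a + c * ⟦ k ⟧ + + g * t) (sym (¬true (disjoint a in-a)))))
          where
          lem : ∀ a b g t → b + (a + g * t - b) * + 1 ≡ a + (a + g * t - b) * + 0 + g * t
          lem = solve-∀

    marked? : ∀ u → (∃ λ m → Conn u m ≡ true × J m ≢ + 0) ⊎ (∀ m → Conn u m ≡ true → J m ≡ + 0)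
    marked? u with search (λ m → (Conn u m ∧ not (does (J m ℤ.≟ + 0))) Boolₚ.≟ true)
    ... | inj₁ (m , h) with ∧-split {Conn u m} h
    ... | h₁ , h₂ with J m ℤ.≟ + 0
    ... | no e = inj₁ (m , h₁ , e)
    marked? u | inj₁ (m , h) | h₁ , () | yes _
    marked? u | inj₂ none = inj₂ go
      where
      go : ∀ m → Conn u m ≡ true → J m ≡ + 0
      go m Km with J m ℤ.≟ + 0 | none m
      ... | yes e | _ = e
      ... | no e | h = ⊥-elim (h (cong₂ _∧_ Km refl))

    mark-of-sign : ∀ u → (∃ λ m → Conn u m ≡ true × J m ≢ + 0) → ∀ σ → σ ≡ + 1 ⊎ σ ≡ - + 1 → ∃ λ m → Conn u m ≡ true × J m ≡ σ
    mark-of-sign u (m , c , nz) σ σu with sign-split (J-val m) σu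
    ... | inj₁ e = ⊥-elim (nz e)
    ... | inj₂ (inj₁ e) = m , c , e
    ... | inj₂ (inj₂ e) with mark-partner o (Conn u) η ω J g (conn-φ o u) (conn-bar o u) ω-bar η-φ J-val m c nz
    ... | m' , c' , e' = m' , c' , trans e' (trans (cong -_ e) (ℤₚ.neg-involutive σ))

    -- With all marks on one side, no two equal signs can meet in the union, and raising the
    -- component of `y` as a whole makes the heights at `x` and `y` equal.
    join-plain : (∀ m → Conn x m ≡ true → J m ≡ + 0) ⊎ (∀ m → Conn y m ≡ true → J m ≡ + 0) → Joined
    join-plain free = record { a = x ; b = y ; in-a = rx ; in-b = ry ; state = st }
      where
      rx = reach-refl (φ ∷ bar ∷ []) x
      ry = reach-refl (φ ∷ bar ∷ []) y
      open At x y rx ry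
      open Raised (+ 0)
      st : (φ' : Fin n → Fin n) → (∀ z → φ' z ≡ swapF x y (φ z)) → State g D φ' bar
      st φ' eq = S.state-jump s̃ (+ 0) η̃b (λ z → subst Sign (sym (J0 z)) (J-val z)) uniq
        where
        module S = Jump o a≢b eq
        J0 : ∀ z → J z - + 0 * S.turn z ≡ J z
        J0 z = ℤₚ.+-identityʳ (J z)
        mixed : ∀ z w → Conn x z ≡ true → Conn y w ≡ true → J z ≢ + 0 → J w ≢ + 0 → ⊥
        mixed z w p q nz nw = [ (λ h → nz (h z p)) , (λ h → nw (h w q)) ]′ free
        uniq : ∀ z w → reach (φ' ∷ bar ∷ []) z w ≡ true → J z - + 0 * S.turn z ≡ J w - + 0 * S.turn w → J z - + 0 * S.turn z ≢ + 0 → z ≡ w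
        uniq z w c e nz with conn-cases φ' eq z w c | trans (sym (J0 z)) (trans e (J0 w)) | nz ∘ trans (J0 z)
        ... | inj₁ h | e' | nz' = J-uniq z w h e' nz'
        ... | inj₂ (inj₁ p , inj₁ q) | e' | nz' = J-uniq z w (conn-trans o z x w (conn-sym o x z p) q) e' nz'
        ... | inj₂ (inj₂ p , inj₂ q) | e' | nz' = J-uniq z w (conn-trans o z y w (conn-sym o y z p) q) e' nz'
        ... | inj₂ (inj₁ p , inj₂ q) | e' | nz' = ⊥-elim (mixed z w p q nz' (nz' ∘ trans e'))
        ... | inj₂ (inj₂ p , inj₁ q) | e' | nz' = ⊥-elim (mixed w z q p (nz' ∘ trans e') nz')

    -- Two marked components contain both signs each, one pair too many for their union. Gluing
    -- directly behind a negative mark of one and a positive mark of the other, with the heights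
    -- offset by `g`, cancels exactly these two marks.
    join-marked : (∃ λ m → Conn x m ≡ true × J m ≡ - + 1) → (∃ λ m → Conn y m ≡ true × J m ≡ + 1) → Joined
    join-marked (m , Cm , Jm) (m' , Cm' , Jm') = record { a = φ m ; b = φ m' ; in-a = ra ; in-b = rb ; state = st }
      where
      ra = trans (conn-φ o x m) Cm
      rb = trans (conn-φ o y m') Cm'
      open At (φ m) (φ m') ra rb
      open Raised (- + 1)
      st : (φ' : Fin n → Fin n) → (∀ z → φ' z ≡ swapF (φ m) (φ m') (φ z)) → State g D φ' bar
      st φ' eq = S.state-jump s̃ (- + 1) η̃b (λ z → val z (z Fin.≟ m) (z Fin.≟ m')) uniq
        where
        module S = Jump o a≢b eq
        J₁ : Fin n → ℤ
        J₁ z = J z - - + 1 * S.turn z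
        J₁-m : J₁ m ≡ + 0
        J₁-m = cong₂ (λ u v → u - - + 1 * v) Jm (S.turn-a m refl)
        J₁-m' : J₁ m' ≡ + 0
        J₁-m' = cong₂ (λ u v → u - - + 1 * v) Jm' (S.turn-b m' refl)
        J₁-other : ∀ z → z ≢ m → z ≢ m' → J₁ z ≡ J z
        J₁-other z p q = trans (cong (λ v → J z - - + 1 * v) (S.turn-other z (p ∘ φ-inj) (q ∘ φ-inj))) (ℤₚ.+-identityʳ (J z))
        val : ∀ z → Dec (z ≡ m) → Dec (z ≡ m') → Sign (J₁ z)
        val z (yes refl) _ = inj₁ J₁-m
        val z _ (yes refl) = inj₁ J₁-m'
        val z (no p) (no q) = subst Sign (sym (J₁-other z p q)) (J-val z)
        mixed : ∀ z w → Conn x z ≡ true → Conn y w ≡ true → z ≢ m → w ≢ m' → J z ≡ J w → J z ≢ + 0 → ⊥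
        mixed z w p q zm wm e nz with J-val z
        ... | inj₁ h = nz h
        ... | inj₂ (inj₁ h) = wm (J-uniq w m' (conn-trans o w y m' (conn-sym o y w q) Cm') (trans (sym e) (trans h (sym Jm'))) (nz ∘ trans e))
        ... | inj₂ (inj₂ h) = zm (J-uniq z m (conn-trans o z x m (conn-sym o x z p) Cm) (trans h (sym Jm)) nz)
        uniq : ∀ z w → reach (φ' ∷ bar ∷ []) z w ≡ true → J₁ z ≡ J₁ w → J₁ z ≢ + 0 → z ≡ w
        uniq z w c e nz = go (z Fin.≟ m) (z Fin.≟ m') (w Fin.≟ m) (w Fin.≟ m')
          where
          go : Dec (z ≡ m) → Dec (z ≡ m') → Dec (w ≡ m) → Dec (w ≡ m') → z ≡ w
          go (yes refl) _ _ _ = ⊥-elim (nz J₁-m)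
          go _ (yes refl) _ _ = ⊥-elim (nz J₁-m')
          go _ _ (yes refl) _ = ⊥-elim (nz (trans e J₁-m))
          go _ _ _ (yes refl) = ⊥-elim (nz (trans e J₁-m'))
          go (no p) (no q) (no p') (no q') with conn-cases φ' eq z w c | trans (sym (J₁-other z p q)) (trans e (J₁-other w p' q')) | nz ∘ trans (J₁-other z p q)
          ... | inj₁ h | e' | nz' = J-uniq z w h e' nz'
          ... | inj₂ (inj₁ u , inj₁ v) | e' | nz' = J-uniq z w (conn-trans o z x w (conn-sym o x z u) v) e' nz'
          ... | inj₂ (inj₂ u , inj₂ v) | e' | nz' = J-uniq z w (conn-trans o z y w (conn-sym o y z u) v) e' nz'
          ... | inj₂ (inj₁ u , inj₂ v) | e' | nz' = ⊥-elim (mixed z w u v p q' e' nz')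
          ... | inj₂ (inj₂ u , inj₁ v) | e' | nz' = ⊥-elim (mixed w z v u p' q (sym e') (nz' ∘ trans e'))

  join : Joined
  join with marked? x | marked? y
  ... | inj₁ h | inj₁ h' = join-marked (mark-of-sign x h (- + 1) (inj₂ refl)) (mark-of-sign y h' (+ 1) (inj₁ refl))
  ... | inj₂ h | _ = join-plain (inj₁ h)
  ... | _ | inj₂ h = join-plain (inj₂ h)

-- A fold whose two ends already coincide

module Pinch {n : ℕ} {φ bar : Fin n → Fin n} (o : Perms φ bar) (ex : Exact φ bar) {g : ℕ} (g≥2 : 2 ℕ.≤ g) {D : Fin n → Bool}
  (s : State g D φ bar) (marks-conn : ∀ z w → State.J s z ≢ + 0 → State.J s w ≢ + 0 → reach (φ ∷ bar ∷ []) z w ≡ true)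
  (y : Fin n) (Dy : D y ≡ true) (Da : D (φ y) ≡ true)
  (Ja : State.J s (φ y) ≡ + 0) (Jφa : State.J s (φ (φ y)) ≡ + 0) (fold : State.ω s (φ y) + State.ω s (φ (φ y)) ≡ + 0)
  (a≢b : φ (φ (φ y)) ≢ φ y) (ab : reach (φ ∘ bar ∷ []) (φ y) (φ (φ (φ y))) ≡ true) where
  open Perms o
  open State s
  private
    instance
      g-nz : ℕ.NonZero g
      g-nz = ℕ.>-nonZero (ℕₚ.≤-trans (s≤s z≤n) g≥2)
    a = φ y
    b = φ (φ a)
    φ' : Fin n → Fin n
    φ' z = swapF a b (φ z)
    open Swap {φ' = φ'} o {a} {b} (λ _ → refl)
    Conn' : Fin n → Fin n → Bool
    Conn' = reach (φ' ∷ bar ∷ [])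

    ηab : η a ≡ η b
    ηab = sym (trans (η-φ (φ a)) (trans (cong₂ (λ u v → u + ω (φ a) - + g * v) (trans (η-φ a) (cong (λ v → η a + ω a - + g * v) Ja)) Jφa)
      (trans (lem (η a) (ω a) (ω (φ a)) (+ g)) (trans (cong (λ z → η a + z) fold) (ℤₚ.+-identityʳ (η a))))))
      where
      lem : ∀ η w w' g → η + w - g * + 0 + w' - g * + 0 ≡ η + (w + w')
      lem = solve-∀

    moves : ∀ z → D z ≡ true → φ z ≢ z
    moves z Dz e = unit-cong g≥2 (ω-unit z Dz) (J z , height-fixed (η z) (ω z) (+ g * J z) (trans (sym (cong η e)) (η-φ z)))

    -- Here `v` lives on the vertices and `f` on the faces of `φ'`. The differential of `v` is
    -- closed for `φ` too, because its witness `v - f` takes the same value at `a` and `b`. Its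
    -- potential `p` for `φ` cannot distinguish `a` from `b`, which lie at one vertex of `φ`, so
    -- `v - p` is locally constant for `φ'` and yet distinguishes them. This is the Jordan curve
    -- argument for the closed curve through the vertex and the face.
    separating : (v f : Fin n → ℤ) → v a ≡ + 1 → v b ≡ + 0 → (∀ x → v (φ' (bar x)) ≡ v x) → f a ≡ + 1 → f b ≡ + 0 → (∀ x → f (φ' x) ≡ f x) →
      Σ (Fin n → ℤ) λ F → (∀ x → F (φ' x) ≡ F x) × (∀ x → F (bar x) ≡ F x) × F a ≡ F b + + 1
    separating v f va vb vτ fa fb fφ = F , F-φ , F-bar , Fab
      where
      vφ : ∀ x → v (bar x) ≡ v (φ' x)
      vφ x = trans (sym (vτ (bar x))) (cong (v ∘ φ') (bar-inv x))
      ζ q : Fin n → ℤ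
      ζ x = v (φ' x) - v x
      q x = v x - f x
      q-ab : q a ≡ q b
      q-ab = trans (cong₂ _-_ va fa) (sym (cong₂ _-_ vb fb))
      P = ex ζ q (λ x → trans (cong₂ _-_ (vτ x) (vφ x)) (l0 (v x) (v (φ' x))))
        (λ x → trans (sym (along q q-ab x)) (trans (cong (λ u → v (φ' x) - u) (fφ x)) (l1 (v (φ' x)) (v x) (f x))))
        where
        l0 : ∀ u w → u - w ≡ - (w - u)
        l0 = solve-∀
        l1 : ∀ u v f → u - f ≡ v - f + (u - v)
        l1 = solve-∀
      p = proj₁ P
      pab : p a ≡ p b
      pab = sym (τ-fun o p (proj₁ (proj₂ P)) a b ab)
      F : Fin n → ℤ
      F x = v x - p x
      F-φ : ∀ x → F (φ' x) ≡ F x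
      F-φ x = trans (cong (λ u → v (φ' x) - u) (trans (along p pab x) (proj₂ (proj₂ P) x))) (l2 (v (φ' x)) (v x) (p x))
        where
        l2 : ∀ u v p → u - (p + (u - v)) ≡ v - p
        l2 = solve-∀
      F-bar : ∀ x → F (bar x) ≡ F x
      F-bar x = trans (sym (F-φ (bar x))) (cong₂ _-_ (vτ x) (trans (along p pab (bar x)) (proj₁ (proj₂ P) x)))
      Fab : F a ≡ F b + + 1
      Fab = trans (cong₂ _-_ va pab) (trans (l3 (p b)) (cong (λ u → u - p b + + 1) (sym vb)))
        where
        l3 : ∀ p → + 1 - p ≡ + 0 - p + + 1
        l3 = solve-∀

    apart : Conn' a b ≡ false
    apart = ¬true λ h → contra (conn-fun o' (proj₁ S) (proj₁ (proj₂ S)) (proj₁ (proj₂ (proj₂ S))) a b h) (proj₂ (proj₂ (proj₂ S)))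
      where
      S = separating (λ x → ⟦ reach (φ' ∘ bar ∷ []) a x ⟧) (λ x → ⟦ reach (φ' ∷ []) a x ⟧)
        (cong ⟦_⟧ (reach-refl (φ' ∘ bar ∷ []) a)) (cong ⟦_⟧ (split-cycle (τ-inj o) (a≢b ∘ sym) (λ _ → refl) ab))
        (λ x → cong ⟦_⟧ (reach-inv (φ' ∘ bar ∷ []) a (here refl) (τ-inj o') x))
        (cong ⟦_⟧ (reach-refl (φ' ∷ []) a)) (cong ⟦_⟧ (split-cycle φ-inj (a≢b ∘ sym) (λ _ → refl) ab-face))
        (λ x → cong ⟦_⟧ (reach-inv (φ' ∷ []) a (here refl) φ'-inj x))
        where
        ab-face : reach (φ ∷ []) a b ≡ true
        ab-face = reach-step (φ ∷ []) a (here refl) (φ a) (reach-step (φ ∷ []) a (here refl) a (reach-refl (φ ∷ []) a))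
      contra : ∀ {u w} → w ≡ u → u ≡ w + + 1 → ⊥
      contra {u} refl e with trans (sym (ℤₚ.+-inverseˡ u)) (trans (cong (λ z → - u + z) e) (lem u))
        where
        lem : ∀ u → - u + (u + + 1) ≡ + 1
        lem = solve-∀
      ... | ()

    K : Fin n → Bool
    K = Conn' a
    Kφ : ∀ z → K (φ' z) ≡ K z
    Kφ = conn-φ o' a
    Kbar : ∀ z → K (bar z) ≡ K z
    Kbar = conn-bar o' a
    Ka : K a ≡ true
    Ka = reach-refl (φ' ∷ bar ∷ []) a
    Ky : K y ≡ false
    Ky = trans (sym (Kφ y)) (trans (cong K (swap-a a b)) apart)
    Kφa : K (φ a) ≡ true
    Kφa = trans (cong K (sym (swap-other (moves a Da) (λ e → moves a Da (sym (φ-inj e)))))) (trans (Kφ a) Ka)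

  -- The rise of `y` is a unit, so `y` is not at the vertex of `a` and `b`. Rotating around its own
  -- vertex, `φ` and `φ'` agree, so the rotation stays in the part of `φ'` that contains `y`; but
  -- `φ a` lies in the part of `a`.
  separated : reach (φ ∘ bar ∷ []) y (φ (φ y)) ≡ false
  separated = ¬true λ h → absurdᵇ Kφa (proj₂ (reach-ind (φ ∘ bar ∷ []) y (φ a) P (y∉ , Ky) step h))
    where
    V : Fin n → Bool
    V = reach (φ ∘ bar ∷ []) a
    P : Fin n → Set
    P z = V z ≡ false × K z ≡ false
    y∉ : V y ≡ false
    y∉ = ¬true λ h → unit-cong g≥2 (ω-unit y Dy) (difference (τ-cong o s a y h))
      where
      difference : η y ≡ η a [ g ] → ∃ λ t → ω y ≡ + g * t
      difference (via t e) = J y - t , lem (η y) (ω y) (+ g) (J y) t (trans e (cong (_+ + g * t) (η-φ y)))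
        where
        lem : ∀ h w g j t → h ≡ h + w - g * j + g * t → w ≡ g * (j - t)
        lem h w g j t e = trans (l1 h w g j t) (trans (cong (λ z → z - h + g * (j - t)) (sym e)) (l2 h (g * (j - t))))
          where
          l1 : ∀ h w g j t → w ≡ h + w - g * j + g * t - h + g * (j - t)
          l1 = solve-∀
          l2 : ∀ h u → h - h + u ≡ u
          l2 = solve-∀
    step : ∀ {h} → h ∈ φ ∘ bar ∷ [] → ∀ z → P z → P (h z)
    step (here refl) z (p , q) = Vτ , trans (cong K (sym (swap-other (λ e → absurdᵇ (trans (cong V e) (reach-refl (φ ∘ bar ∷ []) a)) Vτ) (λ e → absurdᵇ (trans (cong V e) ab) Vτ)))) (trans (Kφ (bar z)) (trans (Kbar z) q))
      where
      Vτ : V (φ (bar z)) ≡ false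
      Vτ = trans (reach-inv (φ ∘ bar ∷ []) a (here refl) (τ-inj o) z) p

  private
    flip : Bool → ℤ → ℤ
    flip true  w = - w
    flip false w = w

    -- The reflection of heights at `η a` fixes the common height of `a` and `b`, the only place
    -- where the two parts of `φ'` are attached, so it can be applied to `R` alone. It would negate
    -- marks, hence `R` must carry none.
    reflect : (R : Fin n → Bool) → (∀ z → R (φ' z) ≡ R z) → (∀ z → R (bar z) ≡ R z) → (∀ z → R z ≡ true → J z ≡ + 0) → State g D φ bar
    reflect R Rφ Rbar RJ = record
      { State s
      ; ω = λ z → flip (R z) (ω z) ; η = H ; e = λ z → flip (R z) (e z)
      ; ω-unit = λ z Dz → unit (R z) (ω-unit z Dz)
      ; ω-bar = λ z → trans (cong₂ flip (Rbar z) (ω-bar z)) (flip-neg (R z) (ω z))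
      ; η-φ = λ z → trans (sym (along H Hab z)) (trans (cong₂ mirror (Rφ z) (trans (along η ηab z) (η-φ z))) (l1 (R z) (η z) (ω z) (J z) (RJ z)))
      ; η-τ = λ z → trans (sym (along H Hab (bar z))) (trans (cong₂ mirror (trans (Rφ (bar z)) (Rbar z)) (trans (along η ηab (bar z)) (η-τ z))) (l2 (R z) (η z) (e z))) }
      where
      mirror : Bool → ℤ → ℤ
      mirror true  h = η a + η a - h
      mirror false h = h
      H : Fin n → ℤ
      H z = mirror (R z) (η z)
      mirror-a : ∀ r → mirror r (η a) ≡ η a
      mirror-a true = l (η a)
        where
        l : ∀ h → h + h - h ≡ h
        l = solve-∀
      mirror-a false = refl
      Hab : H a ≡ H b
      Hab = trans (mirror-a (R a)) (trans (sym (mirror-a (R b))) (cong (mirror (R b)) ηab))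
      unit : ∀ r {w} → w ≡ + 1 ⊎ w ≡ - + 1 → flip r w ≡ + 1 ⊎ flip r w ≡ - + 1
      unit true (inj₁ refl) = inj₂ refl
      unit true (inj₂ refl) = inj₁ refl
      unit false h = h
      flip-neg : ∀ r w → flip r (- w) ≡ - flip r w
      flip-neg true w = refl
      flip-neg false w = refl
      l1 : ∀ r h w j → (r ≡ true → j ≡ + 0) → mirror r (h + w - + g * j) ≡ mirror r h + flip r w - + g * j
      l1 false h w j z = refl
      l1 true h w j z rewrite z refl = l (η a) h w (+ g)
        where
        l : ∀ c h w g → c + c - (h + w - g * + 0) ≡ c + c - h + - w - g * + 0
        l = solve-∀
      l2 : ∀ r h e → mirror r (h + + g * e) ≡ mirror r h + + g * flip r e
      l2 false h e = refl
      l2 true h e = l (η a) h (+ g) e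
        where
        l : ∀ c h g e → c + c - (h + g * e) ≡ c + c - h + g * - e
        l = solve-∀

    -- The marks on `K` sum to zero for `φ'` as well, so a mark in `K` has its partner in `K`; by
    -- uniqueness these two are all the marks.
    side : (∀ z → K z ≡ true → J z ≡ + 0) ⊎ (∀ z → not (K z) ≡ true → J z ≡ + 0)
    side with search (λ m → (K m ∧ not (does (J m ℤ.≟ + 0))) Boolₚ.≟ true)
    ... | inj₂ none = inj₁ go
      where
      go : ∀ z → K z ≡ true → J z ≡ + 0
      go z Kz with J z ℤ.≟ + 0 | none z
      ... | yes e | _ = e
      ... | no _ | h = ⊥-elim (h (cong₂ _∧_ Kz refl))
    ... | inj₁ (m , h) = inj₂ (other-side (proj₁ split) (proj₂ split))
      where
      split : K m ≡ true × J m ≢ + 0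
      split with ∧-split {K m} h
      ... | Km , h' with J m ℤ.≟ + 0
      ... | no e = Km , e
      split | Km , () | yes _
      other-side : K m ≡ true → J m ≢ + 0 → ∀ z → not (K z) ≡ true → J z ≡ + 0
      other-side Km Jm z Kz with sign-split (J-val z) (sign≢0 (J-val m) Jm)
      ... | inj₁ e = e
      ... | inj₂ (inj₁ e) = absurdᵇ Kz (cong not (trans (cong K (J-uniq z m (marks-conn z m (Jm ∘ trans (sym e)) Jm) e (Jm ∘ trans (sym e)))) Km))
      ... | inj₂ (inj₂ e) with mark-partner o' K η ω J g Kφ Kbar ω-bar (λ w → trans (along η ηab w) (η-φ w)) J-val m Km Jm
      ... | m' , Km' , Jm' = absurdᵇ Kz (cong not (trans (cong K (J-uniq z m' (marks-conn z m' nz (nz ∘ trans (trans e (sym Jm')))) (trans e (sym Jm')) nz)) Km'))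
        where
        nz : J z ≢ + 0
        nz h0 = Jm (trans (sym (ℤₚ.neg-involutive (J m))) (cong -_ (trans (sym e) h0)))

    -- Since `y` lies outside `K` and `a` inside, reflecting either side reverses exactly one of the
    -- two rises, and the side without marks can be chosen.
    turn : ∀ w → ω y ≡ w → ω a ≡ w → Σ (State g D φ bar) λ s' → State.ω s' y + State.ω s' (φ y) ≡ + 0
    turn w p q with side
    ... | inj₁ h = reflect K Kφ Kbar h , trans (cong₂ _+_ (cong₂ flip Ky p) (cong₂ flip Ka q)) (ℤₚ.+-inverseʳ w)
    ... | inj₂ h = reflect (not ∘ K) (cong not ∘ Kφ) (cong not ∘ Kbar) h ,
      trans (cong₂ _+_ (cong₂ flip (cong not Ky) p) (cong₂ flip (cong not Ka) q)) (ℤₚ.+-inverseˡ w)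

  foldable : Σ (State g D φ bar) λ s' → State.ω s' y + State.ω s' (φ y) ≡ + 0
  foldable with ω-unit y Dy | ω-unit a Da
  ... | inj₁ p | inj₂ q = s , cong₂ _+_ p q
  ... | inj₂ p | inj₁ q = s , cong₂ _+_ p q
  ... | inj₁ p | inj₁ q = turn (+ 1) p q
  ... | inj₂ p | inj₂ q = turn (- + 1) p q

-- Residues and closed walks

residue-unique : ∀ {r u v : ℕ} → u ℕ.< r → v ℕ.< r → ∀ t → + u ≡ + v + + r * t → u ≡ v
residue-unique {r} {u} {v} u<r v<r (+ zero) e = ℤₚ.+-injective (trans e (trans (cong (λ z → + v + z) (ℤₚ.*-zeroʳ (+ r))) (ℤₚ.+-identityʳ (+ v))))
residue-unique {r} {u} {v} u<r v<r (+ suc k) e = ⊥-elim (ℕₚ.<⇒≱ u<r (subst (r ℕ.≤_) (sym (ℤₚ.+-injective (trans e (cong (λ z → + v + z) (sym (ℤₚ.pos-* r (suc k)))))))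
  (ℕₚ.≤-trans (ℕₚ.m≤m*n r (suc k)) (ℕₚ.m≤n+m (r ℕ.* suc k) v))))
residue-unique {r} {u} {v} u<r v<r -[1+ k ] e = ⊥-elim (ℕₚ.<⇒≱ v<r (subst (r ℕ.≤_) (sym (ℤₚ.+-injective back))
  (ℕₚ.≤-trans (ℕₚ.m≤m*n r (suc k)) (ℕₚ.m≤n+m (r ℕ.* suc k) u))))
  where
  lem : ∀ v r k → v ≡ v + r * (- k) + r * k
  lem = solve-∀
  back : + v ≡ + (u ℕ.+ r ℕ.* suc k)
  back = trans (lem (+ v) (+ r) (+ suc k)) (trans (cong (_+ + r * + suc k) (sym e)) (cong (λ z → + u + z) (sym (ℤₚ.pos-* r (suc k)))))

%ℕ-cong : ∀ {a b} r .{{_ : ℕ.NonZero r}} → a ≡ b [ r ] → a %ℕ r ≡ b %ℕ r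
%ℕ-cong {a} {b} r (via t e) = residue-unique (n%ℕd<d a r) (n%ℕd<d b r) (b /ℕ r - a /ℕ r + t)
  (lem (+ (a %ℕ r)) (a /ℕ r) (+ (b %ℕ r)) (b /ℕ r) (+ r) t (trans (sym (a≡a%ℕn+[a/ℕn]*n a r)) (trans e (cong (_+ + r * t) (a≡a%ℕn+[a/ℕn]*n b r)))))
  where
  lem : ∀ x q y p r t → x + q * r ≡ y + p * r + r * t → x ≡ y + r * (p - q + t)
  lem x q y p r t e = trans (l1 x q r) (trans (cong (_- q * r) e) (l2 y p q r t))
    where
    l1 : ∀ x q r → x ≡ x + q * r - q * r
    l1 = solve-∀
    l2 : ∀ y p q r t → y + p * r + r * t - q * r ≡ y + r * (p - q + t)
    l2 = solve-∀

uip : {A : Set} {i j : A} (p p' : i ≡ j) → p ≡ p'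
uip refl refl = refl

all-or : ∀ {n} {P : Fin n → Set} {Q : Set} → (∀ i → P i ⊎ Q) → (∀ i → P i) ⊎ Q
all-or {zero} h = inj₁ λ ()
all-or {suc n} h with h zero | all-or (h ∘ suc)
... | inj₂ q | _ = inj₂ q
... | inj₁ p | inj₂ q = inj₂ q
... | inj₁ p | inj₁ ps = inj₁ λ { zero → p ; (suc i) → ps i }

-- The cycle of `z` ends at `w` outside `S`, so going along it from `z` there is a first place where
-- `S` is left.
exit-point : ∀ {n} {σ : Fin n → Fin n} → Inj σ → (S : Fin n → Bool) → ∀ {z w} → S z ≡ true → S w ≡ false → σ w ≡ z →
  ∃ λ y → S y ≡ true × S (σ y) ≡ false × reach (σ ∷ []) z y ≡ true
exit-point {n} {σ} σ-inj S {z} {w} Sz Sw σw = go (least (λ i → S (iter i σ z) Boolₚ.≟ false) p (trans (cong S back) Sw))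
  where
  p = proj₁ (period σ-inj z)
  back : iter p σ z ≡ w
  back = σ-inj (trans (proj₂ (proj₂ (period σ-inj z))) (sym σw))
  reach-iter : ∀ i → reach (σ ∷ []) z (iter i σ z) ≡ true
  reach-iter zero = reach-refl (σ ∷ []) z
  reach-iter (suc i) = reach-step (σ ∷ []) z (here refl) (iter i σ z) (reach-iter i)
  go : (∃ λ j → S (iter j σ z) ≡ false × (∀ k → k ℕ.< j → ¬ S (iter k σ z) ≡ false)) →
    ∃ λ y → S y ≡ true × S (σ y) ≡ false × reach (σ ∷ []) z y ≡ true
  go (zero , e , _) = absurdᵇ Sz e
  go (suc i , e , below) = iter i σ z , Boolₚ.¬-not (below i (ℕₚ.n<1+n i)) , e , reach-iter i

-- The walk need not follow a face: at each vertex it may continue with any dart, so `next` only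
-- asks for the same vertex. Labels are congruences because heights on different faces are
-- comparable only modulo `r`.
record Increasing {n : ℕ} {φ bar : Fin n → Fin n} {D : Fin n → Bool} {r : ℕ} (s : State r D φ bar) : Set where
  open State s
  field
    at     : ℕ → Fin n
    dart   : ∀ i → D (at i) ≡ true
    rising : ∀ i → ω (at i) ≡ + 1
    next   : ∀ i → reach (φ ∘ bar ∷ []) (φ (at i)) (at (suc i)) ≡ true
    label  : ∀ i → η (at i) ≡ η (at 0) + + i [ r ]
    closed : at r ≡ at 0

-- Flows in the dual

boundary-start : ∀ {n r} .{{_ : ℕ.NonZero r}} (B : Fin n → Bool) → count B ≡ r → ∃ λ x → B x ≡ true
boundary-start {r = r} B e with search (λ x → B x Boolₚ.≟ true)
... | inj₁ h = h
... | inj₂ none = ⊥-elim (ℕ.≢-nonZero⁻¹ r (trans (sym e) (ℤₚ.+-injective (trans (sym (∑-count B)) (∑-zero (λ x → ⟦ B x ⟧) (λ x → cong ⟦_⟧ (¬true (none x))))))))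

-- A walk through a set of r rising darts closes up after r steps, because its labels run through all residues.
module Walk {n : ℕ} {φ bar : Fin n → Fin n} (o : Perms φ bar) {r : ℕ} .{{_ : ℕ.NonZero r}} {D : Fin n → Bool} (s : State r D φ bar)
  (B : Fin n → Bool) (B-dart : ∀ x → B x ≡ true → D x ≡ true) (B-rising : ∀ x → B x ≡ true → State.ω s x ≡ + 1) (B-count : + count B ≡ + r)
  (R : Fin n → Fin n → Set) (exit : ∀ x → B x ≡ true → ∃ λ z → B z ≡ true × reach (φ ∘ bar ∷ []) (φ x) z ≡ true × R x z)
  (start : ∃ λ x → B x ≡ true) where
  open State s
  E = enum B
  size-r : Enum.size E ≡ r
  size-r = trans (Enum.size-count E) (ℤₚ.+-injective B-count)

  walk : ℕ → ∃ λ x → B x ≡ true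
  walk zero = start
  walk (suc i) = proj₁ found , proj₁ (proj₂ found)
    where found = exit (proj₁ (walk i)) (proj₂ (walk i))

  at : ℕ → Fin n
  at i = proj₁ (walk i)

  next : ∀ i → reach (φ ∘ bar ∷ []) (φ (at i)) (at (suc i)) ≡ true
  next i = proj₁ (proj₂ (proj₂ (exit (proj₁ (walk i)) (proj₂ (walk i)))))

  related : ∀ i → R (at i) (at (suc i))
  related i = proj₂ (proj₂ (proj₂ (exit (proj₁ (walk i)) (proj₂ (walk i)))))

  label : ∀ i → η (at i) ≡ η (at 0) + + i [ r ]
  label zero = via (+ 0) (l (η (at 0)) (+ r))
    where
    l : ∀ h g → h ≡ h + + 0 + g * + 0
    l = solve-∀
  label (suc i) = cong-trans (τ-cong o s (φ (at i)) (at (suc i)) (next i)) (cong-trans (via (- J (at i)) up) shifted)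
    where
    up : η (φ (at i)) ≡ η (at i) + + 1 + + r * (- J (at i))
    up = trans (η-φ (at i)) (trans (cong (λ w → η (at i) + w - + r * J (at i)) (B-rising (at i) (proj₂ (walk i)))) (cong (λ z → η (at i) + + 1 + z) (ℤₚ.neg-distribʳ-* (+ r) (J (at i)))))
    shifted : η (at i) + + 1 ≡ η (at 0) + + suc i [ r ]
    shifted with label i
    ... | via t e = via t (trans (cong (_+ + 1) e) (l (η (at 0)) (+ i) (+ r * t)))
      where
      l : ∀ h i u → h + i + u + + 1 ≡ h + (+ 1 + i) + u
      l = solve-∀

  -- Equal darts have labels differing by a multiple of `r`, and within `r` steps the only such
  -- positive difference is the whole walk.
  full-turn : ∀ i d → i ℕ.+ suc d ℕ.≤ r → (t : ℤ) → + suc d ≡ + r * t → i ≡ 0 × suc d ≡ r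
  full-turn i d le t e = i0 , d-r
    where
    abs-e : suc d ≡ r ℕ.* ℤ.∣ t ∣
    abs-e = trans (cong ℤ.∣_∣ e) (ℤₚ.abs-* (+ r) t)
    r≤ : r ℕ.≤ suc d
    r≤ with ℤ.∣ t ∣ | abs-e
    ... | zero | h = ⊥-elim (ℕₚ.1+n≢0 (trans h (ℕₚ.*-zeroʳ r)))
    ... | suc k | h = subst (r ℕ.≤_) (sym h) (ℕₚ.m≤m*n r (suc k))
    d-r : suc d ≡ r
    d-r = ℕₚ.≤-antisym (ℕₚ.≤-trans (ℕₚ.m≤n+m (suc d) i) le) r≤
    i0 : i ≡ 0
    i0 = ℕₚ.n≤0⇒n≡0 (ℕₚ.+-cancelʳ-≤ (suc d) i 0 (ℕₚ.≤-trans le r≤))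

  closed : at r ≡ at 0
  closed with Finₚ.pigeonhole (subst (ℕ._< suc r) (sym size-r) (ℕₚ.n<1+n r)) (λ i → proj₁ (Enum.onto E (at (toℕ i)) (proj₂ (walk (toℕ i)))))
  ... | i , j , i<j , e with ℕₚ.m≤n⇒∃[o]m+o≡n i<j
  ... | d , q = subst₂ (λ u v → at v ≡ at u) (proj₁ ft) (trans (cong (ℕ._+ suc d) (proj₁ ft)) (proj₂ ft)) (trans (cong at q') (sym same))
    where
    q' : toℕ i ℕ.+ suc d ≡ toℕ j
    q' = trans (ℕₚ.+-suc (toℕ i) d) q
    same : at (toℕ i) ≡ at (toℕ j)
    same = trans (sym (proj₂ (Enum.onto E (at (toℕ i)) (proj₂ (walk (toℕ i)))))) (trans (cong (Enum.emb E) e) (proj₂ (Enum.onto E (at (toℕ j)) (proj₂ (walk (toℕ j))))))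
    difference : ∃ λ t → + suc d ≡ + r * t
    difference with label (toℕ i) | label (toℕ j)
    ... | via t e₁ | via u e₂ = t - u , l (η (at 0)) (+ toℕ i) (+ suc d) (+ r) t u (trans (sym e₁) (trans (cong η same) (trans e₂ (cong (λ k → η (at 0) + + k + + r * u) (sym q')))))
      where
      l : ∀ h i d r t u → h + i + r * t ≡ h + (i + d) + r * u → d ≡ r * (t - u)
      l h i d r t u e = trans (l1 h i d r u) (trans (cong (λ z → z - h - i - r * u) (sym e)) (l2 h i r t u))
        where
        l1 : ∀ h i d r u → d ≡ h + (i + d) + r * u - h - i - r * u
        l1 = solve-∀
        l2 : ∀ h i r t u → h + i + r * t - h - i - r * u ≡ r * (t - u)
        l2 = solve-∀
    ft = full-turn (toℕ i) d (subst (ℕ._≤ r) (sym q') (ℕ.s≤s⁻¹ (Finₚ.toℕ<n j))) (proj₁ difference) (proj₂ difference)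

  increasing : Increasing s
  increasing = record { at = at ; dart = λ i → B-dart (at i) (proj₂ (walk i)) ; rising = λ i → B-rising (at i) (proj₂ (walk i))
                      ; next = next ; label = label ; closed = closed }

module Flow {n : ℕ} {φ bar : Fin n → Fin n} (o : Perms φ bar) (ex : Exact φ bar) {r : ℕ} .{{_ : ℕ.NonZero r}} {D : Fin n → Bool}
  (s : State r D φ bar) (off : ∀ x → D x ≡ false → φ x ≡ x × bar x ≡ x) where
  open Perms o
  open State s
  private
    Conn : Fin n → Fin n → Bool
    Conn = reach (φ ∷ bar ∷ [])

    -- Every edge has capacity one, and its rise can be reversed only from the falling side. These
    -- are the residual arcs of the dual flow; `φ` moves freely within a face.
    cross : Fin n → Fin n
    cross z = if does (ω z ℤ.≟ - + 1) then bar z else z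

    cross-down : ∀ z → ω z ≡ - + 1 → cross z ≡ bar z
    cross-down z e rewrite dec-true (ω z ℤ.≟ - + 1) e = refl

    cross-cases : ∀ z → cross z ≡ z ⊎ (ω z ≡ - + 1 × cross z ≡ bar z)
    cross-cases z with ω z ℤ.≟ - + 1
    ... | yes e = inj₂ (e , refl)
    ... | no _ = inj₁ refl

    gs : List (Fin n → Fin n)
    gs = φ ∷ cross ∷ []

    δ-φ : ∀ z x → δ (φ z) (φ x) ≡ δ z x
    δ-φ z x = go (x Fin.≟ z)
      where
      go : Dec (x ≡ z) → δ (φ z) (φ x) ≡ δ z x
      go (yes refl) = trans (δ-same (φ z)) (sym (δ-same z))
      go (no p) = trans (δ-diff (λ h → p (φ-inj h))) (sym (δ-diff p))

    δ-bar : ∀ z x → δ z (bar x) ≡ δ (bar z) x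
    δ-bar z x = go (x Fin.≟ bar z)
      where
      go : Dec (x ≡ bar z) → δ z (bar x) ≡ δ (bar z) x
      go (yes refl) = trans (cong (δ z) (bar-inv z)) (trans (δ-same z) (sym (δ-same (bar z))))
      go (no p) = trans (δ-diff (λ h → p (trans (sym (bar-inv x)) (cong bar h)))) (sym (δ-diff p))

  module FromMark (m : Fin n) (Jm : J m ≡ + 1) where

    private
      Level : ℕ → Fin n → Set
      Level k x = lookup (level gs m k) x ≡ true

      Before : ℕ → Fin n → Set
      Before zero    x = ⊥
      Before (suc k) x = Level k x

      before-suc : ∀ k x → Before k x → Before (suc k) x
      before-suc (suc k) x h = close⁺ˡ gs (level gs m k) x h

    -- A dual path from the face of `m` to that of `y`, found within `k` rounds and written as an
    -- antisymmetric unit flow; `θ-eq` says that its face sums are 1 at its start and -1 at its end,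
    -- `q` being the potential along faces. `used` prevents an edge from being crossed twice.
    record Dual (k : ℕ) (y : Fin n) : Set where
      field
        θ q   : Fin n → ℤ
        θ-bar : ∀ x → θ (bar x) ≡ - θ x
        θ-eq  : ∀ x → θ x ≡ q (φ x) - q x + δ m x - δ y x
        θ-val : ∀ x → θ x ≡ + 0 ⊎ θ x ≡ - ω x
        used  : ∀ x → θ x ≡ + 1 → Before k x

    private
      dual-suc : ∀ {k y} → Dual k y → Dual (suc k) y
      dual-suc {k} d = record { Dual d ; used = λ x h → before-suc k x (Dual.used d x h) }

      dual-φ : ∀ {k z} → Dual k z → Dual (suc k) (φ z)
      dual-φ {k} {z} d = record
        { θ = θ ; q = λ x → q x - δ (φ z) x ; θ-bar = θ-bar
        ; θ-eq = λ x → trans (θ-eq x) (trans (l1 (q (φ x)) (q x) (δ m x) (δ z x) (δ (φ z) x))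
            (cong (λ u → q (φ x) - u - (q x - δ (φ z) x) + δ m x - δ (φ z) x) (sym (δ-φ z x))))
        ; θ-val = θ-val ; used = λ x h → before-suc k x (used x h) }
        where
        open Dual d
        l1 : ∀ q' q a b c → q' - q + a - b ≡ q' - b - (q - c) + a - c
        l1 = solve-∀

      dual-bar : ∀ {k z} → Dual k z → Level k z → ω z ≡ - + 1 → ¬ Level k (bar z) → Dual (suc k) (bar z)
      dual-bar {k} {z} d Lz ωz nL = record
        { θ = θ' ; q = q ; θ-bar = λ x → trans (cong₂ (λ u v → u + v - δ (bar z) (bar x)) (θ-bar x) (δ-bar z x))
            (trans (cong (λ v → - θ x + δ (bar z) x - v) (trans (δ-bar (bar z) x) (cong (λ u → δ u x) (bar-inv z)))) (l0 (θ x) (δ z x) (δ (bar z) x)))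
        ; θ-eq = λ x → trans (cong (λ u → u + δ z x - δ (bar z) x) (θ-eq x)) (l1 (q (φ x)) (q x) (δ m x) (δ z x) (δ (bar z) x))
        ; θ-val = λ x → val x (x Fin.≟ z) (x Fin.≟ bar z) ; used = λ x → used' x (x Fin.≟ z) (x Fin.≟ bar z) }
        where
        open Dual d
        θ' : Fin n → ℤ
        θ' x = θ x + δ z x - δ (bar z) x
        l0 : ∀ t a b → - t + b - a ≡ - (t + a - b)
        l0 = solve-∀
        l1 : ∀ q' q a b c → q' - q + a - b + b - c ≡ q' - q + a - c
        l1 = solve-∀
        z≢ : z ≢ bar z
        z≢ e = nL (subst (Level k) e Lz)
        -- Had `z` been reached a round earlier, `cross` would already have reached `bar z`.
        fresh : ∀ k → ¬ Level k (bar z) → ¬ Before k z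
        fresh (suc k) nL h = nL (subst (Level (suc k)) (cross-down z ωz) (close⁺ʳ gs (level gs m k) z (there (here refl)) h))
        θz : θ z ≡ + 0
        θz with θ-val z
        ... | inj₁ e = e
        ... | inj₂ e = ⊥-elim (fresh k nL (used z (trans e (cong -_ ωz))))
        θ'z : θ' z ≡ + 1
        θ'z = trans (cong₂ (λ u v → θ z + u - v) (δ-same z) (δ-diff z≢)) (cong (λ u → u + + 1 - + 0) θz)
        θ'bz : θ' (bar z) ≡ - + 1
        θ'bz = trans (cong₂ (λ u v → θ (bar z) + u - v) (δ-diff (z≢ ∘ sym)) (δ-same (bar z))) (cong (λ u → u + + 0 - + 1) (trans (θ-bar z) (cong -_ θz)))
        θ'o : ∀ x → x ≢ z → x ≢ bar z → θ' x ≡ θ x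
        θ'o x p p' = trans (cong₂ (λ u v → θ x + u - v) (δ-diff p) (δ-diff p')) (l2 (θ x))
          where
          l2 : ∀ t → t + + 0 - + 0 ≡ t
          l2 = solve-∀
        val : ∀ x → Dec (x ≡ z) → Dec (x ≡ bar z) → θ' x ≡ + 0 ⊎ θ' x ≡ - ω x
        val x (yes refl) _ = inj₂ (trans θ'z (sym (cong -_ ωz)))
        val x _ (yes refl) = inj₂ (trans θ'bz (sym (trans (cong -_ (ω-bar z)) (trans (ℤₚ.neg-involutive (ω z)) ωz))))
        val x (no p) (no p') with θ-val x
        ... | inj₁ e = inj₁ (trans (θ'o x p p') e)
        ... | inj₂ e = inj₂ (trans (θ'o x p p') e)
        used' : ∀ x → Dec (x ≡ z) → Dec (x ≡ bar z) → θ' x ≡ + 1 → Before (suc k) x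
        used' x (yes refl) _ _ = Lz
        used' x _ (yes refl) h with trans (sym h) θ'bz
        ... | ()
        used' x (no p) (no p') h = before-suc k x (used x (trans (sym (θ'o x p p')) h))

    dual : ∀ k y → Level k y → Dual k y
    dual zero y h with eqᵇ-sound {x = m} {y} (trans (sym (lookup∘tabulate (eqᵇ m) y)) h)
    ... | refl = record { θ = λ _ → + 0 ; q = λ _ → + 0 ; θ-bar = λ _ → refl ; θ-eq = λ x → l0 (δ m x)
                        ; θ-val = λ _ → inj₁ refl ; used = λ x () }
      where
      l0 : ∀ a → + 0 ≡ + 0 - + 0 + a - a
      l0 = solve-∀
    dual (suc k) y h with close⁻ gs (level gs m k) y h
    ... | inj₁ h' = dual-suc (dual k y h')
    ... | inj₂ (_ , here refl , z , hz , refl) = dual-φ (dual k z hz)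
    ... | inj₂ (_ , there (here refl) , z , hz , refl) = go (cross-cases z)
      where
      go : cross z ≡ z ⊎ (ω z ≡ - + 1 × cross z ≡ bar z) → Dual (suc k) (cross z)
      go (inj₁ e) = subst (Dual (suc k)) (sym e) (dual-suc (dual k z hz))
      go (inj₂ (ωz , e)) = subst (Dual (suc k)) (sym e) (go' (lookup (level gs m k) (bar z) Boolₚ.≟ true))
        where
        go' : Dec (lookup (level gs m k) (bar z) ≡ true) → Dual (suc k) (bar z)
        go' (yes p) = dual-suc (dual k (bar z) p)
        go' (no p) = dual-bar (dual k z hz) hz ωz p

    private
      S : Fin n → Bool
      S = reach gs m
      Sm : S m ≡ true
      Sm = reach-refl gs m
      Sφ : ∀ x → S (φ x) ≡ S x
      Sφ = forward-inv φ-inj S (reach-step gs m (here refl))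
      S-down : ∀ x → S x ≡ true → ω x ≡ - + 1 → S (bar x) ≡ true
      S-down x h e = trans (cong S (sym (cross-down x e))) (reach-step gs m (there (here refl)) x h)
      S-conn : ∀ x → S x ≡ true → Conn m x ≡ true
      S-conn x = reach-ind gs m x (λ z → Conn m z ≡ true) (reach-refl (φ ∷ bar ∷ []) m)
        λ { (here refl) z h → trans (conn-φ o m z) h ; (there (here refl)) z h → go z h (cross-cases z) }
        where
        go : ∀ z → Conn m z ≡ true → cross z ≡ z ⊎ (ω z ≡ - + 1 × cross z ≡ bar z) → Conn m (cross z) ≡ true
        go z h (inj₁ e) = trans (cong (Conn m) e) h
        go z h (inj₂ (_ , e)) = trans (cong (Conn m) e) (trans (conn-bar o m z) h)

    Dm : D m ≡ true
    Dm with D m in Dm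
    ... | true = refl
    ... | false = ⊥-elim (ℕ.≢-nonZero⁻¹ r (ℤₚ.+-injective (trans (sym (ℤₚ.*-identityʳ (+ r))) (trans (cong (+ r *_) (sym Jm)) r0))))
      where
      ω0 : ω m ≡ + 0
      ω0 = double-zero (trans (sym (cong ω (proj₂ (off m Dm)))) (ω-bar m))
      r0 : + r * J m ≡ + 0
      r0 = trans (sym (height-fixed (η m) (ω m) (+ r * J m) (trans (sym (cong η (proj₁ (off m Dm)))) (η-φ m)))) ω0

    record Augmentation : Set where
      field
        target : Fin n
        target-conn : Conn m target ≡ true
        target-mark : J target ≡ - + 1
        θ q   : Fin n → ℤ
        θ-bar : ∀ x → θ (bar x) ≡ - θ x
        θ-eq  : ∀ x → θ x ≡ q (φ x) - q x + δ m x - δ target x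
        θ-val : ∀ x → θ x ≡ + 0 ⊎ θ x ≡ - ω x

    private
     module Cut (S : Fin n → Bool) (Sm : S m ≡ true) (Sφ : ∀ x → S (φ x) ≡ S x)
       (S-down : ∀ x → S x ≡ true → ω x ≡ - + 1 → S (bar x) ≡ true) (S-conn : ∀ x → S x ≡ true → Conn m x ≡ true)
       (closed-mark : ∀ x → S x ≡ true → J x ≢ - + 1) where
      SJ : ∑ (λ x → ⟦ S x ⟧ * J x) ≡ + 1
      SJ = trans (∑-δ m (λ x → ⟦ S x ⟧ * J x) other') (cong₂ (λ u v → ⟦ u ⟧ * v) Sm Jm)
        where
        other' : ∀ x → x ≢ m → ⟦ S x ⟧ * J x ≡ + 0
        other' x p with S x in Sx
        ... | false = refl
        ... | true with J-val x
        ... | inj₁ e = trans (ℤₚ.*-identityˡ (J x)) e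
        ... | inj₂ (inj₁ e) = ⊥-elim (p (sym (J-uniq m x (S-conn x Sx) (trans Jm (sym e)) (λ h → unit≢0 (inj₁ Jm) h))))
        ... | inj₂ (inj₂ e) = ⊥-elim (closed-mark x Sx e)

      Sω : ∑ (λ x → ⟦ S x ⟧ * ω x) ≡ + r
      Sω = trans (∑-cong pointwise) (trans (∑-+ (λ x → ⟦ S x ⟧ * η (φ x) - ⟦ S x ⟧ * η x) (λ x → + r * (⟦ S x ⟧ * J x)))
        (trans (cong₂ _+_ (trans (∑-- (λ x → ⟦ S x ⟧ * η (φ x)) (λ x → ⟦ S x ⟧ * η x)) (trans (cong (_- ∑ (λ x → ⟦ S x ⟧ * η x)) perm) (ℤₚ.+-inverseʳ (∑ (λ x → ⟦ S x ⟧ * η x)))))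
          (trans (∑-* (+ r) (λ x → ⟦ S x ⟧ * J x)) (trans (cong (+ r *_) SJ) (ℤₚ.*-identityʳ (+ r))))) (ℤₚ.+-identityˡ (+ r))))
        where
        perm : ∑ (λ x → ⟦ S x ⟧ * η (φ x)) ≡ ∑ (λ x → ⟦ S x ⟧ * η x)
        perm = trans (∑-cong (λ x → cong (λ k → ⟦ k ⟧ * η (φ x)) (sym (Sφ x)))) (∑-perm φ-inj (λ x → ⟦ S x ⟧ * η x))
        lem : ∀ k h w g j → k * w ≡ k * (h + w - g * j) - k * h + g * (k * j)
        lem = solve-∀
        pointwise : ∀ x → ⟦ S x ⟧ * ω x ≡ ⟦ S x ⟧ * η (φ x) - ⟦ S x ⟧ * η x + + r * (⟦ S x ⟧ * J x)
        pointwise x = trans (lem ⟦ S x ⟧ (η x) (ω x) (+ r) (J x)) (cong (λ u → ⟦ S x ⟧ * u - ⟦ S x ⟧ * η x + + r * (⟦ S x ⟧ * J x)) (sym (η-φ x)))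

      B : Fin n → Bool
      B x = S x ∧ not (S (bar x))

      B-split : ∀ x → B x ≡ true → S x ≡ true × S (bar x) ≡ false
      B-split x h with ∧-split {S x} h
      ... | p , q = p , trans (sym (Boolₚ.not-involutive (S (bar x)))) (cong not q)

      B-dart : ∀ x → B x ≡ true → D x ≡ true
      B-dart x h with D x in Dx
      ... | true = refl
      ... | false = absurdᵇ (trans (cong S (proj₂ (off x Dx))) (proj₁ (B-split x h))) (proj₂ (B-split x h))

      B-rising : ∀ x → B x ≡ true → ω x ≡ + 1
      B-rising x h with ω-unit x (B-dart x h)
      ... | inj₁ e = e
      ... | inj₂ e = absurdᵇ (S-down x (proj₁ (B-split x h)) e) (proj₂ (B-split x h))

      -- The marks on `S` sum to one, so its rises sum to `r`. Edges with both sides in `S` cancel,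
      -- and every dart leaving `S` rises, since a falling one could have been crossed.
      B-count : + count B ≡ + r
      B-count = trans (sym (∑-count B)) (trans (sym (ℤₚ.+-identityˡ (∑ (λ x → ⟦ B x ⟧)))) (trans (cong (_+ ∑ (λ x → ⟦ B x ⟧)) (sym inner))
        (trans (sym (∑-+ (λ x → ⟦ S x ⟧ * (⟦ S (bar x) ⟧ * ω x)) (λ x → ⟦ B x ⟧))) (trans (∑-cong (λ x → sym (pointwise x))) Sω))))
        where
        inner : ∑ (λ x → ⟦ S x ⟧ * (⟦ S (bar x) ⟧ * ω x)) ≡ + 0
        inner = ∑-anti (invol-inj bar-inv) _ (λ x → trans (cong₂ (λ u v → ⟦ S (bar x) ⟧ * (⟦ S u ⟧ * v)) (bar-inv x) (ω-bar x)) (l ⟦ S x ⟧ ⟦ S (bar x) ⟧ (ω x)))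
          where
          l : ∀ a b w → b * (a * - w) ≡ - (a * (b * w))
          l = solve-∀
        pointwise : ∀ x → ⟦ S x ⟧ * ω x ≡ ⟦ S x ⟧ * (⟦ S (bar x) ⟧ * ω x) + ⟦ B x ⟧
        pointwise x = go (S x) (S (bar x)) refl refl
          where
          go : ∀ u v → S x ≡ u → S (bar x) ≡ v → ⟦ u ⟧ * ω x ≡ ⟦ u ⟧ * (⟦ v ⟧ * ω x) + ⟦ u ∧ not v ⟧
          go false v _ _ = refl
          go true true _ _ = l (ω x)
            where
            l : ∀ w → + 1 * w ≡ + 1 * (+ 1 * w) + + 0
            l = solve-∀
          go true false p q = trans (ℤₚ.*-identityˡ (ω x)) (B-rising x (cong₂ _∧_ p (cong not q)))

      -- The rotation around the head of `x` starts at `φ x` in `S` and ends at `bar x` outside `S`,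
      -- so it meets another boundary dart.
      first-exit : ∀ x → B x ≡ true → ∃ λ z → B z ≡ true × reach (φ ∘ bar ∷ []) (φ x) z ≡ true × x ≡ x
      first-exit x h with exit-point (τ-inj o) S (trans (Sφ x) (proj₁ (B-split x h))) (proj₂ (B-split x h)) (cong φ (bar-inv x))
      ... | z , Sz , Sτz , q = z , cong₂ _∧_ Sz (cong not (trans (sym (Sφ (bar z))) Sτz)) , q , refl

    -- Max-flow min-cut in the dual: an augmenting dual path between the two marks, or a tight cut.
    augment : Augmentation ⊎ Increasing s
    augment with search (λ z → (S z ∧ does (J z ℤ.≟ - + 1)) Boolₚ.≟ true)
    ... | inj₁ (z , h) = inj₁ (found (∧-split {S z} h))
      where
      found : S z ≡ true × does (J z ℤ.≟ - + 1) ≡ true → Augmentation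
      found (Sz , Jz) = record { target = z ; target-conn = S-conn z Sz ; target-mark = sound Jz
                               ; θ = Dual.θ d ; q = Dual.q d ; θ-bar = Dual.θ-bar d ; θ-eq = Dual.θ-eq d ; θ-val = Dual.θ-val d }
        where
        d = dual n z Sz
        sound : does (J z ℤ.≟ - + 1) ≡ true → J z ≡ - + 1
        sound h with J z ℤ.≟ - + 1
        ... | yes e = e
        sound () | no _
    ... | inj₂ none = inj₂ (Walk.increasing o s B B-dart B-rising B-count (λ x _ → x ≡ x) first-exit (boundary-start B (ℤₚ.+-injective B-count)))
      where open Cut S Sm Sφ S-down S-conn (λ x Sx e → none x (cong₂ _∧_ Sx (dec-true (J x ℤ.≟ - + 1) e)))

  private
    -- A component has at most one positive mark, so the augmentation used at a dart depends only on
    -- its component. A component without a positive mark has no mark at all, and there the flow is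
    -- zero.
    module Combine (aug : ∀ m → (Jm : J m ≡ + 1) → FromMark.Augmentation m Jm) where
      Marked : Fin n → Set
      Marked x = ∃ λ m → J m ≡ + 1 × Conn m x ≡ true

      marked? : ∀ x → Dec (Marked x)
      marked? x with Finₚ.any? (λ m → (does (J m ℤ.≟ + 1) ∧ Conn m x) Boolₚ.≟ true)
      ... | no h = no λ { (m , p , q) → h (m , cong₂ _∧_ (dec-true (J m ℤ.≟ + 1) p) q) }
      ... | yes (m , h) = yes (m , sound (proj₁ (∧-split {does (J m ℤ.≟ + 1)} h)) , proj₂ (∧-split {does (J m ℤ.≟ + 1)} h))
        where
        sound : does (J m ℤ.≟ + 1) ≡ true → J m ≡ + 1
        sound h with J m ℤ.≟ + 1
        ... | yes e = e
        sound () | no _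

      choose : (f : ∀ m → J m ≡ + 1 → Fin n → ℤ) → ∀ x → Dec (Marked x) → ℤ
      choose f x (yes (m , Jm , _)) = f m Jm x
      choose f x (no _) = + 0

      unmarked-φ : ∀ x → ¬ Marked x → ¬ Marked (φ x)
      unmarked-φ x h (m , p , q) = h (m , p , trans (sym (conn-φ o m x)) q)

      unmarked-bar : ∀ x → ¬ Marked x → ¬ Marked (bar x)
      unmarked-bar x h (m , p , q) = h (m , p , trans (sym (conn-bar o m x)) q)

      choose-none : ∀ f x (d : Dec (Marked x)) → ¬ Marked x → choose f x d ≡ + 0
      choose-none f x (yes h) nh = ⊥-elim (nh h)
      choose-none f x (no _) nh = refl

      choose-some : ∀ f x (d : Dec (Marked x)) m → J m ≡ + 1 → Conn m x ≡ true → ∃ λ (Jm : J m ≡ + 1) → choose f x d ≡ f m Jm x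
      choose-some f x (no h) m p q = ⊥-elim (h (m , p , q))
      choose-some f x (yes (m' , p' , q')) m p q with J-uniq m' m (conn-trans o m' x m q' (conn-sym o m x q)) (trans p' (sym p)) (λ z → unit≢0 (inj₁ p') z)
      ... | refl = p' , refl

      θ q : Fin n → ℤ
      θ x = choose (λ m p → FromMark.Augmentation.θ (aug m p)) x (marked? x)
      q x = choose (λ m p → FromMark.Augmentation.q (aug m p)) x (marked? x)

      record Here (x : Fin n) : Set where
        field
          m  : Fin n
          Jm : J m ≡ + 1
          mx : Conn m x ≡ true
        open FromMark.Augmentation (aug m Jm) renaming (θ to θ₁; q to q₁) public
        θ-here : ∀ y → Conn m y ≡ true → θ y ≡ θ₁ y
        θ-here y c with choose-some (λ m p → FromMark.Augmentation.θ (aug m p)) y (marked? y) m Jm c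
        ... | p , e = trans e (cong (λ h → FromMark.Augmentation.θ (aug m h) y) (uip p Jm))
        q-here : ∀ y → Conn m y ≡ true → q y ≡ q₁ y
        q-here y c with choose-some (λ m p → FromMark.Augmentation.q (aug m p)) y (marked? y) m Jm c
        ... | p , e = trans e (cong (λ h → FromMark.Augmentation.q (aug m h) y) (uip p Jm))

      θ-none : ∀ x → ¬ Marked x → θ x ≡ + 0
      θ-none x = choose-none (λ m p → FromMark.Augmentation.θ (aug m p)) x (marked? x)
      q-none : ∀ x → ¬ Marked x → q x ≡ + 0
      q-none x = choose-none (λ m p → FromMark.Augmentation.q (aug m p)) x (marked? x)

      here? : ∀ x → Here x ⊎ ¬ Marked x
      here? x with marked? x
      ... | yes (m , p , c) = inj₁ (record { m = m ; Jm = p ; mx = c })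
      ... | no h = inj₂ h

      J-none : ∀ x → ¬ Marked x → J x ≡ + 0
      J-none x h with J-val x
      ... | inj₁ e = e
      ... | inj₂ (inj₁ e) = ⊥-elim (h (x , e , reach-refl (φ ∷ bar ∷ []) x))
      ... | inj₂ (inj₂ e) with mark-partner o (Conn x) η ω J r (conn-φ o x) (conn-bar o x) ω-bar η-φ J-val x (reach-refl (φ ∷ bar ∷ []) x) (λ z → unit≢0 (inj₂ e) z)
      ... | m , c , e' = ⊥-elim (h (m , trans e' (cong -_ e) , conn-sym o x m c))

      J-here : ∀ x (h : Here x) → J x ≡ δ (Here.m h) x - δ (Here.target h) x
      J-here x h = go (x Fin.≟ m) (x Fin.≟ target)
        where
        open Here h
        m≢t : m ≢ target
        m≢t e with trans (sym Jm) (trans (cong J e) target-mark)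
        ... | ()
        go : Dec (x ≡ m) → Dec (x ≡ target) → J x ≡ δ m x - δ target x
        go (yes e) _ = trans (cong J e) (trans Jm (sym (trans (cong (λ z → δ m z - δ target z) e) (cong₂ _-_ (δ-same m) (δ-diff m≢t)))))
        go _ (yes e) = trans (cong J e) (trans target-mark (sym (trans (cong (λ z → δ m z - δ target z) e) (cong₂ _-_ (δ-diff (m≢t ∘ sym)) (δ-same target)))))
        go (no p) (no p') = trans J0 (sym (cong₂ _-_ (δ-diff p) (δ-diff p')))
          where
          J0 : J x ≡ + 0
          J0 with J-val x
          ... | inj₁ e = e
          ... | inj₂ (inj₁ e) = ⊥-elim (p (sym (J-uniq m x mx (trans Jm (sym e)) (λ z → unit≢0 (inj₁ Jm) z))))
          ... | inj₂ (inj₂ e) = ⊥-elim (p' (J-uniq x target (conn-trans o x m target (conn-sym o m x mx) target-conn) (trans e (sym target-mark)) (λ z → unit≢0 (inj₂ e) z)))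

      θ-bar : ∀ x → θ (bar x) ≡ - θ x
      θ-bar x with here? x
      ... | inj₂ h = trans (θ-none (bar x) (unmarked-bar x h)) (sym (cong -_ (θ-none x h)))
      ... | inj₁ h = trans (Here.θ-here h (bar x) (trans (conn-bar o (Here.m h) x) (Here.mx h))) (trans (Here.θ-bar h x) (cong -_ (sym (Here.θ-here h x (Here.mx h)))))

      θ-val : ∀ x → θ x ≡ + 0 ⊎ θ x ≡ - ω x
      θ-val x with here? x
      ... | inj₂ h = inj₁ (θ-none x h)
      ... | inj₁ h with Here.θ-val h x
      ... | inj₁ e = inj₁ (trans (Here.θ-here h x (Here.mx h)) e)
      ... | inj₂ e = inj₂ (trans (Here.θ-here h x (Here.mx h)) e)

      θ-eq : ∀ x → θ x ≡ q (φ x) - q x + J x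
      θ-eq x with here? x
      ... | inj₂ h = trans (θ-none x h) (sym (trans (cong₂ (λ u v → u - v + J x) (q-none (φ x) (unmarked-φ x h)) (q-none x h)) (trans (ℤₚ.+-identityˡ (J x)) (J-none x h))))
      ... | inj₁ h = trans (Here.θ-here h x (Here.mx h)) (trans (Here.θ-eq h x) (trans (l (q₁ (φ x)) (q₁ x) (δ m x) (δ target x))
            (sym (trans (cong₂ (λ u v → u - v + J x) (q-here (φ x) (trans (conn-φ o m x) mx)) (q-here x mx)) (cong (λ u → q₁ (φ x) - q₁ x + u) (J-here x h))))))
        where
        open Here h
        l : ∀ a b c d → a - b + c - d ≡ a - b + (c - d)
        l = solve-∀

      -- The residue `p` is a genuine function of the vertices, and `κ` counts how often it wraps
      -- around along a dart. Unlike `η` itself, this splits the height into a part that survives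
      -- the change of modulus and a part that is rescaled.
      p q₀ κ : Fin n → ℤ
      p x = + (η x %ℕ r)
      q₀ x = η x /ℕ r
      κ x = q₀ (φ x) - q₀ x + J x

      η-split : ∀ x → η x ≡ p x + q₀ x * + r
      η-split x = a≡a%ℕn+[a/ℕn]*n (η x) r

      p-τ : ∀ x → p (φ (bar x)) ≡ p x
      p-τ x = cong +_ (%ℕ-cong {η (φ (bar x))} {η x} r (via (e x) (η-τ x)))

      p-bar : ∀ x → p (bar x) ≡ p (φ x)
      p-bar x = trans (sym (p-τ (bar x))) (cong (p ∘ φ) (bar-inv x))

      p-φ : ∀ x → p (φ x) ≡ p x + ω x - + r * κ x
      p-φ x = l (p (φ x)) (q₀ (φ x)) (p x) (q₀ x) (ω x) (J x) (+ r) (trans (sym (η-split (φ x))) (trans (η-φ x) (cong (λ h → h + ω x - + r * J x) (η-split x))))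
        where
        l : ∀ p' q' p q w j r → p' + q' * r ≡ p + q * r + w - r * j → p' ≡ p + w - r * (q' - q + j)
        l p' q' p q w j r e = trans (l1 p' q' r) (trans (cong (_- q' * r) e) (l2 q' p q w j r))
          where
          l1 : ∀ p' q' r → p' ≡ p' + q' * r - q' * r
          l1 = solve-∀
          l2 : ∀ q' p q w j r → p + q * r + w - r * j - q' * r ≡ p + w - r * (q' - q + j)
          l2 = solve-∀

      κ-bar : ∀ x → κ (bar x) ≡ - κ x
      κ-bar x = ℤₚ.*-cancelˡ-≡ (+ r) (κ (bar x)) (- κ x) (l (p x) (p (φ x)) (ω x) (κ x) (κ (bar x)) (+ r) (p-φ x)
        (trans (sym (p-τ x)) (trans (p-φ (bar x)) (cong₂ (λ u v → u + v - + r * κ (bar x)) (p-bar x) (ω-bar x)))))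
        where
        l : ∀ p p' w k k' r → p' ≡ p + w - r * k → p ≡ p' + - w - r * k' → r * k' ≡ r * - k
        l p p' w k k' r e e' = trans (l1 p p' w r k') (trans (cong (λ z → p' - w - z) (sym e')) (trans (cong (λ z → z - w - p) e) (l2 p w r k)))
          where
          l1 : ∀ p p' w r k' → r * k' ≡ p' - w - (p' + - w - r * k')
          l1 = solve-∀
          l2 : ∀ p w r k → p + w - r * k - w - p ≡ r * - k
          l2 = solve-∀

      -- Both `θ` and `κ` have the marks as face sums, so their difference is closed, with witness
      -- `q - q₀`.
      P = ex (λ x → θ x - κ x) (λ x → q x - q₀ x)
        (λ x → trans (cong₂ _-_ (θ-bar x) (κ-bar x)) (l0 (θ x) (κ x)))
        (λ x → trans (l1 (q (φ x)) (q₀ (φ x)) (q x) (q₀ x) (J x)) (cong (λ u → q x - q₀ x + (u - κ x)) (sym (θ-eq x))))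
        where
        l0 : ∀ a b → - a - - b ≡ - (a - b)
        l0 = solve-∀
        l1 : ∀ a b c d j → a - b ≡ c - d + (a - c + j - (b - d + j))
        l1 = solve-∀
      k = proj₁ P
      k-τ = proj₁ (proj₂ P)
      k-φ = proj₂ (proj₂ P)

      -- Adding `2 * θ` reverses the rises crossed by the flow. With `k` the potential of `θ - κ`,
      -- the summand `2 * k` accounts for these reversals up to `2 * κ`, and replacing `r` by
      -- `r + 2` in front of `q₀` supplies the rest, leaving the marks as they were.
      state⁺ : State (2 ℕ.+ r) D φ bar
      state⁺ = record
        { State s
        ; ω = λ x → ω x + + 2 * θ x ; η = H ; e = λ x → q₀ (φ (bar x)) - q₀ x
        ; ω-unit = λ x Dx → unit (ω-unit x Dx) (θ-val x)
        ; ω-bar = λ x → trans (cong₂ (λ u v → u + + 2 * v) (ω-bar x) (θ-bar x)) (l0 (ω x) (θ x))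
        ; η-φ = λ x → trans (cong₂ (λ u v → u + + 2 * v + + (2 ℕ.+ r) * q₀ (φ x)) (p-φ x) (k-φ x)) (l1 (p x) (ω x) (+ r) (q₀ (φ x)) (q₀ x) (J x) (k x) (θ x))
        ; η-τ = λ x → trans (cong₂ (λ u v → u + + 2 * v + + (2 ℕ.+ r) * q₀ (φ (bar x))) (p-τ x) (k-τ x)) (l2 (p x) (k x) (+ (2 ℕ.+ r)) (q₀ (φ (bar x))) (q₀ x)) }
        where
        H : Fin n → ℤ
        H x = p x + + 2 * k x + + (2 ℕ.+ r) * q₀ x
        unit : ∀ {w t} → w ≡ + 1 ⊎ w ≡ - + 1 → t ≡ + 0 ⊎ t ≡ - w → w + + 2 * t ≡ + 1 ⊎ w + + 2 * t ≡ - + 1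
        unit (inj₁ refl) (inj₁ refl) = inj₁ refl
        unit (inj₁ refl) (inj₂ refl) = inj₂ refl
        unit (inj₂ refl) (inj₁ refl) = inj₂ refl
        unit (inj₂ refl) (inj₂ refl) = inj₁ refl
        l0 : ∀ w t → - w + + 2 * - t ≡ - (w + + 2 * t)
        l0 = solve-∀
        l1 : ∀ p w r q' q j k t → p + w - r * (q' - q + j) + + 2 * (k + (t - (q' - q + j))) + (+ 2 + r) * q' ≡
          p + + 2 * k + (+ 2 + r) * q + (w + + 2 * t) - (+ 2 + r) * j
        l1 = solve-∀
        l2 : ∀ p k g q' q → p + + 2 * k + g * q' ≡ p + + 2 * k + g * q + g * (q' - q)
        l2 = solve-∀

  flow : State (2 ℕ.+ r) D φ bar ⊎ Increasing s
  flow with all-or step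
    where
    step : ∀ m → ((Jm : J m ≡ + 1) → FromMark.Augmentation m Jm) ⊎ Increasing s
    step m with J m ℤ.≟ + 1
    ... | no h = inj₁ (λ e → ⊥-elim (h e))
    ... | yes e with FromMark.augment m e
    ... | inj₁ a = inj₁ (λ { e' → subst (FromMark.Augmentation m) (uip e e') a })
    ... | inj₂ c = inj₂ c
  ... | inj₁ aug = inj₁ (Combine.state⁺ aug)
  ... | inj₂ c = inj₂ c

-- M arises from X by doubling the edge of the dart x: the darts y and ȳ are new and x, y bound a face of degree two.
module Doubling {n m : ℕ} {φM barM : Fin n → Fin n} {φX barX : Fin m → Fin m} (oM : Perms φM barM) (oX : Perms φX barX)
  (emb : Fin m → Fin n) (ρ : Fin n → Fin m) (x : Fin m) (y ȳ : Fin n)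
  (ρ-emb : ∀ z → ρ (emb z) ≡ z) (ρ-y : ρ y ≡ barX x) (ρ-ȳ : ρ ȳ ≡ x)
  (cover : ∀ z → z ≡ emb (ρ z) ⊎ z ≡ y ⊎ z ≡ ȳ ⊎ (φM z ≡ z × barM z ≡ z × φX (ρ z) ≡ ρ z × barX (ρ z) ≡ ρ z))
  (bar-emb : ∀ z → barM (emb z) ≡ emb (barX z)) (bar-y : barM y ≡ ȳ)
  (φ-x : φM (emb x) ≡ y) (φ-y : φM y ≡ emb x)
  (σ : Fin m → Fin n) (σ-x : σ x ≡ ȳ) (σ-other : ∀ z → z ≢ x → σ z ≡ emb z) (φ-σ : ∀ z → φM (σ z) ≡ σ (φX z))
  (emb≢y : ∀ z → emb z ≢ y)
  {DM : Fin n → Bool} {DX : Fin m → Bool} (D-ρ : ∀ z → DM z ≡ DX (ρ z)) where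
  private
    module M = Perms oM
    module X = Perms oX

    -- `emb` respects edges and `σ` respects faces. They differ only at `x`: its face in X is the
    -- one that `ȳ` has in M, since in M the dart `emb x` bounds the digon.
    ρσ : ∀ z → ρ (σ z) ≡ z
    ρσ z = go (z Fin.≟ x)
      where
      go : Dec (z ≡ x) → ρ (σ z) ≡ z
      go (yes refl) = trans (cong ρ σ-x) ρ-ȳ
      go (no p) = trans (cong ρ (σ-other z p)) (ρ-emb z)

    bar-ȳ : barM ȳ ≡ y
    bar-ȳ = trans (cong barM (sym bar-y)) (M.bar-inv y)

    ρ-bar : ∀ z → ρ (barM z) ≡ barX (ρ z)
    ρ-bar z with cover z
    ... | inj₁ e = trans (cong (ρ ∘ barM) e) (trans (cong ρ (bar-emb (ρ z))) (ρ-emb (barX (ρ z))))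
    ... | inj₂ (inj₁ refl) = trans (cong ρ bar-y) (trans ρ-ȳ (trans (sym (X.bar-inv x)) (cong barX (sym ρ-y))))
    ... | inj₂ (inj₂ (inj₁ refl)) = trans (cong ρ bar-ȳ) (trans ρ-y (cong barX (sym ρ-ȳ)))
    ... | inj₂ (inj₂ (inj₂ (_ , p , _ , q))) = trans (cong ρ p) (sym q)

    ρ-φ : ∀ z → z ≢ emb x → z ≢ y → ρ (φM z) ≡ φX (ρ z)
    ρ-φ z z≢x z≢y with cover z
    ... | inj₁ e = trans (cong (ρ ∘ φM) (trans e (sym (σ-other (ρ z) λ h → z≢x (trans e (cong emb h)))))) (trans (cong ρ (φ-σ (ρ z))) (ρσ (φX (ρ z))))
    ... | inj₂ (inj₁ e) = ⊥-elim (z≢y e)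
    ... | inj₂ (inj₂ (inj₁ refl)) = trans (cong (ρ ∘ φM) (sym σ-x)) (trans (cong ρ (φ-σ x)) (trans (ρσ (φX x)) (cong φX (sym ρ-ȳ))))
    ... | inj₂ (inj₂ (inj₂ (p , _ , q , _))) = trans (cong ρ p) (sym q)

    embx≢y = emb≢y x

    extend : (Fin m → ℤ) → ℤ → Fin n → ℤ
    extend h c z = if eqᵇ z y then c else h (ρ z)

    extend-y : ∀ h c → extend h c y ≡ c
    extend-y h c = cong (λ b → if b then c else h (ρ y)) (eqᵇ-refl y)

    extend-other : ∀ h c z → z ≢ y → extend h c z ≡ h (ρ z)
    extend-other h c z p = cong (λ b → if b then c else h (ρ z)) (eqᵇ-≢ p)

    extend-φ : ∀ h c z → z ≢ emb x → z ≢ y → extend h c (φM z) ≡ h (φX (ρ z))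
    extend-φ h c z p q = trans (extend-other h c (φM z) (λ e → p (M.φ-inj (trans e (sym φ-x))))) (cong h (ρ-φ z p q))

    at-x : ∀ h c → extend h c (emb x) ≡ h x
    at-x h c = trans (extend-other h c (emb x) embx≢y) (cong h (ρ-emb x))

    three : ∀ z {A : Set} → (z ≡ emb x → A) → (z ≡ y → A) → (z ≢ emb x → z ≢ y → A) → A
    three z f g h with z Fin.≟ emb x | z Fin.≟ y
    ... | yes p | _ = f p
    ... | no _ | yes q = g q
    ... | no p | no q = h p q

    conn-ρ : ∀ z w → reach (φM ∷ barM ∷ []) z w ≡ true → reach (φX ∷ barX ∷ []) (ρ z) (ρ w) ≡ true
    conn-ρ z w c = trans (conn-fun oM (λ u → R (ρ u)) φ-inv' (λ u → trans (cong R (ρ-bar u)) (conn-bar oX (ρ z) (ρ u))) z w c) (reach-refl (φX ∷ barX ∷ []) (ρ z))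
      where
      R = reach (φX ∷ barX ∷ []) (ρ z)
      φ-inv' : ∀ u → R (ρ (φM u)) ≡ R (ρ u)
      φ-inv' u = three u
        (λ { refl → trans (cong (R ∘ ρ) φ-x) (trans (cong R ρ-y) (trans (conn-bar oX (ρ z) x) (cong R (sym (ρ-emb x))))) })
        (λ { refl → trans (cong (R ∘ ρ) φ-y) (trans (cong R (ρ-emb x)) (trans (sym (conn-bar oX (ρ z) x)) (cong R (sym ρ-y)))) })
        (λ p q → trans (cong R (ρ-φ u p q)) (conn-φ oX (ρ z) (ρ u)))

  -- The digon receives no marks, and `y` gets the height reached at the end of `x`. Elsewhere
  -- everything is pulled back along `ρ`; away from the digon and the crosses that are not darts `ρ`
  -- is injective, so uniqueness of marks is kept.
  double : ∀ {g} .{{_ : ℕ.NonZero g}} → State g DX φX barX → State g DM φM barM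
  double {g} s = record
    { ω = ω ∘ ρ ; η = H ; J = L ; e = λ z → _≡_[_].multiple (τ-rel z)
    ; ω-unit = λ z h → ω-unit (ρ z) (trans (sym (D-ρ z)) h)
    ; ω-bar = λ z → trans (cong ω (ρ-bar z)) (ω-bar (ρ z))
    ; η-φ = face ; η-τ = λ z → _≡_[_].equation (τ-rel z)
    ; J-val = λ z → L-ind Sign z (inj₁ refl) (J-val (ρ z))
    ; J-uniq = uniq }
    where
    open State s
    H L : Fin n → ℤ
    H = extend η (η x + ω x)
    L z = if eqᵇ z (emb x) then + 0 else extend J (+ 0) z
    L-x : L (emb x) ≡ + 0
    L-x = cong (λ b → if b then + 0 else extend J (+ 0) (emb x)) (eqᵇ-refl (emb x))
    L-y : L y ≡ + 0
    L-y = trans (cong (λ b → if b then + 0 else extend J (+ 0) y) (eqᵇ-≢ (embx≢y ∘ sym))) (extend-y J (+ 0))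
    L-other : ∀ z → z ≢ emb x → z ≢ y → L z ≡ J (ρ z)
    L-other z p q = trans (cong (λ b → if b then + 0 else extend J (+ 0) z) (eqᵇ-≢ p)) (extend-other J (+ 0) z q)
    L-ind : (P : ℤ → Set) → ∀ z → P (+ 0) → P (J (ρ z)) → P (L z)
    L-ind P z p0 p = three z (λ { refl → subst P (sym L-x) p0 }) (λ { refl → subst P (sym L-y) p0 }) (λ u v → subst P (sym (L-other z u v)) p)
    face : ∀ z → H (φM z) ≡ H z + ω (ρ z) - + g * L z
    face z = three z
      (λ { refl → trans (cong H φ-x) (trans (extend-y η (η x + ω x)) (trans (l1 (η x) (ω x) (+ g))
              (sym (trans (cong₂ (λ u v → u + ω (ρ (emb x)) - + g * v) (at-x η (η x + ω x)) L-x) (cong (λ u → η x + ω u - + g * + 0) (ρ-emb x)))))) })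
      (λ { refl → trans (cong H φ-y) (trans (at-x η (η x + ω x)) (trans (l2 (η x) (ω x) (+ g))
              (sym (trans (cong₂ (λ u v → u + ω (ρ y) - + g * v) (extend-y η (η x + ω x)) L-y) (cong (λ u → η x + ω x + u - + g * + 0) (trans (cong ω ρ-y) (ω-bar x))))))) })
      (λ p q → trans (extend-φ η (η x + ω x) z p q) (trans (η-φ (ρ z)) (sym (cong₂ (λ u v → u + ω (ρ z) - + g * v) (extend-other η (η x + ω x) z q) (L-other z p q)))))
      where
      l1 : ∀ h w g → h + w ≡ h + w - g * + 0
      l1 = solve-∀
      l2 : ∀ h w g → h ≡ h + w + - w - g * + 0
      l2 = solve-∀
    head-x : η x + ω x ≡ η (barX x) [ g ]
    head-x = cong-trans (via (J x) (trans (l (η x) (ω x) (+ g) (J x)) (cong (_+ + g * J x) (sym (η-φ x))))) (via (e (barX x)) (trans (cong (η ∘ φX) (sym (X.bar-inv x))) (η-τ (barX x))))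
      where
      l : ∀ h w g j → h + w ≡ h + w - g * j + g * j
      l = solve-∀
    H-rel : ∀ z → H z ≡ η (ρ z) [ g ]
    H-rel z = go (z Fin.≟ y)
      where
      go : Dec (z ≡ y) → H z ≡ η (ρ z) [ g ]
      go (yes refl) = subst₂ (λ u v → u ≡ η v [ g ]) (sym (extend-y η (η x + ω x))) (sym ρ-y) head-x
      go (no p) = subst (λ u → u ≡ η (ρ z) [ g ]) (sym (extend-other η (η x + ω x) z p)) cong-refl
    turn : ∀ z → η (ρ (φM z)) ≡ η (barX (ρ z)) [ g ]
    turn z = three z
      (λ { refl → subst₂ (λ u v → η u ≡ η v [ g ]) (sym (trans (cong ρ φ-x) ρ-y)) (cong barX (sym (ρ-emb x))) cong-refl })
      (λ { refl → subst₂ (λ u v → η u ≡ η v [ g ]) (sym (trans (cong ρ φ-y) (ρ-emb x))) (trans (sym (X.bar-inv x)) (cong barX (sym ρ-y))) cong-refl })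
      (λ p q → via (e (barX (ρ z))) (trans (cong η (ρ-φ z p q)) (trans (cong (η ∘ φX) (sym (X.bar-inv (ρ z)))) (η-τ (barX (ρ z))))))
    τ-rel : ∀ z → H (φM (barM z)) ≡ H z [ g ]
    τ-rel z = cong-trans (H-rel (φM (barM z))) (cong-trans (turn (barM z))
      (subst (λ u → η u ≡ H z [ g ]) (trans (sym (X.bar-inv (ρ z))) (cong barX (sym (ρ-bar z)))) (cong-sym (H-rel z))))
    uniq : ∀ z w → reach (φM ∷ barM ∷ []) z w ≡ true → L z ≡ L w → L z ≢ + 0 → z ≡ w
    uniq z w c eq nz = three z (λ { refl → ⊥-elim (nz L-x) }) (λ { refl → ⊥-elim (nz L-y) }) λ p q →
      three w (λ { refl → ⊥-elim (nz (trans eq L-x)) }) (λ { refl → ⊥-elim (nz (trans eq L-y)) }) λ p' q' →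
      inj z w p q p' q' (J-uniq (ρ z) (ρ w) (conn-ρ z w c) (trans (sym (L-other z p q)) (trans eq (L-other w p' q'))) (nz ∘ trans (L-other z p q)))
        (nz ∘ trans (L-other z p q)) (nz ∘ trans eq ∘ trans (L-other w p' q'))
      where
      fixed : ∀ z → φX (ρ z) ≡ ρ z → barX (ρ z) ≡ ρ z → J (ρ z) ≡ + 0
      fixed z p q = ℤₚ.*-cancelˡ-≡ (+ g) (J (ρ z)) (+ 0) (trans (trans (sym (height-fixed (η (ρ z)) (ω (ρ z)) (+ g * J (ρ z)) (trans (sym (cong η p)) (η-φ (ρ z))))) (double-zero (trans (sym (cong ω q)) (ω-bar (ρ z))))) (sym (ℤₚ.*-zeroʳ (+ g))))
      inj : ∀ z w → z ≢ emb x → z ≢ y → w ≢ emb x → w ≢ y → ρ z ≡ ρ w → J (ρ z) ≢ + 0 → J (ρ w) ≢ + 0 → z ≡ w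
      inj z w p q p' q' e nz nw with cover z | cover w
      ... | inj₂ (inj₁ h) | _ = ⊥-elim (q h)
      ... | _ | inj₂ (inj₁ h) = ⊥-elim (q' h)
      ... | inj₁ h | inj₁ h' = trans h (trans (cong emb e) (sym h'))
      ... | inj₂ (inj₂ (inj₁ h)) | inj₂ (inj₂ (inj₁ h')) = trans h (sym h')
      ... | inj₁ h | inj₂ (inj₂ (inj₁ refl)) = ⊥-elim (p (trans h (cong emb (trans e ρ-ȳ))))
      ... | inj₂ (inj₂ (inj₁ refl)) | inj₁ h = ⊥-elim (p' (trans h (cong emb (trans (sym e) ρ-ȳ))))
      ... | inj₂ (inj₂ (inj₂ (_ , _ , u , v))) | _ = ⊥-elim (nz (fixed z u v))
      ... | _ | inj₂ (inj₂ (inj₂ (_ , _ , u , v))) = ⊥-elim (nw (fixed w u v))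

  -- The sum of `ζ` around the digon vanishes, so parallel darts carry equal values and `ζ` factors
  -- through `ρ`.
  exact-double : Exact φX barX → Exact φM barM
  exact-double ex ζ q ζ-bar q-φ = p' , (λ z → trans (cong p' refl) (pτ z)) , pφ
    where
    ζy : ζ y ≡ - ζ (emb x)
    ζy = l (q (emb x)) (q y) (ζ (emb x)) (ζ y) (trans (sym (cong q φ-x)) (q-φ (emb x))) (trans (sym (cong q φ-y)) (q-φ y))
      where
      l : ∀ a b z w → b ≡ a + z → a ≡ b + w → w ≡ - z
      l a .(a + z) z w refl e = trans (l1 a z w) (trans (cong (λ u → u - a - z) (sym e)) (l2 a z))
        where
        l1 : ∀ a z w → w ≡ a + z + w - a - z
        l1 = solve-∀
        l2 : ∀ a z → a - a - z ≡ - z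
        l2 = solve-∀
    ζȳ : ζ ȳ ≡ ζ (emb x)
    ζȳ = trans (cong ζ (sym bar-y)) (trans (ζ-bar y) (trans (cong -_ ζy) (ℤₚ.neg-involutive (ζ (emb x)))))
    ζ' : Fin m → ℤ
    ζ' = ζ ∘ emb
    ζ'-bar : ∀ z → ζ' (barX z) ≡ - ζ' z
    ζ'-bar z = trans (cong ζ (sym (bar-emb z))) (ζ-bar (emb z))
    ζσ : ∀ z → ζ (σ z) ≡ ζ' z
    ζσ z = go (z Fin.≟ x)
      where
      go : Dec (z ≡ x) → ζ (σ z) ≡ ζ' z
      go (yes refl) = trans (cong ζ σ-x) ζȳ
      go (no p) = cong ζ (σ-other z p)
    P = ex ζ' (q ∘ σ) ζ'-bar (λ z → trans (cong q (sym (φ-σ z))) (trans (q-φ (σ z)) (cong (λ u → q (σ z) + u) (ζσ z))))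
    p = proj₁ P
    p' : Fin n → ℤ
    p' = p ∘ ρ
    ζρ : ∀ z → ζ z ≡ ζ' (ρ z)
    ζρ z with cover z
    ... | inj₁ e = cong ζ e
    ... | inj₂ (inj₁ refl) = trans ζy (trans (sym (ζ'-bar x)) (cong ζ' (sym ρ-y)))
    ... | inj₂ (inj₂ (inj₁ refl)) = trans ζȳ (cong ζ' (sym ρ-ȳ))
    ... | inj₂ (inj₂ (inj₂ (_ , u , _ , v))) = trans (double-zero (trans (sym (cong ζ u)) (ζ-bar z))) (sym (double-zero (trans (sym (cong ζ' v)) (ζ'-bar (ρ z)))))
    p-bar : ∀ z → p (φX z) ≡ p (barX z)
    p-bar z = trans (cong (p ∘ φX) (sym (X.bar-inv z))) (proj₁ (proj₂ P) (barX z))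
    p'φ : ∀ z → p' (φM z) ≡ p (φX (ρ z))
    p'φ z = three z
      (λ { refl → trans (cong p' φ-x) (trans (cong p ρ-y) (trans (sym (p-bar x)) (cong (p ∘ φX) (sym (ρ-emb x))))) })
      (λ { refl → trans (cong p' φ-y) (trans (cong p (ρ-emb x)) (trans (sym (proj₁ (proj₂ P) x)) (cong (p ∘ φX) (sym ρ-y)))) })
      (λ u v → cong p (ρ-φ z u v))
    pφ : ∀ z → p' (φM z) ≡ p' z + ζ z
    pφ z = trans (p'φ z) (trans (proj₂ (proj₂ P) (ρ z)) (cong (λ u → p (ρ z) + u) (sym (ζρ z))))
    pτ : ∀ z → p' (φM (barM z)) ≡ p' z
    pτ z = trans (p'φ (barM z)) (trans (cong (p ∘ φX) (ρ-bar z)) (proj₁ (proj₂ P) (ρ z)))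

  τ-x : φM (barM ȳ) ≡ emb x
  τ-x = trans (cong φM bar-ȳ) φ-y

  τ-y : φM (barM (emb (barX x))) ≡ y
  τ-y = trans (cong φM (trans (bar-emb (barX x)) (cong emb (X.bar-inv x)))) φ-x

  -- The form is pulled back along `ρ`; the digon forces the value of the extended witness at `y`.
  exact-undouble : Exact φM barM → Exact φX barX
  exact-undouble ex ζ q ζ-bar q-φ = p ∘ emb
    , (λ z → trans (emb-φ (barX z)) (trans (cong (λ u → p (φM u)) (sym (bar-emb z))) (proj₁ (proj₂ P) (emb z))))
    , (λ z → trans (emb-φ z) (trans (proj₂ (proj₂ P) (emb z)) (cong (λ u → p (emb z) + ζ u) (ρ-emb z))))
    where
    Q : Fin n → ℤ
    Q = extend q (q x + ζ x)
    Q-φ : ∀ z → Q (φM z) ≡ Q z + ζ (ρ z)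
    Q-φ z = three z
      (λ { refl → trans (cong Q φ-x) (trans (extend-y q (q x + ζ x)) (sym (cong₂ (λ u v → u + ζ v) (at-x q (q x + ζ x)) (ρ-emb x)))) })
      (λ { refl → trans (cong Q φ-y) (trans (at-x q (q x + ζ x)) (trans (l (q x) (ζ x)) (sym (cong₂ _+_ (extend-y q (q x + ζ x)) (trans (cong ζ ρ-y) (ζ-bar x)))))) })
      (λ u v → trans (extend-φ q (q x + ζ x) z u v) (trans (q-φ (ρ z)) (cong (_+ ζ (ρ z)) (sym (extend-other q (q x + ζ x) z v)))))
      where
      l : ∀ a z → a ≡ a + z + - z
      l = solve-∀
    P = ex (ζ ∘ ρ) Q (λ z → trans (cong ζ (ρ-bar z)) (ζ-bar (ρ z))) Q-φ
    p = proj₁ P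
    pσ : ∀ z → p (σ z) ≡ p (emb z)
    pσ z = go (z Fin.≟ x)
      where
      go : Dec (z ≡ x) → p (σ z) ≡ p (emb z)
      go (yes refl) = trans (cong p σ-x) (trans (sym (proj₁ (proj₂ P) ȳ)) (cong p τ-x))
      go (no u) = cong p (σ-other z u)
    emb-φ : ∀ z → p (emb (φX z)) ≡ p (φM (emb z))
    emb-φ z = trans (sym (pσ (φX z))) (trans (cong p (sym (φ-σ z))) (trans (proj₂ (proj₂ P) (σ z))
      (trans (cong₂ (λ u v → u + ζ v) (pσ z) (trans (ρσ z) (sym (ρ-emb z)))) (sym (proj₂ (proj₂ P) (emb z))))))

  -- The hypothesis on `ω` says that the digon does not wind, so both parallel edges rise alike and
  -- either may represent the remaining edge. Heights and marks are read along `σ`, which preserves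
  -- faces.
  undouble : ∀ {g} (s : State g DM φM barM) → State.ω s y ≡ - State.ω s (emb x) → State g DX φX barX
  undouble {g} s ωy = record
    { ω = ω ∘ emb ; η = η ∘ σ ; J = J ∘ σ ; e = λ z → _≡_[_].multiple (τ-rel z)
    ; ω-unit = λ z h → ω-unit (emb z) (trans (D-ρ (emb z)) (trans (cong DX (ρ-emb z)) h))
    ; ω-bar = λ z → trans (cong ω (sym (bar-emb z))) (ω-bar (emb z))
    ; η-φ = λ z → trans (cong η (sym (φ-σ z))) (trans (η-φ (σ z)) (cong (λ u → η (σ z) + u - + g * J (σ z)) (ωσ z)))
    ; η-τ = λ z → _≡_[_].equation (τ-rel z)
    ; J-val = λ z → J-val (σ z)
    ; J-uniq = λ z w c e nz → trans (sym (ρσ z)) (trans (cong ρ (J-uniq (σ z) (σ w) (conn-σ z w c) e nz)) (ρσ w)) }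
    where
    open State s
    ωσ : ∀ z → ω (σ z) ≡ ω (emb z)
    ωσ z = go (z Fin.≟ x)
      where
      go : Dec (z ≡ x) → ω (σ z) ≡ ω (emb z)
      go (yes refl) = trans (cong ω (trans σ-x (sym bar-y))) (trans (ω-bar y) (trans (cong -_ ωy) (ℤₚ.neg-involutive (ω (emb x)))))
      go (no p) = cong ω (σ-other z p)
    -- ȳ lies at the vertex of x, so σ only moves darts within a vertex
    same : ∀ z → η (σ z) ≡ η (emb z) [ g ]
    same z = go (z Fin.≟ x)
      where
      go : Dec (z ≡ x) → η (σ z) ≡ η (emb z) [ g ]
      go (yes refl) = cong-sym (via (e ȳ) (trans (cong η (sym τ-x)) (trans (η-τ ȳ) (cong (λ u → η u + + g * e ȳ) (sym σ-x)))))
      go (no p) = subst (λ u → η u ≡ η (emb z) [ g ]) (sym (σ-other z p)) cong-refl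
    turn : ∀ z → η (φM (σ z)) ≡ η (emb (barX z)) [ g ]
    turn z = go (z Fin.≟ x)
      where
      go : Dec (z ≡ x) → η (φM (σ z)) ≡ η (emb (barX z)) [ g ]
      go (yes refl) = cong-trans (subst (λ u → η u ≡ η y [ g ]) (cong φM (trans bar-y (sym σ-x))) (via (e y) (η-τ y)))
        (subst (λ u → η u ≡ η (emb (barX x)) [ g ]) τ-y (via (e (emb (barX x))) (η-τ (emb (barX x)))))
      go (no p) = subst (λ u → η u ≡ η (emb (barX z)) [ g ]) (cong φM (trans (bar-emb (barX z)) (trans (cong emb (X.bar-inv z)) (sym (σ-other z p)))))
        (via (e (emb (barX z))) (η-τ (emb (barX z))))
    τ-rel : ∀ z → η (σ (φX (barX z))) ≡ η (σ z) [ g ]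
    τ-rel z = cong-trans (subst (λ u → η u ≡ η (emb (barX (barX z))) [ g ]) (φ-σ (barX z)) (turn (barX z)))
      (subst (λ u → η (emb u) ≡ η (σ z) [ g ]) (sym (X.bar-inv z)) (cong-sym (same z)))
    conn-σ : ∀ z w → reach (φX ∷ barX ∷ []) z w ≡ true → reach (φM ∷ barM ∷ []) (σ z) (σ w) ≡ true
    conn-σ z w c = trans (conn-fun oX (λ u → R (σ u)) (λ u → trans (cong R (sym (φ-σ u))) (conn-φ oM (σ z) (σ u))) barR z w c) (reach-refl (φM ∷ barM ∷ []) (σ z))
      where
      R = reach (φM ∷ barM ∷ []) (σ z)
      Rτ : ∀ u → R (φM (barM u)) ≡ R u
      Rτ u = trans (conn-φ oM (σ z) (barM u)) (conn-bar oM (σ z) u)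
      Rσ : ∀ u → R (σ u) ≡ R (emb u)
      Rσ u = go (u Fin.≟ x)
        where
        go : Dec (u ≡ x) → R (σ u) ≡ R (emb u)
        go (yes refl) = trans (cong R σ-x) (trans (sym (Rτ ȳ)) (cong R τ-x))
        go (no p) = cong R (σ-other u p)
      barR : ∀ u → R (σ (barX u)) ≡ R (σ u)
      barR u = trans (Rσ (barX u)) (trans (cong R (sym (bar-emb u))) (trans (conn-bar oM (σ z) (emb u)) (sym (Rσ u))))

-- Maps, orientations and two-colourings

open Map

module Laws (M : Map) (isM : IsMap M) where
  α₀² : ∀ x → α₀ M (α₀ M x) ≡ x
  α₀² = proj₁ isM
  α₁² : ∀ x → α₁ M (α₁ M x) ≡ x
  α₁² = proj₁ (proj₂ isM)
  α₂² : ∀ x → α₂ M (α₂ M x) ≡ x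
  α₂² = proj₁ (proj₂ (proj₂ isM))
  α₀≢ : ∀ x → α₀ M x ≢ x
  α₀≢ = proj₁ (proj₂ (proj₂ (proj₂ isM)))
  α₁≢ : ∀ x → α₁ M x ≢ x
  α₁≢ = proj₁ (proj₂ (proj₂ (proj₂ (proj₂ isM))))
  α₂≢ : ∀ x → α₂ M x ≢ x
  α₂≢ = proj₁ (proj₂ (proj₂ (proj₂ (proj₂ (proj₂ isM)))))
  α₀α₂ : ∀ x → α₀ M (α₂ M x) ≡ α₂ M (α₀ M x)
  α₀α₂ = proj₂ (proj₂ (proj₂ (proj₂ (proj₂ (proj₂ isM)))))

  α₀-inj : Inj (α₀ M)
  α₀-inj = invol-inj α₀²
  α₁-inj : Inj (α₁ M)
  α₁-inj = invol-inj α₁²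
  α₂-inj : Inj (α₂ M)
  α₂-inj = invol-inj α₂²
  τM-inj : Inj (τ M)
  τM-inj e = α₂-inj (α₁-inj e)
  φM-inj : Inj (φ M)
  φM-inj e = α₀-inj (α₁-inj e)

  v-inj : ∀ {h} → h ∈ vGens M → Inj h
  v-inj (here refl) = α₁-inj
  v-inj (there (here refl)) = α₂-inj

  c-inj : ∀ {h} → h ∈ cGens M → Inj h
  c-inj (here refl) = α₀-inj
  c-inj (there (here refl)) = α₁-inj
  c-inj (there (there (here refl))) = α₂-inj

  vertex-inv₁ : ∀ x y → reach (vGens M) x (α₁ M y) ≡ reach (vGens M) x y
  vertex-inv₁ x = reach-inv (vGens M) x (here refl) α₁-inj
  vertex-inv₂ : ∀ x y → reach (vGens M) x (α₂ M y) ≡ reach (vGens M) x y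
  vertex-inv₂ x = reach-inv (vGens M) x (there (here refl)) α₂-inj

  vertex-fun : {A : Set} (h : Fin (n M) → A) → (∀ x → h (α₁ M x) ≡ h x) → (∀ x → h (α₂ M x) ≡ h x) →
    ∀ x y → reach (vGens M) x y ≡ true → h y ≡ h x
  vertex-fun h p q x y = reach-fun (vGens M) x y h λ { (here refl) → p ; (there (here refl)) → q }

  τ-reflect : ∀ k w → iter k (τ M) (α₂ M (iter k (τ M) w)) ≡ α₂ M w
  τ-reflect zero w = refl
  τ-reflect (suc k) w = trans (iter-suc k (τ M) _) (trans (cong (iter k (τ M)) (trans (cong (α₁ M) (α₂² _)) (α₁² _))) (τ-reflect k w))

  -- These are the reflections of the dihedral group generated by `τ` and `α₂`. Conjugation lowers
  -- `k` by two until `α₂` or `α₁` is left, and these have no fixed points. So `α₂` always changes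
  -- the `τ`-cycle.
  no-reflection-fixed : ∀ k y → iter k (τ M) (α₂ M y) ≢ y
  no-reflection-fixed zero y = α₂≢ y
  no-reflection-fixed (suc zero) y e = α₁≢ y (trans (cong (α₁ M) (sym (α₂² y))) e)
  no-reflection-fixed (suc (suc k)) y e = no-reflection-fixed k (α₂ M (α₁ M y))
    (trans (cong (iter k (τ M)) (trans (α₂² (α₁ M y)) (cong (α₁ M) (sym (α₂² y)))))
      (trans (sym (iter-suc k (τ M) (α₂ M y))) (τM-inj (trans e (sym (trans (cong (α₁ M) (α₂² (α₁ M y))) (α₁² y)))))))

  -- Walk around the vertex of a without crossing the corner {a , α₁ a}.
  around : {A : Set} (u : A → A) → (∀ z → u (u z) ≡ z) → (h : Fin (n M) → A) → (∀ x → h (α₂ M x) ≡ u (h x)) → (a : Fin (n M)) →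
    (∀ y → reach (vGens M) a y ≡ true → y ≢ a → y ≢ α₁ M a → h (α₁ M y) ≡ u (h y)) → h (α₁ M a) ≡ u (h a)
  around u u² h h₂ a h₁ = trans (cong h (trans (cong (α₁ M) (sym back)) (α₁² _))) (trans (h₂ (z p)) (cong u (const p ℕₚ.≤-refl)))
    where
    z : ℕ → Fin (n M)
    z i = iter i (τ M) a
    period' = least (λ i → z (suc i) Fin.≟ a) (proj₁ (period τM-inj a)) (proj₂ (proj₂ (period τM-inj a)))
    p = proj₁ period'
    back : τ M (z p) ≡ a
    back = proj₁ (proj₂ period')
    V : ∀ i → reach (vGens M) a (z i) ≡ true
    V zero = reach-refl (vGens M) a
    V (suc i) = trans (vertex-inv₁ a (α₂ M (z i))) (trans (vertex-inv₂ a (z i)) (V i))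
    const : ∀ i → i ℕ.≤ p → h (z i) ≡ h a
    const zero _ = refl
    const (suc i) lt = trans (h₁ (α₂ M (z i)) (trans (vertex-inv₂ a (z i)) (V i)) not-a not-α₁a)
      (trans (cong u (h₂ (z i))) (trans (u² (h (z i))) (const i (ℕₚ.<⇒≤ lt))))
      where
      not-a : α₂ M (z i) ≢ a
      not-a e = no-reflection-fixed i (α₂ M a) (trans (cong (iter i (τ M)) (α₂² a)) (trans (sym (α₂² (z i))) (cong (α₂ M) e)))
      not-α₁a : α₂ M (z i) ≢ α₁ M a
      not-α₁a e = proj₂ (proj₂ period') i lt (trans (cong (α₁ M) e) (α₁² a))

-- Orientations and two-colourings satisfy equations of one shape, so a single argument pulls both
-- back along gluings and restricts both to submaps. `Orient` changes under all three involutions;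
-- `Bip` changes only along edges, so it colours the vertices.
record Label (A : Set) (u₀ u : A → A) (M : Map) : Set where
  field
    lab  : Fin (n M) → A
    lab₀ : ∀ x → lab (α₀ M x) ≡ u₀ (lab x)
    lab₁ : ∀ x → lab (α₁ M x) ≡ u (lab x)
    lab₂ : ∀ x → lab (α₂ M x) ≡ u (lab x)

  lab-τ : (∀ z → u (u z) ≡ z) → ∀ k x → lab (iter k (τ M) x) ≡ lab x
  lab-τ u² zero x = refl
  lab-τ u² (suc k) x = trans (lab₁ _) (trans (cong u (lab₂ _)) (trans (u² _) (lab-τ u² k x)))

Orient Bip : Map → Set
Orient = Label Bool not not
Bip = Label Bool not id

-- First returns

record FirstReturn {n : ℕ} (K : Fin n → Bool) (σ : Fin n → Fin n) (y z : Fin n) : Set where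
  field
    index : ℕ
    hit   : z ≡ iter (suc index) σ y
    kept  : K z ≡ true
    miss  : ∀ j → j ℕ.< index → K (iter (suc j) σ y) ≡ false

first-unique : ∀ {n} {K : Fin n → Bool} {σ y z w} → FirstReturn K σ y z → FirstReturn K σ y w → z ≡ w
first-unique {K = K} {σ} {y} r s with ℕₚ.<-cmp (FirstReturn.index r) (FirstReturn.index s)
... | tri< lt _ _ = absurdᵇ (trans (cong K (sym (FirstReturn.hit r))) (FirstReturn.kept r)) (FirstReturn.miss s _ lt)
... | tri> _ _ gt = absurdᵇ (trans (cong K (sym (FirstReturn.hit s))) (FirstReturn.kept s)) (FirstReturn.miss r _ gt)
... | tri≈ _ eq _ = trans (FirstReturn.hit r) (trans (cong (λ k → iter (suc k) σ y) eq) (sym (FirstReturn.hit s)))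

nextIn-kept : ∀ {n} (K : Fin n → Bool) (σ : Fin n → Fin n) f y → K (nextIn K σ (suc f) y) ≡ true → FirstReturn K σ y (nextIn K σ (suc f) y)
nextIn-kept K σ f y k with K (σ y) in eq
... | true = record { index = 0 ; hit = refl ; kept = k ; miss = λ j () }
nextIn-kept K σ zero y k | false = absurdᵇ k eq
nextIn-kept K σ (suc f) y k | false with nextIn-kept K σ f (σ y) k
... | r = record { index = suc (FirstReturn.index r) ; hit = trans (FirstReturn.hit r) (sym (iter-suc (suc (FirstReturn.index r)) σ y)) ; kept = FirstReturn.kept r
                 ; miss = λ { zero _ → eq ; (suc j) (s≤s lt) → trans (cong K (iter-suc (suc j) σ y)) (FirstReturn.miss r j lt) } }

nextIn-first : ∀ {n} (K : Fin n → Bool) (σ : Fin n → Fin n) f y i → i ℕ.< f → K (iter (suc i) σ y) ≡ true →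
  (∀ j → j ℕ.< i → K (iter (suc j) σ y) ≡ false) → nextIn K σ f y ≡ iter (suc i) σ y
nextIn-first K σ (suc f) y zero lt k miss rewrite k = refl
nextIn-first K σ (suc f) y (suc i) (s≤s lt) k miss rewrite miss 0 (s≤s z≤n) =
  trans (nextIn-first K σ f (σ y) i lt (trans (cong K (sym (iter-suc (suc i) σ y))) k) (λ j l → trans (cong K (sym (iter-suc (suc j) σ y))) (miss (suc j) (s≤s l))))
    (sym (iter-suc (suc i) σ y))

nextIn-compute : ∀ {n} {K : Fin n → Bool} {σ : Fin n → Fin n} → Inj σ → ∀ {y z} → FirstReturn K σ y z → nextIn K σ n y ≡ z
nextIn-compute {n} {K} {σ} σ-inj {y} r = trans (nextIn-first K σ n y index bound (trans (cong K (sym hit)) kept) miss) (sym hit)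
  where
  open FirstReturn r
  -- the hit occurs within the first period of y
  bound : index ℕ.< n
  bound with period σ-inj (σ y)
  ... | p , p<n , e with index ℕ.≤? p
  ... | yes le = ℕₚ.≤-<-trans le p<n
  ... | no gt with ℕₚ.m≤n⇒∃[o]m+o≡n (ℕₚ.≰⇒> gt)
  ... | o , q = absurdᵇ (trans (cong K (sym (trans hit (wrap)))) kept) (miss o (subst (o ℕ.<_) q (ℕₚ.m<n+m o (s≤s z≤n))))
    where
    wrap : iter (suc index) σ y ≡ iter (suc o) σ y
    wrap = trans (iter-suc index σ y) (trans (cong (λ k → iter k σ (σ y)) (trans (sym q) (ℕₚ.+-comm (suc p) o)))
      (trans (iter-+ o (suc p) σ (σ y)) (trans (cong (iter o σ) e) (sym (iter-suc o σ y)))))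

-- `α₂` reverses the rotation, so the walk back from `α₂ w` meets the same deleted crosses in the
-- opposite order. Hence `α₁` of a submap is an involution.
first-sym : (M : Map) → IsMap M → (K : Fin (n M) → Bool) → (∀ x → K (α₂ M x) ≡ K x) → ∀ {y w} → K y ≡ true → FirstReturn K (τ M) (α₂ M y) w → FirstReturn K (τ M) (α₂ M w) y
first-sym M isM K K₂ {y} {w} Ky r = record
  { index = index
  ; hit = sym (trans (cong (λ v → iter (suc index) (τ M) (α₂ M v)) hit) (trans (Laws.τ-reflect M isM (suc index) (α₂ M y)) (Laws.α₂² M isM y)))
  ; kept = Ky
  ; miss = m }
  where
  open Laws M isM
  open FirstReturn r
  m : ∀ j → j ℕ.< index → K (iter (suc j) (τ M) (α₂ M w)) ≡ false
  m j lt with ℕₚ.m≤n⇒∃[o]m+o≡n lt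
  ... | o , q = trans (cong K (trans (cong (λ v → iter (suc j) (τ M) (α₂ M v)) (trans hit (trans (cong (λ k → iter k (τ M) (α₂ M y)) (trans (cong suc (sym q)) (cong suc (sym (ℕₚ.+-suc j o))))) (iter-+ (suc j) (suc o) (τ M) (α₂ M y)))))
      (τ-reflect (suc j) (iter (suc o) (τ M) (α₂ M y))))) (trans (K₂ _) (miss o (subst (o ℕ.<_) q (s≤s (ℕₚ.m≤n+m o j)))))

-- Submaps

module Sub (X M : Map) (d : SubData M) (isM : IsMap M) (sub : SubIso X M d)
  (K₀ : ∀ x → SubData.keepE d (α₀ M x) ≡ SubData.keepE d x) (K₂ : ∀ x → SubData.keepE d (α₂ M x) ≡ SubData.keepE d x) where
  open Laws M isM
  open SubIso sub
  K = SubData.keepE d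

  first : ∀ z → FirstReturn K (τ M) (α₂ M (emb z)) (emb (α₁ X z))
  first z = subst (FirstReturn K (τ M) (α₂ M (emb z))) (sym (comm₁ z))
    (go (n M) (nonempty (emb z)) (trans (cong K (sym (comm₁ z))) (emb-into (α₁ X z))))
    where
    nonempty : ∀ {k} → Fin k → ∃ λ f → k ≡ suc f
    nonempty {suc k} _ = k , refl
    go : ∀ k → (∃ λ f → k ≡ suc f) → K (nextIn K (τ M) k (α₂ M (emb z))) ≡ true → FirstReturn K (τ M) (α₂ M (emb z)) (nextIn K (τ M) k (α₂ M (emb z)))
    go .(suc f) (f , refl) = nextIn-kept K (τ M) f (α₂ M (emb z))

  isX : IsMap X
  isX = (λ x → emb-inj (trans (comm₀ _) (trans (cong (α₀ M) (comm₀ x)) (α₀² (emb x)))))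
      , (λ x → emb-inj (first-unique (first (α₁ X x)) (first-sym M isM K K₂ (emb-into x) (first x))))
      , (λ x → emb-inj (trans (comm₂ _) (trans (cong (α₂ M) (comm₂ x)) (α₂² (emb x)))))
      , (λ x e → α₀≢ (emb x) (trans (sym (comm₀ x)) (cong emb e)))
      , (λ x e → no-reflection-fixed (suc (FirstReturn.index (first x))) (emb x) (trans (sym (FirstReturn.hit (first x))) (cong emb e)))
      , (λ x e → α₂≢ (emb x) (trans (sym (comm₂ x)) (cong emb e)))
      , (λ x → emb-inj (trans (trans (comm₀ _) (cong (α₀ M) (comm₂ x))) (trans (α₀α₂ (emb x)) (sym (trans (comm₂ _) (cong (α₂ M) (comm₀ x)))))))

  restrict : ∀ {A u₀ u} → (∀ (z : A) → u (u z) ≡ z) → Label A u₀ u M → Label A u₀ u X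
  restrict {u = u} u² l = record
    { lab = lab ∘ emb
    ; lab₀ = λ x → trans (cong lab (comm₀ x)) (lab₀ (emb x))
    ; lab₁ = λ x → trans (cong lab (FirstReturn.hit (first x))) (trans (lab-τ u² (suc (FirstReturn.index (first x))) (α₂ M (emb x))) (lab₂ (emb x)))
    ; lab₂ = λ x → trans (cong lab (comm₂ x)) (lab₂ (emb x)) }
    where open Label l

iso-isMap : ∀ {X Y} → X ≅ Y → IsMap Y → IsMap X
iso-isMap {X} {Y} i isY = (λ x → inj (trans (comm₀ _) (trans (cong (α₀ Y) (comm₀ x)) (α₀² (f x)))))
      , (λ x → inj (trans (comm₁ _) (trans (cong (α₁ Y) (comm₁ x)) (α₁² (f x)))))
      , (λ x → inj (trans (comm₂ _) (trans (cong (α₂ Y) (comm₂ x)) (α₂² (f x)))))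
      , (λ x e → α₀≢ (f x) (trans (sym (comm₀ x)) (cong f e)))
      , (λ x e → α₁≢ (f x) (trans (sym (comm₁ x)) (cong f e)))
      , (λ x e → α₂≢ (f x) (trans (sym (comm₂ x)) (cong f e)))
      , (λ x → inj (trans (trans (comm₀ _) (cong (α₀ Y) (comm₂ x))) (trans (α₀α₂ (f x)) (sym (trans (comm₂ _) (cong (α₂ Y) (comm₀ x)))))))
  where
  open _≅_ i
  open Laws Y isY
  f = Inverse.to bij
  inj : ∀ {x y} → f x ≡ f y → x ≡ y
  inj {x} {y} e = trans (sym (Inverse.strictlyInverseʳ bij x)) (trans (cong (Inverse.from bij) e) (Inverse.strictlyInverseʳ bij y))

iso-label : ∀ {X Y A u₀ u} → X ≅ Y → Label A u₀ u X → Label A u₀ u Y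
iso-label {X} {Y} i l = record
  { lab = lab ∘ f⁻
  ; lab₀ = λ y → trans (cong lab (push (comm₀ (f⁻ y)) (cong (α₀ Y) (ff⁻ y)))) (lab₀ (f⁻ y))
  ; lab₁ = λ y → trans (cong lab (push (comm₁ (f⁻ y)) (cong (α₁ Y) (ff⁻ y)))) (lab₁ (f⁻ y))
  ; lab₂ = λ y → trans (cong lab (push (comm₂ (f⁻ y)) (cong (α₂ Y) (ff⁻ y)))) (lab₂ (f⁻ y)) }
  where
  open _≅_ i
  open Label l
  f = Inverse.to bij
  f⁻ = Inverse.from bij
  ff⁻ : ∀ y → f (f⁻ y) ≡ y
  ff⁻ = Inverse.strictlyInverseˡ bij
  push : ∀ {x y z} → f x ≡ y → y ≡ z → f⁻ z ≡ x
  push {x} refl refl = Inverse.strictlyInverseʳ bij x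

-- Gluing

module Glue (M : Map) (isM : IsMap M) (a b : Fin (n M)) where
  open Laws M isM
  private sw = swapF a b

  glue-isMap : IsMap (glue M a b)
  glue-isMap = α₀² , (λ x → trans (cong (sw ∘ α₁ M) (swap-invol a b _)) (trans (cong sw (α₁² _)) (swap-invol a b x)))
    , α₂² , α₀≢ , (λ x e → α₁≢ (sw x) (trans (sym (swap-invol a b _)) (cong sw e))) , α₂≢ , α₀α₂

  module _ (apart : reach (vGens M) a b ≡ false) where
    a≢b : a ≢ b
    a≢b refl = absurdᵇ (reach-refl (vGens M) a) apart

    private
      α₁a≢b : α₁ M a ≢ b
      α₁a≢b e = absurdᵇ (trans (cong (reach (vGens M) a) (sym e)) (trans (vertex-inv₁ a a) (reach-refl (vGens M) a))) apart

    -- Gluing changes `α₁` only at the corners of `a` and `b`, which belong to different vertices of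
    -- `M`. Each of these vertices thus misses one corner, and `around` recovers the equation there
    -- from all the others.
    module Around {A : Set} {u : A → A} (u² : ∀ z → u (u z) ≡ z) (lab : Fin (n M) → A)
      (lab₁ : ∀ x → lab (α₁ (glue M a b) x) ≡ u (lab x)) (lab₂ : ∀ x → lab (α₂ M x) ≡ u (lab x)) where
      private
        plain : ∀ x → x ≢ a → x ≢ b → x ≢ α₁ M a → x ≢ α₁ M b → lab (α₁ M x) ≡ u (lab x)
        plain x p q r s = trans (cong lab (sym (trans (cong (sw ∘ α₁ M) (swap-other p q))
          (swap-other (λ e → r (trans (sym (α₁² x)) (cong (α₁ M) e))) (λ e → s (trans (sym (α₁² x)) (cong (α₁ M) e))))))) (lab₁ x)
        at-a' : lab (α₁ M a) ≡ u (lab a)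
        at-a' = around u u² lab lab₂ a λ y V p r → plain y p (λ e → absurdᵇ (trans (cong (reach (vGens M) a) (sym e)) V) apart) r
          (λ e → absurdᵇ (trans (sym (vertex-inv₁ a b)) (trans (cong (reach (vGens M) a) (sym e)) V)) apart)
        at-b' : lab (α₁ M b) ≡ u (lab b)
        at-b' = around u u² lab lab₂ b λ y V q s → plain y (λ e → far (trans (cong (reach (vGens M) b) (sym e)) V)) q
          (λ e → far (trans (sym (vertex-inv₁ b a)) (trans (cong (reach (vGens M) b) (sym e)) V))) s
          where
          far : reach (vGens M) b a ≡ true → ⊥
          far h = absurdᵇ (reach-sym (vGens M) v-inj b a h) apart
        back : ∀ y → lab (α₁ M y) ≡ u (lab y) → lab (α₁ M (α₁ M y)) ≡ u (lab (α₁ M y))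
        back y e = trans (cong lab (α₁² y)) (trans (sym (u² (lab y))) (cong u (sym e)))
        cases : ∀ x → Dec (x ≡ a) → Dec (x ≡ b) → Dec (x ≡ α₁ M a) → Dec (x ≡ α₁ M b) → lab (α₁ M x) ≡ u (lab x)
        cases x (yes refl) _ _ _ = at-a'
        cases x _ (yes refl) _ _ = at-b'
        cases x _ _ (yes refl) _ = back a at-a'
        cases x _ _ _ (yes refl) = back b at-b'
        cases x (no p) (no q) (no r) (no s) = plain x p q r s

      unglued : ∀ x → lab (α₁ M x) ≡ u (lab x)
      unglued x = cases x (x Fin.≟ a) (x Fin.≟ b) (x Fin.≟ α₁ M a) (x Fin.≟ α₁ M b)

      glued : lab a ≡ lab b
      glued = trans (sym (u² (lab a))) (trans (cong u (trans (sym (unglued a)) across)) (u² (lab b)))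
        where
        across : lab (α₁ M a) ≡ u (lab b)
        across = trans (cong lab (sym (trans (cong (sw ∘ α₁ M) (swap-b a b)) (swap-other (α₁≢ a) α₁a≢b)))) (lab₁ b)

    unglue-label : ∀ {A u₀ u} → (∀ (z : A) → u (u z) ≡ z) → Label A u₀ u (glue M a b) → Label A u₀ u M
    unglue-label {u = u} u² l = record { lab = lab ; lab₀ = lab₀ ; lab₁ = Around.unglued {u = u} u² lab lab₁ lab₂ ; lab₂ = lab₂ }
      where open Label l

    private
      -- Reachability in the glued map is itself a labelling invariant there; pulled back it shows
      -- that vertices only merge.
      module V (x : Fin (n M)) = Around {u = id} (λ _ → refl) (reach (vGens (glue M a b)) x)
        (Laws.vertex-inv₁ (glue M a b) glue-isMap x) (Laws.vertex-inv₂ (glue M a b) glue-isMap x)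

    vertices-glued : reach (vGens (glue M a b)) a b ≡ true
    vertices-glued = trans (sym (V.glued a)) (reach-refl (vGens (glue M a b)) a)

    vertices-glued' : reach (vGens (glue M a b)) (α₁ M a) (α₁ M b) ≡ true
    vertices-glued' = trans (V.unglued (α₁ M a) b) (trans (sym (V.glued (α₁ M a))) (trans (sym (V.unglued (α₁ M a) a)) (reach-refl (vGens (glue M a b)) (α₁ M a))))

    vertices-coarser : ∀ x y → reach (vGens M) x y ≡ true → reach (vGens (glue M a b)) x y ≡ true
    vertices-coarser x y h = trans (vertex-fun (reach (vGens (glue M a b)) x) (V.unglued x) (Laws.vertex-inv₂ (glue M a b) glue-isMap x) x y h) (reach-refl (vGens (glue M a b)) x)

-- The face permutation and the reversal of the darts of an oriented map, fixing all other crosses.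
module Hat (M : Map) (isM : IsMap M) (O : Orient M) where
  open Laws M isM
  open Label O renaming (lab to c; lab₀ to c₀; lab₁ to c₁; lab₂ to c₂)

  φ̂ bar̂ : Fin (n M) → Fin (n M)
  φ̂ x = if c x then φ M x else x
  bar̂ x = if c x then α₀ M (α₂ M x) else x

  c-φ : ∀ x → c (φ M x) ≡ c x
  c-φ x = trans (c₁ _) (trans (cong not (c₀ x)) (Boolₚ.not-involutive (c x)))
  c-bar : ∀ x → c (α₀ M (α₂ M x)) ≡ c x
  c-bar x = trans (c₀ _) (trans (cong not (c₂ x)) (Boolₚ.not-involutive (c x)))

  φ̂-dart : ∀ x → c x ≡ true → φ̂ x ≡ φ M x
  φ̂-dart x e = cong (λ b → if b then φ M x else x) e
  φ̂-off : ∀ x → c x ≡ false → φ̂ x ≡ x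
  φ̂-off x e = cong (λ b → if b then φ M x else x) e
  bar̂-dart : ∀ x → c x ≡ true → bar̂ x ≡ α₀ M (α₂ M x)
  bar̂-dart x e = cong (λ b → if b then α₀ M (α₂ M x) else x) e
  bar̂-off : ∀ x → c x ≡ false → bar̂ x ≡ x
  bar̂-off x e = cong (λ b → if b then α₀ M (α₂ M x) else x) e

  dart? : ∀ x → c x ≡ true ⊎ c x ≡ false
  dart? x with c x
  ... | true = inj₁ refl
  ... | false = inj₂ refl

  c-φ̂ : ∀ x → c (φ̂ x) ≡ c x
  c-φ̂ x with dart? x
  ... | inj₁ e = trans (cong c (φ̂-dart x e)) (c-φ x)
  ... | inj₂ e = cong c (φ̂-off x e)
  c-bar̂ : ∀ x → c (bar̂ x) ≡ c x
  c-bar̂ x with dart? x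
  ... | inj₁ e = trans (cong c (bar̂-dart x e)) (c-bar x)
  ... | inj₂ e = cong c (bar̂-off x e)

  hat : Perms φ̂ bar̂
  hat = record { φ-inj = inj ; bar-inv = inv }
    where
    inj : Inj φ̂
    inj {x} {y} e with dart? x | dart? y
    ... | inj₁ p | inj₁ q = φM-inj (trans (sym (φ̂-dart x p)) (trans e (φ̂-dart y q)))
    ... | inj₂ p | inj₂ q = trans (sym (φ̂-off x p)) (trans e (φ̂-off y q))
    ... | inj₁ p | inj₂ q = absurdᵇ p (trans (sym (c-φ̂ x)) (trans (cong c e) (trans (c-φ̂ y) q)))
    ... | inj₂ p | inj₁ q = absurdᵇ q (trans (sym (c-φ̂ y)) (trans (cong c (sym e)) (trans (c-φ̂ x) p)))
    inv : ∀ x → bar̂ (bar̂ x) ≡ x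
    inv x with dart? x
    ... | inj₂ p = trans (cong bar̂ (bar̂-off x p)) (bar̂-off x p)
    ... | inj₁ p = trans (cong bar̂ (bar̂-dart x p)) (trans (bar̂-dart _ (trans (c-bar x) p))
      (trans (cong (α₀ M) (trans (sym (α₀α₂ (α₂ M x))) (cong (α₀ M) (α₂² x)))) (α₀² x)))

  τ̂-dart : ∀ x → c x ≡ true → φ̂ (bar̂ x) ≡ τ M x
  τ̂-dart x p = trans (cong φ̂ (bar̂-dart x p)) (trans (φ̂-dart _ (trans (c-bar x) p)) (cong (α₁ M) (α₀² (α₂ M x))))

  -- `α₂` pairs every other cross with a dart at the same end of its edge, so an invariant of darts
  -- extends to all crosses. This is how orbits of crosses are compared with orbits of darts.
  ext : {A : Set} → (Fin (n M) → A) → Fin (n M) → A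
  ext h x = if c x then h x else h (α₂ M x)
  ext-dart : {A : Set} (h : Fin (n M) → A) → ∀ x → c x ≡ true → ext h x ≡ h x
  ext-dart h x e = cong (λ b → if b then h x else h (α₂ M x)) e
  ext-off : {A : Set} (h : Fin (n M) → A) → ∀ x → c x ≡ false → ext h x ≡ h (α₂ M x)
  ext-off h x e = cong (λ b → if b then h x else h (α₂ M x)) e

  ext₂ : {A : Set} (h : Fin (n M) → A) → ∀ x → ext h (α₂ M x) ≡ ext h x
  ext₂ h x with dart? x
  ... | inj₁ p = trans (ext-off h _ (trans (c₂ x) (cong not p))) (trans (cong h (α₂² x)) (sym (ext-dart h x p)))
  ... | inj₂ p = trans (ext-dart h _ (trans (c₂ x) (cong not p))) (sym (ext-off h x p))

  ext₁ : {A : Set} (h : Fin (n M) → A) → (∀ x → h (φ̂ (bar̂ x)) ≡ h x) → ∀ x → ext h (α₁ M x) ≡ ext h x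
  ext₁ h hτ x with dart? x
  ... | inj₁ p = trans (ext-off h _ (trans (c₁ x) (cong not p))) (trans (sym (hτ (α₂ M (α₁ M x))))
        (trans (cong h (trans (τ̂-dart _ (trans (c₂ _) (cong not (trans (c₁ x) (cong not p))))) (trans (cong (α₁ M) (α₂² _)) (α₁² x)))) (sym (ext-dart h x p))))
  ... | inj₂ p = trans (ext-dart h _ (trans (c₁ x) (cong not p))) (trans (cong h (cong (α₁ M) (sym (α₂² x))))
        (trans (cong h (sym (τ̂-dart (α₂ M x) (trans (c₂ x) (cong not p))))) (trans (hτ (α₂ M x)) (sym (ext-off h x p)))))

  ext₀ : {A : Set} (h : Fin (n M) → A) → (∀ x → h (bar̂ x) ≡ h x) → ∀ x → ext h (α₀ M x) ≡ ext h x
  ext₀ h hb x with dart? x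
  ... | inj₁ p = trans (ext-off h _ (trans (c₀ x) (cong not p))) (trans (cong h (sym (α₀α₂ x))) (trans (cong h (sym (bar̂-dart x p))) (trans (hb x) (sym (ext-dart h x p)))))
  ... | inj₂ p = trans (ext-dart h _ (trans (c₀ x) (cong not p))) (trans (cong (h ∘ α₀ M) (sym (α₂² x)))
        (trans (cong h (sym (bar̂-dart (α₂ M x) (trans (c₂ x) (cong not p))))) (trans (hb (α₂ M x)) (sym (ext-off h x p)))))

  -- The crosses at a vertex form two rotations exchanged by `α₂`, and the orientation makes one of
  -- them consist of darts.
  vertex-τ : ∀ x y → c x ≡ true → c y ≡ true → reach (vGens M) x y ≡ true → reach (φ̂ ∘ bar̂ ∷ []) x y ≡ true
  vertex-τ x y p q v = trans (sym (ext-dart h y q)) (trans (vertex-fun (ext h) (ext₁ h (reach-inv (φ̂ ∘ bar̂ ∷ []) x (here refl) (τ-inj hat))) (ext₂ h) x y v)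
    (trans (ext-dart h x p) (reach-refl (φ̂ ∘ bar̂ ∷ []) x)))
    where
    h = reach (φ̂ ∘ bar̂ ∷ []) x

  τ-vertex : ∀ x y → reach (φ̂ ∘ bar̂ ∷ []) x y ≡ true → reach (vGens M) x y ≡ true
  τ-vertex x y r = trans (τ-fun hat (reach (vGens M) x) inv x y r) (reach-refl (vGens M) x)
    where
    inv : ∀ z → reach (vGens M) x (φ̂ (bar̂ z)) ≡ reach (vGens M) x z
    inv z with dart? z
    ... | inj₁ p = trans (cong (reach (vGens M) x) (τ̂-dart z p)) (trans (vertex-inv₁ x _) (vertex-inv₂ x z))
    ... | inj₂ p = cong (reach (vGens M) x) (trans (cong φ̂ (bar̂-off z p)) (φ̂-off z p))

  component-conn : ∀ x y → c x ≡ true → c y ≡ true → reach (cGens M) x y ≡ true → reach (φ̂ ∷ bar̂ ∷ []) x y ≡ true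
  component-conn x y p q v = trans (sym (ext-dart h y q)) (trans (reach-fun (cGens M) x y (ext h)
      (λ { (here refl) → ext₀ h hb ; (there (here refl)) → ext₁ h (λ z → trans (conn-φ hat x (bar̂ z)) (hb z)) ; (there (there (here refl))) → ext₂ h }) v)
    (trans (ext-dart h x p) (reach-refl (φ̂ ∷ bar̂ ∷ []) x)))
    where
    h = reach (φ̂ ∷ bar̂ ∷ []) x
    hb = conn-bar hat x

  conn-component : ∀ x y → reach (φ̂ ∷ bar̂ ∷ []) x y ≡ true → reach (cGens M) x y ≡ true
  conn-component x y r = trans (conn-fun hat R inv-φ inv-bar x y r) (reach-refl (cGens M) x)
    where
    R = reach (cGens M) x
    R₀ = reach-inv (cGens M) x (here refl) α₀-inj
    R₁ = reach-inv (cGens M) x (there (here refl)) α₁-inj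
    R₂ = reach-inv (cGens M) x (there (there (here refl))) α₂-inj
    inv-φ : ∀ z → R (φ̂ z) ≡ R z
    inv-φ z with dart? z
    ... | inj₁ p = trans (cong R (φ̂-dart z p)) (trans (R₁ _) (R₀ z))
    ... | inj₂ p = cong R (φ̂-off z p)
    inv-bar : ∀ z → R (bar̂ z) ≡ R z
    inv-bar z with dart? z
    ... | inj₁ p = trans (cong R (bar̂-dart z p)) (trans (R₀ _) (R₂ z))
    ... | inj₂ p = cong R (bar̂-off z p)

-- Gluing duplicate edges

module Dup (M X : Map) (isM : IsMap M) (x : Fin (n M)) (d : SubData M) (sub : SubIso X M d)
  (K₀ : ∀ z → SubData.keepE d (α₀ M z) ≡ SubData.keepE d z) (K₂ : ∀ z → SubData.keepE d (α₂ M z) ≡ SubData.keepE d z)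
  (xx : φ M (φ M x) ≡ x) (Kx : SubData.keepE d x ≡ true) (Ky : SubData.keepE d (φ M x) ≡ false)
  (K-edge : ∀ z → SubData.keepE d z ≡ false →
    z ≡ φ M x ⊎ z ≡ α₀ M (φ M x) ⊎ z ≡ α₂ M (φ M x) ⊎ z ≡ α₂ M (α₀ M (φ M x))) where
  open Laws M isM
  open SubIso sub
  open Sub X M d isM sub K₀ K₂ public using (first; isX)
  private
    K = SubData.keepE d
  module LX = Laws X isX

  y y₁ y₂ y₃ : Fin (n M)
  y = φ M x
  y₁ = α₀ M y
  y₂ = α₂ M y
  y₃ = α₂ M (α₀ M y)

  Edge : Fin (n M) → Set
  Edge z = z ≡ y ⊎ z ≡ y₁ ⊎ z ≡ y₂ ⊎ z ≡ y₃

  Ky₁ : K y₁ ≡ false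
  Ky₁ = trans (K₀ y) Ky
  Ky₂ : K y₂ ≡ false
  Ky₂ = trans (K₂ y) Ky
  Ky₃ : K y₃ ≡ false
  Ky₃ = trans (K₂ y₁) Ky₁
  K-Edge : ∀ {z} → Edge z → K z ≡ false
  K-Edge (inj₁ refl) = Ky
  K-Edge (inj₂ (inj₁ refl)) = Ky₁
  K-Edge (inj₂ (inj₂ (inj₁ refl))) = Ky₂
  K-Edge (inj₂ (inj₂ (inj₂ refl))) = Ky₃

  α₁y : α₁ M y ≡ α₀ M x
  α₁y = α₁² (α₀ M x)
  α₁y₁ : α₁ M y₁ ≡ x
  α₁y₁ = xx

  x' : Fin (n X)
  x' = proj₁ (emb-onto x Kx)
  emb-x' : emb x' ≡ x
  emb-x' = proj₂ (emb-onto x Kx)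
  emb-x'₀ : emb (α₀ X x') ≡ α₀ M x
  emb-x'₀ = trans (comm₀ x') (cong (α₀ M) emb-x')

  view : ∀ z → (∃ λ w → emb w ≡ z) ⊎ Edge z
  view z = go (K z) refl
    where
    go : ∀ k → K z ≡ k → (∃ λ w → emb w ≡ z) ⊎ Edge z
    go true e = inj₁ (emb-onto z e)
    go false e = inj₂ (K-edge z e)

  -- `y` and `y₁` have kept partners under `α₁`, namely crosses of the edge of `x`, so among the
  -- deleted crosses only `y₂` can be the partner of `y₃`.
  step-y₃ : Edge (α₁ M y₃) → α₁ M y₃ ≡ y₂
  step-y₃ (inj₁ e) = absurdᵇ (trans (K₀ x) Kx) (trans (cong K (trans (sym α₁y) (trans (cong (α₁ M) (sym e)) (α₁² y₃)))) Ky₃)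
  step-y₃ (inj₂ (inj₁ e)) = absurdᵇ Kx (trans (cong K (trans (sym α₁y₁) (trans (cong (α₁ M) (sym e)) (α₁² y₃)))) Ky₃)
  step-y₃ (inj₂ (inj₂ (inj₁ e))) = e
  step-y₃ (inj₂ (inj₂ (inj₂ e))) = ⊥-elim (α₁≢ y₃ e)

  step-y₂ : Edge (α₁ M y₂) → α₁ M y₂ ≡ y₃
  step-y₂ (inj₁ e) = absurdᵇ (trans (K₀ x) Kx) (trans (cong K (trans (sym α₁y) (trans (cong (α₁ M) (sym e)) (α₁² y₂)))) Ky₂)
  step-y₂ (inj₂ (inj₁ e)) = absurdᵇ Kx (trans (cong K (trans (sym α₁y₁) (trans (cong (α₁ M) (sym e)) (α₁² y₂)))) Ky₂)
  step-y₂ (inj₂ (inj₂ (inj₁ e))) = ⊥-elim (α₁≢ y₂ e)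
  step-y₂ (inj₂ (inj₂ (inj₂ e))) = e

  private
    FR = FirstReturn K (τ M)
    one : ∀ w → K (τ M w) ≡ true → FR w (τ M w)
    one w k = record { index = 0 ; hit = refl ; kept = k ; miss = λ j () }
    two : ∀ w → K (τ M w) ≡ false → K (τ M (τ M w)) ≡ true → FR w (τ M (τ M w))
    two w p k = record { index = 1 ; hit = refl ; kept = k ; miss = λ { zero _ → p ; (suc _) (s≤s ()) } }
    three-steps : ∀ w → K (τ M w) ≡ false → K (τ M (τ M w)) ≡ false → K (τ M (τ M (τ M w))) ≡ true → FR w (τ M (τ M (τ M w)))
    three-steps w p q k = record { index = 2 ; hit = refl ; kept = k ; miss = λ { zero _ → p ; (suc zero) _ → q ; (suc (suc _)) (s≤s (s≤s ())) } }

  after-kept : ∀ w v → α₁ M (emb w) ≡ v → K v ≡ true → emb (α₁ X w) ≡ v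
  after-kept w v e k = trans (first-unique (first w) (one (α₂ M (emb w)) (trans (cong K τe) k))) τe
    where
    τe : τ M (α₂ M (emb w)) ≡ v
    τe = trans (cong (α₁ M) (α₂² (emb w))) e

  after-one : ∀ w v v' → α₁ M (emb w) ≡ v → K v ≡ false → α₁ M (α₂ M v) ≡ v' → K v' ≡ true → emb (α₁ X w) ≡ v'
  after-one w v v' e k e' k' = trans (first-unique (first w) (two (α₂ M (emb w)) (trans (cong K τe) k) (trans (cong K ττe) k'))) ττe
    where
    τe : τ M (α₂ M (emb w)) ≡ v
    τe = trans (cong (α₁ M) (α₂² (emb w))) e
    ττe : τ M (τ M (α₂ M (emb w))) ≡ v'
    ττe = trans (cong (τ M) τe) e'

  after-two : ∀ w v v' v'' → α₁ M (emb w) ≡ v → K v ≡ false → α₁ M (α₂ M v) ≡ v' → K v' ≡ false → α₁ M (α₂ M v') ≡ v'' → K v'' ≡ true → emb (α₁ X w) ≡ v''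
  after-two w v v' v'' e k e' k' e'' k'' = trans (first-unique (first w) (three-steps (α₂ M (emb w)) (trans (cong K τe) k) (trans (cong K ττe) k') (trans (cong K τττe) k''))) τττe
    where
    τe : τ M (α₂ M (emb w)) ≡ v
    τe = trans (cong (α₁ M) (α₂² (emb w))) e
    ττe : τ M (τ M (α₂ M (emb w))) ≡ v'
    ττe = trans (cong (τ M) τe) e'
    τττe : τ M (τ M (τ M (α₂ M (emb w)))) ≡ v''
    τττe = trans (cong (τ M) ττe) e''

  α₁x : α₁ M x ≡ y₁
  α₁x = trans (cong (α₁ M) (sym α₁y₁)) (α₁² y₁)

  -- IsMap allows α₀ ∘ α₂ to have fixed points, so the case y₃ ≡ y of an edge with two crosses occurs.
  loop : α₁ M y₃ ≡ y₂ → emb (α₁ X x') ≡ α₀ M x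
  loop e = after-two x' y₁ y₂ (α₀ M x) (trans (cong (α₁ M) emb-x') α₁x) Ky₁ e Ky₂ (trans (cong (α₁ M) (α₂² y)) α₁y) (trans (K₀ x) Kx)

  degenerate-loop : y₃ ≡ y → emb (α₁ X x') ≡ α₀ M x
  degenerate-loop e = after-one x' y₁ (α₀ M x) (trans (cong (α₁ M) emb-x') α₁x) Ky₁ (trans (cong (α₁ M) e) α₁y) (trans (K₀ x) Kx)

  after-x : K (α₁ M y₃) ≡ true → emb (α₁ X x') ≡ α₁ M y₃
  after-x = after-one x' y₁ (α₁ M y₃) (trans (cong (α₁ M) emb-x') α₁x) Ky₁ refl

  after-x₀ : K (α₁ M y₂) ≡ true → emb (α₁ X (α₀ X x')) ≡ α₁ M y₂
  after-x₀ = after-one (α₀ X x') y (α₁ M y₂) (cong (α₁ M) emb-x'₀) Ky refl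

  module Extension {A : Set} (h : Fin (n X) → A) (v v₁ v₂ v₃ : A) (deg : y₃ ≡ y → v₃ ≡ v × v₂ ≡ v₁) where
    value : ∀ {z} → Edge z → A
    value (inj₁ _) = v
    value (inj₂ (inj₁ _)) = v₁
    value (inj₂ (inj₂ (inj₁ _))) = v₂
    value (inj₂ (inj₂ (inj₂ _))) = v₃

    private
      deg' : y₂ ≡ y₁ → v₂ ≡ v₁
      deg' e = proj₂ (deg (trans (cong (α₂ M) (sym e)) (α₂² y)))

    value-unique : ∀ {z} (e e' : Edge z) → value e ≡ value e'
    value-unique (inj₁ _) (inj₁ _) = refl
    value-unique (inj₁ p) (inj₂ (inj₁ q)) = ⊥-elim (α₀≢ y (trans (sym q) p))
    value-unique (inj₁ p) (inj₂ (inj₂ (inj₁ q))) = ⊥-elim (α₂≢ y (trans (sym q) p))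
    value-unique (inj₁ p) (inj₂ (inj₂ (inj₂ q))) = sym (proj₁ (deg (trans (sym q) p)))
    value-unique (inj₂ (inj₁ q)) (inj₁ p) = ⊥-elim (α₀≢ y (trans (sym q) p))
    value-unique (inj₂ (inj₁ _)) (inj₂ (inj₁ _)) = refl
    value-unique (inj₂ (inj₁ p)) (inj₂ (inj₂ (inj₁ q))) = sym (deg' (trans (sym q) p))
    value-unique (inj₂ (inj₁ p)) (inj₂ (inj₂ (inj₂ q))) = ⊥-elim (α₂≢ y₁ (trans (sym q) p))
    value-unique (inj₂ (inj₂ (inj₁ q))) (inj₁ p) = ⊥-elim (α₂≢ y (trans (sym q) p))
    value-unique (inj₂ (inj₂ (inj₁ q))) (inj₂ (inj₁ p)) = deg' (trans (sym q) p)
    value-unique (inj₂ (inj₂ (inj₁ _))) (inj₂ (inj₂ (inj₁ _))) = refl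
    value-unique (inj₂ (inj₂ (inj₁ p))) (inj₂ (inj₂ (inj₂ q))) = ⊥-elim (α₀≢ y (α₂-inj (trans (sym q) p)))
    value-unique (inj₂ (inj₂ (inj₂ q))) (inj₁ p) = proj₁ (deg (trans (sym q) p))
    value-unique (inj₂ (inj₂ (inj₂ q))) (inj₂ (inj₁ p)) = ⊥-elim (α₂≢ y₁ (trans (sym q) p))
    value-unique (inj₂ (inj₂ (inj₂ q))) (inj₂ (inj₂ (inj₁ p))) = ⊥-elim (α₀≢ y (α₂-inj (trans (sym q) p)))
    value-unique (inj₂ (inj₂ (inj₂ _))) (inj₂ (inj₂ (inj₂ _))) = refl

    extend : Fin (n M) → A
    extend z with view z
    ... | inj₁ (w , _) = h w
    ... | inj₂ e = value e

    extend-emb : ∀ w → extend (emb w) ≡ h w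
    extend-emb w with view (emb w)
    ... | inj₁ (w' , e) = cong h (emb-inj e)
    ... | inj₂ e = absurdᵇ (emb-into w) (K-Edge e)

    extend-edge : ∀ {z} (e : Edge z) → extend z ≡ value e
    extend-edge {z} e with view z
    ... | inj₁ (w , q) = absurdᵇ (trans (cong K (sym q)) (emb-into w)) (K-Edge e)
    ... | inj₂ e' = value-unique e' e

  undup-label : ∀ {A u₀ u} → (∀ (z : A) → u (u z) ≡ z) → (∀ z → u₀ (u₀ z) ≡ z) → (∀ z → u₀ (u z) ≡ u (u₀ z)) → (l : Label A u₀ u X) →
    Σ (Label A u₀ u M) λ l' → ∀ z → Label.lab l' (emb z) ≡ Label.lab l z
  undup-label {A} {u₀} {u} u² u₀² u₀u l = record { lab = extend ; lab₀ = h₀ ; lab₁ = h₁ ; lab₂ = h₂ } , extend-emb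
    where
    open Label l
    ℓ = lab x'
    closed-up : emb (α₁ X x') ≡ α₀ M x → u ℓ ≡ u₀ ℓ
    closed-up e = trans (sym (lab₁ x')) (trans (cong lab (emb-inj (trans e (sym emb-x'₀)))) (lab₀ x'))
    fix : u ℓ ≡ u₀ ℓ → ℓ ≡ u (u₀ ℓ)
    fix e = trans (sym (u² ℓ)) (cong u e)
    -- The values are forced from `x`: `α₁` takes `y` to `α₀ x` and `y₁` to `x`, and `α₂` transfers
    -- them to `y₂` and `y₃`. The deleted edge thus repeats the labels of its duplicate.
    open Extension lab (u (u₀ ℓ)) (u ℓ) (u₀ ℓ) ℓ (λ e → fix (closed-up (degenerate-loop e)) , sym (closed-up (degenerate-loop e)))
    ey  = extend-edge (inj₁ refl)
    ey₁ = extend-edge (inj₂ (inj₁ refl))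
    ey₂ = extend-edge (inj₂ (inj₂ (inj₁ refl)))
    ey₃ = extend-edge (inj₂ (inj₂ (inj₂ refl)))
    ex : extend x ≡ ℓ
    ex = trans (cong extend (sym emb-x')) (extend-emb x')
    ex₀ : extend (α₀ M x) ≡ u₀ ℓ
    ex₀ = trans (cong extend (sym emb-x'₀)) (trans (extend-emb (α₀ X x')) (lab₀ x'))
    h₀ : ∀ z → extend (α₀ M z) ≡ u₀ (extend z)
    h₀ z = go (view z)
      where
      go : (∃ λ w → emb w ≡ z) ⊎ Edge z → extend (α₀ M z) ≡ u₀ (extend z)
      go (inj₁ (w , refl)) = trans (cong extend (sym (comm₀ w))) (trans (extend-emb (α₀ X w)) (trans (lab₀ w) (cong u₀ (sym (extend-emb w)))))
      go (inj₂ (inj₁ refl)) = trans ey₁ (trans (sym (u₀² (u ℓ))) (cong u₀ (trans (u₀u ℓ) (sym ey))))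
      go (inj₂ (inj₂ (inj₁ refl))) = trans (cong extend (α₀² y)) (trans ey (trans (sym (u₀u ℓ)) (cong u₀ (sym ey₁))))
      go (inj₂ (inj₂ (inj₂ (inj₁ refl)))) = trans (cong extend (α₀α₂ y)) (trans ey₃ (trans (sym (u₀² ℓ)) (cong u₀ (sym ey₂))))
      go (inj₂ (inj₂ (inj₂ (inj₂ refl)))) = trans (cong extend (trans (α₀α₂ y₁) (cong (α₂ M) (α₀² y)))) (trans ey₂ (cong u₀ (sym ey₃)))
    h₂ : ∀ z → extend (α₂ M z) ≡ u (extend z)
    h₂ z = go (view z)
      where
      go : (∃ λ w → emb w ≡ z) ⊎ Edge z → extend (α₂ M z) ≡ u (extend z)
      go (inj₁ (w , refl)) = trans (cong extend (sym (comm₂ w))) (trans (extend-emb (α₂ X w)) (trans (lab₂ w) (cong u (sym (extend-emb w)))))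
      go (inj₂ (inj₁ refl)) = trans ey₂ (trans (sym (u² (u₀ ℓ))) (cong u (sym ey)))
      go (inj₂ (inj₂ (inj₁ refl))) = trans ey₃ (trans (sym (u² ℓ)) (cong u (sym ey₁)))
      go (inj₂ (inj₂ (inj₂ (inj₁ refl)))) = trans (cong extend (α₂² y)) (trans ey (cong u (sym ey₂)))
      go (inj₂ (inj₂ (inj₂ (inj₂ refl)))) = trans (cong extend (α₂² y₁)) (trans ey₁ (cong u (sym ey₃)))
    w₃ : K (α₁ M y₃) ≡ true → extend (α₁ M y₃) ≡ u ℓ
    w₃ k = trans (cong extend (sym (after-x k))) (trans (extend-emb (α₁ X x')) (lab₁ x'))
    w₂ : K (α₁ M y₂) ≡ true → extend (α₁ M y₂) ≡ u (u₀ ℓ)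
    w₂ k = trans (cong extend (sym (after-x₀ k))) (trans (extend-emb _) (trans (lab₁ _) (cong u (lab₀ x'))))
    kept : ∀ {z w} → emb w ≡ z → K z ≡ true
    kept {w = w} refl = emb-into w
    from-y₃ : extend (α₁ M y₃) ≡ u ℓ
    from-y₃ = go (view (α₁ M y₃))
      where
      go : (∃ λ w → emb w ≡ α₁ M y₃) ⊎ Edge (α₁ M y₃) → extend (α₁ M y₃) ≡ u ℓ
      go (inj₁ (w , e)) = w₃ (kept e)
      go (inj₂ e) = trans (cong extend (step-y₃ e)) (trans ey₂ (sym (closed-up (loop (step-y₃ e)))))
    from-y₂ : extend (α₁ M y₂) ≡ u (u₀ ℓ)
    from-y₂ = go (view (α₁ M y₂))
      where
      go : (∃ λ w → emb w ≡ α₁ M y₂) ⊎ Edge (α₁ M y₂) → extend (α₁ M y₂) ≡ u (u₀ ℓ)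
      go (inj₁ (w , e)) = w₂ (kept e)
      go (inj₂ e) = trans (cong extend (step-y₂ e)) (trans ey₃ (fix (closed-up (loop (trans (cong (α₁ M) (sym (step-y₂ e))) (α₁² y₂))))))
    back : ∀ {z v} → α₁ M z ≡ v → extend (α₁ M v) ≡ u (extend v) → extend (α₁ M z) ≡ u (extend z)
    back {z} {v} e r = trans (cong extend e) (trans (sym (u² (extend v))) (cong u (trans (sym r) (cong extend (trans (cong (α₁ M) (sym e)) (α₁² z))))))
    edge-case : ∀ {z} → Edge z → extend (α₁ M z) ≡ u (extend z)
    edge-case (inj₁ refl) = trans (cong extend α₁y) (trans ex₀ (trans (sym (u² (u₀ ℓ))) (cong u (sym ey))))
    edge-case (inj₂ (inj₁ refl)) = trans (cong extend α₁y₁) (trans ex (trans (sym (u² ℓ)) (cong u (sym ey₁))))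
    edge-case (inj₂ (inj₂ (inj₁ refl))) = trans from-y₂ (cong u (sym ey₂))
    edge-case (inj₂ (inj₂ (inj₂ refl))) = trans from-y₃ (cong u (sym ey₃))
    h₁ : ∀ z → extend (α₁ M z) ≡ u (extend z)
    h₁ z = go (view z) (view (α₁ M z))
      where
      go : (∃ λ w → emb w ≡ z) ⊎ Edge z → (∃ λ w → emb w ≡ α₁ M z) ⊎ Edge (α₁ M z) → extend (α₁ M z) ≡ u (extend z)
      go (inj₂ e) _ = edge-case e
      go (inj₁ _) (inj₂ e) = back refl (edge-case e)
      go (inj₁ (w , refl)) (inj₁ (w' , e)) = trans (cong extend (sym (after-kept w (α₁ M (emb w)) refl (kept e))))
        (trans (extend-emb (α₁ X w)) (trans (lab₁ w) (cong u (sym (extend-emb w)))))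

  -- Supplies the hypotheses of `Doubling`, with `y₃` as the reverse of `y`. The other two crosses
  -- of the deleted edge are not darts and fall under the last case of `cover`.
  module Oriented (cM : Orient M) (cX : Orient X) (agree : ∀ z → Label.lab cM (emb z) ≡ Label.lab cX z)
    (dart : Label.lab cX x' ≡ true) (nondeg : y₃ ≢ y) where
    private
      module HM = Hat M isM cM
      module HX = Hat X isX cX
      c = Label.lab cM
      open Extension {A = Fin (n X)} id (α₂ X (α₀ X x')) (α₂ X x') (α₀ X x') x' (λ e → ⊥-elim (nondeg e)) renaming (extend to ρ; extend-emb to ρ-emb; extend-edge to ρ-edge)
      cx : c x ≡ true
      cx = trans (cong c (sym emb-x')) (trans (agree x') dart)
      cy : c y ≡ true
      cy = trans (HM.c-φ x) cx
      cy₁ : c y₁ ≡ false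
      cy₁ = trans (Label.lab₀ cM y) (cong not cy)
      cy₂ : c y₂ ≡ false
      cy₂ = trans (Label.lab₂ cM y) (cong not cy)
      cy₃ : c y₃ ≡ true
      cy₃ = trans (Label.lab₂ cM y₁) (cong not cy₁)
      ρ-y : ρ y ≡ HX.bar̂ x'
      ρ-y = trans (ρ-edge (inj₁ refl)) (trans (sym (LX.α₀α₂ x')) (sym (HX.bar̂-dart x' dart)))
      ρ-ȳ : ρ y₃ ≡ x'
      ρ-ȳ = ρ-edge (inj₂ (inj₂ (inj₂ refl)))
      ρ-y₁ : ρ y₁ ≡ α₂ X x'
      ρ-y₁ = ρ-edge (inj₂ (inj₁ refl))
      ρ-y₂ : ρ y₂ ≡ α₀ X x'
      ρ-y₂ = ρ-edge (inj₂ (inj₂ (inj₁ refl)))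
      cρ₁ : Label.lab cX (ρ y₁) ≡ false
      cρ₁ = trans (cong (Label.lab cX) ρ-y₁) (trans (Label.lab₂ cX x') (cong not dart))
      cρ₂ : Label.lab cX (ρ y₂) ≡ false
      cρ₂ = trans (cong (Label.lab cX) ρ-y₂) (trans (Label.lab₀ cX x') (cong not dart))
      D-ρ : ∀ z → c z ≡ Label.lab cX (ρ z)
      D-ρ z = go (view z)
        where
        go : (∃ λ w → emb w ≡ z) ⊎ Edge z → c z ≡ Label.lab cX (ρ z)
        go (inj₁ (w , refl)) = trans (agree w) (cong (Label.lab cX) (sym (ρ-emb w)))
        go (inj₂ (inj₁ refl)) = trans cy (sym (trans (cong (Label.lab cX) ρ-y) (trans (HX.c-bar̂ x') dart)))
        go (inj₂ (inj₂ (inj₁ refl))) = trans cy₁ (sym cρ₁)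
        go (inj₂ (inj₂ (inj₂ (inj₁ refl)))) = trans cy₂ (sym cρ₂)
        go (inj₂ (inj₂ (inj₂ (inj₂ refl)))) = trans cy₃ (sym (trans (cong (Label.lab cX) ρ-ȳ) dart))
      cover : ∀ z → z ≡ emb (ρ z) ⊎ z ≡ y ⊎ z ≡ y₃ ⊎ (HM.φ̂ z ≡ z × HM.bar̂ z ≡ z × HX.φ̂ (ρ z) ≡ ρ z × HX.bar̂ (ρ z) ≡ ρ z)
      cover z = go (view z)
        where
        go : (∃ λ w → emb w ≡ z) ⊎ Edge z → z ≡ emb (ρ z) ⊎ z ≡ y ⊎ z ≡ y₃ ⊎ (HM.φ̂ z ≡ z × HM.bar̂ z ≡ z × HX.φ̂ (ρ z) ≡ ρ z × HX.bar̂ (ρ z) ≡ ρ z)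
        go (inj₁ (w , refl)) = inj₁ (cong emb (sym (ρ-emb w)))
        go (inj₂ (inj₁ e)) = inj₂ (inj₁ e)
        go (inj₂ (inj₂ (inj₁ refl))) = inj₂ (inj₂ (inj₂ (HM.φ̂-off y₁ cy₁ , HM.bar̂-off y₁ cy₁ , HX.φ̂-off (ρ y₁) cρ₁ , HX.bar̂-off (ρ y₁) cρ₁)))
        go (inj₂ (inj₂ (inj₂ (inj₁ refl)))) = inj₂ (inj₂ (inj₂ (HM.φ̂-off y₂ cy₂ , HM.bar̂-off y₂ cy₂ , HX.φ̂-off (ρ y₂) cρ₂ , HX.bar̂-off (ρ y₂) cρ₂)))
        go (inj₂ (inj₂ (inj₂ (inj₂ e)))) = inj₂ (inj₂ (inj₁ e))
      bar-emb : ∀ z → HM.bar̂ (emb z) ≡ emb (HX.bar̂ z)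
      bar-emb z with HX.dart? z
      ... | inj₁ p = trans (HM.bar̂-dart (emb z) (trans (agree z) p)) (trans (cong (α₀ M) (sym (comm₂ z))) (trans (sym (comm₀ (α₂ X z))) (cong emb (sym (HX.bar̂-dart z p)))))
      ... | inj₂ p = trans (HM.bar̂-off (emb z) (trans (agree z) p)) (cong emb (sym (HX.bar̂-off z p)))
      bar-y : HM.bar̂ y ≡ y₃
      bar-y = trans (HM.bar̂-dart y cy) (α₀α₂ y)
      φ-x : HM.φ̂ (emb x') ≡ y
      φ-x = trans (cong HM.φ̂ emb-x') (HM.φ̂-dart x cx)
      φ-y : HM.φ̂ y ≡ emb x'
      φ-y = trans (HM.φ̂-dart y cy) (trans xx (sym emb-x'))
      σ : Fin (n X) → Fin (n M)
      σ z = if eqᵇ z x' then y₃ else emb z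
      σ-x : σ x' ≡ y₃
      σ-x = cong (λ k → if k then y₃ else emb x') (eqᵇ-refl x')
      σ-other : ∀ z → z ≢ x' → σ z ≡ emb z
      σ-other z p = cong (λ k → if k then y₃ else emb z) (eqᵇ-≢ p)
      emb≢y : ∀ z → emb z ≢ y
      emb≢y z e = absurdᵇ (trans (cong K (sym e)) (emb-into z)) Ky
      α₁α₂y₃ : α₁ M (α₂ M y₃) ≡ x
      α₁α₂y₃ = trans (cong (α₁ M) (α₂² y₁)) α₁y₁
      φ-y₃ : φ M y₃ ≡ α₁ M y₂
      φ-y₃ = cong (α₁ M) (trans (α₀α₂ y₁) (cong (α₂ M) (α₀² y)))
      φ-σ-x : φ M y₃ ≡ σ (φ X x')
      φ-σ-x = trans φ-y₃ (go (view (α₁ M y₂)))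
        where
        go : (∃ λ w → emb w ≡ α₁ M y₂) ⊎ Edge (α₁ M y₂) → α₁ M y₂ ≡ σ (φ X x')
        go (inj₁ (w , e)) = trans (sym after) (sym (σ-other (φ X x') λ q → nondeg (trans (cong (α₂ M) (α₁-inj (trans α₁y₁ (trans (sym emb-x') (trans (cong emb (sym q)) after))))) (α₂² y))))
          where
          after : emb (φ X x') ≡ α₁ M y₂
          after = after-x₀ (trans (cong K (sym e)) (emb-into w))
        go (inj₂ e) = trans (step-y₂ e) (sym (trans (cong σ (emb-inj (trans after (sym emb-x')))) σ-x))
          where
          after : emb (φ X x') ≡ x
          after = after-two (α₀ X x') y y₃ x (cong (α₁ M) emb-x'₀) Ky (step-y₂ e) Ky₃ α₁α₂y₃ Kx
      φ-σ-dart : ∀ z → z ≢ x' → Label.lab cX z ≡ true → φ M (emb z) ≡ σ (φ X z)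
      φ-σ-dart z z≢ cz = go (view w)
        where
        w = φ M (emb z)
        α₁e : α₁ M (emb (α₀ X z)) ≡ w
        α₁e = cong (α₁ M) (comm₀ z)
        cw : c w ≡ true
        cw = trans (HM.c-φ (emb z)) (trans (agree z) cz)
        go : (∃ λ v → emb v ≡ w) ⊎ Edge w → w ≡ σ (φ X z)
        go (inj₁ (v , e)) = trans (sym after) (sym (σ-other (φ X z) λ q → emb≢y z (φM-inj (trans (sym after) (trans (cong emb q) (trans emb-x' (sym xx)))))))
          where
          after : emb (φ X z) ≡ w
          after = after-kept (α₀ X z) w α₁e (trans (cong K (sym e)) (emb-into v))
        go (inj₂ (inj₁ e)) = ⊥-elim (z≢ (emb-inj (trans (φM-inj e) (sym emb-x'))))
        go (inj₂ (inj₂ (inj₁ e))) = absurdᵇ (trans (cong c (sym e)) cw) cy₁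
        go (inj₂ (inj₂ (inj₂ (inj₁ e)))) = absurdᵇ (trans (cong c (sym e)) cw) cy₂
        go (inj₂ (inj₂ (inj₂ (inj₂ e)))) = trans e (sym (trans (cong σ (emb-inj (trans after (sym emb-x')))) σ-x))
          where
          after : emb (φ X z) ≡ x
          after = after-one (α₀ X z) y₃ x (trans α₁e e) Ky₃ α₁α₂y₃ Kx
      φ-σ : ∀ z → HM.φ̂ (σ z) ≡ σ (HX.φ̂ z)
      φ-σ z = go (z Fin.≟ x') (HX.dart? z)
        where
        go : Dec (z ≡ x') → Label.lab cX z ≡ true ⊎ Label.lab cX z ≡ false → HM.φ̂ (σ z) ≡ σ (HX.φ̂ z)
        go (yes refl) _ = trans (cong HM.φ̂ σ-x) (trans (HM.φ̂-dart y₃ cy₃) (trans φ-σ-x (cong σ (sym (HX.φ̂-dart x' dart)))))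
        go (no p) (inj₁ q) = trans (cong HM.φ̂ (σ-other z p)) (trans (HM.φ̂-dart (emb z) (trans (agree z) q)) (trans (φ-σ-dart z p q) (cong σ (sym (HX.φ̂-dart z q)))))
        go (no p) (inj₂ q) = trans (cong HM.φ̂ (σ-other z p)) (trans (HM.φ̂-off (emb z) (trans (agree z) q)) (trans (sym (σ-other z p)) (cong σ (sym (HX.φ̂-off z q)))))
    open Doubling HM.hat HX.hat emb ρ x' y y₃ ρ-emb ρ-y ρ-ȳ cover bar-emb bar-y φ-x φ-y σ σ-x σ-other φ-σ emb≢y {c} {Label.lab cX} D-ρ public

-- Transport along isomorphisms

module Pull {n m : ℕ} {φ bar : Fin n → Fin n} {φ' bar' : Fin m → Fin m} (o : Perms φ bar) (o' : Perms φ' bar')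
  (f : Fin n → Fin m) (f⁻ : Fin m → Fin n) (ff⁻ : ∀ y → f (f⁻ y) ≡ y) (f⁻f : ∀ x → f⁻ (f x) ≡ x)
  (f-φ : ∀ x → f (φ x) ≡ φ' (f x)) (f-bar : ∀ x → f (bar x) ≡ bar' (f x)) where

  state-pull : ∀ {g D'} → State g D' φ' bar' → State g (D' ∘ f) φ bar
  state-pull s = record
    { ω = ω ∘ f ; η = η ∘ f ; J = J ∘ f ; e = e ∘ f
    ; ω-unit = λ x → ω-unit (f x)
    ; ω-bar = λ x → trans (cong ω (f-bar x)) (ω-bar (f x))
    ; η-φ = λ x → trans (cong η (f-φ x)) (η-φ (f x))
    ; η-τ = λ x → trans (cong η (trans (f-φ (bar x)) (cong φ' (f-bar x)))) (η-τ (f x))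
    ; J-val = λ x → J-val (f x)
    ; J-uniq = λ x y c eq nz → trans (sym (f⁻f x)) (trans (cong f⁻ (J-uniq (f x) (f y) (conn x y c) eq nz)) (f⁻f y)) }
    where
    open State s
    conn : ∀ x y → reach (φ ∷ bar ∷ []) x y ≡ true → reach (φ' ∷ bar' ∷ []) (f x) (f y) ≡ true
    conn x y c = trans (conn-fun o (λ z → R (f z)) (λ z → trans (cong R (f-φ z)) (conn-φ o' (f x) (f z)))
      (λ z → trans (cong R (f-bar z)) (conn-bar o' (f x) (f z))) x y c) (reach-refl (φ' ∷ bar' ∷ []) (f x))
      where R = reach (φ' ∷ bar' ∷ []) (f x)

  exact-pull : Exact φ' bar' → Exact φ bar
  exact-pull ex ζ q ζ-bar q-φ = p ∘ f
    , (λ x → trans (cong p (trans (f-φ (bar x)) (cong φ' (f-bar x)))) (proj₁ (proj₂ P) (f x)))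
    , (λ x → trans (cong p (f-φ x)) (trans (proj₂ (proj₂ P) (f x)) (cong (λ z → p (f x) + ζ z) (f⁻f x))))
    where
    back : ∀ {h' : Fin m → Fin m} {h : Fin n → Fin n} → (∀ x → f (h x) ≡ h' (f x)) → ∀ y → f⁻ (h' y) ≡ h (f⁻ y)
    back {h'} {h} e y = trans (cong (f⁻ ∘ h') (sym (ff⁻ y))) (trans (cong f⁻ (sym (e (f⁻ y)))) (f⁻f (h (f⁻ y))))
    P = ex (ζ ∘ f⁻) (q ∘ f⁻) (λ y → trans (cong ζ (back f-bar y)) (ζ-bar (f⁻ y))) (λ y → trans (cong q (back f-φ y)) (q-φ (f⁻ y)))
    p = proj₁ P

record MState (g : ℕ) (M : Map) (isM : IsMap M) : Set where
  field
    orient : Orient M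
  open Hat M isM orient public
  field
    state : State g (Label.lab orient) φ̂ bar̂
    exact : Exact φ̂ bar̂

iso-state : ∀ {g X Y} (i : X ≅ Y) (isX : IsMap X) (isY : IsMap Y) → MState g X isX → MState g Y isY
iso-state {g} {X} {Y} i isX isY s = record { orient = O ; state = P.state-pull (MState.state s) ; exact = P.exact-pull (MState.exact s) }
  where
  open _≅_ i
  O = iso-label i (MState.orient s)
  module HX = MState s
  module HY = Hat Y isY O
  f = Inverse.to bij
  f⁻ = Inverse.from bij
  ff⁻ = Inverse.strictlyInverseˡ bij
  f⁻f = Inverse.strictlyInverseʳ bij
  back : (hX : Fin (n X) → Fin (n X)) (hY : Fin (n Y) → Fin (n Y)) → (∀ x → f (hX x) ≡ hY (f x)) → ∀ y → f⁻ (hY y) ≡ hX (f⁻ y)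
  back hX hY e y = trans (cong (f⁻ ∘ hY) (sym (ff⁻ y))) (trans (cong f⁻ (sym (e (f⁻ y)))) (f⁻f (hX (f⁻ y))))
  φ-c : ∀ y → f⁻ (HY.φ̂ y) ≡ HX.φ̂ (f⁻ y)
  φ-c y with HY.dart? y
  ... | inj₁ p = trans (cong f⁻ (HY.φ̂-dart y p)) (trans (back (α₁ X) (α₁ Y) comm₁ _) (trans (cong (α₁ X) (back (α₀ X) (α₀ Y) comm₀ y)) (sym (HX.φ̂-dart (f⁻ y) p))))
  ... | inj₂ p = trans (cong f⁻ (HY.φ̂-off y p)) (sym (HX.φ̂-off (f⁻ y) p))
  bar-c : ∀ y → f⁻ (HY.bar̂ y) ≡ HX.bar̂ (f⁻ y)
  bar-c y with HY.dart? y
  ... | inj₁ p = trans (cong f⁻ (HY.bar̂-dart y p)) (trans (back (α₀ X) (α₀ Y) comm₀ _) (trans (cong (α₀ X) (back (α₂ X) (α₂ Y) comm₂ y)) (sym (HX.bar̂-dart (f⁻ y) p))))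
  ... | inj₂ p = trans (cong f⁻ (HY.bar̂-off y p)) (sym (HX.bar̂-off (f⁻ y) p))
  module P = Pull HY.hat HX.hat f⁻ f f⁻f ff⁻ φ-c bar-c

-- Pulling heights back through a vertex gluing

swap-conj : ∀ {n} {σ : Fin n → Fin n} → Inj σ → ∀ a b x → σ (swapF a b x) ≡ swapF (σ a) (σ b) (σ x)
swap-conj {σ = σ} σ-inj a b x with swapF a b x | swapView a b x
... | _ | at-a = sym (swap-a (σ a) (σ b))
... | _ | at-b = sym (swap-b (σ a) (σ b))
... | _ | other p q = sym (swap-other (p ∘ σ-inj) (q ∘ σ-inj))

module GlueHat (M : Map) (isM : IsMap M) (a b : Fin (n M)) (O : Orient M) (O' : Orient (glue M a b)) (agree : ∀ z → Label.lab O' z ≡ Label.lab O z) where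
  open Laws M isM
  open Hat M isM O
  open Label O renaming (lab to c; lab₀ to c₀; lab₁ to c₁; lab₂ to c₂)
  module H' = Hat (glue M a b) (Glue.glue-isMap M isM a b) O'
  private sw = swapF a b

  swap-off : ∀ {k} → c a ≡ k → c b ≡ k → ∀ z → c z ≡ not k → sw z ≡ z
  swap-off ca cb z cz = swap-other (λ { refl → Boolₚ.not-¬ (trans (sym cz) ca) refl }) (λ { refl → Boolₚ.not-¬ (trans (sym cz) cb) refl })

  glue-φ : c a ≡ true → c b ≡ true → ∀ z → H'.φ̂ z ≡ sw (φ̂ z)
  glue-φ ca cb z with dart? z
  ... | inj₁ p = trans (H'.φ̂-dart z (trans (agree z) p)) (trans (cong (sw ∘ α₁ M) (swap-off ca cb (α₀ M z) (trans (c₀ z) (cong not p)))) (cong sw (sym (φ̂-dart z p))))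
  ... | inj₂ p = trans (H'.φ̂-off z (trans (agree z) p)) (trans (sym (swap-off ca cb z p)) (cong sw (sym (φ̂-off z p))))

  -- If `a` and `b` are not darts, the swap acts on the argument of `α₁` instead of its value;
  -- conjugating by `α₁` turns it into a transposition of the darts `α₁ a` and `α₁ b`.
  glue-φ' : c a ≡ false → c b ≡ false → ∀ z → H'.φ̂ z ≡ swapF (α₁ M a) (α₁ M b) (φ̂ z)
  glue-φ' ca cb z with dart? z
  ... | inj₁ p = trans (H'.φ̂-dart z (trans (agree z) p)) (trans (swap-off ca cb _ (trans (c₁ _) (cong not (off-swap _ (trans (c₀ z) (cong not p))))))
        (trans (swap-conj α₁-inj a b (α₀ M z)) (cong (swapF (α₁ M a) (α₁ M b)) (sym (φ̂-dart z p)))))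
    where
    off-swap : ∀ w → c w ≡ false → c (sw w) ≡ false
    off-swap w cw = trans (swap-inv c (trans ca (sym cb)) w) cw
  ... | inj₂ p = trans (H'.φ̂-off z (trans (agree z) p)) (trans (sym (swap-other (λ { refl → absurdᵇ (trans (c₁ a) (cong not ca)) p }) (λ { refl → absurdᵇ (trans (c₁ b) (cong not cb)) p })))
        (cong (swapF (α₁ M a) (α₁ M b)) (sym (φ̂-off z p))))

module BackGlue {g : ℕ} .{{_ : ℕ.NonZero g}} (M : Map) (isM : IsMap M) (a b : Fin (n M)) (apart : reach (vGens M) a b ≡ false)
  (s : MState g (glue M a b) (Glue.glue-isMap M isM a b)) where
  open Laws M isM
  open Glue M isM a b
  private
    isX = glue-isMap
    O' = MState.orient s
    O : Orient M
    O = unglue-label apart Boolₚ.not-involutive O'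
    open Hat M isM O
    c = Label.lab O
    c₁ = Label.lab₁ O
    module G = GlueHat M isM a b O O' (λ _ → refl)
    module H' = Hat (glue M a b) isX O'
    cab : c a ≡ c b
    cab = Around.glued apart {u = not} Boolₚ.not-involutive c (Label.lab₁ O') (Label.lab₂ O')

    pull-face : ∀ x y → c x ≡ true → reach (φ M ∷ []) x y ≡ true → reach (φ̂ ∷ []) x y ≡ true
    pull-face x y cx r = proj₂ (reach-ind (φ M ∷ []) x y (λ z → c z ≡ true × reach (φ̂ ∷ []) x z ≡ true) (cx , reach-refl (φ̂ ∷ []) x)
      (λ { (here refl) z (p , q) → trans (c-φ z) p , trans (cong (reach (φ̂ ∷ []) x) (sym (φ̂-dart z p))) (reach-step (φ̂ ∷ []) x (here refl) z q) }) r)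

    finish : (a' b' : Fin (n M)) → c a' ≡ true → c b' ≡ true → (∀ z → H'.φ̂ z ≡ swapF a' b' (φ̂ z)) → reach (vGens M) a' b' ≡ false →
      reach (vGens (glue M a b)) a' b' ≡ true → reach (φ M ∷ []) a' b' ≡ true ⊎ reach (cGens M) a' b' ≡ false → MState g M isM
    finish a' b' ca cb eq far near cond = record { orient = O ; state = st cond ; exact = ex }
      where
      a≢b' : a' ≢ b'
      a≢b' refl = absurdᵇ (reach-refl (vGens M) a') far
      τab : reach (H'.φ̂ ∘ H'.bar̂ ∷ []) a' b' ≡ true
      τab = H'.vertex-τ a' b' ca cb near
      ex : Exact φ̂ bar̂
      ex = Swap.exact-split hat eq (¬true (λ r → absurdᵇ (τ-vertex a' b' r) far)) τab (MState.exact s)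
      module U = Unglue hat a≢b' eq (MState.state s) τab
      st : reach (φ M ∷ []) a' b' ≡ true ⊎ reach (cGens M) a' b' ≡ false → State g c φ̂ bar̂
      st (inj₁ f) = U.state-unglue-face (pull-face a' b' ca f)
      st (inj₂ f) = U.state-unglue-components (¬true (λ r → absurdᵇ (conn-component a' b' r) f))

    -- `α₁` conjugates `φ` to its inverse, so it carries cycles to cycles. This replaces crosses
    -- that are not darts by darts in the gluing condition.
    reverse-face : ∀ x y → reach (φ M ∷ []) x y ≡ true → reach (φ M ∷ []) (α₁ M x) (α₁ M y) ≡ true
    reverse-face x y r = reach-sym (φ M ∷ []) inj (α₁ M y) (α₁ M x) (reach-ind (φ M ∷ []) x y (λ z → reach (φ M ∷ []) (α₁ M z) (α₁ M x) ≡ true)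
      (reach-refl (φ M ∷ []) (α₁ M x)) (λ { (here refl) z h → reach-trans (φ M ∷ []) inj (α₁ M (φ M z)) (α₁ M z) (α₁ M x)
        (trans (cong (reach (φ M ∷ []) (α₁ M (φ M z))) (sym (φα z))) (reach-step (φ M ∷ []) (α₁ M (φ M z)) (here refl) (α₁ M (φ M z)) (reach-refl (φ M ∷ []) (α₁ M (φ M z))))) h }) r)
      where
      inj : ∀ {h} → h ∈ φ M ∷ [] → Inj h
      inj (here refl) = φM-inj
      φα : ∀ z → φ M (α₁ M (φ M z)) ≡ α₁ M z
      φα z = cong (α₁ M) (trans (cong (α₀ M) (α₁² (α₀ M z))) (α₀² z))

  back-glue : reach (φ M ∷ []) a b ≡ true ⊎ reach (cGens M) a b ≡ false → MState g M isM
  back-glue cond with dart? a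
  ... | inj₁ ca = finish a b ca (trans (sym cab) ca) (G.glue-φ ca (trans (sym cab) ca)) apart (vertices-glued apart) cond
  ... | inj₂ ca = finish (α₁ M a) (α₁ M b) (trans (c₁ a) (cong not ca)) (trans (c₁ b) (cong not (trans (sym cab) ca))) (G.glue-φ' ca (trans (sym cab) ca))
        (¬true (λ r → absurdᵇ (reach-trans (vGens M) v-inj a (α₁ M a) b (trans (vertex-inv₁ a a) (reach-refl (vGens M) a)) (trans (sym (vertex-inv₁ (α₁ M a) b)) r)) apart))
        (vertices-glued' apart) (cond' cond)
    where
    cond' : reach (φ M ∷ []) a b ≡ true ⊎ reach (cGens M) a b ≡ false → reach (φ M ∷ []) (α₁ M a) (α₁ M b) ≡ true ⊎ reach (cGens M) (α₁ M a) (α₁ M b) ≡ false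
    cond' (inj₁ f) = inj₁ (reverse-face a b f)
    cond' (inj₂ f) = inj₂ (¬true (λ r → absurdᵇ (reach-trans (cGens M) c-inj a (α₁ M a) b
      (reach-step (cGens M) a (there (here refl)) a (reach-refl (cGens M) a))
      (trans (sym (reach-inv (cGens M) (α₁ M a) (there (here refl)) α₁-inj b)) r)) f))

-- Faces of degree two

countᵇ-tabulate : ∀ {n} {A : Set} (p : A → Bool) (f : Fin n → A) → countᵇ p (List.tabulate f) ≡ count (p ∘ f)
countᵇ-tabulate {zero}  p f = refl
countᵇ-tabulate {suc n} p f = cong ((if p (f zero) then 1 else 0) ℕ.+_) (countᵇ-tabulate p (f ∘ suc))

two-cycle : ∀ {n} {σ : Fin n → Fin n} → Inj σ → ∀ x → cycleSize σ x ≡ 2 → σ (σ x) ≡ x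
two-cycle {n} {σ} σ-inj x e with σ (σ x) Fin.≟ x
... | yes p = p
... | no p = ⊥-elim (clash (Finₚ.pigeonhole (subst (ℕ._< 3) (sym size2) (s≤s (s≤s (s≤s z≤n)))) idx))
  where
  R = reach (σ ∷ []) x
  E = enum R
  size2 : Enum.size E ≡ 2
  size2 = trans (Enum.size-count E) (trans (sym (countᵇ-tabulate R id)) e)
  r₀ : R x ≡ true
  r₀ = reach-refl (σ ∷ []) x
  r₁ : R (σ x) ≡ true
  r₁ = reach-step (σ ∷ []) x (here refl) x r₀
  r₂ : R (σ (σ x)) ≡ true
  r₂ = reach-step (σ ∷ []) x (here refl) (σ x) r₁
  idx : Fin 3 → Fin (Enum.size E)
  idx zero = proj₁ (Enum.onto E x r₀)
  idx (suc zero) = proj₁ (Enum.onto E (σ x) r₁)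
  idx (suc (suc zero)) = proj₁ (Enum.onto E (σ (σ x)) r₂)
  same : ∀ {u v} (p : R u ≡ true) (q : R v ≡ true) → proj₁ (Enum.onto E u p) ≡ proj₁ (Enum.onto E v q) → u ≡ v
  same {u} {v} p q h = trans (sym (proj₂ (Enum.onto E u p))) (trans (cong (Enum.emb E) h) (proj₂ (Enum.onto E v q)))
  fixed : x ≡ σ x → ⊥
  fixed h = p (trans (cong σ (sym h)) (sym h))
  clash : (∃ λ i → ∃ λ j → i Fin.< j × idx i ≡ idx j) → ⊥
  clash (zero , suc zero , _ , h) = fixed (same r₀ r₁ h)
  clash (zero , suc (suc zero) , _ , h) = p (sym (same r₀ r₂ h))
  clash (suc zero , suc (suc zero) , _ , h) = fixed (σ-inj (same r₁ r₂ h))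
  clash (zero , zero , () , _)
  clash (suc zero , zero , () , _)
  clash (suc zero , suc zero , s≤s () , _)
  clash (suc (suc zero) , zero , () , _)
  clash (suc (suc zero) , suc zero , s≤s () , _)
  clash (suc (suc zero) , suc (suc zero) , s≤s (s≤s ()) , _)

record DupAt (M : Map) (d : SubData M) (x : Fin (n M)) : Set where
  field
    K₀ : ∀ z → SubData.keepE d (α₀ M z) ≡ SubData.keepE d z
    K₂ : ∀ z → SubData.keepE d (α₂ M z) ≡ SubData.keepE d z
    xx : φ M (φ M x) ≡ x
    Kx : SubData.keepE d x ≡ true
    Ky : SubData.keepE d (φ M x) ≡ false
    K-edge : ∀ z → SubData.keepE d z ≡ false → z ≡ φ M x ⊎ z ≡ α₀ M (φ M x) ⊎ z ≡ α₂ M (φ M x) ⊎ z ≡ α₂ M (α₀ M (φ M x))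

module _ (M : Map) (isM : IsMap M) where
  open Laws M isM

  -- From `α₀ x` the digon is traversed in the other direction, with the same edge deleted. One of
  -- the two starting crosses is a dart.
  dup-flip : ∀ {d x} → DupAt M d x → DupAt M d (α₀ M x)
  dup-flip {d} {x} D = record { K₀ = K₀ ; K₂ = K₂ ; xx = trans (cong (φ M) turn) (trans (cong (α₁ M) (α₀² (φ M x))) (α₁² (α₀ M x))) ; Kx = trans (K₀ x) Kx
    ; Ky = trans (cong K turn) (trans (K₀ (φ M x)) Ky) ; K-edge = λ z k → shift z (K-edge z k) }
    where
    open DupAt D
    K = SubData.keepE d
    turn : φ M (α₀ M x) ≡ α₀ M (φ M x)
    turn = trans (cong (α₁ M) (α₀² x)) (trans (cong (α₁ M) (sym xx)) (α₁² _))
    shift : ∀ z → z ≡ φ M x ⊎ z ≡ α₀ M (φ M x) ⊎ z ≡ α₂ M (φ M x) ⊎ z ≡ α₂ M (α₀ M (φ M x)) →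
      z ≡ φ M (α₀ M x) ⊎ z ≡ α₀ M (φ M (α₀ M x)) ⊎ z ≡ α₂ M (φ M (α₀ M x)) ⊎ z ≡ α₂ M (α₀ M (φ M (α₀ M x)))
    shift z (inj₁ e) = inj₂ (inj₁ (trans e (sym (trans (cong (α₀ M) turn) (α₀² _)))))
    shift z (inj₂ (inj₁ e)) = inj₁ (trans e (sym turn))
    shift z (inj₂ (inj₂ (inj₁ e))) = inj₂ (inj₂ (inj₂ (trans e (sym (cong (α₂ M) (trans (cong (α₀ M) turn) (α₀² _)))))))
    shift z (inj₂ (inj₂ (inj₂ e))) = inj₂ (inj₂ (inj₁ (trans e (sym (cong (α₂ M) turn)))))

  e-inj : ∀ {h} → h ∈ eGens M → Inj h
  e-inj (here refl) = α₀-inj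
  e-inj (there (here refl)) = α₂-inj

  edge-elems : ∀ y z → reach (eGens M) y z ≡ true → z ≡ y ⊎ z ≡ α₀ M y ⊎ z ≡ α₂ M y ⊎ z ≡ α₂ M (α₀ M y)
  edge-elems y z = reach-ind (eGens M) y z (λ z → z ≡ y ⊎ z ≡ α₀ M y ⊎ z ≡ α₂ M y ⊎ z ≡ α₂ M (α₀ M y)) (inj₁ refl)
    (λ { (here refl) _ (inj₁ refl) → inj₂ (inj₁ refl) ; (here refl) _ (inj₂ (inj₁ refl)) → inj₁ (α₀² y)
       ; (here refl) _ (inj₂ (inj₂ (inj₁ refl))) → inj₂ (inj₂ (inj₂ (α₀α₂ y)))
       ; (here refl) _ (inj₂ (inj₂ (inj₂ refl))) → inj₂ (inj₂ (inj₁ (trans (α₀α₂ (α₀ M y)) (cong (α₂ M) (α₀² y)))))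
       ; (there (here refl)) _ (inj₁ refl) → inj₂ (inj₂ (inj₁ refl)) ; (there (here refl)) _ (inj₂ (inj₁ refl)) → inj₂ (inj₂ (inj₂ refl))
       ; (there (here refl)) _ (inj₂ (inj₂ (inj₁ refl))) → inj₁ (α₂² y)
       ; (there (here refl)) _ (inj₂ (inj₂ (inj₂ refl))) → inj₂ (inj₁ (α₂² (α₀ M y))) })

  dup-at : ∀ x → φ M (φ M x) ≡ x → reach (eGens M) x (φ M x) ≡ false → DupAt M (delEdge M (φ M x)) x
  dup-at x xx far = record { K₀ = λ z → cong not (reach-inv (eGens M) y (here refl) α₀-inj z) ; K₂ = λ z → cong not (reach-inv (eGens M) y (there (here refl)) α₂-inj z)
    ; xx = xx ; Kx = cong not (¬true (λ r → absurdᵇ (reach-sym (eGens M) e-inj y x r) far)) ; Ky = cong not (reach-refl (eGens M) y)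
    ; K-edge = λ z k → edge-elems y z (trans (sym (Boolₚ.not-involutive _)) (cong not k)) }
    where
    y = φ M x

  -- The face consists of `x`, `φ M x` and their images under `α₀`, and `y` is not on the edge of
  -- `x`. So `y` is `φ M x` or its image under `α₀`; in the second case the digon is read from
  -- `α₀ M x`.
  dup-of-gluing : ∀ x y → reach (eGens M) x y ≡ false → reach (fGens M) x y ≡ true → cycleSize (φ M) x ≡ 2 →
    ∃ λ x' → DupAt M (delEdge M y) x'
  dup-of-gluing x y far face size = go (reach-ind (fGens M) x y Face (inj₁ refl) step face)
    where
    xx = two-cycle φM-inj x size
    Face : Fin (n M) → Set
    Face z = z ≡ x ⊎ z ≡ α₀ M x ⊎ z ≡ φ M x ⊎ z ≡ α₀ M (φ M x)
    α₁x : α₁ M x ≡ α₀ M (φ M x)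
    α₁x = trans (cong (α₁ M) (sym xx)) (α₁² _)
    step : ∀ {h} → h ∈ fGens M → ∀ z → Face z → Face (h z)
    step (here refl) _ (inj₁ refl) = inj₂ (inj₁ refl)
    step (here refl) _ (inj₂ (inj₁ refl)) = inj₁ (α₀² x)
    step (here refl) _ (inj₂ (inj₂ (inj₁ refl))) = inj₂ (inj₂ (inj₂ refl))
    step (here refl) _ (inj₂ (inj₂ (inj₂ refl))) = inj₂ (inj₂ (inj₁ (α₀² _)))
    step (there (here refl)) _ (inj₁ refl) = inj₂ (inj₂ (inj₂ α₁x))
    step (there (here refl)) _ (inj₂ (inj₁ refl)) = inj₂ (inj₂ (inj₁ refl))
    step (there (here refl)) _ (inj₂ (inj₂ (inj₁ refl))) = inj₂ (inj₁ (α₁² _))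
    step (there (here refl)) _ (inj₂ (inj₂ (inj₂ refl))) = inj₁ xx
    go : Face y → ∃ λ x' → DupAt M (delEdge M y) x'
    go (inj₁ refl) = absurdᵇ (reach-refl (eGens M) x) far
    go (inj₂ (inj₁ refl)) = absurdᵇ (reach-step (eGens M) x (here refl) x (reach-refl (eGens M) x)) far
    go (inj₂ (inj₂ (inj₁ refl))) = x , dup-at x xx far
    go (inj₂ (inj₂ (inj₂ refl))) = α₀ M x , subst (λ w → DupAt M (delEdge M w) (α₀ M x)) turn (dup-at (α₀ M x) (trans (cong (φ M) turn) (trans (cong (α₁ M) (α₀² (φ M x))) (α₁² (α₀ M x)))) far')
      where
      turn : φ M (α₀ M x) ≡ α₀ M (φ M x)
      turn = trans (cong (α₁ M) (α₀² x)) α₁x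
      far' : reach (eGens M) (α₀ M x) (φ M (α₀ M x)) ≡ false
      far' = ¬true λ r → absurdᵇ (reach-trans (eGens M) e-inj x (α₀ M x) (α₀ M (φ M x)) (reach-step (eGens M) x (here refl) x (reach-refl (eGens M) x))
        (trans (cong (reach (eGens M) (α₀ M x)) (sym turn)) r)) far

  module _ {X : Map} {d : SubData M} (sub : SubIso X M d) where
    dup-isMap : ∀ {x} → DupAt M d x → IsMap X
    dup-isMap D = Sub.isX X M d isM sub (DupAt.K₀ D) (DupAt.K₂ D)

    dup-label : ∀ {x} → DupAt M d x → ∀ {A u₀ u} → (∀ (z : A) → u (u z) ≡ z) → (∀ z → u₀ (u₀ z) ≡ z) → (∀ z → u₀ (u z) ≡ u (u₀ z)) → Label A u₀ u X → Label A u₀ u M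
    dup-label {x} D u² u₀² u₀u l = proj₁ (Dup.undup-label M X isM x d sub K₀ K₂ xx Kx Ky K-edge u² u₀² u₀u l)
      where open DupAt D

    dup-back : ∀ {g} → 2 ℕ.≤ g → (isX : IsMap X) → MState g X isX → ∀ {x} → DupAt M d x → MState g M isM
    dup-back {g} g≥2 isX s {x} D = choose (Label.lab cX Dx.x' Boolₚ.≟ true)
      where
      cX = MState.orient s
      module Dx = Dup M X isM x d sub (DupAt.K₀ D) (DupAt.K₂ D) (DupAt.xx D) (DupAt.Kx D) (DupAt.Ky D) (DupAt.K-edge D)
      instance
        g-nz : ℕ.NonZero g
        g-nz = ℕ.>-nonZero (ℕₚ.≤-trans (s≤s z≤n) g≥2)
      go : ∀ x (D : DupAt M d x) → Label.lab cX (proj₁ (SubIso.emb-onto sub x (DupAt.Kx D))) ≡ true → MState g M isM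
      go x D dart = record { orient = cM ; state = O.double (MState.state s) ; exact = O.exact-double (MState.exact s) }
        where
        open DupAt D
        module E = Dup M X isM x d sub K₀ K₂ xx Kx Ky K-edge
        cM : Orient M
        cM = proj₁ (E.undup-label Boolₚ.not-involutive Boolₚ.not-involutive (λ _ → refl) cX)
        agree : ∀ z → Label.lab cM (SubIso.emb sub z) ≡ Label.lab cX z
        agree = proj₂ (E.undup-label Boolₚ.not-involutive Boolₚ.not-involutive (λ _ → refl) cX)
        module HX = Hat X isX cX
        open State (MState.state s)
        -- A degenerate edge would make `x'` a fixed point of the face permutation of X, against its
        -- unit rise.
        nondeg : E.y₃ ≢ E.y
        nondeg e = unit-cong g≥2 (ω-unit E.x' dart) (J E.x' , height-fixed (η E.x') (ω E.x') (+ g * J E.x') (trans (sym (cong η loop)) (η-φ E.x')))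
          where
          loop : HX.φ̂ E.x' ≡ E.x'
          loop = trans (HX.φ̂-dart E.x' dart) (trans (cong (α₁ X) (sym (SubIso.emb-inj sub (trans (E.degenerate-loop e) (sym E.emb-x'₀))))) (Laws.α₁² X isX E.x'))
        module O = E.Oriented cM cX agree dart nondeg
      choose : Dec (Label.lab cX Dx.x' ≡ true) → MState g M isM
      choose (yes t) = go x D t
      choose (no t) = go (α₀ M x) D' (trans (cong (Label.lab cX) at) (trans (Label.lab₀ cX Dx.x') (cong not (¬true t))))
        where
        D' = dup-flip D
        at : proj₁ (SubIso.emb-onto sub (α₀ M x) (DupAt.Kx D')) ≡ α₀ X Dx.x'
        at = SubIso.emb-inj sub (trans (proj₂ (SubIso.emb-onto sub (α₀ M x) (DupAt.Kx D'))) (sym Dx.emb-x'₀))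

-- Steps

step-isMap : ∀ {M X} → IsMap M → Step M X → IsMap X
step-isMap {M} isM (inj₁ (inj₁ (a , b , _ , _ , _ , i))) = iso-isMap i (Glue.glue-isMap M isM a b)
step-isMap isM (inj₁ (inj₂ (_ , _ , i))) = iso-isMap i isM
step-isMap {M} {X} isM (inj₂ (x , y , far , face , size , sub)) = dup-isMap M isM sub (proj₂ (dup-of-gluing M isM x y far face size))

step-label : ∀ {M X A u₀ u} → (∀ (z : A) → u (u z) ≡ z) → (∀ z → u₀ (u₀ z) ≡ z) → (∀ z → u₀ (u z) ≡ u (u₀ z)) →
  IsMap M → Step M X → Label A u₀ u X → Label A u₀ u M
step-label {M} {X} u² u₀² u₀u isM (inj₁ (inj₁ (a , b , _ , apart , _ , i))) l = Glue.unglue-label M isM a b apart u² (iso-label i l)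
step-label {M} {X} u² u₀² u₀u isM (inj₁ (inj₂ (_ , _ , i))) l = record { Label (iso-label i l) }
step-label {M} {X} u² u₀² u₀u isM (inj₂ (x , y , far , face , size , sub)) l =
  dup-label M isM sub (proj₂ (dup-of-gluing M isM x y far face size)) u² u₀² u₀u l

step-state : ∀ {g M X} → 2 ℕ.≤ g → (isM : IsMap M) (isX : IsMap X) → Step M X → MState g X isX → MState g M isM
step-state {g} {M} {X} g≥2 isM isX (inj₁ (inj₁ (a , b , _ , apart , cond , i))) s =
  BackGlue.back-glue {{ℕ.>-nonZero (ℕₚ.≤-trans (s≤s z≤n) g≥2)}} M isM a b apart (iso-state i isX (Glue.glue-isMap M isM a b) s) cond
step-state {g} {M} {X} g≥2 isM isX (inj₁ (inj₂ (_ , _ , i))) s = record { orient = record { Label (MState.orient t) } ; state = MState.state t ; exact = MState.exact t }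
  where t = iso-state i isX isM s
step-state {g} {M} {X} g≥2 isM isX (inj₂ (x , y , far , face , size , sub)) s =
  dup-back M isM sub g≥2 isX s (proj₂ (dup-of-gluing M isM x y far face size))

steps-isMap : ∀ {M X} → IsMap M → Star Step M X → IsMap X
steps-isMap isM ε = isM
steps-isMap isM (st ◅ sts) = steps-isMap (step-isMap isM st) sts

steps-label : ∀ {M X A u₀ u} → (∀ (z : A) → u (u z) ≡ z) → (∀ z → u₀ (u₀ z) ≡ z) → (∀ z → u₀ (u z) ≡ u (u₀ z)) →
  IsMap M → Star Step M X → Label A u₀ u X → Label A u₀ u M
steps-label u² u₀² u₀u isM ε l = l
steps-label u² u₀² u₀u isM (st ◅ sts) l = step-label u² u₀² u₀u isM st (steps-label u² u₀² u₀u (step-isMap isM st) sts l)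

steps-state : ∀ {g M X} → 2 ℕ.≤ g → (isM : IsMap M) (isX : IsMap X) → Star Step M X → MState g X isX → MState g M isM
steps-state g≥2 isM isX ε s = record { orient = MState.orient s ; state = MState.state s ; exact = MState.exact s }
steps-state g≥2 isM isX (st ◅ sts) s = step-state g≥2 isM (step-isMap isM st) st (steps-state g≥2 (step-isMap isM st) isX sts s)

-- Coordinates of the crosses of a cycle

toℕ-mod : ∀ c k .{{_ : ℕ.NonZero k}} → toℕ (c mod k) ≡ c % k
toℕ-mod c k = Finₚ.toℕ-fromℕ< (m%n<n c k)

bit : Bool → ℕ
bit false = 0
bit true  = 1

odd-part : Bool → Bool → ℕ
odd-part s t = 2 ℕ.* bit s ℕ.+ bit t

code : ℕ → Bool → Bool → ℕ
code j s t = 4 ℕ.* j ℕ.+ 2 ℕ.* bit s ℕ.+ bit t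

code-form : ∀ j s t → code j s t ≡ odd-part s t ℕ.+ j ℕ.* 4
code-form j s t = trans (ℕₚ.+-assoc (4 ℕ.* j) _ _) (trans (ℕₚ.+-comm (4 ℕ.* j) _) (cong (odd-part s t ℕ.+_) (ℕₚ.*-comm 4 j)))

code-% : ∀ j s t → code j s t % 4 ≡ odd-part s t
code-% j s t = trans (cong (_% 4) (code-form j s t)) (trans ([m+kn]%n≡m%n (odd-part s t) j 4) (small s t))
  where
  small : ∀ s t → odd-part s t % 4 ≡ odd-part s t
  small false false = refl
  small false true  = refl
  small true  false = refl
  small true  true  = refl

code-/ : ∀ j s t → code j s t / 4 ≡ j
code-/ j s t = trans (cong (_/ 4) (code-form j s t)) (trans (+-distrib-/-∣ʳ (odd-part s t) (divides j refl)) (trans (cong₂ ℕ._+_ (small s t) (m*n/n≡m j 4)) refl))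
  where
  small : ∀ s t → odd-part s t / 4 ≡ 0
  small false false = refl
  small false true  = refl
  small true  false = refl
  small true  true  = refl

code-%2 : ∀ j s t → code j s t % 2 ≡ bit t
code-%2 j s t = trans (cong (_% 2) (trans (code-form j s t) (cong (odd-part s t ℕ.+_) (sym (ℕₚ.*-assoc j 2 2))))) (trans ([m+kn]%n≡m%n (odd-part s t) (j ℕ.* 2) 2) (small s t))
  where
  small : ∀ s t → odd-part s t % 2 ≡ bit t
  small false false = refl
  small false true  = refl
  small true  false = refl
  small true  true  = refl

code-s : ∀ j s t → (code j s t % 4) / 2 ≡ bit s
code-s j s t = trans (cong (_/ 2) (code-% j s t)) (small s t)
  where
  small : ∀ s t → odd-part s t / 2 ≡ bit s
  small false false = refl
  small false true  = refl
  small true  false = refl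
  small true  true  = refl

decode : ∀ c → ∃ λ s → ∃ λ t → code (c / 4) s t ≡ c
decode c = build (bits (c % 4) (m%n<n c 4))
  where
  bits : ∀ r → r ℕ.< 4 → ∃ λ s → ∃ λ t → odd-part s t ≡ r
  bits 0 _ = false , false , refl
  bits 1 _ = false , true , refl
  bits 2 _ = true , false , refl
  bits 3 _ = true , true , refl
  bits (suc (suc (suc (suc _)))) (s≤s (s≤s (s≤s (s≤s ()))))
  build : (∃ λ s → ∃ λ t → odd-part s t ≡ c % 4) → ∃ λ s → ∃ λ t → code (c / 4) s t ≡ c
  build (s , t , e) = s , t , trans (code-form (c / 4) s t) (trans (cong (ℕ._+ (c / 4) ℕ.* 4) e) (sym (m≡m%n+[m/n]*n c 4)))

module Cycle (m : ℕ) where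
  L : ℕ
  L = 3 ℕ.+ m
  CM : Map
  CM = Cyc m

  abstract
    enc : Fin L → Bool → Bool → Fin (n CM)
    enc j s t = code (toℕ j) s t mod (4 ℕ.* L)

    code<N : ∀ (j : Fin L) s t → code (toℕ j) s t ℕ.< 4 ℕ.* L
    code<N j s t = subst₂ ℕ._<_ (sym (code-form (toℕ j) s t)) (ℕₚ.*-comm L 4)
      (ℕₚ.≤-trans (ℕₚ.+-monoˡ-< (toℕ j ℕ.* 4) (small s t)) (ℕₚ.*-monoˡ-≤ 4 (Finₚ.toℕ<n j)))
      where
      small : ∀ s t → odd-part s t ℕ.< 4
      small false false = s≤s z≤n
      small false true  = s≤s (s≤s z≤n)
      small true  false = s≤s (s≤s (s≤s z≤n))
      small true  true  = s≤s (s≤s (s≤s (s≤s z≤n)))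

    toℕ-enc : ∀ j s t → toℕ (enc j s t) ≡ code (toℕ j) s t
    toℕ-enc j s t = trans (toℕ-mod (code (toℕ j) s t) (4 ℕ.* L)) (m<n⇒m%n≡m (code<N j s t))

    next prev : Fin L → Fin L
    next j = (toℕ j ℕ.+ 1) mod L
    prev j = (toℕ j ℕ.+ L ℕ.∸ 1) mod L

    div4 : ∀ j s t → toℕ (enc j s t) / 4 ≡ toℕ j
    div4 j s t = trans (cong (_/ 4) (toℕ-enc j s t)) (code-/ (toℕ j) s t)
    mid : ∀ j s t → (toℕ (enc j s t) % 4) / 2 ≡ bit s
    mid j s t = trans (cong (λ c → (c % 4) / 2) (toℕ-enc j s t)) (code-s (toℕ j) s t)
    low : ∀ j s t → toℕ (enc j s t) % 2 ≡ bit t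
    low j s t = trans (cong (_% 2) (toℕ-enc j s t)) (code-%2 (toℕ j) s t)
    bit-not : ∀ s → 1 ℕ.∸ bit s ≡ bit (not s)
    bit-not true = refl
    bit-not false = refl

    α₀-enc : ∀ j s t → α₀ CM (enc j s t) ≡ enc j (not s) t
    α₀-enc j s t = cong (_mod (4 ℕ.* L)) (cong₂ ℕ._+_ (cong₂ (λ a b → 4 ℕ.* a ℕ.+ 2 ℕ.* b) (div4 j s t) (trans (cong (1 ℕ.∸_) (mid j s t)) (bit-not s))) (low j s t))

    α₂-enc : ∀ j s t → α₂ CM (enc j s t) ≡ enc j s (not t)
    α₂-enc j s t = cong (_mod (4 ℕ.* L)) (cong₂ ℕ._+_ (cong₂ (λ a b → 4 ℕ.* a ℕ.+ 2 ℕ.* b) (div4 j s t) (mid j s t)) (trans (cong (1 ℕ.∸_) (low j s t)) (bit-not t)))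

    α₁-enc-start : ∀ j t → α₁ CM (enc j false t) ≡ enc (prev j) true t
    α₁-enc-start j t = cong (_mod (4 ℕ.* L)) (trans (cong (λ b → if b ℕ.≡ᵇ 0 then 4 ℕ.* ((toℕ (enc j false t) / 4 ℕ.+ L ℕ.∸ 1) % L) ℕ.+ 2 ℕ.+ toℕ (enc j false t) % 2 else 4 ℕ.* ((toℕ (enc j false t) / 4 ℕ.+ 1) % L) ℕ.+ toℕ (enc j false t) % 2) (mid j false t))
      (cong₂ (λ a b → 4 ℕ.* a ℕ.+ 2 ℕ.+ b) (trans (cong (λ q → (q ℕ.+ L ℕ.∸ 1) % L) (div4 j false t)) (sym (toℕ-mod (toℕ j ℕ.+ L ℕ.∸ 1) L))) (low j false t)))

    α₁-enc-end : ∀ j t → α₁ CM (enc j true t) ≡ enc (next j) false t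
    α₁-enc-end j t = cong (_mod (4 ℕ.* L)) (trans (cong (λ b → if b ℕ.≡ᵇ 0 then 4 ℕ.* ((toℕ (enc j true t) / 4 ℕ.+ L ℕ.∸ 1) % L) ℕ.+ 2 ℕ.+ toℕ (enc j true t) % 2 else 4 ℕ.* ((toℕ (enc j true t) / 4 ℕ.+ 1) % L) ℕ.+ toℕ (enc j true t) % 2) (mid j true t))
      (trans (cong₂ (λ a b → 4 ℕ.* a ℕ.+ b) (trans (cong (λ q → (q ℕ.+ 1) % L) (div4 j true t)) (sym (toℕ-mod (toℕ j ℕ.+ 1) L))) (low j true t))
        (cong (ℕ._+ bit t) (sym (ℕₚ.+-identityʳ (4 ℕ.* toℕ (next j)))))))

    enc-surjective : ∀ x → ∃ λ j → ∃ λ s → ∃ λ t → enc j s t ≡ x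
    enc-surjective x = surj (decode (toℕ x))
      where
      j<L : toℕ x / 4 ℕ.< L
      j<L = m<n*o⇒m/o<n (ℕₚ.<-≤-trans (Finₚ.toℕ<n x) (ℕₚ.≤-reflexive (ℕₚ.*-comm 4 L)))
      surj : (∃ λ s → ∃ λ t → code (toℕ x / 4) s t ≡ toℕ x) → ∃ λ j → ∃ λ s → ∃ λ t → enc j s t ≡ x
      surj (s , t , e) = Fin.fromℕ< j<L , s , t , Finₚ.toℕ-injective (trans (toℕ-enc (Fin.fromℕ< j<L) s t) (trans (cong (λ i → code i s t) (Finₚ.toℕ-fromℕ< j<L)) e))

    enc-injective : ∀ j s t j' s' t' → enc j s t ≡ enc j' s' t' → j ≡ j' × s ≡ s' × t ≡ t'
    enc-injective j s t j' s' t' e =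
      Finₚ.toℕ-injective (trans (sym (div4 j s t)) (trans (cong (λ x → toℕ x / 4) e) (div4 j' s' t'))) ,
      bit-inj (trans (sym (mid j s t)) (trans (cong (λ x → (toℕ x % 4) / 2) e) (mid j' s' t'))) ,
      bit-inj (trans (sym (low j s t)) (trans (cong (λ x → toℕ x % 2) e) (low j' s' t')))
      where
      bit-inj : ∀ {s s'} → bit s ≡ bit s' → s ≡ s'
      bit-inj {false} {false} _ = refl
      bit-inj {true} {true} _ = refl

    next-last : ∀ j → suc (toℕ j) ≡ L → next j ≡ zero
    next-last j e = Finₚ.toℕ-injective (trans (toℕ-mod (toℕ j ℕ.+ 1) L) (trans (cong (_% L) (trans (ℕₚ.+-comm (toℕ j) 1) e)) (n%n≡0 L)))

    next-suc : ∀ j → suc (toℕ j) ℕ.< L → toℕ (next j) ≡ suc (toℕ j)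
    next-suc j lt = trans (toℕ-mod (toℕ j ℕ.+ 1) L) (trans (cong (_% L) (ℕₚ.+-comm (toℕ j) 1)) (m<n⇒m%n≡m lt))

    prev-zero : toℕ (prev zero) ≡ 2 ℕ.+ m
    prev-zero = trans (toℕ-mod (0 ℕ.+ L ℕ.∸ 1) L) (m<n⇒m%n≡m (ℕₚ.n<1+n (2 ℕ.+ m)))

    prev-suc : ∀ j k → toℕ j ≡ suc k → toℕ (prev j) ≡ k
    prev-suc j k e = trans (toℕ-mod (toℕ j ℕ.+ L ℕ.∸ 1) L) (trans (cong (λ q → (q ℕ.+ L ℕ.∸ 1) % L) e) (trans ([m+n]%n≡m%n k L)
      (m<n⇒m%n≡m (ℕₚ.<-trans (ℕₚ.n<1+n k) (subst (ℕ._< L) e (Finₚ.toℕ<n j))))))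

-- Cycles

-- The plane cycle of length 3 + m in terms of the edge j, its end s and its side t of a cross.
record CycleLike (m : ℕ) (M : Map) : Set where
  field
    enc  : Fin (3 ℕ.+ m) → Bool → Bool → Fin (n M)
    next prev : Fin (3 ℕ.+ m) → Fin (3 ℕ.+ m)
    α₀-enc : ∀ j s t → α₀ M (enc j s t) ≡ enc j (not s) t
    α₂-enc : ∀ j s t → α₂ M (enc j s t) ≡ enc j s (not t)
    α₁-enc-start : ∀ j t → α₁ M (enc j false t) ≡ enc (prev j) true t
    α₁-enc-end : ∀ j t → α₁ M (enc j true t) ≡ enc (next j) false t
    enc-surjective : ∀ x → ∃ λ j → ∃ λ s → ∃ λ t → enc j s t ≡ x
    enc-injective : ∀ j s t j' s' t' → enc j s t ≡ enc j' s' t' → j ≡ j' × s ≡ s' × t ≡ t'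
    next-last : ∀ j → suc (toℕ j) ≡ 3 ℕ.+ m → next j ≡ zero
    next-suc : ∀ j → suc (toℕ j) ℕ.< 3 ℕ.+ m → toℕ (next j) ≡ suc (toℕ j)
    prev-zero : toℕ (prev zero) ≡ 2 ℕ.+ m
    prev-suc : ∀ j k → toℕ j ≡ suc k → toℕ (prev j) ≡ k
    no-isolated : iso M ≡ 0

cycle-like : ∀ m → CycleLike m (Cyc m)
cycle-like m = record { Cycle m ; no-isolated = refl }

module CycleOf {m : ℕ} {CM : Map} (like : CycleLike m CM) where
  open CycleLike like public

  L : ℕ
  L = 3 ℕ.+ m

  data View : Fin (n CM) → Set where
    enc′ : ∀ j s t → View (enc j s t)

  view : ∀ x → View x
  view x with enc-surjective x
  ... | j , s , t , refl = enc′ j s t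

  on : {A : Set} → (Fin L → Bool → Bool → A) → Fin (n CM) → A
  on F x = F (proj₁ (enc-surjective x)) (proj₁ (proj₂ (enc-surjective x))) (proj₁ (proj₂ (proj₂ (enc-surjective x))))

  on-enc : {A : Set} (F : Fin L → Bool → Bool → A) → ∀ j s t → on F (enc j s t) ≡ F j s t
  on-enc F j s t = go (enc-surjective (enc j s t))
    where
    go : (e : ∃ λ j' → ∃ λ s' → ∃ λ t' → enc j' s' t' ≡ enc j s t) → F (proj₁ e) (proj₁ (proj₂ e)) (proj₁ (proj₂ (proj₂ e))) ≡ F j s t
    go (j' , s' , t' , e) with enc-injective j' s' t' j s t e
    ... | refl , refl , refl = refl

  last : Fin L
  last = Fin.fromℕ (2 ℕ.+ m)

  next-cases : ∀ j → (suc (toℕ j) ℕ.< L) ⊎ (suc (toℕ j) ≡ L)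
  next-cases j with ℕₚ.m≤n⇒m<n∨m≡n (Finₚ.toℕ<n j)
  ... | inj₁ lt = inj₁ lt
  ... | inj₂ e = inj₂ e

  prev-next : ∀ j → prev (next j) ≡ j
  prev-next j with next-cases j
  ... | inj₁ lt = Finₚ.toℕ-injective (prev-suc (next j) (toℕ j) (next-suc j lt))
  ... | inj₂ e = Finₚ.toℕ-injective (trans (cong (toℕ ∘ prev) (next-last j e)) (trans prev-zero (sym (ℕₚ.suc-injective e))))

  next-prev : ∀ j → next (prev j) ≡ j
  next-prev j = go (toℕ j) refl
    where
    go : ∀ k → toℕ j ≡ k → next (prev j) ≡ j
    go zero e = trans (next-last (prev j) (cong suc (trans (cong (toℕ ∘ prev) j0) prev-zero))) (sym j0)
      where
      j0 : j ≡ zero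
      j0 = Finₚ.toℕ-injective e
    go (suc k) e = Finₚ.toℕ-injective (trans (next-suc (prev j) (subst (λ q → suc q ℕ.< L) (sym (prev-suc j k e)) (subst (ℕ._< L) e (Finₚ.toℕ<n j))))
      (trans (cong suc (prev-suc j k e)) (sym e)))

  isCyc : IsMap CM
  isCyc = inv₀ , inv₁ , inv₂ , fix₀ , fix₁ , fix₂ , comm
    where
    nn : ∀ s → not s ≢ s
    nn true ()
    nn false ()
    inv₀ : ∀ x → α₀ CM (α₀ CM x) ≡ x
    inv₀ x with view x
    ... | enc′ j s t = trans (cong (α₀ CM) (α₀-enc j s t)) (trans (α₀-enc j (not s) t) (cong (λ b → enc j b t) (Boolₚ.not-involutive s)))
    inv₂ : ∀ x → α₂ CM (α₂ CM x) ≡ x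
    inv₂ x with view x
    ... | enc′ j s t = trans (cong (α₂ CM) (α₂-enc j s t)) (trans (α₂-enc j s (not t)) (cong (enc j s) (Boolₚ.not-involutive t)))
    inv₁ : ∀ x → α₁ CM (α₁ CM x) ≡ x
    inv₁ x with view x
    ... | enc′ j false t = trans (cong (α₁ CM) (α₁-enc-start j t)) (trans (α₁-enc-end (prev j) t) (cong (λ i → enc i false t) (next-prev j)))
    ... | enc′ j true t = trans (cong (α₁ CM) (α₁-enc-end j t)) (trans (α₁-enc-start (next j) t) (cong (λ i → enc i true t) (prev-next j)))
    fix₀ : ∀ x → α₀ CM x ≢ x
    fix₀ x e with view x
    ... | enc′ j s t = nn s (proj₁ (proj₂ (enc-injective j (not s) t j s t (trans (sym (α₀-enc j s t)) e))))
    fix₂ : ∀ x → α₂ CM x ≢ x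
    fix₂ x e with view x
    ... | enc′ j s t = nn t (proj₂ (proj₂ (enc-injective j s (not t) j s t (trans (sym (α₂-enc j s t)) e))))
    fix₁ : ∀ x → α₁ CM x ≢ x
    fix₁ x e with view x
    ... | enc′ j false t = nn false (proj₁ (proj₂ (enc-injective (prev j) true t j false t (trans (sym (α₁-enc-start j t)) e))))
    ... | enc′ j true t = nn true (proj₁ (proj₂ (enc-injective (next j) false t j true t (trans (sym (α₁-enc-end j t)) e))))
    comm : ∀ x → α₀ CM (α₂ CM x) ≡ α₂ CM (α₀ CM x)
    comm x with view x
    ... | enc′ j s t = trans (cong (α₀ CM) (α₂-enc j s t)) (trans (α₀-enc j s (not t)) (sym (trans (cong (α₂ CM) (α₀-enc j s t)) (α₂-enc j (not s) t))))

module CycleDarts {m : ℕ} {CM : Map} (like : CycleLike m CM) where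
  open CycleOf like
  open Laws CM isCyc

  pos neg : Fin L → Fin (n CM)
  pos j = enc j false false
  neg j = enc j true true

  private
    -- The darts are the crosses with equal end and side: they start edges on one side and end them
    -- on the other, so the two faces are traversed in opposite directions.
    colour : Fin L → Bool → Bool → Bool
    colour _ false t = not t
    colour _ true  t = t

    dartwise : (p q : Fin L → ℤ) → Fin L → Bool → Bool → ℤ
    dartwise p q j false false = p j
    dartwise p q j true  true  = q j
    dartwise p q j false true  = + 0
    dartwise p q j true  false = + 0

  orientation : Orient CM
  orientation = record { lab = on colour ; lab₀ = l₀ ; lab₁ = l₁ ; lab₂ = l₂ }
    where
    c = colour
    flip : ∀ j s t → c j (not s) t ≡ not (c j s t)
    flip j false t = sym (Boolₚ.not-involutive t)
    flip j true t = refl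
    flip₂ : ∀ j s t → c j s (not t) ≡ not (c j s t)
    flip₂ j false t = refl
    flip₂ j true t = refl
    l₀ : ∀ x → on c (α₀ CM x) ≡ not (on c x)
    l₀ x with view x
    ... | enc′ j s t = trans (cong (on c) (α₀-enc j s t)) (trans (on-enc c j (not s) t) (trans (flip j s t) (cong not (sym (on-enc c j s t)))))
    l₂ : ∀ x → on c (α₂ CM x) ≡ not (on c x)
    l₂ x with view x
    ... | enc′ j s t = trans (cong (on c) (α₂-enc j s t)) (trans (on-enc c j s (not t)) (trans (flip₂ j s t) (cong not (sym (on-enc c j s t)))))
    l₁ : ∀ x → on c (α₁ CM x) ≡ not (on c x)
    l₁ x with view x
    ... | enc′ j false t = trans (cong (on c) (α₁-enc-start j t)) (trans (on-enc c (prev j) true t) (trans (sym (Boolₚ.not-involutive t)) (cong not (sym (on-enc c j false t)))))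
    ... | enc′ j true t = trans (cong (on c) (α₁-enc-end j t)) (trans (on-enc c (next j) false t) (cong not (sym (on-enc c j true t))))

  open Hat CM isCyc orientation public
  private c = Label.lab orientation

  c-pos : ∀ j → c (pos j) ≡ true
  c-pos j = on-enc colour j false false
  c-neg : ∀ j → c (neg j) ≡ true
  c-neg j = on-enc colour j true true

  φ-pos : ∀ j → φ CM (pos j) ≡ pos (next j)
  φ-pos j = trans (cong (α₁ CM) (α₀-enc j false false)) (α₁-enc-end j false)
  φ̂-pos : ∀ j → φ̂ (pos j) ≡ pos (next j)
  φ̂-pos j = trans (φ̂-dart _ (c-pos j)) (φ-pos j)
  φ̂-neg : ∀ j → φ̂ (neg j) ≡ neg (prev j)
  φ̂-neg j = trans (φ̂-dart _ (c-neg j)) (trans (cong (α₁ CM) (α₀-enc j true true)) (α₁-enc-start j true))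
  bar̂-pos : ∀ j → bar̂ (pos j) ≡ neg j
  bar̂-pos j = trans (bar̂-dart _ (c-pos j)) (trans (cong (α₀ CM) (α₂-enc j false false)) (α₀-enc j false true))
  bar̂-neg : ∀ j → bar̂ (neg j) ≡ pos j
  bar̂-neg j = trans (bar̂-dart _ (c-neg j)) (trans (cong (α₀ CM) (α₂-enc j true true)) (α₀-enc j true false))

  data DartView : Fin (n CM) → Set where
    at-pos : ∀ j → DartView (pos j)
    at-neg : ∀ j → DartView (neg j)
    off    : ∀ {x} → c x ≡ false → DartView x

  dartView : ∀ x → DartView x
  dartView x with view x
  ... | enc′ j false false = at-pos j
  ... | enc′ j true true = at-neg j
  ... | enc′ j false true = off (on-enc colour j false true)
  ... | enc′ j true false = off (on-enc colour j true false)

  onDarts : (p q : Fin L → ℤ) → Fin (n CM) → ℤ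
  onDarts p q = on (dartwise p q)

  onDarts-pos : ∀ p q j → onDarts p q (pos j) ≡ p j
  onDarts-pos p q j = on-enc (dartwise p q) j false false
  onDarts-neg : ∀ p q j → onDarts p q (neg j) ≡ q j
  onDarts-neg p q j = on-enc (dartwise p q) j true true
  onDarts-off : ∀ p q x → c x ≡ false → onDarts p q x ≡ + 0
  onDarts-off p q x h with view x
  ... | enc′ j false false = absurdᵇ (c-pos j) h
  ... | enc′ j true true = absurdᵇ (c-neg j) h
  ... | enc′ j false true = on-enc (dartwise p q) j false true
  ... | enc′ j true false = on-enc (dartwise p q) j true false

  -- The face of the darts `pos j` passes every vertex exactly once, so its witness is already a
  -- function of the vertices; antisymmetry of `ζ` settles the other face.
  exact-cycle : Exact φ̂ bar̂
  exact-cycle ζ q ζ-bar q-φ = p , p-τ , p-φ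
    where
    p : Fin (n CM) → ℤ
    p = onDarts (λ j → q (pos j)) (λ j → q (pos (next j)))
    p-pos = onDarts-pos (λ j → q (pos j)) (λ j → q (pos (next j)))
    p-neg = onDarts-neg (λ j → q (pos j)) (λ j → q (pos (next j)))
    q-next : ∀ j → q (pos (next j)) ≡ q (pos j) + ζ (pos j)
    q-next j = trans (cong q (sym (φ̂-pos j))) (q-φ (pos j))
    p-τ : ∀ x → p (φ̂ (bar̂ x)) ≡ p x
    p-τ x with dartView x
    ... | at-pos j = trans (cong p (trans (cong φ̂ (bar̂-pos j)) (φ̂-neg j))) (trans (p-neg (prev j)) (trans (cong (q ∘ pos) (next-prev j)) (sym (p-pos j))))
    ... | at-neg j = trans (cong p (trans (cong φ̂ (bar̂-neg j)) (φ̂-pos j))) (trans (p-pos (next j)) (sym (p-neg j)))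
    ... | off h = cong p (trans (cong φ̂ (bar̂-off _ h)) (φ̂-off _ h))
    p-φ : ∀ x → p (φ̂ x) ≡ p x + ζ x
    p-φ x with dartView x
    ... | at-pos j = trans (cong p (φ̂-pos j)) (trans (p-pos (next j)) (trans (q-next j) (cong (_+ ζ (pos j)) (sym (p-pos j)))))
    ... | at-neg j = trans (cong p (φ̂-neg j)) (trans (p-neg (prev j)) (trans (cong (q ∘ pos) (next-prev j)) (trans (lem (q (pos j)) (ζ (pos j)))
          (sym (cong₂ _+_ (trans (p-neg j) (q-next j)) (trans (cong ζ (sym (bar̂-pos j))) (ζ-bar (pos j))))))))
      where
      lem : ∀ a z → a ≡ a + z + - z
      lem = solve-∀
    ... | off {x} h = trans (cong p (φ̂-off x h)) (trans (sym (ℤₚ.+-identityʳ (p x))) (cong (λ z → p x + z) (sym (double-zero (trans (cong ζ (sym (bar̂-off x h))) (ζ-bar x))))))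

  -- A walk `f` with unit steps from 0 to `g` winds the cycle once around the integers modulo `g`.
  -- Closing it up jumps by `g`, which is marked on the last edge in the face running forwards and
  -- on edge zero in the face running backwards.
  module Heights (g : ℕ) (f : ℕ → ℤ) (f0 : f 0 ≡ + 0) (fL : f L ≡ + g)
    (f-step : ∀ i → i ℕ.< L → f (suc i) - f i ≡ + 1 ⊎ f (suc i) - f i ≡ - + 1) where
    private
      Δ : Fin L → ℤ
      Δ j = f (suc (toℕ j)) - f (toℕ j)
      at-last : Fin L → ℤ
      at-last j = ⟦ eqᵇ j last ⟧
      at-zero : Fin L → ℤ
      at-zero j = ⟦ eqᵇ j zero ⟧

      f-next : ∀ j → f (toℕ (next j)) ≡ f (suc (toℕ j)) - + g * at-last j
      f-next j with next-cases j
      ... | inj₁ lt = trans (cong f (next-suc j lt)) (trans (lem (f (suc (toℕ j))) (+ g)) (cong (λ b → f (suc (toℕ j)) - + g * ⟦ b ⟧) (sym (eqᵇ-≢ ne))))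
        where
        lem : ∀ a g → a ≡ a - g * + 0
        lem = solve-∀
        ne : j ≢ last
        ne e = ℕₚ.<-irrefl (cong suc (trans (cong toℕ e) (Finₚ.toℕ-fromℕ (2 ℕ.+ m)))) lt
      ... | inj₂ e = trans (cong (f ∘ toℕ) (next-last j e)) (trans f0 (trans (lem (+ g)) (sym (trans (cong (λ i → f i - + g * at-last j) e)
          (trans (cong (λ z → z - + g * at-last j) fL) (cong (λ b → + g - + g * ⟦ b ⟧) (trans (cong (λ i → eqᵇ i last) j-last) (eqᵇ-refl last))))))))
        where
        lem : ∀ g → + 0 ≡ g - g * + 1
        lem = solve-∀
        j-last : j ≡ last
        j-last = Finₚ.toℕ-injective (trans (ℕₚ.suc-injective e) (sym (Finₚ.toℕ-fromℕ (2 ℕ.+ m))))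

      f-prev : ∀ j → f (suc (toℕ (prev j))) ≡ f (toℕ j) + + g * at-zero j
      f-prev zero = trans (cong (f ∘ suc) prev-zero) (trans fL (sym (trans (cong (_+ + g * + 1) f0) (trans (ℤₚ.+-identityˡ (+ g * + 1)) (ℤₚ.*-identityʳ (+ g))))))
      f-prev (suc j) = trans (cong (f ∘ suc) (prev-suc (suc j) (toℕ j) refl)) (lem (f (suc (toℕ j))) (+ g))
        where
        lem : ∀ a g → a ≡ a + g * + 0
        lem = solve-∀

      ω η J e : Fin (n CM) → ℤ
      ω = onDarts Δ (λ j → - Δ j)
      η = onDarts (f ∘ toℕ) (λ j → f (suc (toℕ j)))
      J = onDarts at-last (λ j → - at-zero j)
      e = onDarts at-zero (λ j → - at-last j)

      ω-unit : ∀ x → c x ≡ true → ω x ≡ + 1 ⊎ ω x ≡ - + 1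
      ω-unit x cx with dartView x
      ... | off h = absurdᵇ cx h
      ... | at-pos j = subst (λ w → w ≡ + 1 ⊎ w ≡ - + 1) (sym (onDarts-pos Δ (λ j → - Δ j) j)) (f-step (toℕ j) (Finₚ.toℕ<n j))
      ... | at-neg j = subst (λ w → w ≡ + 1 ⊎ w ≡ - + 1) (sym (onDarts-neg Δ (λ j → - Δ j) j)) (negate (f-step (toℕ j) (Finₚ.toℕ<n j)))
        where
        negate : ∀ {w} → w ≡ + 1 ⊎ w ≡ - + 1 → - w ≡ + 1 ⊎ - w ≡ - + 1
        negate (inj₁ refl) = inj₂ refl
        negate (inj₂ refl) = inj₁ refl

      ω-bar : ∀ x → ω (bar̂ x) ≡ - ω x
      ω-bar x with dartView x
      ... | at-pos j = trans (cong ω (bar̂-pos j)) (trans (onDarts-neg Δ (λ j → - Δ j) j) (cong -_ (sym (onDarts-pos Δ (λ j → - Δ j) j))))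
      ... | at-neg j = trans (cong ω (bar̂-neg j)) (trans (onDarts-pos Δ (λ j → - Δ j) j) (trans (sym (ℤₚ.neg-involutive (Δ j))) (cong -_ (sym (onDarts-neg Δ (λ j → - Δ j) j)))))
      ... | off {x} h = trans (cong ω (bar̂-off x h)) (trans (onDarts-off Δ (λ j → - Δ j) x h) (cong -_ (sym (onDarts-off Δ (λ j → - Δ j) x h))))

      η-pos = onDarts-pos (f ∘ toℕ) (λ j → f (suc (toℕ j)))
      η-neg = onDarts-neg (f ∘ toℕ) (λ j → f (suc (toℕ j)))

      η-φ : ∀ x → η (φ̂ x) ≡ η x + ω x - + g * J x
      η-φ x with dartView x
      ... | at-pos j = trans (cong η (φ̂-pos j)) (trans (η-pos (next j)) (trans (f-next j) (trans (lem (f (toℕ j)) (f (suc (toℕ j))) (+ g * at-last j))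
            (sym (cong₂ (λ u v → u - + g * v) (cong₂ _+_ (η-pos j) (onDarts-pos Δ (λ j → - Δ j) j)) (onDarts-pos at-last (λ j → - at-zero j) j))))))
        where
        lem : ∀ a b u → b - u ≡ a + (b - a) - u
        lem = solve-∀
      ... | at-neg j = trans (cong η (φ̂-neg j)) (trans (η-neg (prev j)) (trans (f-prev j) (trans (lem (f (toℕ j)) (f (suc (toℕ j))) (+ g) (at-zero j))
            (sym (cong₂ (λ u v → u - + g * v) (cong₂ _+_ (η-neg j) (onDarts-neg Δ (λ j → - Δ j) j)) (onDarts-neg at-last (λ j → - at-zero j) j))))))
        where
        lem : ∀ a b g u → a + g * u ≡ b + - (b - a) - g * - u
        lem = solve-∀
      ... | off {x} h = trans (cong η (φ̂-off x h)) (trans (lem (η x) (+ g)) (sym (cong₂ (λ u v → η x + u - + g * v) (onDarts-off Δ (λ j → - Δ j) x h) (onDarts-off at-last (λ j → - at-zero j) x h))))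
        where
        lem : ∀ a g → a ≡ a + + 0 - g * + 0
        lem = solve-∀

      η-τ : ∀ x → η (φ̂ (bar̂ x)) ≡ η x + + g * e x
      η-τ x with dartView x
      ... | at-pos j = trans (cong η (trans (cong φ̂ (bar̂-pos j)) (φ̂-neg j))) (trans (η-neg (prev j)) (trans (f-prev j)
            (sym (cong₂ (λ u v → u + + g * v) (η-pos j) (onDarts-pos at-zero (λ j → - at-last j) j)))))
      ... | at-neg j = trans (cong η (trans (cong φ̂ (bar̂-neg j)) (φ̂-pos j))) (trans (η-pos (next j)) (trans (f-next j)
            (trans (lem (f (suc (toℕ j))) (+ g) (at-last j)) (sym (cong₂ (λ u v → u + + g * v) (η-neg j) (onDarts-neg at-zero (λ j → - at-last j) j))))))
        where
        lem : ∀ a g u → a - g * u ≡ a + g * - u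
        lem = solve-∀
      ... | off {x} h = trans (cong η (trans (cong φ̂ (bar̂-off x h)) (φ̂-off x h))) (trans (lem (η x) (+ g)) (cong (λ v → η x + + g * v) (sym (onDarts-off at-zero (λ j → - at-last j) x h))))
        where
        lem : ∀ a g → a ≡ a + g * + 0
        lem = solve-∀

      mark : ∀ x → J x ≡ + 0 ⊎ (J x ≡ + 1 × x ≡ pos last) ⊎ (J x ≡ - + 1 × x ≡ neg zero)
      mark x with dartView x
      ... | off {x} h = inj₁ (onDarts-off at-last (λ j → - at-zero j) x h)
      ... | at-pos j = go (j Fin.≟ last)
        where
        go : Dec (j ≡ last) → J (pos j) ≡ + 0 ⊎ (J (pos j) ≡ + 1 × pos j ≡ pos last) ⊎ (J (pos j) ≡ - + 1 × pos j ≡ neg zero)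
        go (yes e) = inj₂ (inj₁ (trans (onDarts-pos at-last (λ j → - at-zero j) j) (cong ⟦_⟧ (trans (cong (λ i → eqᵇ i last) e) (eqᵇ-refl last))) , cong pos e))
        go (no p) = inj₁ (trans (onDarts-pos at-last (λ j → - at-zero j) j) (cong ⟦_⟧ (eqᵇ-≢ p)))
      ... | at-neg j = go (j Fin.≟ zero)
        where
        go : Dec (j ≡ zero) → J (neg j) ≡ + 0 ⊎ (J (neg j) ≡ + 1 × neg j ≡ pos last) ⊎ (J (neg j) ≡ - + 1 × neg j ≡ neg zero)
        go (yes e) = inj₂ (inj₂ (trans (onDarts-neg at-last (λ j → - at-zero j) j) (cong (λ i → - at-zero i) e) , cong neg e))
        go (no p) = inj₁ (trans (onDarts-neg at-last (λ j → - at-zero j) j) (cong (λ b → - ⟦ b ⟧) (eqᵇ-≢ p)))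

      J-uniq : ∀ x y → J x ≡ J y → J x ≢ + 0 → x ≡ y
      J-uniq x y h nz with mark x | mark y
      ... | inj₁ p | _ = ⊥-elim (nz p)
      ... | _ | inj₁ q = ⊥-elim (nz (trans h q))
      ... | inj₂ (inj₁ (_ , p)) | inj₂ (inj₁ (_ , q)) = trans p (sym q)
      ... | inj₂ (inj₂ (_ , p)) | inj₂ (inj₂ (_ , q)) = trans p (sym q)
      ... | inj₂ (inj₁ (p , _)) | inj₂ (inj₂ (q , _)) with trans (sym p) (trans h q)
      ... | ()
      J-uniq x y h nz | inj₂ (inj₂ (p , _)) | inj₂ (inj₁ (q , _)) with trans (sym p) (trans h q)
      ... | ()

      J-val : ∀ x → J x ≡ + 0 ⊎ J x ≡ + 1 ⊎ J x ≡ - + 1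
      J-val x with mark x
      ... | inj₁ p = inj₁ p
      ... | inj₂ (inj₁ (p , _)) = inj₂ (inj₁ p)
      ... | inj₂ (inj₂ (p , _)) = inj₂ (inj₂ p)

    cycle-state : MState g CM isCyc
    cycle-state = record { orient = orientation
      ; state = record { ω = ω ; η = η ; J = J ; e = e ; ω-unit = ω-unit ; ω-bar = ω-bar ; η-φ = η-φ ; η-τ = η-τ ; J-val = J-val ; J-uniq = λ x y _ → J-uniq x y }
      ; exact = exact-cycle }

  cycle-state-L : MState L CM isCyc
  cycle-state-L = Heights.cycle-state L +_ refl refl (λ i _ → inj₁ (lem (+ i)))
    where
    lem : ∀ i → + 1 + i - i ≡ + 1
    lem = solve-∀

  odd-cycle : (∀ b → iter L not b ≡ not b) → ¬ Bip CM
  odd-cycle odd l = absurd (b (pos zero)) (trans (sym (odd (b (pos zero)))) (trans (cong not (sym (run (2 ℕ.+ m) last (Finₚ.toℕ-fromℕ (2 ℕ.+ m)))))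
      (trans (sym (flip last)) (cong (b ∘ pos) (next-last last (cong suc (Finₚ.toℕ-fromℕ (2 ℕ.+ m))))))))
    where
    open Label l renaming (lab to b)
    absurd : ∀ x → not x ≢ x
    absurd true ()
    absurd false ()
    flip : ∀ j → b (pos (next j)) ≡ not (b (pos j))
    flip j = trans (cong b (sym (φ-pos j))) (trans (lab₁ _) (lab₀ (pos j)))
    run : ∀ i j → toℕ j ≡ i → b (pos j) ≡ iter i not (b (pos zero))
    run zero j h = cong (b ∘ pos) (Finₚ.toℕ-injective h)
    run (suc i) j h = trans (cong (b ∘ pos) (sym (next-prev j))) (trans (flip (prev j)) (cong not (run i (prev j) (prev-suc j i h))))

≅-refl : ∀ M → M ≅ M
≅-refl M = record { bij = ↔-id _ ; comm₀ = λ _ → refl ; comm₁ = λ _ → refl ; comm₂ = λ _ → refl ; isoEq = refl }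

-- Folding

separate : (M : Map) → Fin (n M ℕ.* n M) → Bool
separate M k = not (reach (vGens M) (proj₁ (Fin.remQuot {n M} (n M) k)) (proj₂ (Fin.remQuot {n M} (n M) k)))

-- Termination measure: every vertex gluing decreases it.
pairs : Map → ℕ
pairs M = count (separate M)

pairs-glue : ∀ M (isM : IsMap M) a b → reach (vGens M) a b ≡ false → pairs (glue M a b) ℕ.< pairs M
pairs-glue M isM a b apart = count-strict (separate (glue M a b)) (separate M)
    (λ k h → cong not (¬true (λ r → absurdᵇ (vertices-coarser apart (fst k) (snd k) r) (trans (sym (Boolₚ.not-involutive (reach (vGens (glue M a b)) (fst k) (snd k)))) (cong not h)))))
    (Fin.combine a b) (trans (cong (λ q → not (reach (vGens (glue M a b)) (proj₁ q) (proj₂ q))) (Finₚ.remQuot-combine a b)) (cong not (vertices-glued apart)))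
    (trans (cong (λ q → not (reach (vGens M) (proj₁ q) (proj₂ q))) (Finₚ.remQuot-combine a b)) (cong not apart))
  where
  open Glue M isM a b
  fst snd : Fin (n M ℕ.* n M) → Fin (n M)
  fst k = proj₁ (Fin.remQuot {n M} (n M) k)
  snd k = proj₂ (Fin.remQuot {n M} (n M) k)

-- `less` is a lexicographic order in which the number of crosses counts first, so deleting a
-- duplicate edge may do anything to the second component.
record Move (g : ℕ) (M : Map) : Set where
  field
    X      : Map
    isX    : IsMap X
    step   : Step M X
    state  : MState g X isX
    less   : (n X ≡ n M × pairs X ℕ.+ iso X ℕ.< pairs M ℕ.+ iso M) ⊎ n X ℕ.< n M

-- Gluings that keep the heights

module Moves {g : ℕ} (g≥3 : 3 ℕ.≤ g) (M : Map) (isM : IsMap M) (orient : Orient M) where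
  open Laws M isM
  open Hat M isM orient
  open Label orient renaming (lab to c; lab₀ to c₀; lab₁ to c₁; lab₂ to c₂)
  St : Set
  St = State g c φ̂ bar̂
  private
    g≥2 : 2 ℕ.≤ g
    g≥2 = ℕₚ.≤-trans (s≤s (s≤s z≤n)) g≥3
    instance
      g-nz : ℕ.NonZero g
      g-nz = ℕ.>-nonZero (ℕₚ.≤-trans (s≤s z≤n) g≥3)

  module GlueMove (a b : Fin (n M)) (ca : c a ≡ true) (cb : c b ≡ true) (apart : reach (vGens M) a b ≡ false) where
    open Glue M isM a b using (glue-isMap; a≢b) public
    orient' : Orient (glue M a b)
    orient' = record { lab = c ; lab₀ = c₀ ; lab₁ = λ x → trans (swap-inv c (trans ca (sym cb)) _) (trans (c₁ _) (cong not (swap-inv c (trans ca (sym cb)) x))) ; lab₂ = c₂ }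
    module H' = Hat (glue M a b) glue-isMap orient'
    eq : ∀ z → H'.φ̂ z ≡ swapF a b (φ̂ z)
    eq = GlueHat.glue-φ M isM a b orient orient' (λ _ → refl) ca cb
    glue-move : reach (φ M ∷ []) a b ≡ true ⊎ reach (cGens M) a b ≡ false → State g c H'.φ̂ H'.bar̂ → Exact H'.φ̂ H'.bar̂ → Move g M
    glue-move cond s ex = record { X = glue M a b ; isX = glue-isMap ; step = inj₁ (inj₁ (a , b , a≢b apart , apart , cond , ≅-refl (glue M a b)))
      ; state = record { orient = orient' ; state = s ; exact = ex } ; less = inj₁ (refl , ℕₚ.+-monoˡ-< (iso M) (pairs-glue M isM a b apart)) }

  moves : (s : St) → ∀ z → c z ≡ true → φ̂ z ≢ z
  moves s z cz fix = unit-cong g≥2 (ω-unit z cz) (J z , height-fixed (η z) (ω z) (+ g * J z) (trans (sym (cong η fix)) (η-φ z)))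
    where open State s

  join-move : (s : St) → Exact φ̂ bar̂ → ∀ x y → c x ≡ true → c y ≡ true → reach (cGens M) x y ≡ false → Move g M
  join-move s ex x y cx cy far = glue-move (inj₂ far') (J.state H'.φ̂ eq) (Swap.exact-merge-components hat eq nab ex)
    where
    module J = Join.Joined (Join.join hat s x y (¬true (λ r → absurdᵇ (conn-component x y r) far)))
    dart-of : ∀ u v → reach (φ̂ ∷ bar̂ ∷ []) u v ≡ true → c u ≡ true → c v ≡ true
    dart-of u v r cu = trans (conn-fun hat c c-φ̂ c-bar̂ u v r) cu
    ca = dart-of x J.a J.in-a cx
    cb = dart-of y J.b J.in-b cy
    far' : reach (cGens M) J.a J.b ≡ false
    far' = ¬true λ r → absurdᵇ (reach-trans (cGens M) c-inj x J.a y (conn-component x J.a J.in-a)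
      (reach-trans (cGens M) c-inj J.a J.b y r (reach-sym (cGens M) c-inj y J.b (conn-component y J.b J.in-b)))) far
    apart : reach (vGens M) J.a J.b ≡ false
    apart = ¬true λ r → absurdᵇ (trans (vertex-fun (reach (cGens M) J.a) (reach-inv (cGens M) J.a (there (here refl)) α₁-inj)
      (reach-inv (cGens M) J.a (there (there (here refl))) α₂-inj) J.a J.b r) (reach-refl (cGens M) J.a)) far'
    nab : reach (φ̂ ∷ bar̂ ∷ []) J.a J.b ≡ false
    nab = ¬true λ r → absurdᵇ (conn-component J.a J.b r) far'
    open GlueMove J.a J.b ca cb apart

  -- The two ends of the fold have the same integer height only if no mark lies on its two darts, so
  -- marks are moved to the dart `y` before the corner. This is why folds are indexed by the
  -- preceding dart.
  module Cleared (s : St) (y : Fin (n M)) (cy : c y ≡ true) (ne : φ̂ (φ̂ (φ̂ y)) ≢ φ̂ y) where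
    private
      x = φ̂ y
      cx : c x ≡ true
      cx = trans (c-φ̂ y) cy
      -- The order matters: from `φ̂ x` to `x`, then from `x` to `y`. The second push cannot refill
      -- `φ̂ x` because `φ̂ x` differs from `y`.
      module C₁ = Clear hat s x (moves s x cx)
      module C₂ = Clear hat C₁.clear y (moves s y cy)
      φx≢y : φ̂ x ≢ y
      φx≢y e = ne (cong φ̂ e)
    cleared : St
    cleared = C₂.clear
    J-x : State.J cleared x ≡ + 0
    J-x = C₂.clear-J
    J-φx : State.J cleared (φ̂ x) ≡ + 0
    J-φx = C₂.clear-J-other (φ̂ x) φx≢y C₁.clear-J

  corner-move : (s : St) → Exact φ̂ bar̂ → ∀ y → c y ≡ true → State.ω s (φ̂ y) + State.ω s (φ̂ (φ̂ y)) ≡ + 0 →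
    reach (vGens M) (φ̂ y) (φ̂ (φ̂ (φ̂ y))) ≡ false → Move g M
  corner-move s ex y cy fold apart = glue-move (inj₁ face) (Swap.state-swap hat eq cleared ηab conn) (Swap.exact-merge-face hat eq (a≢b apart) face-hat ex)
    where
    x = φ̂ y
    b = φ̂ (φ̂ x)
    cx : c x ≡ true
    cx = trans (c-φ̂ y) cy
    cφx : c (φ̂ x) ≡ true
    cφx = trans (c-φ̂ x) cx
    cb : c b ≡ true
    cb = trans (c-φ̂ (φ̂ x)) cφx
    open GlueMove x b cx cb apart
    open Cleared s y cy (λ e → a≢b apart (sym e))
    open State cleared using (η; ω; η-φ)
    ηab : η x ≡ η b
    ηab = sym (trans (η-φ (φ̂ x)) (trans (cong₂ (λ u v → u + ω (φ̂ x) - + g * v) (trans (η-φ x) (cong (λ v → η x + ω x - + g * v) J-x)) J-φx)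
      (trans (lem (η x) (ω x) (ω (φ̂ x)) (+ g)) (trans (cong (λ z → η x + z) fold) (ℤₚ.+-identityʳ (η x))))))
      where
      lem : ∀ η w w' g → η + w - g * + 0 + w' - g * + 0 ≡ η + (w + w')
      lem = solve-∀
    face-hat : reach (φ̂ ∷ []) x b ≡ true
    face-hat = reach-step (φ̂ ∷ []) x (here refl) (φ̂ x) (reach-step (φ̂ ∷ []) x (here refl) x (reach-refl (φ̂ ∷ []) x))
    conn : reach (φ̂ ∷ bar̂ ∷ []) x b ≡ true
    conn = trans (conn-φ hat x (φ̂ x)) (trans (conn-φ hat x x) (reach-refl (φ̂ ∷ bar̂ ∷ []) x))
    face : reach (φ M ∷ []) x b ≡ true
    face = trans (cong (reach (φ M ∷ []) x) (trans (φ̂-dart (φ̂ x) cφx) (cong (φ M) (φ̂-dart x cx))))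
      (reach-step (φ M ∷ []) x (here refl) (φ M x) (reach-step (φ M ∷ []) x (here refl) x (reach-refl (φ M ∷ []) x)))

  J-off : (s : St) → ∀ z → c z ≡ false → State.J s z ≡ + 0
  J-off s z h = ℤₚ.*-cancelˡ-≡ (+ g) (J z) (+ 0) (trans (sym (height-fixed (η z) (ω z) (+ g * J z) (trans (sym (cong η (φ̂-off z h))) (η-φ z))))
    (trans (double-zero (trans (sym (cong ω (bar̂-off z h))) (ω-bar z))) (sym (ℤₚ.*-zeroʳ (+ g)))))
    where open State s

  fold-move : (s : St) → Exact φ̂ bar̂ → (∀ x y → reach (cGens M) x y ≡ true) → ∀ x → c x ≡ true → State.ω s x + State.ω s (φ̂ x) ≡ + 0 →
    φ̂ (φ̂ x) ≢ x → Move g M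
  fold-move s ex conn x cx fold ne = go (reach (vGens M) x (φ̂ (φ̂ x)) Boolₚ.≟ true)
    where
    y = inverse (Perms.φ-inj hat) x
    φy : φ̂ y ≡ x
    φy = inverseʳ (Perms.φ-inj hat) x
    cy : c y ≡ true
    cy = trans (sym (c-φ̂ y)) (trans (cong c φy) cx)
    -- The replacement fold uses the darts `y` and `x`, so its marks must be pushed one dart further
    -- back than those of the original one.
    y₀ = inverse (Perms.φ-inj hat) y
    φy₀ : φ̂ y₀ ≡ y
    φy₀ = inverseʳ (Perms.φ-inj hat) y
    go : Dec (reach (vGens M) x (φ̂ (φ̂ x)) ≡ true) → Move g M
    go (no p) = corner-move s ex y cy (trans (cong (λ z → State.ω s z + State.ω s (φ̂ z)) φy) fold) (trans (cong (λ z → reach (vGens M) z (φ̂ (φ̂ z))) φy) (¬true p))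
    go (yes p) = corner-move (proj₁ P.foldable) ex y₀ (trans (sym (c-φ̂ y₀)) (trans (cong c φy₀) cy))
        (trans (cong (λ z → State.ω (proj₁ P.foldable) z + State.ω (proj₁ P.foldable) (φ̂ z)) φy₀) (proj₂ P.foldable))
        (trans (cong (λ z → reach (vGens M) z (φ̂ (φ̂ z))) φy₀) (¬true (λ r → absurdᵇ (vertex-τ y (φ̂ (φ̂ y)) cy (trans (c-φ̂ (φ̂ y)) (trans (c-φ̂ y) cy)) r) P.separated)))
      where
      ne' : φ̂ (φ̂ (φ̂ y)) ≢ φ̂ y
      ne' e = ne (trans (cong (φ̂ ∘ φ̂) (sym φy)) (trans e φy))
      open Cleared s y cy ne'
      dart-mark : ∀ z → State.J cleared z ≢ + 0 → c z ≡ true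
      dart-mark z nz with dart? z
      ... | inj₁ h = h
      ... | inj₂ h = ⊥-elim (nz (J-off cleared z h))
      module P = Pinch hat ex g≥2 cleared (λ z w p q → component-conn z w (dart-mark z p) (dart-mark w q) (conn z w)) y cy (trans (c-φ̂ y) cy)
        J-x J-φx (trans (cong (λ z → State.ω s z + State.ω s (φ̂ z)) φy) fold) ne'
        (subst (λ z → reach (φ̂ ∘ bar̂ ∷ []) z (φ̂ (φ̂ z)) ≡ true) (sym φy) (vertex-τ x (φ̂ (φ̂ x)) cx (trans (c-φ̂ (φ̂ x)) (trans (c-φ̂ x) cx)) p))

module Delete (M : Map) (isM : IsMap M) (d : SubData M)
  (K₀ : ∀ z → SubData.keepE d (α₀ M z) ≡ SubData.keepE d z) (K₂ : ∀ z → SubData.keepE d (α₂ M z) ≡ SubData.keepE d z) where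
  open Laws M isM
  private
    K = SubData.keepE d
    E = enum K
    open Enum E
    idx : ∀ z → K z ≡ true → Fin size
    idx z k = proj₁ (onto z k)
    emb-idx : ∀ z k → emb (idx z k) ≡ z
    emb-idx z k = proj₂ (onto z k)
    returns : ∀ i → ∃ λ z → FirstReturn K (τ M) (α₂ M (emb i)) z
    returns i with period τM-inj (α₂ M (emb i))
    -- The rotation comes back to its kept starting cross, so a first kept cross exists.
    ... | p , _ , e with least (λ k → K (iter (suc k) (τ M) (α₂ M (emb i))) Boolₚ.≟ true) p (trans (cong K e) (trans (K₂ (emb i)) (into i)))
    ... | k , h , below = iter (suc k) (τ M) (α₂ M (emb i)) , record { index = k ; hit = refl ; kept = h ; miss = λ j lt → ¬true (below j lt) }
    next-eq : ∀ i → subα₁ M d (emb i) ≡ proj₁ (returns i)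
    next-eq i = nextIn-compute τM-inj (proj₂ (returns i))

  deleted : Map
  deleted = record { n = size ; α₀ = λ i → idx (α₀ M (emb i)) (trans (K₀ (emb i)) (into i))
                   ; α₁ = λ i → idx (proj₁ (returns i)) (FirstReturn.kept (proj₂ (returns i)))
                   ; α₂ = λ i → idx (α₂ M (emb i)) (trans (K₂ (emb i)) (into i)) ; iso = subIsoCount M d }

  delete : ∀ z → K z ≡ false → Σ Map λ X → SubIso X M d × n X ℕ.< n M
  delete z k = deleted , record { emb = emb ; emb-inj = inj ; emb-into = into ; emb-onto = onto
      ; comm₀ = λ i → emb-idx (α₀ M (emb i)) (trans (K₀ (emb i)) (into i))
      ; comm₁ = λ i → trans (emb-idx (proj₁ (returns i)) (FirstReturn.kept (proj₂ (returns i)))) (sym (next-eq i))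
      ; comm₂ = λ i → emb-idx (α₂ M (emb i)) (trans (K₂ (emb i)) (into i)) ; isoEq = refl }
    , ℕₚ.≤-trans (subst (ℕ._< count {n M} (λ _ → true)) (sym size-count) (count-strict K (λ _ → true) (λ _ _ → refl) z k refl)) (count≤n {n M} (λ _ → true))

count-two : ∀ {n} (p : Fin n → Bool) a b → a ≢ b → p a ≡ true → p b ≡ true → (∀ x → p x ≡ true → x ≡ a ⊎ x ≡ b) → count p ≡ 2
count-two p a b a≢b pa pb only = ℤₚ.+-injective (trans (sym (∑-count p)) (trans (∑-cong pointwise) (trans (∑-+ (δ a) (δ b))
    (cong₂ _+_ (trans (∑-δ a (δ a) (λ x → δ-diff)) (δ-same a)) (trans (∑-δ b (δ b) (λ x → δ-diff)) (δ-same b))))))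
  where
  pointwise : ∀ x → ⟦ p x ⟧ ≡ δ a x + δ b x
  pointwise x = go (x Fin.≟ a) (x Fin.≟ b)
    where
    go : Dec (x ≡ a) → Dec (x ≡ b) → ⟦ p x ⟧ ≡ δ a x + δ b x
    go (yes refl) _ = trans (cong ⟦_⟧ pa) (sym (cong₂ _+_ (δ-same a) (δ-diff a≢b)))
    go _ (yes refl) = trans (cong ⟦_⟧ pb) (sym (cong₂ _+_ (δ-diff (a≢b ∘ sym)) (δ-same b)))
    go (no q) (no r) = trans (cong ⟦_⟧ (¬true (λ h → neither (only x h)))) (sym (cong₂ _+_ (δ-diff q) (δ-diff r)))
      where
      neither : x ≡ a ⊎ x ≡ b → ⊥
      neither (inj₁ e) = q e
      neither (inj₂ e) = r e

module DupMove {g : ℕ} (g≥3 : 3 ℕ.≤ g) (M : Map) (isM : IsMap M) (orient : Orient M) where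
  open Laws M isM
  open Hat M isM orient
  open Moves g≥3 M isM orient using (St; moves)
  private c = Label.lab orient

  nondegenerate : (s : St) → ∀ z → c z ≡ true → α₂ M (α₀ M z) ≢ z
  nondegenerate s z cz fix = unit≢neg (ω-unit z cz) (trans (cong ω (sym (trans (bar̂-dart z cz) (trans (α₀α₂ z) fix)))) (ω-bar z))
    where open State s

  dup-move : (s : St) → Exact φ̂ bar̂ → ∀ x → c x ≡ true → State.ω s x + State.ω s (φ̂ x) ≡ + 0 → φ̂ (φ̂ x) ≡ x →
    reach (eGens M) x (φ M x) ≡ false → Move g M
  dup-move s ex x cx fold xx̂ far = build (proj₁ Del) (proj₁ (proj₂ Del)) (proj₂ (proj₂ Del))
   where
   y = φ M x
   φ̂x : φ̂ x ≡ y
   φ̂x = φ̂-dart x cx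
   xx : φ M y ≡ x
   xx = trans (sym (φ̂-dart y (trans (c-φ x) cx))) (trans (cong φ̂ (sym φ̂x)) xx̂)
   D = dup-at M isM x xx far
   open DupAt D using (K₀; K₂; Kx; Ky; K-edge)
   d = delEdge M y
   Del = Delete.delete M isM d K₀ K₂ y Ky
   build : (X : Map) → SubIso X M d → n X ℕ.< n M → Move g M
   build X sub smaller = record { X = X ; isX = E.isX
    ; step = inj₂ (x , y , far , reach-step (fGens M) x (there (here refl)) (α₀ M x) (reach-step (fGens M) x (here refl) x (reach-refl (fGens M) x)) , size2 , sub)
    ; state = record { orient = cX ; state = O.undouble s ωy ; exact = O.exact-undouble ex }
    ; less = inj₂ smaller }
    where
    module E = Dup M X isM x d sub K₀ K₂ xx Kx Ky K-edge
    cX : Orient X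
    cX = Sub.restrict X M d isM sub K₀ K₂ Boolₚ.not-involutive orient
    module O = E.Oriented orient cX (λ _ → refl) (trans (cong c E.emb-x') cx) (nondegenerate s y (trans (c-φ x) cx))
    ωy : State.ω s E.y ≡ - State.ω s (SubIso.emb sub E.x')
    ωy = trans (neg (State.ω s x) (State.ω s y) (trans (cong (λ z → State.ω s x + State.ω s z) (sym φ̂x)) fold)) (cong (λ z → - State.ω s z) (sym E.emb-x'))
      where
      neg : ∀ u v → u + v ≡ + 0 → v ≡ - u
      neg u v e = trans (l u v) (trans (cong (_- u) e) (ℤₚ.+-identityˡ (- u)))
        where
        l : ∀ u v → v ≡ u + v - u
        l = solve-∀
    size2 : cycleSize (φ M) x ≡ 2
    size2 = trans (countᵇ-tabulate (reach (φ M ∷ []) x) id) (count-two (reach (φ M ∷ []) x) x y (λ e → moves s x cx (trans φ̂x (sym e)))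
      (reach-refl (φ M ∷ []) x) (reach-step (φ M ∷ []) x (here refl) x (reach-refl (φ M ∷ []) x))
      (λ z → reach-ind (φ M ∷ []) x z (λ w → w ≡ x ⊎ w ≡ y) (inj₁ refl) (λ { (here refl) _ (inj₁ refl) → inj₂ refl ; (here refl) _ (inj₂ refl) → inj₁ xx })))

  -- A digon whose two darts form one edge closes up on itself, and by connectivity these four
  -- crosses are the whole map; its two ends then receive different colours. Non-bipartite maps thus
  -- never get stuck here.
  single-edge : (s : St) → (∀ x y → reach (cGens M) x y ≡ true) → ∀ x → c x ≡ true → φ̂ (φ̂ x) ≡ x → reach (eGens M) x (φ M x) ≡ true → Bip M
  single-edge s conn x cx xx̂ near = record { lab = b ; lab₀ = λ z → b₀ (quad z) ; lab₁ = λ z → b₁ (quad z) ; lab₂ = λ z → b₂ (quad z) }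
    where
    x₀ = α₀ M x
    x₂ = α₂ M x
    x₃ = α₂ M (α₀ M x)
    φx : φ M x ≡ x₃
    φx with edge-elems M isM x (φ M x) near
    ... | inj₁ e = ⊥-elim (moves s x cx (trans (φ̂-dart x cx) e))
    ... | inj₂ (inj₁ e) = absurdᵇ (trans (cong c (sym e)) (trans (c-φ x) cx)) (trans (Label.lab₀ orient x) (cong not cx))
    ... | inj₂ (inj₂ (inj₁ e)) = absurdᵇ (trans (cong c (sym e)) (trans (c-φ x) cx)) (trans (Label.lab₂ orient x) (cong not cx))
    ... | inj₂ (inj₂ (inj₂ e)) = e
    cx₃ : c x₃ ≡ true
    cx₃ = trans (cong c (sym φx)) (trans (c-φ x) cx)
    φx₃ : φ M x₃ ≡ x
    φx₃ = trans (sym (φ̂-dart x₃ cx₃)) (trans (cong φ̂ (sym (trans (φ̂-dart x cx) φx))) xx̂)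
    α₁x₂ : α₁ M x₂ ≡ x
    α₁x₂ = trans (cong (α₁ M) (sym (trans (α₀α₂ x₀) (cong (α₂ M) (α₀² x))))) φx₃
    Quad : Fin (n M) → Set
    Quad z = z ≡ x ⊎ z ≡ x₀ ⊎ z ≡ x₂ ⊎ z ≡ x₃
    quad : ∀ z → Quad z
    quad z = reach-ind (cGens M) x z Quad (inj₁ refl) (λ { (here refl) → q₀ ; (there (here refl)) → q₁ ; (there (there (here refl))) → q₂ }) (conn x z)
      where
      q₀ : ∀ z → Quad z → Quad (α₀ M z)
      q₀ _ (inj₁ refl) = inj₂ (inj₁ refl)
      q₀ _ (inj₂ (inj₁ refl)) = inj₁ (α₀² x)
      q₀ _ (inj₂ (inj₂ (inj₁ refl))) = inj₂ (inj₂ (inj₂ (α₀α₂ x)))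
      q₀ _ (inj₂ (inj₂ (inj₂ refl))) = inj₂ (inj₂ (inj₁ (trans (α₀α₂ x₀) (cong (α₂ M) (α₀² x)))))
      q₁ : ∀ z → Quad z → Quad (α₁ M z)
      q₁ _ (inj₁ refl) = inj₂ (inj₂ (inj₁ (trans (cong (α₁ M) (sym α₁x₂)) (α₁² x₂))))
      q₁ _ (inj₂ (inj₁ refl)) = inj₂ (inj₂ (inj₂ φx))
      q₁ _ (inj₂ (inj₂ (inj₁ refl))) = inj₁ α₁x₂
      q₁ _ (inj₂ (inj₂ (inj₂ refl))) = inj₂ (inj₁ (trans (cong (α₁ M) (sym φx)) (α₁² x₀)))
      q₂ : ∀ z → Quad z → Quad (α₂ M z)
      q₂ _ (inj₁ refl) = inj₂ (inj₂ (inj₁ refl))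
      q₂ _ (inj₂ (inj₁ refl)) = inj₂ (inj₂ (inj₂ refl))
      q₂ _ (inj₂ (inj₂ (inj₁ refl))) = inj₁ (α₂² x)
      q₂ _ (inj₂ (inj₂ (inj₂ refl))) = inj₂ (inj₁ (α₂² x₀))
    b : Fin (n M) → Bool
    b z = eqᵇ z x ∨ eqᵇ z x₂
    bx : b x ≡ true
    bx = cong (_∨ eqᵇ x x₂) (eqᵇ-refl x)
    bx₂ : b x₂ ≡ true
    bx₂ = trans (cong (eqᵇ x₂ x ∨_) (eqᵇ-refl x₂)) (Boolₚ.∨-zeroʳ (eqᵇ x₂ x))
    x₃≢x : x₃ ≢ x
    x₃≢x = nondegenerate s x cx
    bx₀ : b x₀ ≡ false
    bx₀ = cong₂ _∨_ (eqᵇ-≢ (α₀≢ x)) (eqᵇ-≢ (λ e → x₃≢x (trans (cong (α₂ M) e) (α₂² x))))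
    bx₃ : b x₃ ≡ false
    bx₃ = cong₂ _∨_ (eqᵇ-≢ x₃≢x) (eqᵇ-≢ (λ e → α₀≢ x (α₂-inj e)))
    b₀ : ∀ {z} → Quad z → b (α₀ M z) ≡ not (b z)
    b₀ (inj₁ refl) = trans bx₀ (cong not (sym bx))
    b₀ (inj₂ (inj₁ refl)) = trans (cong b (α₀² x)) (trans bx (cong not (sym bx₀)))
    b₀ (inj₂ (inj₂ (inj₁ refl))) = trans (cong b (α₀α₂ x)) (trans bx₃ (cong not (sym bx₂)))
    b₀ (inj₂ (inj₂ (inj₂ refl))) = trans (cong b (trans (α₀α₂ x₀) (cong (α₂ M) (α₀² x)))) (trans bx₂ (cong not (sym bx₃)))
    b₁ : ∀ {z} → Quad z → b (α₁ M z) ≡ b z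
    b₁ (inj₁ refl) = trans (cong b (trans (cong (α₁ M) (sym α₁x₂)) (α₁² x₂))) (trans bx₂ (sym bx))
    b₁ (inj₂ (inj₁ refl)) = trans (cong b φx) (trans bx₃ (sym bx₀))
    b₁ (inj₂ (inj₂ (inj₁ refl))) = trans (cong b α₁x₂) (trans bx (sym bx₂))
    b₁ (inj₂ (inj₂ (inj₂ refl))) = trans (cong b (trans (cong (α₁ M) (sym φx)) (α₁² x₀))) (trans bx₀ (sym bx₃))
    b₂ : ∀ {z} → Quad z → b (α₂ M z) ≡ b z
    b₂ (inj₁ refl) = trans bx₂ (sym bx)
    b₂ (inj₂ (inj₁ refl)) = trans bx₃ (sym bx₀)
    b₂ (inj₂ (inj₂ (inj₁ refl))) = trans (cong b (α₂² x)) (trans bx (sym bx₂))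
    b₂ (inj₂ (inj₂ (inj₂ refl))) = trans (cong b (α₂² x₀)) (trans bx₀ (sym bx₃))

-- Recognising the cycle

countᵇ-none : {A : Set} (p : A → Bool) (xs : List A) → (∀ x → p x ≡ false) → countᵇ p xs ≡ 0
countᵇ-none p [] h = refl
countᵇ-none p (x ∷ xs) h = cong₂ ℕ._+_ (cong (λ b → if b then 1 else 0) (h x)) (countᵇ-none p xs h)

-- The edges of a sequence of rising darts with distinct labels, in the coordinates of a cycle.
module Ring {m : ℕ} {CM : Map} (like : CycleLike m CM) (M : Map) (isM : IsMap M) (orient : Orient M)
  (s : State (3 ℕ.+ m) (Label.lab orient) (Hat.φ̂ M isM orient) (Hat.bar̂ M isM orient))
  (at : ℕ → Fin (n M)) (dart : ∀ i → Label.lab orient (at i) ≡ true) (rising : ∀ i → State.ω s (at i) ≡ + 1)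
  (label : ∀ i → State.η s (at i) ≡ State.η s (at 0) + + i [ 3 ℕ.+ m ]) where
  open CycleOf like
  open Laws M isM
  open Hat M isM orient
  open Label orient renaming (lab to c; lab₀ to c₀; lab₁ to c₁; lab₂ to c₂)
  open State s using (ω; η; ω-bar; η-φ)

  same-label : ∀ (i j : Fin L) → η (at (toℕ i)) ≡ η (at (toℕ j)) [ L ] → i ≡ j
  same-label i j h = Finₚ.toℕ-injective (unique (cong-trans (cong-sym (label (toℕ i))) (cong-trans h (label (toℕ j)))))
    where
    unique : η (at 0) + + toℕ i ≡ η (at 0) + + toℕ j [ L ] → toℕ i ≡ toℕ j
    unique (via t e) = residue-unique (Finₚ.toℕ<n i) (Finₚ.toℕ<n j) t (l (η (at 0)) (+ toℕ i) (+ toℕ j) (+ L * t) e)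
      where
      l : ∀ h i j u → h + i ≡ h + j + u → i ≡ j + u
      l h i j u e = trans (l₁ h i) (trans (cong (_- h) e) (l₂ h j u))
        where
        l₁ : ∀ h i → i ≡ h + i - h
        l₁ = solve-∀
        l₂ : ∀ h j u → h + j + u - h ≡ j + u
        l₂ = solve-∀

  at-injective : ∀ (i j : Fin L) → at (toℕ i) ≡ at (toℕ j) → i ≡ j
  at-injective i j e = same-label i j (subst (λ z → η (at (toℕ i)) ≡ η z [ L ]) e cong-refl)

  corner : Fin L → Bool → Bool → Fin (n M)
  corner j false false = at (toℕ j)
  corner j false true  = α₂ M (at (toℕ j))
  corner j true  false = α₀ M (at (toℕ j))
  corner j true  true  = α₀ M (α₂ M (at (toℕ j)))

  F : Fin (n CM) → Fin (n M)
  F = on corner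

  F-enc : ∀ j s t → F (enc j s t) ≡ corner j s t
  F-enc = on-enc corner

  F₀ : ∀ x → F (α₀ CM x) ≡ α₀ M (F x)
  F₀ x with view x
  ... | enc′ j s t = trans (cong F (α₀-enc j s t)) (trans (F-enc j (not s) t) (trans (go s t) (cong (α₀ M) (sym (F-enc j s t)))))
    where
    go : ∀ s t → corner j (not s) t ≡ α₀ M (corner j s t)
    go false false = refl
    go false true = refl
    go true false = sym (α₀² _)
    go true true = sym (α₀² _)

  F₂ : ∀ x → F (α₂ CM x) ≡ α₂ M (F x)
  F₂ x with view x
  ... | enc′ j s t = trans (cong F (α₂-enc j s t)) (trans (F-enc j s (not t)) (trans (go s t) (cong (α₂ M) (sym (F-enc j s t)))))
    where
    go : ∀ s t → corner j s (not t) ≡ α₂ M (corner j s t)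
    go false false = refl
    go false true = sym (α₂² _)
    go true false = α₀α₂ _
    go true true = sym (trans (cong (α₂ M) (α₀α₂ _)) (α₂² _))

  bar-at : ∀ i → bar̂ (at i) ≡ α₀ M (α₂ M (at i))
  bar-at i = bar̂-dart (at i) (dart i)

  falling : ∀ i → ω (α₀ M (α₂ M (at i))) ≡ - + 1
  falling i = trans (cong ω (sym (bar-at i))) (trans (ω-bar (at i)) (cong -_ (rising i)))

  head-label : ∀ i → η (α₀ M (α₂ M (at i))) ≡ η (at 0) + + suc i [ L ]
  head-label i = cong-trans (subst (λ z → η z ≡ η (φ̂ (at i)) [ L ]) (bar-at i) (cong-sym (via (State.e s (bar̂ (at i))) (trans (cong (λ z → η (φ̂ z)) (sym (Perms.bar-inv hat (at i)))) (State.η-τ s (bar̂ (at i)))))))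
    (cong-trans (via (- State.J s (at i)) (trans (η-φ (at i)) (trans (cong (λ w → η (at i) + w - + L * State.J s (at i)) (rising i)) (cong (λ u → η (at i) + + 1 + u) (ℤₚ.neg-distribʳ-* (+ L) (State.J s (at i))))))) (up (label i)))
    where
    up : η (at i) ≡ η (at 0) + + i [ L ] → η (at i) + + 1 ≡ η (at 0) + + suc i [ L ]
    up (via t e) = via t (trans (cong (_+ + 1) e) (l (η (at 0)) (+ i) (+ L * t)))
      where
      l : ∀ h i u → h + i + u + + 1 ≡ h + (+ 1 + i) + u
      l = solve-∀

  -- Three invariants separate the images: the orientation tells darts from other crosses, the rise
  -- tells the two directions of an edge apart, and the label determines the edge.
  corner-injective : ∀ j s t j' s' t' → corner j s t ≡ corner j' s' t' → enc j s t ≡ enc j' s' t'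
  corner-injective j s t j' s' t' = go s t s' t'
    where
    X = at (toℕ j)
    Y = at (toℕ j')
    same : ∀ {s t} → X ≡ Y → enc j s t ≡ enc j' s t
    same {s} {t} e = cong (λ i → enc i s t) (at-injective j j' e)
    cX = dart (toℕ j)
    cY = dart (toℕ j')
    not-both : ∀ {u v} → u ≡ + 1 → v ≡ - + 1 → u ≡ v → ⊥
    not-both refl refl ()
    off₂ : ∀ i → c (α₂ M (at i)) ≡ false
    off₂ i = trans (c₂ (at i)) (cong not (dart i))
    off₀ : ∀ i → c (α₀ M (at i)) ≡ false
    off₀ i = trans (c₀ (at i)) (cong not (dart i))
    on₂ : ∀ i → c (α₀ M (α₂ M (at i))) ≡ true
    on₂ i = trans (c-bar (at i)) (dart i)
    go : ∀ s t s' t' → corner j s t ≡ corner j' s' t' → enc j s t ≡ enc j' s' t'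
    go false false false false e = same e
    go false true false true e = same (α₂-inj e)
    go true false true false e = same (α₀-inj e)
    go true true true true e = same (α₂-inj (α₀-inj e))
    go false false true true e = ⊥-elim (not-both (rising (toℕ j)) (falling (toℕ j')) (cong ω e))
    go true true false false e = ⊥-elim (not-both (rising (toℕ j')) (falling (toℕ j)) (cong ω (sym e)))
    go false true true false e = ⊥-elim (not-both (rising (toℕ j)) (falling (toℕ j')) (cong ω (trans (sym (α₂² X)) (trans (cong (α₂ M) e) (sym (α₀α₂ Y))))))
    go true false false true e = ⊥-elim (not-both (rising (toℕ j')) (falling (toℕ j)) (cong ω (trans (sym (α₂² Y)) (trans (cong (α₂ M) (sym e)) (sym (α₀α₂ X))))))
    go false false false true e = absurdᵇ cX (trans (cong c e) (off₂ _))
    go false false true false e = absurdᵇ cX (trans (cong c e) (off₀ _))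
    go true true false true e = absurdᵇ (on₂ _) (trans (cong c e) (off₂ _))
    go true true true false e = absurdᵇ (on₂ _) (trans (cong c e) (off₀ _))
    go false true false false e = absurdᵇ cY (trans (cong c (sym e)) (off₂ _))
    go true false false false e = absurdᵇ cY (trans (cong c (sym e)) (off₀ _))
    go false true true true e = absurdᵇ (on₂ _) (trans (cong c (sym e)) (off₂ _))
    go true false true true e = absurdᵇ (on₂ _) (trans (cong c (sym e)) (off₀ _))

  F-injective : ∀ {x y} → F x ≡ F y → x ≡ y
  F-injective {x} {y} e with view x | view y
  ... | enc′ j s t | enc′ j' s' t' = corner-injective j s t j' s' t' (trans (sym (F-enc j s t)) (trans e (F-enc j' s' t')))

-- The map is the cycle once a face x₀, x₁, … of rising darts contains all rising darts.
module Assemble {m : ℕ} {CM : Map} (like : CycleLike m CM) (M : Map) (isM : IsMap M) (orient : Orient M)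
  (s : State (3 ℕ.+ m) (Label.lab orient) (Hat.φ̂ M isM orient) (Hat.bar̂ M isM orient))
  (monotone : ∀ x → Label.lab orient x ≡ true → State.ω s (Hat.φ̂ M isM orient x) ≡ State.ω s x)
  (at : ℕ → Fin (n M)) (at-dart : ∀ i → Label.lab orient (at i) ≡ true) (at-rising : ∀ i → State.ω s (at i) ≡ + 1)
  (at-label : ∀ i → State.η s (at i) ≡ State.η s (at 0) + + i [ 3 ℕ.+ m ]) (at-closed : at (3 ℕ.+ m) ≡ at 0)
  (related : ∀ i → at (suc i) ≡ Hat.φ̂ M isM orient (at i))
  (reached : ∀ z → Label.lab orient z ≡ true → State.ω s z ≡ + 1 → ∃ λ k → iter k (Hat.φ̂ M isM orient) (at 0) ≡ z) where
  open CycleOf like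
  open Laws M isM
  open Hat M isM orient
  open Label orient renaming (lab to c; lab₀ to c₀; lab₁ to c₁; lab₂ to c₂)
  open State s
  private
    x₀ = at 0
    module R = Ring like M isM orient s at at-dart at-rising at-label

    at-iter : ∀ k → iter k φ̂ x₀ ≡ at k
    at-iter zero = refl
    at-iter (suc k) = trans (cong φ̂ (at-iter k)) (sym (related k))

    at-wrap : ∀ q r → at (q ℕ.* L ℕ.+ r) ≡ at r
    at-wrap zero r = refl
    at-wrap (suc q) r = trans (cong at (trans (ℕₚ.+-assoc L (q ℕ.* L) r) (ℕₚ.+-comm L (q ℕ.* L ℕ.+ r)))) (trans (sym (at-iter (q ℕ.* L ℕ.+ r ℕ.+ L)))
      (trans (iter-+ (q ℕ.* L ℕ.+ r) L φ̂ x₀) (trans (cong (iter (q ℕ.* L ℕ.+ r) φ̂) (trans (at-iter L) at-closed)) (trans (at-iter (q ℕ.* L ℕ.+ r)) (at-wrap q r)))))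

    at-all : ∀ z → c z ≡ true → ω z ≡ + 1 → ∃ λ (j : Fin L) → at (toℕ j) ≡ z
    at-all z cz ωz with reached z cz ωz
    ... | k , e = Fin.fromℕ< (m%n<n k L) , trans (cong at (Finₚ.toℕ-fromℕ< (m%n<n k L))) (trans (sym (at-wrap (k / L) (k % L)))
          (trans (cong at (trans (ℕₚ.+-comm ((k / L) ℕ.* L) (k % L)) (sym (m≡m%n+[m/n]*n k L)))) (trans (sym (at-iter k)) e)))

    at-next : ∀ j → φ̂ (at (toℕ j)) ≡ at (toℕ (next j))
    at-next j with next-cases j
    ... | inj₁ lt = trans (sym (related (toℕ j))) (cong at (sym (next-suc j lt)))
    ... | inj₂ e = trans (sym (related (toℕ j))) (trans (cong at e) (trans at-closed (cong (at ∘ toℕ) (sym (next-last j e)))))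

    bar-rising : ∀ z → c z ≡ true → ω z ≡ - + 1 → ω (bar̂ z) ≡ + 1
    bar-rising z cz h = trans (ω-bar z) (cong -_ h)

    -- By monotonicity the successor of a falling dart falls, so it is the reverse of some rising
    -- dart `at i`, and comparing labels leaves only `i ≡ j`. Hence the rotation at each vertex of
    -- the walk has just two darts.
    back-face : ∀ j → φ̂ (bar̂ (at (toℕ (next j)))) ≡ bar̂ (at (toℕ j))
    back-face j = trans (sym (Perms.bar-inv hat w)) (cong bar̂ (trans (sym (proj₂ found)) (cong (at ∘ toℕ) i≡j)))
      where
      y = at (toℕ (next j))
      w = φ̂ (bar̂ y)
      cw : c w ≡ true
      cw = trans (c-φ̂ _) (trans (c-bar̂ y) (at-dart (toℕ (next j))))
      ωw : ω w ≡ - + 1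
      ωw = trans (monotone (bar̂ y) (trans (c-bar̂ y) (at-dart (toℕ (next j))))) (trans (ω-bar y) (cong -_ (at-rising (toℕ (next j)))))
      found = at-all (bar̂ w) (trans (c-bar̂ w) cw) (bar-rising w cw ωw)
      i = proj₁ found
      -- w is the reverse of at i, so it lies at the head of at i and at the head of at j
      w-bar : bar̂ (at (toℕ i)) ≡ w
      w-bar = trans (cong bar̂ (proj₂ found)) (Perms.bar-inv hat w)
      heads : η (at (toℕ (next i))) ≡ η (at (toℕ (next j))) [ L ]
      heads = cong-trans (subst₂ (λ u v → η u ≡ η v [ L ]) (trans (cong φ̂ (Perms.bar-inv hat (at (toℕ i)))) (at-next i)) w-bar (via (e (bar̂ (at (toℕ i)))) (η-τ (bar̂ (at (toℕ i))))))
        (via (e y) (η-τ y))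
      i≡j : i ≡ j
      i≡j = trans (sym (prev-next i)) (trans (cong prev (R.same-label (next i) (next j) heads)) (prev-next j))

    F-end : ∀ j t → α₁ M (R.F (enc j true t)) ≡ R.F (enc (next j) false t)
    F-end j false = trans (cong (α₁ M) (R.F-enc j true false)) (trans (sym (φ̂-dart (at (toℕ j)) (at-dart (toℕ j)))) (trans (at-next j) (sym (R.F-enc (next j) false false))))
    F-end j true = trans (cong (α₁ M) (R.F-enc j true true)) (trans (cong (α₁ M) (sym start)) (trans (α₁² _) (sym (R.F-enc (next j) false true))))
      where
      y = at (toℕ (next j))
      start : α₁ M (α₂ M y) ≡ α₀ M (α₂ M (at (toℕ j)))
      start = trans (sym (τ̂-dart y (at-dart _))) (trans (back-face j) (bar̂-dart (at (toℕ j)) (at-dart _)))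

    F₁ : ∀ x → R.F (α₁ CM x) ≡ α₁ M (R.F x)
    F₁ x with view x
    ... | enc′ j true t = trans (cong R.F (α₁-enc-end j t)) (sym (F-end j t))
    ... | enc′ j false t = trans (cong R.F (α₁-enc-start j t)) (trans (sym (α₁² _)) (cong (α₁ M) (trans (F-end (prev j) t) (cong (λ i → R.F (enc i false t)) (next-prev j)))))

    F-onto-dart : ∀ z → c z ≡ true → ∃ λ x → R.F x ≡ z
    F-onto-dart z cz with ω-unit z cz
    ... | inj₁ h = enc (proj₁ f) false false , trans (R.F-enc (proj₁ f) false false) (proj₂ f)
      where f = at-all z cz h
    ... | inj₂ h = enc (proj₁ f) true true , trans (R.F-enc (proj₁ f) true true) (trans (sym (R.bar-at (toℕ (proj₁ f)))) (trans (cong bar̂ (proj₂ f)) (Perms.bar-inv hat z)))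
      where f = at-all (bar̂ z) (trans (c-bar̂ z) cz) (bar-rising z cz h)

    F-onto : ∀ z → ∃ λ x → R.F x ≡ z
    F-onto z with dart? z
    ... | inj₁ cz = F-onto-dart z cz
    ... | inj₂ cz with F-onto-dart (α₂ M z) (trans (c₂ z) (cong not cz))
    ... | x , e = α₂ CM x , trans (R.F₂ x) (trans (cong (α₂ M) e) (α₂² z))

  terminal : iso M ≡ 0 → HasSubmap CM M
  terminal iso0 = d , valid , record { emb = G ; emb-inj = λ {x} {y} e → trans (sym (FG x)) (trans (cong R.F e) (FG y)) ; emb-into = λ _ → refl
      ; emb-onto = λ y _ → R.F y , R.F-injective (FG (R.F y))
      ; comm₀ = λ z → R.F-injective (trans (FG (α₀ M z)) (trans (cong (α₀ M) (sym (FG z))) (sym (R.F₀ (G z)))))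
      ; comm₁ = λ z → trans (R.F-injective (trans (FG (α₁ M z)) (trans (cong (α₁ M) (sym (FG z))) (sym (F₁ (G z)))))) (sym (full (G z)))
      ; comm₂ = λ z → R.F-injective (trans (FG (α₂ M z)) (trans (cong (α₂ M) (sym (FG z))) (sym (R.F₂ (G z)))))
      ; isoEq = trans iso0 (sym (countᵇ-none _ (allFin (n CM)) none)) }
    where
    module LC = Laws CM isCyc
    d : SubData CM
    d = record { keepE = λ _ → true ; keepV = λ _ → true ; keepI = 0 }
    valid : ValidSub CM d
    valid = (λ _ → refl) , (λ _ → refl) , (λ _ → refl) , (λ _ → refl) , (λ _ _ → refl) , z≤n
    G : Fin (n M) → Fin (n CM)
    G z = proj₁ (F-onto z)
    FG : ∀ z → R.F (G z) ≡ z
    FG z = proj₂ (F-onto z)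
    full : ∀ y → subα₁ CM d y ≡ α₁ CM y
    full y = trans (nextIn-compute {K = λ _ → true} LC.τM-inj {z = τ CM (α₂ CM y)} (record { index = 0 ; hit = refl ; kept = refl ; miss = λ j () })) (cong (α₁ CM) (LC.α₂² y))
    none : ∀ x → isRep (vGens CM) x ∧ true ∧ all (λ y → not (reach (vGens CM) x y ∧ true)) (allFin (n CM)) ≡ false
    none x = trans (cong (isRep (vGens CM) x ∧_) (¬true (λ h → absurdᵇ (all⁻ (λ y → not (reach (vGens CM) x y ∧ true)) h (∈-allFin x)) (cong (λ b → not (b ∧ true)) (reach-refl (vGens CM) x))))) (Boolₚ.∧-zeroʳ (isRep (vGens CM) x))

-- A map all of whose faces are monotone is the cycle.
module Terminal {m : ℕ} {CM : Map} (like : CycleLike m CM) (M : Map) (isM : IsMap M) (orient : Orient M)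
  (s : State (3 ℕ.+ m) (Label.lab orient) (Hat.φ̂ M isM orient) (Hat.bar̂ M isM orient))
  (conn : ∀ x y → reach (cGens M) x y ≡ true)
  (monotone : ∀ x → Label.lab orient x ≡ true → State.ω s (Hat.φ̂ M isM orient x) ≡ State.ω s x)
  (x₀ : Fin (n M)) (c-x₀ : Label.lab orient x₀ ≡ true) (ω-x₀ : State.ω s x₀ ≡ + 1) where
  open CycleOf like
  open Laws M isM
  open Hat M isM orient
  open Label orient renaming (lab to c; lab₀ to c₀; lab₁ to c₁; lab₂ to c₂)
  open State s
  private
    φ-inj' : Inj φ̂
    φ-inj' = Perms.φ-inj hat

    module Orbit (z : Fin (n M)) (cz : c z ≡ true) (ωz : ω z ≡ + 1) (K : Fin (n M) → Bool) (Kz : K z ≡ true) (Kφ : ∀ w → K (φ̂ w) ≡ K w)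
      (K-dart : ∀ w → K w ≡ true → c w ≡ true) (K-rising : ∀ w → K w ≡ true → ω w ≡ + 1) where
      S : ℤ
      S = ∑ (λ w → ⟦ K w ⟧ * J w)
      -- Every rise on `K` is one, so the summed height law counts the darts of `K` while the
      -- heights telescope.
      count-S : + count K ≡ + L * S
      count-S = trans (sym (∑-count K)) (trans (∑-cong pointwise) (trans (∑-+ (λ w → ⟦ K w ⟧ * η (φ̂ w) - ⟦ K w ⟧ * η w) (λ w → + L * (⟦ K w ⟧ * J w)))
        (trans (cong₂ _+_ (trans (∑-- (λ w → ⟦ K w ⟧ * η (φ̂ w)) (λ w → ⟦ K w ⟧ * η w)) (trans (cong (_- ∑ (λ w → ⟦ K w ⟧ * η w)) perm) (ℤₚ.+-inverseʳ (∑ (λ w → ⟦ K w ⟧ * η w)))))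
          (∑-* (+ L) (λ w → ⟦ K w ⟧ * J w))) (ℤₚ.+-identityˡ (+ L * S)))))
        where
        perm : ∑ (λ w → ⟦ K w ⟧ * η (φ̂ w)) ≡ ∑ (λ w → ⟦ K w ⟧ * η w)
        perm = trans (∑-cong (λ w → cong (λ k → ⟦ k ⟧ * η (φ̂ w)) (sym (Kφ w)))) (∑-perm φ-inj' (λ w → ⟦ K w ⟧ * η w))
        lem : ∀ k h w g j → k * w ≡ k * (h + w - g * j) - k * h + g * (k * j)
        lem = solve-∀
        pointwise : ∀ w → ⟦ K w ⟧ ≡ ⟦ K w ⟧ * η (φ̂ w) - ⟦ K w ⟧ * η w + + L * (⟦ K w ⟧ * J w)
        pointwise w = trans (go (K w) refl) (trans (lem ⟦ K w ⟧ (η w) (ω w) (+ L) (J w)) (cong (λ u → ⟦ K w ⟧ * u - ⟦ K w ⟧ * η w + + L * (⟦ K w ⟧ * J w)) (sym (η-φ w))))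
          where
          go : ∀ k → K w ≡ k → ⟦ k ⟧ ≡ ⟦ k ⟧ * ω w
          go true h = sym (trans (ℤₚ.*-identityˡ (ω w)) (K-rising w h))
          go false h = refl

      positive : 0 ℕ.< count K
      positive = ℕₚ.≤-<-trans z≤n (count-strict (λ _ → false) K (λ _ ()) z refl Kz)

      nonpos-absurd : S ℤ.≤ + 0 → ⊥
      nonpos-absurd S≤0 = ℕₚ.<⇒≱ positive (ℤₚ.drop‿+≤+ (subst (ℤ._≤ + 0) (sym count-S) (subst (+ L * S ℤ.≤_) (ℤₚ.*-zeroʳ (+ L)) (ℤₚ.*-monoˡ-≤-nonNeg (+ L) S≤0))))

      has-mark : ∃ λ w → K w ≡ true × J w ≡ + 1
      has-mark with search (λ w → (K w ∧ does (J w ℤ.≟ + 1)) Boolₚ.≟ true)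
      ... | inj₁ (w , h) = w , proj₁ (∧-split {K w} h) , sound (proj₂ (∧-split {K w} h))
        where
        sound : does (J w ℤ.≟ + 1) ≡ true → J w ≡ + 1
        sound h with J w ℤ.≟ + 1
        ... | yes e = e
        sound () | no _
      ... | inj₂ none = ⊥-elim (nonpos-absurd (subst (S ℤ.≤_) (∑-zero {n M} (λ _ → + 0) (λ _ → refl)) (∑-mono (λ w → ⟦ K w ⟧ * J w) (λ _ → + 0) small)))
        where
        small : ∀ w → ⟦ K w ⟧ * J w ℤ.≤ + 0
        small w = go (K w) refl (J-val w)
          where
          go : ∀ k → K w ≡ k → J w ≡ + 0 ⊎ J w ≡ + 1 ⊎ J w ≡ - + 1 → ⟦ k ⟧ * J w ℤ.≤ + 0
          go false _ _ = ℤₚ.≤-refl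
          go true _ (inj₁ e) = ℤₚ.≤-reflexive (trans (ℤₚ.*-identityˡ (J w)) e)
          go true h (inj₂ (inj₁ e)) = ⊥-elim (none w (cong₂ _∧_ h (dec-true (J w ℤ.≟ + 1) e)))
          go true _ (inj₂ (inj₂ e)) = subst (ℤ._≤ + 0) (sym (trans (ℤₚ.*-identityˡ (J w)) e)) ℤ.-≤+

      conn-K : ∀ u w → K u ≡ true → K w ≡ true → reach (φ̂ ∷ bar̂ ∷ []) u w ≡ true
      conn-K u w p q = component-conn u w (K-dart u p) (K-dart w q) (conn u w)

      S≤1 : S ℤ.≤ + 1
      S≤1 = subst (S ℤ.≤_) (trans (∑-δ μ (δ μ) (λ x → δ-diff)) (δ-same μ)) (∑-mono (λ w → ⟦ K w ⟧ * J w) (δ μ) (λ w → small w (w Fin.≟ μ)))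
        where
        μ = proj₁ has-mark
        Kμ = proj₁ (proj₂ has-mark)
        Jμ = proj₂ (proj₂ has-mark)
        small : ∀ w → Dec (w ≡ μ) → ⟦ K w ⟧ * J w ℤ.≤ δ μ w
        small w (yes e) = ℤₚ.≤-reflexive (trans (cong (λ v → ⟦ K v ⟧ * J v) e) (trans (cong₂ (λ k j → ⟦ k ⟧ * j) Kμ Jμ) (sym (trans (cong (δ μ) e) (δ-same μ)))))
        small w (no ne) = subst (⟦ K w ⟧ * J w ℤ.≤_) (sym (δ-diff ne)) (go (K w) refl (J-val w))
          where
          go : ∀ k → K w ≡ k → J w ≡ + 0 ⊎ J w ≡ + 1 ⊎ J w ≡ - + 1 → ⟦ k ⟧ * J w ℤ.≤ + 0
          go false _ _ = ℤₚ.≤-refl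
          go true _ (inj₁ e) = ℤₚ.≤-reflexive (trans (ℤₚ.*-identityˡ (J w)) e)
          go true h (inj₂ (inj₁ e)) = ⊥-elim (ne (J-uniq w μ (conn-K w μ h Kμ) (trans e (sym Jμ)) (λ z → unit≢0 (inj₁ e) z)))
          go true _ (inj₂ (inj₂ e)) = subst (ℤ._≤ + 0) (sym (trans (ℤₚ.*-identityˡ (J w)) e)) ℤ.-≤+

      -- The sum of marks is positive because `K` has a dart, and at most one because the component
      -- has a single positive mark. So the face winds exactly once.
      count-L : + count K ≡ + L
      count-L = trans count-S (trans (cong (+ L *_) (one S S≤1 nonpos-absurd)) (ℤₚ.*-identityʳ (+ L)))
        where
        one : ∀ S → S ℤ.≤ + 1 → (S ℤ.≤ + 0 → ⊥) → S ≡ + 1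
        one (+ 0) _ h = ⊥-elim (h ℤₚ.≤-refl)
        one (+ 1) _ _ = refl
        one (+ suc (suc k)) (ℤ.+≤+ (s≤s ())) _
        one -[1+ k ] _ h = ⊥-elim (h ℤ.-≤+)

    face : Fin (n M) → Fin (n M) → Bool
    face = reach (φ̂ ∷ [])
    face-φ : ∀ z w → face z (φ̂ w) ≡ face z w
    face-φ z = reach-inv (φ̂ ∷ []) z (here refl) φ-inj'
    face-rising : ∀ z → c z ≡ true → ω z ≡ + 1 → ∀ w → face z w ≡ true → c w ≡ true × ω w ≡ + 1
    face-rising z cz ωz w = reach-ind (φ̂ ∷ []) z w (λ v → c v ≡ true × ω v ≡ + 1) (cz , ωz)
      (λ { (here refl) v (p , q) → trans (c-φ̂ v) p , trans (monotone v p) q })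
    module O (z : Fin (n M)) (cz : c z ≡ true) (ωz : ω z ≡ + 1) = Orbit z cz ωz (face z) (reach-refl (φ̂ ∷ []) z) (face-φ z)
      (λ w h → proj₁ (face-rising z cz ωz w h)) (λ w h → proj₂ (face-rising z cz ωz w h))

    -- Each rising face carries the unique positive mark.
    one-face : ∀ z → c z ≡ true → ω z ≡ + 1 → face x₀ z ≡ true
    one-face z cz ωz = reach-trans (φ̂ ∷ []) inj x₀ (proj₁ A) z (proj₁ (proj₂ A)) (reach-sym (φ̂ ∷ []) inj z (proj₁ A)
        (subst (λ v → face z v ≡ true) (J-uniq (proj₁ B) (proj₁ A) joined (trans (proj₂ (proj₂ B)) (sym (proj₂ (proj₂ A)))) (λ h → unit≢0 (inj₁ (proj₂ (proj₂ B))) h)) (proj₁ (proj₂ B))))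
      where
      A = O.has-mark x₀ c-x₀ ω-x₀
      B = O.has-mark z cz ωz
      inj : ∀ {h} → h ∈ φ̂ ∷ [] → Inj h
      inj (here refl) = φ-inj'
      joined : reach (φ̂ ∷ bar̂ ∷ []) (proj₁ B) (proj₁ A) ≡ true
      joined = component-conn (proj₁ B) (proj₁ A) (proj₁ (face-rising z cz ωz _ (proj₁ (proj₂ B)))) (proj₁ (face-rising x₀ c-x₀ ω-x₀ _ (proj₁ (proj₂ A)))) (conn (proj₁ B) (proj₁ A))

    module W = Walk hat s (face x₀) (λ w h → proj₁ (face-rising x₀ c-x₀ ω-x₀ w h)) (λ w h → proj₂ (face-rising x₀ c-x₀ ω-x₀ w h)) (O.count-L x₀ c-x₀ ω-x₀)
      (λ x z → z ≡ φ̂ x) (λ x h → φ̂ x , trans (face-φ x₀ x) h , reach-refl (φ̂ ∘ bar̂ ∷ []) (φ̂ x) , refl) (x₀ , reach-refl (φ̂ ∷ []) x₀)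
    module I = Increasing W.increasing

  terminal : iso M ≡ 0 → HasSubmap CM M
  terminal = Assemble.terminal like M isM orient s monotone I.at I.dart I.rising I.label I.closed W.related
    (λ z cz ωz → reach-ind (φ̂ ∷ []) x₀ z (λ w → ∃ λ k → iter k φ̂ (I.at 0) ≡ w) (0 , refl) (λ { (here refl) _ (k , refl) → suc k , refl }) (one-face z cz ωz))

-- The folding procedure

record Folded (CM M : Map) : Set where
  field
    X : Map
    steps : Star Step M X
    sub : HasSubmap CM X

-- `k` bounds the crosses and `p` the separated pairs plus isolated vertices; `p` is chosen anew
-- after an edge is deleted. A two-colouring of the result of a move would pull back, so being
-- non-bipartite persists; it also guarantees that there are crosses.
fold : ∀ {m CM} (like : CycleLike m CM) (k p : ℕ) (M : Map) (isM : IsMap M) → n M ℕ.≤ k → pairs M ℕ.+ iso M ℕ.≤ p → ¬ Bip M → MState (3 ℕ.+ m) M isM → Folded CM M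
fold {m} {CM} like = go
  where
  go : ∀ (k p : ℕ) (M : Map) (isM : IsMap M) → n M ℕ.≤ k → pairs M ℕ.+ iso M ℕ.≤ p → ¬ Bip M → MState (3 ℕ.+ m) M isM → Folded CM M
  after : ∀ (k p : ℕ) (M : Map) (isM : IsMap M) → n M ℕ.≤ k → pairs M ℕ.+ iso M ℕ.≤ p → ¬ Bip M → Move (3 ℕ.+ m) M → Folded CM M
  after k p M isM nk pp nb mv with Move.less mv
  after k zero M isM nk pp nb mv | inj₁ (_ , lt) = ⊥-elim (ℕₚ.<⇒≱ (ℕₚ.<-≤-trans lt pp) z≤n)
  after k (suc p) M isM nk pp nb mv | inj₁ (e , lt) = record { Folded f ; steps = Move.step mv ◅ Folded.steps f }
    where
    f = go k p (Move.X mv) (Move.isX mv) (subst (ℕ._≤ k) (sym e) nk) (ℕ.s≤s⁻¹ (ℕₚ.<-≤-trans lt pp))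
      (λ b → nb (step-label {u = id} (λ _ → refl) Boolₚ.not-involutive (λ _ → refl) isM (Move.step mv) b)) (Move.state mv)
  after zero p M isM nk pp nb mv | inj₂ lt = ⊥-elim (ℕₚ.<⇒≱ (ℕₚ.<-≤-trans lt nk) z≤n)
  after (suc k) p M isM nk pp nb mv | inj₂ lt = record { Folded f ; steps = Move.step mv ◅ Folded.steps f }
    where
    f = go k (pairs (Move.X mv) ℕ.+ iso (Move.X mv)) (Move.X mv) (Move.isX mv) (ℕ.s≤s⁻¹ (ℕₚ.<-≤-trans lt nk)) ℕₚ.≤-refl
      (λ b → nb (step-label {u = id} (λ _ → refl) Boolₚ.not-involutive (λ _ → refl) isM (Move.step mv) b)) (Move.state mv)
  go k p M isM nk pp nb ms = finish (choose (iso M) refl)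
    where
    open MState ms
    g≥3 : 3 ℕ.≤ 3 ℕ.+ m
    g≥3 = s≤s (s≤s (s≤s z≤n))
    module Mv = Moves g≥3 M isM orient
    module DM = DupMove g≥3 M isM orient
    c = Label.lab orient
    open State state using (ω; ω-unit; ω-bar)
    element : Fin (n M)
    element = pick (n M) refl
      where
      pick : ∀ k → n M ≡ k → Fin (n M)
      pick (suc k) e = subst Fin (sym e) zero
      pick zero e = ⊥-elim (nb (record { lab = λ x → none x ; lab₀ = λ x → none x ; lab₁ = λ x → none x ; lab₂ = λ x → none x }))
        where
        none : ∀ {A : Set} → Fin (n M) → A
        none x with subst Fin e x
        ... | ()
    to-dart : ∀ x → ∃ λ y → c y ≡ true × reach (cGens M) x y ≡ true
    to-dart x with dart? x
    ... | inj₁ cx = x , cx , reach-refl (cGens M) x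
    ... | inj₂ cx = α₂ M x , trans (Label.lab₂ orient x) (cong not cx) , reach-step (cGens M) x (there (there (here refl))) x (reach-refl (cGens M) x)
    Done : Set
    Done = Move (3 ℕ.+ m) M ⊎ HasSubmap CM M
    finish : Done → Folded CM M
    finish (inj₁ mv) = after k p M isM nk pp nb mv
    finish (inj₂ sub) = record { X = M ; steps = ε ; sub = sub }
    connected : iso M ≡ 0 → (∀ x y → reach (cGens M) x y ≡ true) → Done
    connected i0 conn with search (λ x → (c x ∧ does (ω x + ω (φ̂ x) ℤ.≟ + 0)) Boolₚ.≟ true)
    ... | inj₁ (x , h) = inj₁ (at-fold (proj₁ (∧-split {c x} h)) (sound (proj₂ (∧-split {c x} h))))
      where
      sound : does (ω x + ω (φ̂ x) ℤ.≟ + 0) ≡ true → ω x + ω (φ̂ x) ≡ + 0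
      sound h with ω x + ω (φ̂ x) ℤ.≟ + 0
      ... | yes e = e
      sound () | no _
      at-fold : c x ≡ true → ω x + ω (φ̂ x) ≡ + 0 → Move (3 ℕ.+ m) M
      at-fold cx fold = split (φ̂ (φ̂ x) Fin.≟ x) (reach (eGens M) x (φ M x) Boolₚ.≟ true)
        where
        split : Dec (φ̂ (φ̂ x) ≡ x) → Dec (reach (eGens M) x (φ M x) ≡ true) → Move (3 ℕ.+ m) M
        split (no ne) _ = Mv.fold-move state exact conn x cx fold ne
        split (yes e) (no far) = DM.dup-move state exact x cx fold e (¬true far)
        split (yes e) (yes near) = ⊥-elim (nb (DM.single-edge state conn x cx e near))
    ... | inj₂ none = inj₂ (Terminal.terminal like M isM orient state conn monotone (proj₁ x₀) (proj₁ (proj₂ x₀)) (proj₂ (proj₂ x₀)) i0)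
      where
      monotone : ∀ x → c x ≡ true → ω (φ̂ x) ≡ ω x
      monotone x cx = decide (ω-unit x cx) (ω-unit (φ̂ x) (trans (c-φ̂ x) cx))
        where
        no-fold : ω x + ω (φ̂ x) ≢ + 0
        no-fold e = none x (cong₂ _∧_ cx (dec-true (ω x + ω (φ̂ x) ℤ.≟ + 0) e))
        decide : ω x ≡ + 1 ⊎ ω x ≡ - + 1 → ω (φ̂ x) ≡ + 1 ⊎ ω (φ̂ x) ≡ - + 1 → ω (φ̂ x) ≡ ω x
        decide (inj₁ p) (inj₁ q) = trans q (sym p)
        decide (inj₂ p) (inj₂ q) = trans q (sym p)
        decide (inj₁ p) (inj₂ q) = ⊥-elim (no-fold (cong₂ _+_ p q))
        decide (inj₂ p) (inj₁ q) = ⊥-elim (no-fold (cong₂ _+_ p q))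
      x₀ : ∃ λ x → c x ≡ true × ω x ≡ + 1
      x₀ with to-dart element
      ... | x , cx , _ with ω-unit x cx
      ... | inj₁ h = x , cx , h
      ... | inj₂ h = bar̂ x , trans (c-bar̂ x) cx , trans (ω-bar x) (cong -_ h)
    -- Isolated vertices are absorbed first and components joined next, because both the pinching
    -- argument and the final recognition need a connected map.
    choose : ∀ i → iso M ≡ i → Done
    choose (suc i) e = inj₁ (record { X = record M { iso = iso M ℕ.∸ 1 } ; isX = isM
      ; step = inj₁ (inj₂ (subst (1 ℕ.≤_) (sym e) (s≤s z≤n) , inj₁ (ℕₚ.≤-trans (s≤s z≤n) (Finₚ.toℕ<n element)) , ≅-refl (record M { iso = iso M ℕ.∸ 1 })))
      ; state = record { orient = record { Label orient } ; state = state ; exact = exact }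
      ; less = inj₁ (refl , ℕₚ.+-monoʳ-< (pairs M) (subst (λ q → q ℕ.∸ 1 ℕ.< q) (sym e) (ℕₚ.n<1+n i))) })
    choose zero e with search (λ x → Finₚ.any? (λ y → reach (cGens M) x y Boolₚ.≟ false))
    ... | inj₂ none = connected e (λ x y → Boolₚ.¬-not (λ h → none x (y , h)))
    ... | inj₁ (x , y , far) = inj₁ (Mv.join-move state exact (proj₁ X) (proj₁ Y) (proj₁ (proj₂ X)) (proj₁ (proj₂ Y))
          (¬true (λ r → absurdᵇ (reach-trans (cGens M) inj x (proj₁ X) y (proj₂ (proj₂ X)) (reach-trans (cGens M) inj (proj₁ X) (proj₁ Y) y r (reach-sym (cGens M) inj y (proj₁ Y) (proj₂ (proj₂ Y))))) far)))
      where
      X = to-dart x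
      Y = to-dart y
      inj : ∀ {h} → h ∈ cGens M → Inj h
      inj = Laws.c-inj M isM

-- The cycle spanned by an increasing closed walk

full-α₁ : ∀ (M : Map) (isM : IsMap M) (d : SubData M) → (∀ z → SubData.keepE d z ≡ true) → ∀ y → subα₁ M d y ≡ α₁ M y
full-α₁ M isM d all-kept y = trans (nextIn-compute {K = SubData.keepE d} τM-inj {z = τ M (α₂ M y)} (record { index = 0 ; hit = refl ; kept = all-kept _ ; miss = λ j () })) (cong (α₁ M) (α₂² y))
  where open Laws M isM

module RingSubmap {m : ℕ} {CM : Map} (like : CycleLike m CM) (M : Map) (isM : IsMap M) (orient : Orient M)
  (s : State (3 ℕ.+ m) (Label.lab orient) (Hat.φ̂ M isM orient) (Hat.bar̂ M isM orient)) (inc : Increasing s) where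
  open CycleOf like
  open Laws M isM
  open Hat M isM orient
  open Label orient renaming (lab to c; lab₀ to c₀; lab₁ to c₁; lab₂ to c₂)
  open State s
  private
    module I = Increasing inc
  open I using (at; dart; rising; label; closed)
  open Ring like M isM orient s at dart rising label
  private
    K : Fin (n M) → Bool
    K z = does (Finₚ.any? (λ y → F y Fin.≟ z))

    K-F : ∀ y → K (F y) ≡ true
    K-F y = dec-true (Finₚ.any? (λ x → F x Fin.≟ F y)) (y , refl)

    K-sound : ∀ z → K z ≡ true → ∃ λ y → F y ≡ z
    K-sound z h with Finₚ.any? (λ y → F y Fin.≟ z)
    ... | yes p = p
    K-sound z () | no _

    K-inv : (h : Fin (n CM) → Fin (n CM)) (h' : Fin (n M) → Fin (n M)) → (∀ z → h' (h' z) ≡ z) → (∀ y → F (h y) ≡ h' (F y)) → ∀ z → K (h' z) ≡ K z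
    K-inv h h' inv e z = ≡ᵇ-both (λ k → subst (λ w → K w ≡ true) (inv z) (fwd (h' z) k)) (fwd z)
      where
      fwd : ∀ z → K z ≡ true → K (h' z) ≡ true
      fwd z k with K-sound z k
      ... | y , refl = subst (λ w → K w ≡ true) (e y) (K-F (h y))
    K₀ : ∀ z → K (α₀ M z) ≡ K z
    K₀ = K-inv (α₀ CM) (α₀ M) α₀² F₀
    K₂ : ∀ z → K (α₂ M z) ≡ K z
    K₂ = K-inv (α₂ CM) (α₂ M) α₂² F₂

    τ̂ : Fin (n M) → Fin (n M)
    τ̂ = φ̂ ∘ bar̂

    hat-iter : ∀ i u → c u ≡ true → iter i τ̂ u ≡ iter i (τ M) u × c (iter i τ̂ u) ≡ true
    hat-iter zero u cu = refl , cu
    hat-iter (suc i) u cu with hat-iter i u cu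
    ... | e , ci = trans (τ̂-dart _ ci) (cong (τ M) e) , trans (c-φ̂ _) (trans (c-bar̂ _) ci)

    -- The rotation from `u` can meet a kept dart before `v` only by returning to `u`, and then `v`
    -- would be hit earlier than its first time.
    first-of-two : ∀ u v → c u ≡ true → K v ≡ true → u ≢ v → reach (τ̂ ∷ []) u v ≡ true →
      (∀ z → K z ≡ true → reach (τ̂ ∷ []) u z ≡ true → z ≡ u ⊎ z ≡ v) → FirstReturn K (τ M) u v
    first-of-two u v cu Kv u≢v uv only = build path
      where
      path : ∃ λ k → iter (suc k) τ̂ u ≡ v
      path with reach-ind (τ̂ ∷ []) u v (λ w → ∃ λ k → iter k τ̂ u ≡ w) (0 , refl) (λ { (here refl) _ (k , refl) → suc k , refl }) uv
      ... | zero , e = ⊥-elim (u≢v e)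
      ... | suc k , e = k , e
      reach-iter : ∀ i → reach (τ̂ ∷ []) u (iter i τ̂ u) ≡ true
      reach-iter zero = reach-refl (τ̂ ∷ []) u
      reach-iter (suc i) = reach-step (τ̂ ∷ []) u (here refl) (iter i τ̂ u) (reach-iter i)
      build : (∃ λ k → iter (suc k) τ̂ u ≡ v) → FirstReturn K (τ M) u v
      build (k₀ , e₀) with least (λ k → iter (suc k) τ̂ u Fin.≟ v) k₀ e₀
      ... | k , e , below = record { index = k ; hit = trans (sym e) (proj₁ (hat-iter (suc k) u cu)) ; kept = Kv
                                   ; miss = λ j lt → trans (cong K (sym (proj₁ (hat-iter (suc j) u cu)))) (¬true (λ h → no-hit j lt (only _ h (reach-iter (suc j))))) }
        where
        no-hit : ∀ j → j ℕ.< k → iter (suc j) τ̂ u ≡ u ⊎ iter (suc j) τ̂ u ≡ v → ⊥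
        no-hit j lt (inj₂ h) = below j lt h
        no-hit j lt (inj₁ h) with ℕₚ.m≤n⇒∃[o]m+o≡n lt
        ... | o , q = below o (subst (o ℕ.<_) q (ℕₚ.m<n+m o (s≤s z≤n)))
              (trans (sym (trans (iter-+ (suc o) (suc j) τ̂ u) (cong (iter (suc o) τ̂) h))) (trans (cong (λ i → iter (suc i) τ̂ u) (trans (ℕₚ.+-comm o (suc j)) q)) e))

    at-next : ∀ j → at (toℕ (next j)) ≡ at (suc (toℕ j))
    at-next j with next-cases j
    ... | inj₁ lt = cong at (next-suc j lt)
    ... | inj₂ e = trans (cong (at ∘ toℕ) (next-last j e)) (trans (sym closed) (cong at (sym e)))

    x y : Fin L → Fin (n M)
    x j = at (toℕ (next j))
    y j = α₀ M (α₂ M (at (toℕ j)))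

    label-x : ∀ j → η (x j) ≡ η (at 0) + + suc (toℕ j) [ L ]
    label-x j = subst (λ z → η z ≡ η (at 0) + + suc (toℕ j) [ L ]) (sym (at-next j)) (label (suc (toℕ j)))

    label-y : ∀ j → η (y j) ≡ η (x j) [ L ]
    label-y j = cong-trans (head-label (toℕ j)) (cong-sym (label-x j))

    cy : ∀ j → c (y j) ≡ true
    cy j = trans (c-bar _) (dart (toℕ j))

    x≢y : ∀ j → x j ≢ y j
    x≢y j e with trans (sym (rising (toℕ (next j)))) (trans (cong ω e) (falling (toℕ j)))
    ... | ()

    τ-inj' : ∀ {h} → h ∈ τ̂ ∷ [] → Inj h
    τ-inj' (here refl) = τ-inj hat

    yx : ∀ j → reach (τ̂ ∷ []) (y j) (x j) ≡ true
    yx j = reach-trans (τ̂ ∷ []) τ-inj' (y j) (φ̂ (at (toℕ j))) (x j)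
      (trans (cong (reach (τ̂ ∷ []) (y j)) (trans (cong φ̂ (sym (Perms.bar-inv hat (at (toℕ j))))) (cong τ̂ (bar-at (toℕ j))))) (reach-step (τ̂ ∷ []) (y j) (here refl) (y j) (reach-refl (τ̂ ∷ []) (y j))))
      (trans (cong (reach (τ̂ ∷ []) (φ̂ (at (toℕ j)))) (at-next j)) (I.next (toℕ j)))

    xy : ∀ j → reach (τ̂ ∷ []) (x j) (y j) ≡ true
    xy j = reach-sym (τ̂ ∷ []) τ-inj' (y j) (x j) (yx j)

    -- Labels along the walk are distinct modulo its length, so the walk passes a vertex at most
    -- once and uses one dart in each direction there.
    only-two : ∀ j z → K z ≡ true → c z ≡ true → η z ≡ η (x j) [ L ] → z ≡ y j ⊎ z ≡ x j
    only-two j z Kz cz ηz with K-sound z Kz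
    ... | w , refl with view w
    ... | enc′ i s t = go s t (trans (cong c (sym (F-enc i s t))) cz) (subst (λ v → η v ≡ η (x j) [ L ]) (F-enc i s t) ηz) (F-enc i s t)
      where
      go : ∀ s t → c (corner i s t) ≡ true → η (corner i s t) ≡ η (x j) [ L ] → F (enc i s t) ≡ corner i s t → F (enc i s t) ≡ y j ⊎ F (enc i s t) ≡ x j
      go false false _ h e = inj₂ (trans e (cong (at ∘ toℕ) (same-label i (next j) h)))
      go true true _ h e = inj₁ (trans e (cong y (trans (sym (prev-next i)) (trans (cong prev (same-label (next i) (next j) (cong-trans (cong-sym (label-y i)) h))) (prev-next j)))))
      go false true h _ _ = absurdᵇ h (trans (c₂ _) (cong not (dart (toℕ i))))
      go true false h _ _ = absurdᵇ h (trans (c₀ _) (cong not (dart (toℕ i))))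

    orbit-dart : ∀ u z → c u ≡ true → reach (τ̂ ∷ []) u z ≡ true → c z ≡ true
    orbit-dart u z cu r = trans (τ-fun hat c (λ w → trans (c-φ̂ (bar̂ w)) (c-bar̂ w)) u z r) cu

    K-x : ∀ j → K (x j) ≡ true
    K-x j = subst (λ z → K z ≡ true) (F-enc (next j) false false) (K-F (enc (next j) false false))
    K-y : ∀ j → K (y j) ≡ true
    K-y j = subst (λ z → K z ≡ true) (F-enc j true true) (K-F (enc j true true))

    first-yx : ∀ j → FirstReturn K (τ M) (y j) (x j)
    first-yx j = first-of-two (y j) (x j) (cy j) (K-x j) (x≢y j ∘ sym) (yx j)
      (λ z Kz r → only-two j z Kz (orbit-dart (y j) z (cy j) r) (cong-trans (τ-cong hat s (y j) z r) (label-y j)))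

    first-xy : ∀ j → FirstReturn K (τ M) (x j) (y j)
    first-xy j = first-of-two (x j) (y j) (dart (toℕ (next j))) (K-y j) (x≢y j) (xy j)
      (λ z Kz r → flip (only-two j z Kz (orbit-dart (x j) z (dart (toℕ (next j))) r) (τ-cong hat s (x j) z r)))
      where
      flip : ∀ {z} → z ≡ y j ⊎ z ≡ x j → z ≡ x j ⊎ z ≡ y j
      flip (inj₁ e) = inj₂ e
      flip (inj₂ e) = inj₁ e

    FR : Fin (n CM) → Fin (n CM) → Set
    FR u v = FirstReturn K (τ M) (α₂ M (F u)) (F v)

    end-false : ∀ j → FR (enc j true false) (enc (next j) false false)
    end-false j = subst₂ (FirstReturn K (τ M)) (sym (trans (cong (α₂ M) (F-enc j true false)) (sym (α₀α₂ _)))) (sym (F-enc (next j) false false)) (first-yx j)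
    start-true : ∀ j → FR (enc (next j) false true) (enc j true true)
    start-true j = subst₂ (FirstReturn K (τ M)) (sym (trans (cong (α₂ M) (F-enc (next j) false true)) (α₂² _))) (sym (F-enc j true true)) (first-xy j)

    first-α₁ : ∀ z → FR z (α₁ CM z)
    first-α₁ z with view z
    ... | enc′ j true false = subst (FR (enc j true false)) (sym (α₁-enc-end j false)) (end-false j)
    ... | enc′ j true true = subst (FR (enc j true true)) (sym (α₁-enc-end j true)) (first-sym M isM K K₂ (K-F (enc (next j) false true)) (start-true j))
    ... | enc′ j false true = subst (FR (enc j false true)) (sym (α₁-enc-start j true)) (subst (λ i → FR (enc i false true) (enc (prev j) true true)) (next-prev j) (start-true (prev j)))
    ... | enc′ j false false = subst (FR (enc j false false)) (sym (α₁-enc-start j false))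
          (subst (λ i → FR (enc i false false) (enc (prev j) true false)) (next-prev j) (first-sym M isM K K₂ (K-F (enc (prev j) true false)) (end-false (prev j))))

    -- The vertices met by the walk. Keeping any other would leave it as an isolated vertex, which
    -- the cycle does not have.
    touches : Fin (n M) → Bool
    touches z = any (λ w → reach (vGens M) z w ∧ K w) (allFin (n M))

    touch⁺ : ∀ z w → reach (vGens M) z w ≡ true → K w ≡ true → touches z ≡ true
    touch⁺ z w r k = any⁺ (λ w → reach (vGens M) z w ∧ K w) (∈-allFin w) (cong₂ _∧_ r k)

    touch-inv : (h : Fin (n M) → Fin (n M)) → (∀ z → h (h z) ≡ z) → (∀ z → reach (vGens M) (h z) z ≡ true) → ∀ z → touches (h z) ≡ touches z
    touch-inv h inv near z = ≡ᵇ-both (λ t → subst (λ w → touches w ≡ true) (inv z) (fwd (h z) t)) (fwd z)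
      where
      fwd : ∀ z → touches z ≡ true → touches (h z) ≡ true
      fwd z t with any⁻ (λ w → reach (vGens M) z w ∧ K w) (allFin (n M)) t
      ... | w , _ , e with ∧-split {reach (vGens M) z w} e
      ... | r , k = touch⁺ (h z) w (reach-trans (vGens M) v-inj (h z) z w (near z) r) k

    d : SubData M
    d = record { keepE = K ; keepV = touches ; keepI = 0 }

    no-isolated-left : ∀ z → isRep (vGens M) z ∧ touches z ∧ all (λ w → not (reach (vGens M) z w ∧ K w)) (allFin (n M)) ≡ false
    no-isolated-left z = trans (cong (isRep (vGens M) z ∧_) (go (touches z) refl)) (Boolₚ.∧-zeroʳ (isRep (vGens M) z))
      where
      go : ∀ t → touches z ≡ t → t ∧ all (λ w → not (reach (vGens M) z w ∧ K w)) (allFin (n M)) ≡ false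
      go false _ = refl
      go true e with any⁻ (λ w → reach (vGens M) z w ∧ K w) (allFin (n M)) e
      ... | w , i , k = ¬true (λ a → absurdᵇ (all⁻ (λ w → not (reach (vGens M) z w ∧ K w)) a i) (cong not k))

  ring-submap : HasSubmap M CM
  ring-submap = d , (K₀ , K₂ , touch-inv (α₁ M) α₁² (λ z → reach-sym (vGens M) v-inj z (α₁ M z) (trans (vertex-inv₁ z z) (reach-refl (vGens M) z)))
      , touch-inv (α₂ M) α₂² (λ z → reach-sym (vGens M) v-inj z (α₂ M z) (trans (vertex-inv₂ z z) (reach-refl (vGens M) z)))
      , (λ z k → touch⁺ z z (reach-refl (vGens M) z) k) , z≤n)
    , record { emb = F ; emb-inj = F-injective ; emb-into = K-F ; emb-onto = K-sound ; comm₀ = F₀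
             ; comm₁ = λ z → sym (nextIn-compute τM-inj (first-α₁ z)) ; comm₂ = F₂
             ; isoEq = trans no-isolated (sym (countᵇ-none _ (allFin (n M)) no-isolated-left)) }

-- Submaps of an odd cycle

module SubOfCycle {m : ℕ} {CM : Map} (like : CycleLike m CM) (odd : ∀ b → iter (3 ℕ.+ m) not b ≡ not b)
  (X : Map) (d : SubData CM) (valid : ValidSub CM d) (sub : SubIso X CM d) where
  open CycleOf like
  open SubIso sub
  private
    K = SubData.keepE d
    K₀ = proj₁ valid
    K₂ = proj₁ (proj₂ valid)
    module S = Sub X CM d isCyc sub K₀ K₂

  sub-isMap : IsMap X
  sub-isMap = S.isX

  proper-bipartite : (∃ λ y → K y ≡ false) → Bip X
  proper-bipartite (y₀ , Ky₀) = go (view y₀) Ky₀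
    where
    go : ∀ {y} → View y → K y ≡ false → Bip X
    go (enc′ j₀ s₀ t₀) K-j₀ = record { lab = β ∘ emb ; lab₀ = λ x → trans (cong β (comm₀ x)) (β₀ (emb x) (emb-into x))
        ; lab₁ = λ x → trans (cong β (FirstReturn.hit (S.first x))) (trans (β-τ (suc (FirstReturn.index (S.first x))) (α₂ CM (emb x))) (β₂ (emb x)))
        ; lab₂ = λ x → trans (cong β (comm₂ x)) (β₂ (emb x)) }
      where
      K-enc : ∀ s t s' t' → K (enc j₀ s t) ≡ K (enc j₀ s' t')
      K-enc s t s' t' = trans (to00 s t) (sym (to00 s' t'))
        where
        to00 : ∀ s t → K (enc j₀ s t) ≡ K (enc j₀ false false)
        to00 false false = refl
        to00 false true = trans (cong K (sym (α₂-enc j₀ false false))) (K₂ _)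
        to00 true false = trans (cong K (sym (α₀-enc j₀ false false))) (K₀ _)
        to00 true true = trans (cong K (sym (α₀-enc j₀ false true))) (trans (K₀ _) (to00 false true))
      -- Colours alternate with the position, and the comparison with `j₀` adds one more flip behind
      -- the deleted edge. This repairs the parity defect where an odd cycle wraps from its last
      -- position to zero.
      B : Fin L → Bool
      B v = iter (toℕ v) not (does (toℕ j₀ ℕ.<? toℕ v))
      even : ∀ b → iter (2 ℕ.+ m) not b ≡ b
      even b = trans (sym (Boolₚ.not-involutive _)) (trans (cong not (odd b)) (Boolₚ.not-involutive b))
      B-next : ∀ j → j ≢ j₀ → B (next j) ≡ not (B j)
      B-next j ne with next-cases j
      ... | inj₁ lt = trans (cong (λ k → iter k not (does (toℕ j₀ ℕ.<? k))) (next-suc j lt)) (cong (λ b → not (iter (toℕ j) not b)) same)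
        where
        same : does (toℕ j₀ ℕ.<? suc (toℕ j)) ≡ does (toℕ j₀ ℕ.<? toℕ j)
        same = compare (toℕ j₀ ℕ.<? toℕ j)
          where
          compare : Dec (toℕ j₀ ℕ.< toℕ j) → does (toℕ j₀ ℕ.<? suc (toℕ j)) ≡ does (toℕ j₀ ℕ.<? toℕ j)
          compare (yes p) = trans (dec-true (toℕ j₀ ℕ.<? suc (toℕ j)) (ℕₚ.m<n⇒m<1+n p)) (sym (dec-true (toℕ j₀ ℕ.<? toℕ j) p))
          compare (no p) = trans (dec-false (toℕ j₀ ℕ.<? suc (toℕ j)) (λ q → p (ℕₚ.≤∧≢⇒< (ℕ.s≤s⁻¹ q) (λ e → ne (sym (Finₚ.toℕ-injective e)))))) (sym (dec-false (toℕ j₀ ℕ.<? toℕ j) p))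
      ... | inj₂ e = trans (cong B (next-last j e)) (sym (cong not (trans (cong (λ b → iter (toℕ j) not b) above) (trans (cong (λ k → iter k not true) (ℕₚ.suc-injective e)) (even true)))))
        where
        above : does (toℕ j₀ ℕ.<? toℕ j) ≡ true
        above = dec-true (toℕ j₀ ℕ.<? toℕ j) (ℕₚ.≤∧≢⇒< (ℕ.s≤s⁻¹ (subst (toℕ j₀ ℕ.<_) (sym e) (Finₚ.toℕ<n j₀))) (λ q → ne (sym (Finₚ.toℕ-injective q))))
      vertex : Fin L → Bool → Bool → Bool
      vertex j false _ = B j
      vertex j true  _ = B (next j)
      β : Fin (n CM) → Bool
      β = on vertex
      β₀ : ∀ z → K z ≡ true → β (α₀ CM z) ≡ not (β z)
      β₀ z Kz with view z
      ... | enc′ j s t = trans (cong β (α₀-enc j s t)) (trans (on-enc vertex j (not s) t) (trans (flip s) (cong not (sym (on-enc vertex j s t)))))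
        where
        ne : j ≢ j₀
        ne refl = absurdᵇ Kz (trans (K-enc s t s₀ t₀) K-j₀)
        flip : ∀ s → vertex j (not s) t ≡ not (vertex j s t)
        flip false = B-next j ne
        flip true = trans (sym (Boolₚ.not-involutive (B j))) (cong not (sym (B-next j ne)))
      β₂ : ∀ z → β (α₂ CM z) ≡ β z
      β₂ z with view z
      ... | enc′ j s t = trans (cong β (α₂-enc j s t)) (trans (on-enc vertex j s (not t)) (trans (same s) (sym (on-enc vertex j s t))))
        where
        same : ∀ s → vertex j s (not t) ≡ vertex j s t
        same false = refl
        same true = refl
      β₁ : ∀ z → β (α₁ CM z) ≡ β z
      β₁ z with view z
      ... | enc′ j false t = trans (cong β (α₁-enc-start j t)) (trans (on-enc vertex (prev j) true t) (trans (cong B (next-prev j)) (sym (on-enc vertex j false t))))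
      ... | enc′ j true t = trans (cong β (α₁-enc-end j t)) (trans (on-enc vertex (next j) false t) (sym (on-enc vertex j true t)))
      β-τ : ∀ k z → β (iter k (τ CM) z) ≡ β z
      β-τ zero z = refl
      β-τ (suc k) z = trans (β₁ _) (trans (β₂ _) (β-τ k z))

  -- Isolated vertices carry no crosses and do not affect heights; the cycle is given as many of
  -- them as `X` has, and becomes isomorphic to it.
  full-state : ∀ {g} → (∀ y → K y ≡ true) → MState g CM isCyc → MState g X sub-isMap
  full-state full s = record { orient = record { Label (MState.orient t) } ; state = MState.state t ; exact = MState.exact t }
    where
    Y : Map
    Y = record CM { iso = iso X }
    s' : MState _ Y isCyc
    s' = record { orient = record { Label (MState.orient s) } ; state = MState.state s ; exact = MState.exact s }
    e⁻ : Fin (n CM) → Fin (n X)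
    e⁻ y = proj₁ (emb-onto y (full y))
    ee⁻ : ∀ y → emb (e⁻ y) ≡ y
    ee⁻ y = proj₂ (emb-onto y (full y))
    comm : (h : Fin (n X) → Fin (n X)) (h' : Fin (n CM) → Fin (n CM)) → (∀ x → emb (h x) ≡ h' (emb x)) → ∀ y → e⁻ (h' y) ≡ h (e⁻ y)
    comm h h' q y = emb-inj (trans (ee⁻ (h' y)) (trans (cong h' (sym (ee⁻ y))) (sym (q (e⁻ y)))))
    i : Y ≅ X
    i = record { bij = mk↔ₛ′ e⁻ emb (λ x → emb-inj (ee⁻ (emb x))) ee⁻
               ; comm₀ = comm (α₀ X) (α₀ CM) comm₀ ; comm₁ = comm (α₁ X) (α₁ CM) (λ x → trans (comm₁ x) (full-α₁ CM isCyc d full (emb x))) ; comm₂ = comm (α₂ X) (α₂ CM) comm₂ ; isoEq = refl }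
    t = iso-state i isCyc sub-isMap s'

-- Orbits are counted by their least elements. A complete invariant is injective on these, and every
-- value is attained at the least element of its class.
orbits-invariant : ∀ {n k} (gs : List (Fin n → Fin n)) (cls : Fin n → Fin k) → (∀ {g} → g ∈ gs → Inj g) → (∀ {g} → g ∈ gs → ∀ z → cls (g z) ≡ cls z) →
  (∀ x y → cls x ≡ cls y → reach gs x y ≡ true) → (∀ i → ∃ λ x → cls x ≡ i) → orbits gs ≡ k
orbits-invariant {n} {k} gs cls inj inv complete surj = trans (countᵇ-tabulate (isRep gs) id) (trans (sym (Enum.size-count E)) (ℕₚ.≤-antisym
    (Finₚ.injective⇒≤ {f = λ i → cls (Enum.emb E i)} (λ {i} {j} e → Enum.inj E (rep-unique (Enum.into E i) (Enum.into E j) e)))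
    (Finₚ.injective⇒≤ {f = λ i → proj₁ (Enum.onto E (rep i) (isRep-rep i))} (λ {i} {j} e → trans (sym (cls-rep i)) (trans (cong cls (trans (sym (proj₂ (Enum.onto E (rep i) (isRep-rep i)))) (trans (cong (Enum.emb E) e) (proj₂ (Enum.onto E (rep j) (isRep-rep j)))))) (cls-rep j))))))
  where
  E = enum (isRep gs)
  test : Fin n → Fin n → Bool
  test x y = not ((toℕ y ℕ.<ᵇ toℕ x) ∧ reach gs x y)
  minimal : ∀ {x y} → isRep gs x ≡ true → reach gs x y ≡ true → ¬ (toℕ y ℕ.< toℕ x)
  minimal {x} {y} h r lt = absurdᵇ (all⁻ (test x) h (∈-allFin y)) (cong not (cong₂ _∧_ (Equivalence.to Boolₚ.T-≡ (ℕₚ.<⇒<ᵇ lt)) r))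
  rep-unique : ∀ {x y} → isRep gs x ≡ true → isRep gs y ≡ true → cls x ≡ cls y → x ≡ y
  rep-unique {x} {y} p q e = Finₚ.toℕ-injective (ℕₚ.≤-antisym (ℕₚ.≮⇒≥ (minimal p (complete x y e))) (ℕₚ.≮⇒≥ (minimal q (complete y x (sym e)))))
  P : Fin k → ℕ → Set
  P i t = ∃ λ x → toℕ x ≡ t × cls x ≡ i
  P? : ∀ i t → Dec (P i t)
  P? i t = Finₚ.any? (λ x → (toℕ x ℕ.≟ t) ×-dec (cls x Fin.≟ i))
  first : ∀ i → ∃ λ t → P i t × (∀ u → u ℕ.< t → ¬ P i u)
  first i = least (P? i) (toℕ (proj₁ (surj i))) (proj₁ (surj i) , refl , proj₂ (surj i))
  rep : Fin k → Fin n
  rep i = proj₁ (proj₁ (proj₂ (first i)))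
  cls-rep : ∀ i → cls (rep i) ≡ i
  cls-rep i = proj₂ (proj₂ (proj₁ (proj₂ (first i))))
  isRep-rep : ∀ i → isRep gs (rep i) ≡ true
  isRep-rep i = all⁺ (test (rep i)) (allFin n) λ y _ → go y ((toℕ y ℕ.<ᵇ toℕ (rep i)) Boolₚ.≟ true) (reach gs (rep i) y Boolₚ.≟ true)
    where
    go : ∀ y → Dec ((toℕ y ℕ.<ᵇ toℕ (rep i)) ≡ true) → Dec (reach gs (rep i) y ≡ true) → test (rep i) y ≡ true
    go y (no p) _ = cong (λ b → not (b ∧ reach gs (rep i) y)) (¬true p)
    go y (yes _) (no q) = cong not (trans (cong ((toℕ y ℕ.<ᵇ toℕ (rep i)) ∧_) (¬true q)) (Boolₚ.∧-zeroʳ _))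
    go y (yes p) (yes q) = ⊥-elim (proj₂ (proj₂ (first i)) (toℕ y) (subst (toℕ y ℕ.<_) (proj₁ (proj₂ (proj₁ (proj₂ (first i))))) (ℕₚ.<ᵇ⇒< (toℕ y) (toℕ (rep i)) (Equivalence.from Boolₚ.T-≡ p)))
      (y , refl , trans (reach-fun gs (rep i) y cls inv q) (cls-rep i)))

-- The genus of a cycle

module CycleGenus {m : ℕ} {CM : Map} (like : CycleLike m CM) where
  open CycleOf like
  open Laws CM isCyc
  private
    base : Fin L → Fin (n CM)
    base j = enc j false false

    count-by : ∀ {k} (gs : List (Fin (n CM) → Fin (n CM))) → (∀ {g} → g ∈ gs → Inj g) → (G : Fin L → Bool → Bool → Fin k) →
      (∀ {g} → g ∈ gs → ∀ j s t → on G (g (enc j s t)) ≡ G j s t) → (r : Fin k → Fin (n CM)) →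
      (∀ j s t → reach gs (enc j s t) (r (G j s t)) ≡ true) → (∀ i → on G (r i) ≡ i) → orbits gs ≡ k
    count-by gs inj G inv r joins section = orbits-invariant gs (on G) inj inv' complete (λ i → r i , section i)
      where
      inv' : ∀ {g} → g ∈ gs → ∀ z → on G (g z) ≡ on G z
      inv' i z with view z
      ... | enc′ j s t = trans (inv i j s t) (sym (on-enc G j s t))
      to-rep : ∀ x → reach gs x (r (on G x)) ≡ true
      to-rep x with view x
      ... | enc′ j s t = trans (cong (λ i → reach gs (enc j s t) (r i)) (on-enc G j s t)) (joins j s t)
      complete : ∀ x y → on G x ≡ on G y → reach gs x y ≡ true
      complete x y e = reach-trans gs inj x (r (on G x)) y (to-rep x) (reach-sym gs inj y (r (on G x)) (trans (cong (λ i → reach gs y (r i)) e) (to-rep y)))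

    go-to : ∀ (gs : List (Fin (n CM) → Fin (n CM))) {g} → g ∈ gs → ∀ x y {z} → reach gs x y ≡ true → g y ≡ z → reach gs x z ≡ true
    go-to gs i x y r e = trans (cong (reach gs x) (sym e)) (reach-step gs x i y r)

    hop : ∀ (gs : List (Fin (n CM) → Fin (n CM))) {g} → g ∈ gs → ∀ x {z} → g x ≡ z → reach gs x z ≡ true
    hop gs i x = go-to gs i x x (reach-refl gs x)

    e-gens : ∀ {g} → g ∈ eGens CM → Inj g
    e-gens = e-inj CM isCyc

    f-gens : ∀ {g} → g ∈ fGens CM → Inj g
    f-gens (here refl) = α₀-inj
    f-gens (there (here refl)) = α₁-inj

  vertices : orbits (vGens CM) ≡ L
  vertices = count-by (vGens CM) v-inj G inv base joins (λ i → on-enc G i false false)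
    where
    G : Fin L → Bool → Bool → Fin L
    G j false _ = j
    G j true  _ = next j
    inv : ∀ {g} → g ∈ vGens CM → ∀ j s t → on G (g (enc j s t)) ≡ G j s t
    inv (here refl) j false t = trans (cong (on G) (α₁-enc-start j t)) (trans (on-enc G (prev j) true t) (next-prev j))
    inv (here refl) j true t = trans (cong (on G) (α₁-enc-end j t)) (on-enc G (next j) false t)
    inv (there (here refl)) j false t = trans (cong (on G) (α₂-enc j false t)) (on-enc G j false (not t))
    inv (there (here refl)) j true t = trans (cong (on G) (α₂-enc j true t)) (on-enc G j true (not t))
    joins : ∀ j s t → reach (vGens CM) (enc j s t) (base (G j s t)) ≡ true
    joins j false false = reach-refl (vGens CM) (enc j false false)
    joins j false true = hop (vGens CM) (there (here refl)) (enc j false true) (α₂-enc j false true)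
    joins j true false = hop (vGens CM) (here refl) (enc j true false) (α₁-enc-end j false)
    joins j true true = go-to (vGens CM) (there (here refl)) (enc j true true) (enc (next j) false true) (hop (vGens CM) (here refl) (enc j true true) (α₁-enc-end j true)) (α₂-enc (next j) false true)

  edges : orbits (eGens CM) ≡ L
  edges = count-by (eGens CM) e-gens G inv base joins (λ i → on-enc G i false false)
    where
    G : Fin L → Bool → Bool → Fin L
    G j _ _ = j
    inv : ∀ {g} → g ∈ eGens CM → ∀ j s t → on G (g (enc j s t)) ≡ G j s t
    inv (here refl) j s t = trans (cong (on G) (α₀-enc j s t)) (on-enc G j (not s) t)
    inv (there (here refl)) j s t = trans (cong (on G) (α₂-enc j s t)) (on-enc G j s (not t))
    joins : ∀ j s t → reach (eGens CM) (enc j s t) (base j) ≡ true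
    joins j false false = reach-refl (eGens CM) (enc j false false)
    joins j false true = hop (eGens CM) (there (here refl)) (enc j false true) (α₂-enc j false true)
    joins j true false = hop (eGens CM) (here refl) (enc j true false) (α₀-enc j true false)
    joins j true true = go-to (eGens CM) (there (here refl)) (enc j true true) (enc j false true) (hop (eGens CM) (here refl) (enc j true true) (α₀-enc j true true)) (α₂-enc j false true)

  private
    around-face : ∀ (gs : List (Fin (n CM) → Fin (n CM))) → α₀ CM ∈ gs → α₁ CM ∈ gs → ∀ j s t → reach gs (enc j s t) (enc zero false t) ≡ true
    around-face gs i₀ i₁ j s t = down (toℕ j) (enc j s t) j refl (start s)
      where
      start : ∀ s → reach gs (enc j s t) (enc j false t) ≡ true
      start false = reach-refl gs (enc j false t)
      start true = hop gs i₀ (enc j true t) (α₀-enc j true t)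
      down : ∀ k x j → toℕ j ≡ k → reach gs x (enc j false t) ≡ true → reach gs x (enc zero false t) ≡ true
      down zero x j e r = trans (cong (λ i → reach gs x (enc i false t)) (sym (Finₚ.toℕ-injective {i = j} {j = zero} e))) r
      down (suc k) x j e r = down k x (prev j) (prev-suc j k e) (go-to gs i₀ x (enc (prev j) true t) (go-to gs i₁ x (enc j false t) r (α₁-enc-start j t)) (α₀-enc (prev j) true t))

  faces : orbits (fGens CM) ≡ 2
  faces = count-by (fGens CM) f-gens G inv r joins section
    where
    G : Fin L → Bool → Bool → Fin 2
    G _ _ false = zero
    G _ _ true  = suc zero
    r : Fin 2 → Fin (n CM)
    r zero = enc zero false false
    r (suc zero) = enc zero false true
    inv : ∀ {g} → g ∈ fGens CM → ∀ j s t → on G (g (enc j s t)) ≡ G j s t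
    inv (here refl) j s false = trans (cong (on G) (α₀-enc j s false)) (on-enc G j (not s) false)
    inv (here refl) j s true = trans (cong (on G) (α₀-enc j s true)) (on-enc G j (not s) true)
    inv (there (here refl)) j false false = trans (cong (on G) (α₁-enc-start j false)) (on-enc G (prev j) true false)
    inv (there (here refl)) j false true = trans (cong (on G) (α₁-enc-start j true)) (on-enc G (prev j) true true)
    inv (there (here refl)) j true false = trans (cong (on G) (α₁-enc-end j false)) (on-enc G (next j) false false)
    inv (there (here refl)) j true true = trans (cong (on G) (α₁-enc-end j true)) (on-enc G (next j) false true)
    joins : ∀ j s t → reach (fGens CM) (enc j s t) (r (G j s t)) ≡ true
    joins j s false = around-face (fGens CM) (here refl) (there (here refl)) j s false
    joins j s true = around-face (fGens CM) (here refl) (there (here refl)) j s true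
    section : ∀ i → on G (r i) ≡ i
    section zero = on-enc G zero false false
    section (suc zero) = on-enc G zero false true

  components : orbits (cGens CM) ≡ 1
  components = count-by (cGens CM) c-inj (λ _ _ _ → zero) (λ _ _ _ _ → refl) (λ _ → base zero) joins (λ { zero → refl })
    where
    joins : ∀ j s t → reach (cGens CM) (enc j s t) (base zero) ≡ true
    joins j s false = around-face (cGens CM) (here refl) (there (here refl)) j s false
    joins j s true = go-to (cGens CM) (there (there (here refl))) (enc j s true) (enc zero false true) (around-face (cGens CM) (here refl) (there (here refl)) j s true) (α₂-enc zero false true)

  eg-cycle : eg CM ≡ + 0
  eg-cycle = trans (cong₂ (λ k x → + (2 ℕ.* k) - x) (cong₂ ℕ._+_ components no-isolated) χ-cycle) refl
    where
    χ-cycle : χ CM ≡ + 2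
    χ-cycle = trans (cong₂ (λ v e → + v - + e + + 𝐟 CM) (trans (cong₂ ℕ._+_ vertices no-isolated) (ℕₚ.+-identityʳ L)) edges)
      (trans (cong (λ f → + L - + L + + f) (cong₂ ℕ._+_ faces no-isolated)) (cong (_+ + 2) (ℤₚ.+-inverseʳ (+ L))))

  sg-cycle : sg CM ≡ + 0
  sg-cycle = trans (cong ((+ (2 ℕ.* 𝐨 CM) - + 3) *_) (trans (cong (λ z → divℤ z (𝐨 CM)) eg-cycle) (div0 (𝐨 CM)))) (ℤₚ.*-zeroʳ (+ (2 ℕ.* 𝐨 CM) - + 3))
    where
    div0 : ∀ k → divℤ (+ 0) k ≡ + 0
    div0 zero = refl
    div0 (suc k) = cong +_ (0/n≡0 (suc k))

-- The gap between consecutive odd cycles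

private
  2≤3+ : ∀ {m} → 2 ℕ.≤ 3 ℕ.+ m
  2≤3+ = s≤s (s≤s z≤n)

sub-bip : ∀ {X N} → IsMap N → HasSubmap N X → Bip N → Bip X
sub-bip {X} {N} isN (d , valid , sub) = Sub.restrict X N d isN sub (proj₁ valid) (proj₁ (proj₂ valid)) (λ _ → refl)

steps-bip : ∀ {M X} → IsMap M → Star Step M X → Bip X → Bip M
steps-bip isM = steps-label (λ _ → refl) Boolₚ.not-involutive (λ _ → refl) isM

folded-hom : ∀ {M CM} → sg M ≡ sg CM → Folded CM M → Hom M CM
folded-hom e f = e , Folded.X f , Folded.steps f , Folded.sub f

module Gap (m : ℕ) {short long : Map} (short-like : CycleLike m short) (long-like : CycleLike (2 ℕ.+ m) long)
  (odd : ∀ b → iter (3 ℕ.+ m) not b ≡ not b) where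
  private
    module S = CycleOf short-like
    module Lg = CycleOf long-like
    odd-long : ∀ b → iter (5 ℕ.+ m) not b ≡ not b
    odd-long b = trans (cong (not ∘ not) (odd b)) (Boolₚ.not-involutive (not b))
    long-odd : ¬ Bip long
    long-odd = CycleDarts.odd-cycle long-like odd-long

    -- The long cycle is wound once around the short one by turning back along its last edge.
    height : ℕ → ℤ
    height i = if does (i ℕ.≤? 4 ℕ.+ m) then + i else + (3 ℕ.+ m)
    height-low : ∀ i → i ℕ.≤ 4 ℕ.+ m → height i ≡ + i
    height-low i le = cong (λ b → if b then + i else + (3 ℕ.+ m)) (dec-true (i ℕ.≤? 4 ℕ.+ m) le)
    height-end : height (5 ℕ.+ m) ≡ + (3 ℕ.+ m)
    height-end = cong (λ b → if b then + (5 ℕ.+ m) else + (3 ℕ.+ m)) (dec-false (5 ℕ.+ m ℕ.≤? 4 ℕ.+ m) ℕₚ.1+n≰n)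
    height-step : ∀ i → i ℕ.< 5 ℕ.+ m → height (suc i) - height i ≡ + 1 ⊎ height (suc i) - height i ≡ - + 1
    height-step i lt with ℕₚ.m≤n⇒m<n∨m≡n (ℕ.s≤s⁻¹ lt)
    ... | inj₁ lt' = inj₁ (trans (cong₂ _-_ (height-low (suc i) lt') (height-low i (ℕₚ.<⇒≤ lt'))) (l (+ i)))
      where
      l : ∀ i → + 1 + i - i ≡ + 1
      l = solve-∀
    ... | inj₂ refl = inj₂ (trans (cong₂ _-_ height-end (height-low (4 ℕ.+ m) ℕₚ.≤-refl)) (l (+ (3 ℕ.+ m))))
      where
      l : ∀ i → i - (+ 1 + i) ≡ - + 1
      l = solve-∀

  long-to-short : Hom long short
  long-to-short = folded-hom (trans (CycleGenus.sg-cycle long-like) (sym (CycleGenus.sg-cycle short-like)))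
    (fold short-like (n long) (pairs long ℕ.+ iso long) long Lg.isCyc ℕₚ.≤-refl ℕₚ.≤-refl long-odd
      (CycleDarts.Heights.cycle-state long-like (3 ℕ.+ m) height (height-low 0 z≤n) height-end height-step))

  no-map-between : ∀ N → IsMap N → long ≺ N → N ≺ short → ⊥
  no-map-between N isN ((sg₁ , Y , steps₁ , sub₁) , no-back₁) ((sg₂ , X , steps₂ , (d , valid , sub₂)) , no-back₂) = conclude (Flow.flow hat exact state off)
    where
    nonbip : ¬ Bip N
    nonbip b = long-odd (steps-bip Lg.isCyc steps₁ (sub-bip isN sub₁ b))
    module SX = SubOfCycle short-like odd X d valid sub₂
    -- If an edge of the short cycle were missed, the image would be bipartite; the colouring would
    -- pull back to `N` and from there to the long cycle, which is odd.
    full : ∀ y → SubData.keepE d y ≡ true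
    full y = Boolₚ.¬-not (λ h → nonbip (steps-bip isN steps₂ (SX.proper-bipartite (y , h))))
    N-state : MState (3 ℕ.+ m) N isN
    N-state = steps-state 2≤3+ isN SX.sub-isMap steps₂ (SX.full-state full (CycleDarts.cycle-state-L short-like))
    open MState N-state
    off : ∀ x → Label.lab orient x ≡ false → φ̂ x ≡ x × bar̂ x ≡ x
    off x h = φ̂-off x h , bar̂-off x h
    conclude : State (5 ℕ.+ m) (Label.lab orient) φ̂ bar̂ ⊎ Increasing state → ⊥
    -- Heights modulo the length of the long cycle let `N` fold onto it, against the strictness of
    -- the lower inequality.
    conclude (inj₁ s⁺) = no-back₁ (folded-hom (sym sg₁) (fold long-like (n N) (pairs N ℕ.+ iso N) N isN ℕₚ.≤-refl ℕₚ.≤-refl nonbip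
      (record { orient = orient ; state = s⁺ ; exact = exact })))
    -- A tight cut embeds the short cycle in `N`; the empty chain of gluings is then a homomorphism
    -- back, against the strictness of the upper inequality.
    conclude (inj₂ inc) = no-back₂ (sym sg₂ , short , ε , RingSubmap.ring-submap short-like N isN orient state inc)

theorem4p23 : (k : ℕ) → 1 ℕ.≤ k →
    Hom (C (2 ℕ.* k ℕ.+ 3)) (C (2 ℕ.* k ℕ.+ 1)) ×
    ¬ (Σ Map λ N → IsMap N × IsCore N × sg N ≡ + 0 ×
    C (2 ℕ.* k ℕ.+ 3) ≺ N × N ≺ C (2 ℕ.* k ℕ.+ 1))
theorem4p23 (suc k) _ = subst₂ (λ a b → Hom (Cyc a) (Cyc b) × ¬ (Σ Map λ N → IsMap N × IsCore N × sg N ≡ + 0 × Cyc a ≺ N × N ≺ Cyc b)) (sym long) (sym short)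
    (G.long-to-short , λ { (N , isN , _ , _ , below , above) → G.no-map-between N isN below above })
  where
  double-not : ∀ k b → iter (2 ℕ.* k) not b ≡ b
  double-not zero b = refl
  double-not (suc k) b = trans (cong (λ i → not (iter i not b)) (ℕₚ.+-suc k (k ℕ.+ 0))) (trans (Boolₚ.not-involutive _) (double-not k b))
  -- `Cyc` is indexed by the length minus three; at `suc k` the shorter cycle has length
  -- `3 + 2 * k`.
  short : 2 ℕ.* suc k ℕ.+ 1 ℕ.∸ 3 ≡ 2 ℕ.* k
  short = trans (cong (ℕ._∸ 3) (trans (ℕₚ.+-comm (2 ℕ.* suc k) 1) (cong suc (ℕₚ.*-suc 2 k)))) refl
  long : 2 ℕ.* suc k ℕ.+ 3 ℕ.∸ 3 ≡ 2 ℕ.+ 2 ℕ.* k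
  long = trans (ℕₚ.m+n∸n≡m (2 ℕ.* suc k) 3) (ℕₚ.*-suc 2 k)
  module G = Gap (2 ℕ.* k) (cycle-like (2 ℕ.* k)) (cycle-like (2 ℕ.+ 2 ℕ.* k)) (λ b → cong not (trans (Boolₚ.not-involutive _) (double-not k b)))
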